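{- Let $n\ge 0$ be an integer and let $u_1,\dots,u_n$ be indeterminates; write $\bar u_i=u_i^{ -1}$. Then \[ \Bigl(\widetilde{Z}_{2n+1}(u_1,\dots,u_n,\bar u_1,\dots,\bar u_n,1)/s\Bigr)\Big|_{s=0,\;q^2+q^{ -2}=1} =3^{ -n^2}\prod_{i=1}^n\frac{(u_i+\bar u_i)^2}{u_i^2+\bar u_i^2-1}\; \mathrm{sp}_{(n,n,n-1,n-1,\dots,1,1,0,0)}\bigl(u_1^2,\dots,u_n^2,\bar u_1^2,\dots,\bar u_n^2,1,-1\bigr), \] where the left side means: divide the polynomial-in-$s$ function $\widetilde Z_{2n+1}$ by $s$, set $s=0$, and evaluate at a complex number $q$ with $q^2+q^{ -2}=1$.
   Context: Notation: $\bar x=x^{ -1}$, $\sigma(x)=x-x^{ -1}$, $\widehat\sigma(x)=\sigma(x)/\sigma(q^4)$, where $q$ is a constant. Grid graph $T_m$: vertices are top vertices $(0,j)$ for $1\le j\le m$, left boundary vertices $(i,i)$ for $1\le i\le m$, bulk vertices $(i,j)$ for $1\le i<j\le m$, and right boundary vertices $(i,m+1)$ for $1\le i\le m$. Edges join $(i,j)$ to $(i,j+1)$ whenever both are vertices (horizontal edges, row $i$ running from $(i,i)$ to $(i,m+1)$) and $(i,j)$ to $(i+1,j)$ whenever both are vertices (vertical edges, column $j$ running from $(0,j)$ down to $(j,j)$). Thus each left boundary vertex $(i,i)$ has exactly two edges: one "upward" to $(i-1,i)$ and one "rightward" to $(i,i+1)$. A six-vertex configuration on $T_m$ is an orientation of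 all edges such that: every bulk vertex has exactly two incoming and two outgoing edges; every edge at a top vertex points toward the top vertex (upward); every edge at a right boundary vertex points away from it (leftward). Weights (specialized, with indeterminates $u_1,\dots,u_m$ and $s$): top and right boundary vertices have weight $1$. A left boundary vertex $(i,i)$ has weight $s$ if exactly one of its two edges points into it, and weight $\sigma(qu_i)/\sigma(q)$ if both point into it or both point out of it. A bulk vertex $(i,j)$ has weight: $1$ if both horizontal edges point toward it and both vertical edges point away from it, or both horizontal edges point away and both vertical point toward it; $\widehat\sigma(q^2\bar u_i\bar u_j)$ if both horizontal edges point left and both vertical edges point up (toward smaller row index), or both horizontal point right and both vertical point down; $\widehat\sigma(q^2u_iu_j)$ if both horizontal edges point left and both vertical point down, or both horizontal point right and both vertical point up. Then $\widetilde Z_m(u_1,\dots,u_m)$ is the sum over all six-vertex configurations on $T_m$ of the product of all vertex weights; it is a polynomial in $s$ with coefficients rational in the $u_i$ and $q$, and it is divisible by $s$ when $m$ is odd. Symplectic character: for a partition $\lambda=(\lambda_1\ge\dots\ge\lambda_N\ge0)$, $\mathrm{sp}_\lambda(x_1,\dots,x_N)=\det_{1\le i,j\le N}\bigl(x_i^{\lambda_j+N+1-j}-x_i^{ -(\lambda_j+N+1-j)}\bigr)/\det_{1\le i,j\le N}\bigl(x_i^{N+1-j}-x_i^{ -(N+1-j)}\bigr)$, a Laurent polynomial in $x_1,\dots,x_N$, which may be evaluated at any nonzero arguments. Here $N=2n+2$ and $\lambda=(n,n,n-1,n-1,\dots,0,0)$. -}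

module Defs where

open import Level using (0ℓ)
open import Algebra.Bundles using (CommutativeRing)
open import Data.Nat as ℕ using (ℕ; zero; suc; _∸_)
open import Data.Integer using (ℤ; +_; -[1+_])
open import Data.Fin as Fin using (Fin; zero; suc; toℕ; punchIn; fromℕ<)
open import Data.List as List using (List; []; _∷_)
open import Data.Bool using (Bool; true; false; if_then_else_; not; _xor_; _∧_)
open import Relation.Nullary using (yes; no)

-- Integer-coefficient Laurent polynomial expressions in k variables
-- x₀ … x_{k-1}; 'ivar i' stands for the inverse x_i⁻¹.

data Expr (k : ℕ) : Set where
  var ivar : Fin k → Expr k
  con      : ℤ → Expr k
  _⊕_ _⊗_  : Expr k → Expr k → Expr k

-- Edges of the grid graph T_m (indices as in the paper)
--   hor i j : edge between (i,j) and (i,j+1)   (value true = points right)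
--   ver i j : edge between (i,j) and (i+1,j)   (value true = points down)

data Edge : Set where
  hor ver : ℕ → ℕ → Edge

eqE : Edge → Edge → Bool
eqE (hor i j) (hor k l) = (i ℕ.≡ᵇ k) ∧ (j ℕ.≡ᵇ l)
eqE (ver i j) (ver k l) = (i ℕ.≡ᵇ k) ∧ (j ℕ.≡ᵇ l)
eqE _ _ = false

range : ℕ → ℕ → List ℕ
range a b = List.map (a ℕ.+_) (List.upTo (suc b ∸ a))

edges : ℕ → List Edge
edges m =
  List.concatMap (λ i → List.map (hor i) (range i m)) (range 1 m)
  List.++
  List.concatMap (λ j → List.map (λ i → ver i j) (range 0 (j ∸ 1))) (range 1 m)

Orientation : Set
Orientation = Edge → Bool

setE : Edge → Bool → Orientation → Orientation
setE e b f e' = if eqE e' e then b else f e'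

-- all orientations of the given (duplicate-free) list of edges;
-- edges outside the list are given the irrelevant default value false
allOrients : List Edge → List Orientation
allOrients []       = (λ _ → false) ∷ []
allOrients (e ∷ es) =
  List.concatMap (λ f → setE e true f ∷ setE e false f ∷ []) (allOrients es)

atℕ : ∀ {A : Set} {n : ℕ} → (Fin n → A) → A → ℕ → A
atℕ {n = n} v d k with k ℕ.<? n
... | yes p = v (fromℕ< p)
... | no _  = d

module _ (R : CommutativeRing 0ℓ 0ℓ) where
  open CommutativeRing R using (Carrier; _+_; _*_; -_; 0#; 1#)

  pow : Carrier → ℕ → Carrier
  pow x zero    = 1#
  pow x (suc k) = x * pow x k

  natR : ℕ → Carrier
  natR zero    = 0#
  natR (suc k) = 1# + natR k

  intR : ℤ → Carrier
  intR (+ k)      = natR k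
  intR -[1+ k ]   = - natR (suc k)

  -- σ(x) = x - x⁻¹, given x and its inverse
  σ : Carrier → Carrier → Carrier
  σ x x̄ = x + - x̄

  sumFin : (k : ℕ) → (Fin k → Carrier) → Carrier
  sumFin zero    f = 0#
  sumFin (suc k) f = f zero + sumFin k (λ i → f (suc i))

  prodFin : (k : ℕ) → (Fin k → Carrier) → Carrier
  prodFin zero    f = 1#
  prodFin (suc k) f = f zero * prodFin k (λ i → f (suc i))

  det : (k : ℕ) → (Fin k → Fin k → Carrier) → Carrier
  det zero    A = 1#
  det (suc k) A = sumFin (suc k) λ j →
    pow (- 1#) (toℕ j) * (A zero j * det k (λ r c → A (suc r) (punchIn j c)))

  evalE : {k : ℕ} → (Fin k → Carrier) → (Fin k → Carrier) → Expr k → Carrier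
  evalE x x̄ (var i)  = x i
  evalE x x̄ (ivar i) = x̄ i
  evalE x x̄ (con z)  = intR z
  evalE x x̄ (e ⊕ f)  = evalE x x̄ e + evalE x x̄ f
  evalE x x̄ (e ⊗ f)  = evalE x x̄ e * evalE x x̄ f

  -- numerator / denominator matrices of the symplectic character
  -- (row i, column j 0-indexed: exponent λ_j + N - j, resp. N - j)
  numMat : (N : ℕ) → (Fin N → ℕ) → (Fin N → Carrier) → (Fin N → Carrier)
         → Fin N → Fin N → Carrier
  numMat N lam x x̄ i j =
    pow (x i) (lam j ℕ.+ (N ∸ toℕ j)) + - pow (x̄ i) (lam j ℕ.+ (N ∸ toℕ j))

  denMat : (N : ℕ) → (Fin N → Carrier) → (Fin N → Carrier)
         → Fin N → Fin N → Carrier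
  denMat N x x̄ i j = pow (x i) (N ∸ toℕ j) + - pow (x̄ i) (N ∸ toℕ j)

  -- polynomials in s with coefficients in R (coefficient lists, s^0 first)

  Poly : Set
  Poly = List Carrier

  _+P_ : Poly → Poly → Poly
  []      +P q       = q
  (a ∷ p) +P []      = a ∷ p
  (a ∷ p) +P (b ∷ q) = (a + b) ∷ (p +P q)

  _*P_ : Poly → Poly → Poly
  []      *P q = []
  (a ∷ p) *P q = List.map (a *_) q +P (0# ∷ (p *P q))

  cP : Carrier → Poly
  cP a = a ∷ []

  sP : Poly
  sP = 0# ∷ 1# ∷ []

  coeff : ℕ → Poly → Carrier
  coeff k       []      = 0#
  coeff zero    (a ∷ p) = a
  coeff (suc k) (a ∷ p) = coeff k p

  prodP : List Poly → Poly
  prodP = List.foldr _*P_ (cP 1#)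

  sumP : List Poly → Poly
  sumP = List.foldr _+P_ []

  -- The six-vertex partition function Z̃_m as a polynomial in s.
  -- Parameters: q, q̄ = q⁻¹, sq = σ(q)⁻¹, sq4 = σ(q⁴)⁻¹,
  -- U k, Ū k = spectral parameter u_k and its inverse (1-indexed).

  module SixVertex (q q̄ sq sq4 : Carrier) (U Ū : ℕ → Carrier) where

    σ̂ : Carrier → Carrier → Carrier
    σ̂ x x̄ = σ x x̄ * sq4

    -- bulk weight at (i,j); arguments:
    -- hL = left horizontal edge points right (into the vertex),
    -- hR = right horizontal edge points right (away),
    -- vU = upper vertical edge points down (into),
    -- vD = lower vertical edge points down (away)
    bulkW : ℕ → ℕ → Bool → Bool → Bool → Bool → Carrier
    bulkW i j true  false false true  = 1#
    bulkW i j false true  true  false = 1#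
    bulkW i j false false false false = σ̂ (q * q * Ū i * Ū j) (q̄ * q̄ * U i * U j)
    bulkW i j true  true  true  true  = σ̂ (q * q * Ū i * Ū j) (q̄ * q̄ * U i * U j)
    bulkW i j false false true  true  = σ̂ (q * q * U i * U j) (q̄ * q̄ * Ū i * Ū j)
    bulkW i j true  true  false false = σ̂ (q * q * U i * U j) (q̄ * q̄ * Ū i * Ū j)
    bulkW i j _     _     _     _     = 0#

    ind : Bool → Carrier
    ind true  = 1#
    ind false = 0#

    topW : Orientation → ℕ → Poly
    topW f j = cP (ind (not (f (ver 0 j))))

    rightW : ℕ → Orientation → ℕ → Poly
    rightW m f i = cP (ind (not (f (hor i m))))

    leftW : Orientation → ℕ → Poly
    leftW f i =
      if f (ver (i ∸ 1) i) xor not (f (hor i i))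
      then sP
      else cP (σ (q * U i) (q̄ * Ū i) * sq)

    bulkP : Orientation → ℕ → ℕ → Poly
    bulkP f i j = cP (bulkW i j (f (hor i (j ∸ 1))) (f (hor i j))
                                (f (ver (i ∸ 1) j)) (f (ver i j)))

    weight : ℕ → Orientation → Poly
    weight m f = prodP
      (  List.map (topW f) (range 1 m)
      List.++ List.map (rightW m f) (range 1 m)
      List.++ List.map (leftW f) (range 1 m)
      List.++ List.concatMap (λ i → List.map (bulkP f i) (range (suc i) m)) (range 1 m))

    Ztilde : ℕ → Poly
    Ztilde m = sumP (List.map (weight m) (allOrients (edges m)))

  -- spectral parameters (u_1,…,u_n, ū_1,…,ū_n, 1), 1-indexed
  specU : (n : ℕ) → (Fin n → Carrier) → (Fin n → Carrier) → ℕ → Carrier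
  specU n u ū k =
    if k ℕ.≤ᵇ n then atℕ u 1# (k ∸ 1) else atℕ ū 1# (k ∸ suc n)

  -- (Z̃_{2n+1}(u,ū,1)/s)|_{s=0} = coefficient of s¹
  Zcoeff1 : (n : ℕ) → (q q̄ sq sq4 : Carrier) → (u ū : Fin n → Carrier) → Carrier
  Zcoeff1 n q q̄ sq sq4 u ū =
    coeff 1 (SixVertex.Ztilde q q̄ sq sq4 (specU n u ū) (specU n ū u) (suc (n ℕ.+ n)))

  spPoint : (n : ℕ) → (Fin n → Carrier) → (Fin n → Carrier)
          → Fin (suc (suc (n ℕ.+ n))) → Carrier
  spPoint n u ū k =
    if toℕ k ℕ.<ᵇ n then atℕ (λ i → u i * u i) 1# (toℕ k)
    else if toℕ k ℕ.<ᵇ (n ℕ.+ n) then atℕ (λ i → ū i * ū i) 1# (toℕ k ∸ n)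
    else if toℕ k ℕ.≡ᵇ (n ℕ.+ n) then 1#
    else - 1#

spLam : (n : ℕ) → Fin (suc (suc (n ℕ.+ n))) → ℕ
spLam n j = n ∸ (toℕ j ℕ./ 2)

-- P represents the Laurent polynomial sp_λ in N variables:
-- P · det(x_i^{N+1-j} - x_i^{-(N+1-j)}) = det(x_i^{λ_j+N+1-j} - x_i^{-(λ_j+N+1-j)})
-- holds identically (in every commutative ring, for all invertible x_i).
IsSp : (N : ℕ) → (Fin N → ℕ) → Expr N → Set₁
IsSp N lam P =
  (S : CommutativeRing 0ℓ 0ℓ) →
  (x x̄ : Fin N → CommutativeRing.Carrier S) →
  (∀ i → CommutativeRing._≈_ S (CommutativeRing._*_ S (x i) (x̄ i)) (CommutativeRing.1# S)) →
  CommutativeRing._≈_ S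
    (CommutativeRing._*_ S (evalE S x x̄ P) (det S N (denMat S N x x̄)))
    (det S N (numMat S N lam x x̄))

{-# OPTIONS --safe #-}
-- Write κ(u) = σ(q u)/σ(q).  Over the dual numbers, s² = 0, the partition
-- function Z is symmetric by the Yang–Baxter and reflection equations, is a
-- Laurent polynomial of bounded degree in each u_i, and obeys a recursion where
-- u_i u_j = q^{±2}.  For q² + q⁻² = 1, so that q⁴ is a primitive cube root of
-- unity, the symmetrisation ∏ κ(u_i⁻¹) Z(u) + ∏ κ(u_i) Z(u⁻¹) and
-- s 3^{-n²} ∏ (u_i + u_i⁻¹) sp(u₁², …, u²_{2n+1}, −1) obey the same recursion, and
-- Lagrange interpolation in u₁ shows that they agree.  The interpolation points
-- differ by regular elements once the u_i are replaced by u_i tⁱ over Laurent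
-- polynomials in t, and t = 1 recovers the given ones.  At (u, u⁻¹, 1) the two
-- summands of the symmetrisation coincide.
module Submission where

open import Defs
open import Level using (0ℓ)
open import Algebra.Bundles using (CommutativeRing)
open import Data.Bool using (Bool; true; false; not; if_then_else_; _∧_; _xor_; T)
open import Data.Empty using (⊥; ⊥-elim)
open import Data.Fin using (Fin; zero; suc; toℕ; punchIn)
import Data.Fin.Properties as FinP
open import Data.Integer as ℤ using (ℤ; +_; -[1+_]; +[1+_])
import Data.Integer.Properties as ℤP
open import Data.List as List using (List; []; _∷_; length; _++_)
open import Data.List.Membership.Propositional using (_∈_; _∉_)
open import Data.List.Membership.Propositional.Properties using (∈-∃++; ∈-map⁺)
open import Data.List.Properties using (++-assoc; map-++; length-map; length-++; length-tabulate; map-tabulate; map-applyUpTo)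
open import Data.List.Relation.Binary.Permutation.Propositional as Perm using (_↭_; ↭-sym; ↭-trans; ↭-refl; ↭-reflexive)
open import Data.List.Relation.Binary.Permutation.Propositional.Properties as PermP using (↭-length; map⁺; ++-comm)
open import Data.List.Relation.Binary.Pointwise as LPW using ([]; _∷_) renaming (Pointwise to ListPointwise)
open import Data.List.Relation.Unary.All as All using (All; []; _∷_)
import Data.List.Relation.Unary.All.Properties as AllP
open import Data.List.Relation.Unary.AllPairs using (AllPairs; []; _∷_)
open import Data.List.Relation.Unary.Any using (here; there)
open import Data.Nat as ℕ using (ℕ; zero; suc; _∸_; z≤n; s≤s)
open import Data.Nat.DivMod using (m/n≡1+[m∸n]/n)
import Data.Nat.Properties as ℕP
open import Data.Nat.Tactic.RingSolver using (solve-∀)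
open import Data.Product using (Σ; Σ-syntax; ∃; ∃-syntax; _×_; _,_; proj₁; proj₂)
import Data.Product.Properties as ProductP
open import Data.Sum using (_⊎_; inj₁; inj₂)
open import Data.Unit using (tt)
open import Data.Vec as Vec using (Vec; []; _∷_; tabulate) renaming (_++_ to _++ᵥ_)
import Data.Vec.Properties as VecP
open import Data.Vec.Relation.Binary.Pointwise.Inductive as PW using ([]; _∷_) renaming (Pointwise to VecPointwise)
open import Function using (_∘_; case_of_)
open import Relation.Nullary using (Dec; yes; no)
open import Relation.Binary.PropositionalEquality as ≡ using (_≡_; _≢_; refl)

-- The coefficient of s lives in dual numbers over an arbitrary commutative ring, where nonzero
-- elements may be zero divisors. Every cancellation therefore goes through an element shown to be
-- regular; over any coefficient ring, u tᵏ - u⁻¹ t⁻ᵏ with k ≠ 0 is regular. Since the inductions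
-- pass to this extension, their hypotheses quantify over all rings. At u v = q⁻² the first row is
-- frozen, κ(u) + κ(v) = 0 cancels the cross terms, and the recursion is immediate. At u v = q² the
-- first row does not freeze; that recursion is itself an interpolation, in a third parameter. Both
-- enter: in u₁ the symmetrisation has degree 2n+1, so 2n+2 points must be checked, and the 2n
-- points q⁻² u_j⁻¹ are completed by two of the points q² u_j⁻¹, which invariance under inversion
-- provides. For the character, the exponents 3n+2, 3n+1, ..., 5, 4, 2, 1 are prime to 3, and column
-- operations multiply rows by x³ + x⁻³ - t. Two arguments with x³ + x⁻³ = t split off a 2 by 2
-- block, which is the recursion; their product is a primitive cube root of unity, as it is for u²
-- and v² when u v = q^{±2}.

record Invertible (K : CommutativeRing 0ℓ 0ℓ) : Set where
  constructor unit
  open CommutativeRing K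
  field
    val inv : Carrier
    val*inv : val * inv ≈ 1#

open Invertible public

-- Ring identities in plain and in invertible variables

data Term : Set where
  x⟨_⟩ u⟨_⟩ ū⟨_⟩ : ℕ → Term
  :0 :1          : Term
  _:+_ _:*_      : Term → Term → Term
  :-_            : Term → Term

infixl 6 _:+_
infixl 7 _:*_
infix  8 :-_
infix  9 _:^_

_:^_ : Term → ℕ → Term
t :^ zero        = :1
t :^ suc zero    = t
t :^ suc (suc n) = t :* t :^ suc n

Equation : Set
Equation = Term × Term

infix 5 _:=_

_:=_ : Term → Term → Equation
_:=_ = _,_

-- Each equation comes with its cofactor.
Combination : Set
Combination = List (Term × Equation)

:combine : Combination → Term
:combine []                 = :0
:combine ((c , l , r) ∷ hs) = c :* (l :+ :- r) :+ :combine hs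

-- An invertible variable is passed along with its inverse.
Abstraction : ℕ → ℕ → Set → Set
Abstraction zero    zero    A = A
Abstraction zero    (suc k) A = Term → Term → Abstraction zero k A
Abstraction (suc n) k       A = Term → Abstraction n k A

instantiate : ∀ {A} n k → ℕ → ℕ → Abstraction n k A → A
instantiate zero    zero    i j f = f
instantiate zero    (suc k) i j f = instantiate zero k i (suc j) (f u⟨ j ⟩ ū⟨ j ⟩)
instantiate (suc n) k       i j f = instantiate n k (suc i) j (f x⟨ i ⟩)

-- Monomials carry plain exponents and, for the invertible variables, pairs
-- (exponent of u, exponent of u⁻¹) of which at least one is kept at zero.
Monomial : ℕ → ℕ → Set
Monomial n k = Vec ℕ n × Vec (ℕ × ℕ) k

_≟ᴹ_ : ∀ {n k} (m p : Monomial n k) → Dec (m ≡ p)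
_≟ᴹ_ = ProductP.≡-dec (VecP.≡-dec ℕ._≟_) (VecP.≡-dec (ProductP.≡-dec ℕ._≟_ ℕ._≟_))

-- Coefficients are unary: an integer coefficient is a repetition of one signed monomial, and
-- opposite signs cancel on insertion. A certificate is accepted when everything cancels down to
-- `[]`.
Signed : ℕ → ℕ → Set
Signed n k = Bool × Monomial n k

addExp : ℕ × ℕ → ℕ × ℕ → ℕ × ℕ
addExp (a , b) (c , d) = ((a ℕ.+ c) ∸ (b ℕ.+ d)) , ((b ℕ.+ d) ∸ (a ℕ.+ c))

mulMonomial : ∀ {n k} → Monomial n k → Monomial n k → Monomial n k
mulMonomial (a , b) (c , d) = Vec.zipWith ℕ._+_ a c , Vec.zipWith addExp b d

eqSign : Bool → Bool → Bool
eqSign true  b = b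
eqSign false b = not b

mulSigned : ∀ {n k} → Signed n k → Signed n k → Signed n k
mulSigned (s , m) (t , p) = eqSign s t , mulMonomial m p

insert : ∀ {n k} → Signed n k → List (Signed n k) → List (Signed n k)
insert t [] = t ∷ []
insert (s , m) ((t , p) ∷ ps) with m ≟ᴹ p
... | yes _ = if eqSign s t then (s , m) ∷ (t , p) ∷ ps else ps
... | no  _ = (t , p) ∷ insert (s , m) ps

insertAll : ∀ {n k} → List (Signed n k) → List (Signed n k) → List (Signed n k)
insertAll []       qs = qs
insertAll (p ∷ ps) qs = insert p (insertAll ps qs)

negate : ∀ {n k} → List (Signed n k) → List (Signed n k)
negate = List.map (λ (s , m) → not s , m)

mulAll : ∀ {n k} → List (Signed n k) → List (Signed n k) → List (Signed n k)
mulAll []       qs = []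
mulAll (p ∷ ps) qs = insertAll (List.map (mulSigned p) qs) (mulAll ps qs)

-- An index beyond the end gives zero exponents, that is the monomial 1. The defaults of `lookupOr`
-- make the same choice, so terms need no scoping.
indicator : ∀ {A : Set} → A → A → ∀ {n} → ℕ → Vec A n
indicator z e {zero}  i       = []
indicator z e {suc n} zero    = e ∷ Vec.replicate n z
indicator z e {suc n} (suc i) = z ∷ indicator z e i

normal : ∀ {n k} → Term → List (Signed n k)
normal x⟨ i ⟩   = (true , indicator 0 1 i , Vec.replicate _ (0 , 0)) ∷ []
normal u⟨ i ⟩   = (true , Vec.replicate _ 0 , indicator (0 , 0) (1 , 0) i) ∷ []
normal ū⟨ i ⟩   = (true , Vec.replicate _ 0 , indicator (0 , 0) (0 , 1) i) ∷ []
normal :0       = []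
normal :1       = (true , Vec.replicate _ 0 , Vec.replicate _ (0 , 0)) ∷ []
normal (s :+ t) = insertAll (normal s) (normal t)
normal (s :* t) = mulAll (normal s) (normal t)
normal (:- t)   = negate (normal t)

∀ⁿ : ∀ {A : Set} n → (Vec A n → Set) → Set
∀ⁿ zero    P = P []
∀ⁿ (suc n) P = ∀ x → ∀ⁿ n λ xs → P (x ∷ xs)

∀ⁿ-intro : ∀ {A : Set} n {P : Vec A n → Set} → (∀ xs → P xs) → ∀ⁿ n P
∀ⁿ-intro zero    f = f []
∀ⁿ-intro (suc n) f = λ x → ∀ⁿ-intro n λ xs → f (x ∷ xs)

module Ring (K : CommutativeRing 0ℓ 0ℓ) where
  open CommutativeRing K hiding (zero) renaming (refl to ≈-refl; sym to ≈-sym; trans to ≈-trans) public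
  open import Algebra.Properties.Ring ring public
  open import Relation.Binary.Reasoning.Setoid setoid public
  open import Algebra.Properties.CommutativeSemigroup *-commutativeSemigroup public
    using () renaming (interchange to *-interchange; x∙yz≈y∙xz to *-swap)
  open import Algebra.Properties.CommutativeSemigroup +-commutativeSemigroup public
    using () renaming (interchange to +-interchange)

  pow-+ : ∀ x a b → pow K x (a ℕ.+ b) ≈ pow K x a * pow K x b
  pow-+ x zero    b = ≈-sym (*-identityˡ _)
  pow-+ x (suc a) b = ≈-trans (*-congˡ (pow-+ x a b)) (≈-sym (*-assoc _ _ _))

  1ᵤ : Invertible K
  1ᵤ = unit 1# 1# (*-identityˡ 1#)

  lookupOr : ∀ {A : Set} {n} → A → Vec A n → ℕ → A
  lookupOr d []       i       = d
  lookupOr d (x ∷ xs) zero    = x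
  lookupOr d (x ∷ xs) (suc i) = lookupOr d xs i

  plain : ∀ {n} → Vec Carrier n → Vec ℕ n → Carrier
  plain []       []       = 1#
  plain (x ∷ xs) (e ∷ es) = pow K x e * plain xs es

  power : Invertible K → ℕ × ℕ → Carrier
  power u (a , b) = pow K (val u) a * pow K (inv u) b

  units : ∀ {k} → Vec (Invertible K) k → Vec (ℕ × ℕ) k → Carrier
  units []       []       = 1#
  units (u ∷ us) (e ∷ es) = power u e * units us es

  -- Each step cancels one factor `val u * inv u`, until one of the two exponents is zero.
  power-reduce : ∀ u a b → power u (a ∸ b , b ∸ a) ≈ power u (a , b)
  power-reduce u zero    zero    = ≈-refl
  power-reduce u zero    (suc b) = ≈-refl
  power-reduce u (suc a) zero    = ≈-refl
  power-reduce u (suc a) (suc b) = begin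
    power u (a ∸ b , b ∸ a)                  ≈⟨ power-reduce u a b ⟩
    power u (a , b)                          ≈⟨ *-identityˡ _ ⟨
    1# * power u (a , b)                     ≈⟨ *-congʳ (val*inv u) ⟨
    (val u * inv u) * power u (a , b)        ≈⟨ *-interchange _ _ _ _ ⟩
    power u (suc a , suc b)                  ∎

  power-add : ∀ u e f → power u (addExp e f) ≈ power u e * power u f
  power-add u (a , b) (c , d) = begin
    power u (addExp (a , b) (c , d))            ≈⟨ power-reduce u (a ℕ.+ c) (b ℕ.+ d) ⟩
    pow K (val u) (a ℕ.+ c) * pow K (inv u) (b ℕ.+ d)
      ≈⟨ *-cong (pow-+ (val u) a c) (pow-+ (inv u) b d) ⟩
    (pow K (val u) a * pow K (val u) c) * (pow K (inv u) b * pow K (inv u) d)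
      ≈⟨ *-interchange _ _ _ _ ⟩
    power u (a , b) * power u (c , d)           ∎

  plain-mul : ∀ {n} (xs : Vec _ n) es fs → plain xs (Vec.zipWith ℕ._+_ es fs) ≈ plain xs es * plain xs fs
  plain-mul []       []       []       = ≈-sym (*-identityˡ 1#)
  plain-mul (x ∷ xs) (e ∷ es) (f ∷ fs) =
    ≈-trans (*-cong (pow-+ x e f) (plain-mul xs es fs)) (*-interchange _ _ _ _)

  units-mul : ∀ {k} (us : Vec _ k) es fs → units us (Vec.zipWith addExp es fs) ≈ units us es * units us fs
  units-mul []       []       []       = ≈-sym (*-identityˡ 1#)
  units-mul (u ∷ us) (e ∷ es) (f ∷ fs) =
    ≈-trans (*-cong (power-add u e f) (units-mul us es fs)) (*-interchange _ _ _ _)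

  plain-one : ∀ {n} (xs : Vec _ n) → plain xs (Vec.replicate _ 0) ≈ 1#
  plain-one []       = ≈-refl
  plain-one (x ∷ xs) = ≈-trans (*-identityˡ _) (plain-one xs)

  units-one : ∀ {k} (us : Vec _ k) → units us (Vec.replicate _ (0 , 0)) ≈ 1#
  units-one []       = ≈-refl
  units-one (u ∷ us) = ≈-trans (*-cong (*-identityˡ 1#) (units-one us)) (*-identityˡ 1#)

  plain-var : ∀ {n} (xs : Vec _ n) i → plain xs (indicator 0 1 i) ≈ lookupOr 1# xs i
  plain-var []       i       = ≈-refl
  plain-var (x ∷ xs) zero    =
    ≈-trans (*-cong (*-identityʳ x) (plain-one xs)) (*-identityʳ x)
  plain-var (x ∷ xs) (suc i) = ≈-trans (*-identityˡ _) (plain-var xs i)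

  units-val : ∀ {k} (us : Vec _ k) i → units us (indicator (0 , 0) (1 , 0) i) ≈ val (lookupOr 1ᵤ us i)
  units-val []       i       = ≈-refl
  units-val (u ∷ us) zero    = ≈-trans
    (*-cong (≈-trans (*-identityʳ _) (*-identityʳ _)) (units-one us)) (*-identityʳ _)
  units-val (u ∷ us) (suc i) =
    ≈-trans (*-cong (*-identityˡ 1#) (units-val us i)) (*-identityˡ _)

  units-inv : ∀ {k} (us : Vec _ k) i → units us (indicator (0 , 0) (0 , 1) i) ≈ inv (lookupOr 1ᵤ us i)
  units-inv []       i       = ≈-refl
  units-inv (u ∷ us) zero    = ≈-trans
    (*-cong (≈-trans (*-identityˡ _) (*-identityʳ _)) (units-one us)) (*-identityʳ _)
  units-inv (u ∷ us) (suc i) =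
    ≈-trans (*-cong (*-identityˡ 1#) (units-inv us i)) (*-identityˡ _)

  signed : Bool → Carrier → Carrier
  signed true  x = x
  signed false x = - x

  signed-mul : ∀ s t x y → signed (eqSign s t) (x * y) ≈ signed s x * signed t y
  signed-mul true  true  x y = ≈-refl
  signed-mul true  false x y = -‿distribʳ-* x y
  signed-mul false true  x y = -‿distribˡ-* x y
  signed-mul false false x y = begin
    x * y           ≈⟨ -‿involutive _ ⟨
    - - (x * y)     ≈⟨ -‿cong (-‿distribˡ-* x y) ⟩
    - (- x * y)     ≈⟨ -‿distribʳ-* (- x) y ⟩
    - x * - y       ∎

  signed-not : ∀ s x → signed (not s) x ≈ - signed s x
  signed-not true  x = ≈-refl
  signed-not false x = ≈-sym (-‿involutive x)

  module Solution {n k} (xs : Vec Carrier n) (us : Vec (Invertible K) k) where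

    eval : Term → Carrier
    eval x⟨ i ⟩   = lookupOr 1# xs i
    eval u⟨ i ⟩   = val (lookupOr 1ᵤ us i)
    eval ū⟨ i ⟩   = inv (lookupOr 1ᵤ us i)
    eval :0       = 0#
    eval :1       = 1#
    eval (s :+ t) = eval s + eval t
    eval (s :* t) = eval s * eval t
    eval (:- t)   = - eval t

    Holds : Equation → Set
    Holds (s , t) = eval s ≈ eval t

    infixr 3 _Implies_

    _Implies_ : Combination → Set → Set
    []           Implies P = P
    ((_ , h) ∷ hs) Implies P = Holds h → hs Implies P

    evalM : Monomial n k → Carrier
    evalM (a , b) = plain xs a * units us b

    evalS : Signed n k → Carrier
    evalS (s , m) = signed s (evalM m)

    evalN : List (Signed n k) → Carrier
    evalN []       = 0#
    evalN (p ∷ ps) = evalS p + evalN ps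

    insert-sound : ∀ p ps → evalN (insert p ps) ≈ evalS p + evalN ps
    insert-sound p       []             = ≈-refl
    insert-sound (s , m) ((t , p) ∷ ps) with m ≟ᴹ p
    insert-sound (s , m) ((t , p) ∷ ps) | no _ = begin
      evalS (t , p) + evalN (insert (s , m) ps)     ≈⟨ +-congˡ (insert-sound (s , m) ps) ⟩
      evalS (t , p) + (evalS (s , m) + evalN ps)    ≈⟨ +-assoc _ _ _ ⟨
      (evalS (t , p) + evalS (s , m)) + evalN ps    ≈⟨ +-congʳ (+-comm _ _) ⟩
      (evalS (s , m) + evalS (t , p)) + evalN ps    ≈⟨ +-assoc _ _ _ ⟩
      evalS (s , m) + (evalS (t , p) + evalN ps)    ∎
    insert-sound (true  , m) ((true  , .m) ∷ ps) | yes refl = ≈-refl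
    insert-sound (false , m) ((false , .m) ∷ ps) | yes refl = ≈-refl
    insert-sound (true  , m) ((false , .m) ∷ ps) | yes refl =
      ≈-sym (≈-trans (≈-sym (+-assoc _ _ _)) (≈-trans (+-congʳ (-‿inverseʳ _)) (+-identityˡ _)))
    insert-sound (false , m) ((true  , .m) ∷ ps) | yes refl =
      ≈-sym (≈-trans (≈-sym (+-assoc _ _ _)) (≈-trans (+-congʳ (-‿inverseˡ _)) (+-identityˡ _)))

    insertAll-sound : ∀ ps qs → evalN (insertAll ps qs) ≈ evalN ps + evalN qs
    insertAll-sound []       qs = ≈-sym (+-identityˡ _)
    insertAll-sound (p ∷ ps) qs = ≈-trans (insert-sound p (insertAll ps qs))
      (≈-trans (+-congˡ (insertAll-sound ps qs)) (≈-sym (+-assoc _ _ _)))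

    negate-sound : ∀ ps → evalN (negate ps) ≈ - evalN ps
    negate-sound []             = ≈-sym -0#≈0#
    negate-sound ((s , m) ∷ ps) = ≈-trans (+-cong (signed-not s _) (negate-sound ps)) (-‿+-comm _ _)

    mulSigned-sound : ∀ p q → evalS (mulSigned p q) ≈ evalS p * evalS q
    mulSigned-sound (s , a , b) (t , c , d) = ≈-trans
      (signed-cong (eqSign s t) (≈-trans (*-cong (plain-mul xs a c) (units-mul us b d)) (*-interchange _ _ _ _)))
      (signed-mul s t _ _)
      where
      signed-cong : ∀ s {x y} → x ≈ y → signed s x ≈ signed s y
      signed-cong true  e = e
      signed-cong false e = -‿cong e

    scale-sound : ∀ p qs → evalN (List.map (mulSigned p) qs) ≈ evalS p * evalN qs
    scale-sound p []       = ≈-sym (zeroʳ _)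
    scale-sound p (q ∷ qs) =
      ≈-trans (+-cong (mulSigned-sound p q) (scale-sound p qs)) (≈-sym (distribˡ _ _ _))

    mulAll-sound : ∀ ps qs → evalN (mulAll ps qs) ≈ evalN ps * evalN qs
    mulAll-sound []       qs = ≈-sym (zeroˡ _)
    mulAll-sound (p ∷ ps) qs = ≈-trans (insertAll-sound (List.map (mulSigned p) qs) (mulAll ps qs))
      (≈-trans (+-cong (scale-sound p qs) (mulAll-sound ps qs)) (≈-sym (distribʳ _ _ _)))

    normal-sound : ∀ t → evalN (normal t) ≈ eval t
    normal-sound x⟨ i ⟩   = ≈-trans (+-identityʳ _)
      (≈-trans (*-cong (plain-var xs i) (units-one us)) (*-identityʳ _))
    normal-sound u⟨ i ⟩   = ≈-trans (+-identityʳ _)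
      (≈-trans (*-cong (plain-one xs) (units-val us i)) (*-identityˡ _))
    normal-sound ū⟨ i ⟩   = ≈-trans (+-identityʳ _)
      (≈-trans (*-cong (plain-one xs) (units-inv us i)) (*-identityˡ _))
    normal-sound :0       = ≈-refl
    normal-sound :1       = ≈-trans (+-identityʳ _)
      (≈-trans (*-cong (plain-one xs) (units-one us)) (*-identityˡ _))
    normal-sound (s :+ t) = ≈-trans (insertAll-sound (normal s) (normal t))
      (+-cong (normal-sound s) (normal-sound t))
    normal-sound (s :* t) = ≈-trans (mulAll-sound (normal s) (normal t))
      (*-cong (normal-sound s) (normal-sound t))
    normal-sound (:- t)   = ≈-trans (negate-sound (normal t)) (-‿cong (normal-sound t))

    -- The hypotheses are discharged one at a time: a true equation makes its summand of `:combine`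
    -- vanish.
    close : ∀ c hs → eval c ≈ eval (:combine hs) → hs Implies eval c ≈ 0#
    close c []                 e = e
    close c ((a , l , r) ∷ hs) e = λ h → close c hs (≈-trans e (≈-trans
      (+-congʳ (≈-trans (*-congˡ (≈-trans (+-congʳ h) (-‿inverseʳ _))) (zeroʳ _))) (+-identityˡ _)))

    x-y≈0⇒x≈y : ∀ hs {x y} → hs Implies (x + - y ≈ 0#) → hs Implies (x ≈ y)
    x-y≈0⇒x≈y []       {x} {y} e = begin
      x               ≈⟨ +-identityʳ x ⟨
      x + 0#          ≈⟨ +-congˡ (-‿inverseˡ y) ⟨
      x + (- y + y)   ≈⟨ +-assoc _ _ _ ⟨
      x + - y + y     ≈⟨ +-congʳ e ⟩
      0# + y          ≈⟨ +-identityˡ y ⟩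
      y               ∎
    x-y≈0⇒x≈y (_ ∷ hs) f = λ h → x-y≈0⇒x≈y hs (f h)

    solution : ∀ s t hs → normal {n} {k} (s :+ :- t :+ :- :combine hs) ≡ [] → hs Implies Holds (s , t)
    solution s t hs eq = x-y≈0⇒x≈y hs (close (s :+ :- t) hs (difference≈0
      (≈-trans (≈-sym (normal-sound (s :+ :- t :+ :- :combine hs))) (reflexive (≡.cong evalN eq)))))
      where
      difference≈0 : ∀ {x y} → x + - y ≈ 0# → x ≈ y
      difference≈0 = x-y≈0⇒x≈y []

  -- An ideal membership certificate: the cofactors write the difference of the two sides as a
  -- combination of the differences of the hypotheses, and this is checked by computing a normal
  -- form.
  solve-by : ∀ n k (f : Abstraction n k (Equation × Combination)) →
    let ((s , t) , hs) = instantiate n k 0 0 f in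
    normal {n} {k} (s :+ :- t :+ :- :combine hs) ≡ [] →
    ∀ⁿ n λ xs → ∀ⁿ k λ us → let open Solution xs us in hs Implies Holds (s , t)
  solve-by n k f eq = let ((s , t) , hs) = instantiate n k 0 0 f in
    ∀ⁿ-intro n λ xs → ∀ⁿ-intro k λ us → Solution.solution xs us s t hs eq

  solve : ∀ n k (f : Abstraction n k Equation) → let (s , t) = instantiate n k 0 0 f in
    normal {n} {k} (s :+ :- t :+ :- :0) ≡ [] →
    ∀ⁿ n λ xs → ∀ⁿ k λ us → Solution.Holds xs us (s , t)
  solve n k f eq = let (s , t) = instantiate n k 0 0 f in
    ∀ⁿ-intro n λ xs → ∀ⁿ-intro k λ us → Solution.solution xs us s t [] eq

-- The six-vertex model

-- `sq` and `sq4` stand for 1/σ(q) and 1/σ(q⁴) but carry no laws here. Exchange relations and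
-- degrees hold for free values; `Lawful` and `Cubic` add the laws behind the recursions.
record Parameters (K : CommutativeRing 0ℓ 0ℓ) : Set where
  open CommutativeRing K
  field
    q          : Invertible K
    s sq sq4   : Carrier

module Vertex (K : CommutativeRing 0ℓ 0ℓ) (P : Parameters K) where
  open Ring K
  open Parameters P

  U : Set
  U = Invertible K

  -- With σ(x) = x - x⁻¹: the bulk weights σ(q²/(w v)) `sq4` and σ(q² w v) `sq4`, and the entries
  -- σ(q⁴ w/v) and σ(v/w) of the R-matrix.
  wA wB ra rb : U → U → Carrier
  wA w v = (val q * val q * inv w * inv v + - (inv q * inv q * val w * val v)) * sq4
  wB w v = (val q * val q * val w * val v + - (inv q * inv q * inv w * inv v)) * sq4
  ra v w = val q * val q * val q * val q * val w * inv v + - (inv q * inv q * inv q * inv q * inv w * val v)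
  rb v w = val v * inv w + - (inv v * val w)

  -- In the model `wC` is 1. Kept as σ(q⁴) `sq4`, it makes the Yang-Baxter and reflection equations
  -- identities without hypotheses.
  wC rc : Carrier
  wC = (val q * val q * val q * val q + - (inv q * inv q * inv q * inv q)) * sq4
  rc = val q * val q * val q * val q + - (inv q * inv q * inv q * inv q)

  κ : U → Carrier
  κ u = (val q * val u + - (inv q * inv u)) * sq

  -- The left and upper edges are given; the continuation `g` receives the right and the lower edge.
  -- Nested calls thus form the sum over configurations.
  vertex : U → U → Bool → Bool → (Bool → Bool → Carrier) → Carrier
  vertex w v false false g = wA w v * g false false
  vertex w v true  true  g = wA w v * g true true
  vertex w v false true  g = wB w v * g false true + wC * g true false
  vertex w v true  false g = wB w v * g true false + wC * g false true

  -- `true` above points into the vertex and `true` on the right points out of it, so equal values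
  -- are the case of weight `s`.
  boundary : U → Bool → (Bool → Carrier) → Carrier
  boundary u b g = s * g b + κ u * g (not b)

  row : ∀ {n} → U → Bool → Vec U n → Vec Bool n → (Vec Bool n → Carrier) → Carrier
  -- The right boundary admits only the leftward arrow, which is `false`.
  row w h []       []       k = if h then 0# else k []
  row w h (v ∷ vs) (b ∷ bs) k = vertex w v h b λ h′ b′ → row w h′ vs bs λ bs′ → k (b′ ∷ bs′)

  -- The triangle is peeled row by row: the first column turns at the left boundary into the first
  -- row, which crosses the other columns and leaves a smaller triangle below it.
  Ψ : ∀ {n} → Vec U n → Vec Bool n → Carrier
  Ψ []       []       = 1#
  Ψ (u ∷ us) (b ∷ bs) = boundary u b λ h → row u h us bs (Ψ us)

  Z : ∀ {n} → Vec U n → Carrier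
  Z us = Ψ us (Vec.replicate _ false)

  -- The R-matrix exchanging two neighbouring lines with parameters `v` and `w`.
  crossing : U → U → (Bool → Bool → Carrier) → Bool → Bool → Carrier
  crossing v w g false false = ra v w * g false false
  crossing v w g true  true  = ra v w * g true true
  crossing v w g false true  = rc * g false true + rb v w * g true false
  crossing v w g true  false = rc * g true false + rb v w * g false true

  -- In the terms below, invertible variable 0 is q and the plain variables 0, 1, 2 are sq4, sq, s.
  :wA :wB :ra :rb : ℕ → ℕ → Term
  :wA w v = (u⟨ 0 ⟩ :* u⟨ 0 ⟩ :* ū⟨ w ⟩ :* ū⟨ v ⟩ :+ :- (ū⟨ 0 ⟩ :* ū⟨ 0 ⟩ :* u⟨ w ⟩ :* u⟨ v ⟩)) :* x⟨ 0 ⟩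
  :wB w v = (u⟨ 0 ⟩ :* u⟨ 0 ⟩ :* u⟨ w ⟩ :* u⟨ v ⟩ :+ :- (ū⟨ 0 ⟩ :* ū⟨ 0 ⟩ :* ū⟨ w ⟩ :* ū⟨ v ⟩)) :* x⟨ 0 ⟩
  :ra v w = u⟨ 0 ⟩ :* u⟨ 0 ⟩ :* u⟨ 0 ⟩ :* u⟨ 0 ⟩ :* u⟨ w ⟩ :* ū⟨ v ⟩
    :+ :- (ū⟨ 0 ⟩ :* ū⟨ 0 ⟩ :* ū⟨ 0 ⟩ :* ū⟨ 0 ⟩ :* ū⟨ w ⟩ :* u⟨ v ⟩)
  :rb v w = u⟨ v ⟩ :* ū⟨ w ⟩ :+ :- (ū⟨ v ⟩ :* u⟨ w ⟩)

  :wC :rc : Term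
  :rc = u⟨ 0 ⟩ :* u⟨ 0 ⟩ :* u⟨ 0 ⟩ :* u⟨ 0 ⟩ :+ :- (ū⟨ 0 ⟩ :* ū⟨ 0 ⟩ :* ū⟨ 0 ⟩ :* ū⟨ 0 ⟩)
  :wC = :rc :* x⟨ 0 ⟩

  :κ : ℕ → Term
  :κ u = (u⟨ 0 ⟩ :* u⟨ u ⟩ :+ :- (ū⟨ 0 ⟩ :* ū⟨ u ⟩)) :* x⟨ 1 ⟩

  :vertex : ℕ → ℕ → Bool → Bool → (Bool → Bool → Term) → Term
  :vertex w v false false g = :wA w v :* g false false
  :vertex w v true  true  g = :wA w v :* g true true
  :vertex w v false true  g = :wB w v :* g false true :+ :wC :* g true false
  :vertex w v true  false g = :wB w v :* g true false :+ :wC :* g false true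

  :boundary : ℕ → Bool → (Bool → Term) → Term
  :boundary u b g = x⟨ 2 ⟩ :* g b :+ :κ u :* g (not b)

  :crossing : ℕ → ℕ → (Bool → Bool → Term) → Bool → Bool → Term
  :crossing v w g false false = :ra v w :* g false false
  :crossing v w g true  true  = :ra v w :* g true true
  :crossing v w g false true  = :rc :* g false true :+ :rb v w :* g true false
  :crossing v w g true  false = :rc :* g true false :+ :rb v w :* g false true

  -- The plain variables 0, 1, 2 are taken, so the values of an unknown continuation start at 3.
  code : Bool → Bool → ℕ
  code false false = 3
  code false true  = 4
  code true  false = 5
  code true  true  = 6

  code₃ : Bool → Bool → Bool → ℕ
  code₃ false b c = code b c
  code₃ true  b c = 4 ℕ.+ code b c

  ybe-plain : (Bool → Bool → Bool → Carrier) → Vec Carrier 11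
  ybe-plain X = sq4 ∷ sq ∷ s ∷ X false false false ∷ X false false true ∷ X false true false ∷ X false true true
    ∷ X true false false ∷ X true false true ∷ X true true false ∷ X true true true ∷ []

  ybe-l ybe-r : Bool → Bool → Bool → Term
  ybe-l h b₁ b₂ =
    :crossing 2 3 (λ c₁ c₂ → :vertex 1 2 h c₁ λ h′ d₁ → :vertex 1 3 h′ c₂ λ h″ d₂ → x⟨ code₃ h″ d₁ d₂ ⟩) b₁ b₂
  ybe-r h b₁ b₂ =
    :vertex 1 3 h b₁ λ h′ d₁ → :vertex 1 2 h′ b₂ λ h″ d₂ → :crossing 2 3 (λ c₁ c₂ → x⟨ code₃ h″ c₁ c₂ ⟩) d₁ d₂

  re-plain : (Bool → Bool → Carrier) → Vec Carrier 7
  re-plain Y = sq4 ∷ sq ∷ s ∷ Y false false ∷ Y false true ∷ Y true false ∷ Y true true ∷ []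

  re-l re-r : Bool → Bool → Term
  re-l b₁ b₂ = :crossing 1 2 (λ c₁ c₂ →
    :boundary 1 c₁ λ h₁ → :vertex 1 2 h₁ c₂ λ h₁′ d → :boundary 2 d λ h₂ → x⟨ code h₁′ h₂ ⟩) b₁ b₂
  re-r b₁ b₂ =
    :boundary 2 b₁ λ h₁ → :vertex 2 1 h₁ b₂ λ h₁′ d → :boundary 1 d λ h₂ →
      :crossing 1 2 (λ c₁ c₂ → x⟨ code c₁ c₂ ⟩) h₁′ h₂

  -- For each boundary state both sides are linear in the eight values of `X`. With these as
  -- independent variables the equation is an identity of polynomials in the parameters and their
  -- inverses.
  ybe : ∀ w v₁ v₂ h b₁ b₂ (X : Bool → Bool → Bool → Carrier) →
    crossing v₁ v₂ (λ c₁ c₂ → vertex w v₁ h c₁ λ h′ d₁ → vertex w v₂ h′ c₂ λ h″ d₂ → X h″ d₁ d₂) b₁ b₂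
      ≈ vertex w v₂ h b₁ (λ h′ d₁ → vertex w v₁ h′ b₂ λ h″ d₂ → crossing v₁ v₂ (X h″) d₁ d₂)
  ybe w v₁ v₂ false false false X = Solution.solution (ybe-plain X) (q ∷ w ∷ v₁ ∷ v₂ ∷ []) (ybe-l false false false) (ybe-r false false false) [] refl
  ybe w v₁ v₂ false false true X = Solution.solution (ybe-plain X) (q ∷ w ∷ v₁ ∷ v₂ ∷ []) (ybe-l false false true) (ybe-r false false true) [] refl
  ybe w v₁ v₂ false true false X = Solution.solution (ybe-plain X) (q ∷ w ∷ v₁ ∷ v₂ ∷ []) (ybe-l false true false) (ybe-r false true false) [] refl
  ybe w v₁ v₂ false true true X = Solution.solution (ybe-plain X) (q ∷ w ∷ v₁ ∷ v₂ ∷ []) (ybe-l false true true) (ybe-r false true true) [] refl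
  ybe w v₁ v₂ true false false X = Solution.solution (ybe-plain X) (q ∷ w ∷ v₁ ∷ v₂ ∷ []) (ybe-l true false false) (ybe-r true false false) [] refl
  ybe w v₁ v₂ true false true X = Solution.solution (ybe-plain X) (q ∷ w ∷ v₁ ∷ v₂ ∷ []) (ybe-l true false true) (ybe-r true false true) [] refl
  ybe w v₁ v₂ true true false X = Solution.solution (ybe-plain X) (q ∷ w ∷ v₁ ∷ v₂ ∷ []) (ybe-l true true false) (ybe-r true true false) [] refl
  ybe w v₁ v₂ true true true X = Solution.solution (ybe-plain X) (q ∷ w ∷ v₁ ∷ v₂ ∷ []) (ybe-l true true true) (ybe-r true true true) [] refl

  -- The boundary weights solve the reflection equation for arbitrary `s` and `sq`. As for `ybe`,
  -- the values of `Y` become independent variables.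
  reflection : ∀ v₁ v₂ b₁ b₂ (Y : Bool → Bool → Carrier) →
    crossing v₁ v₂ (λ c₁ c₂ → boundary v₁ c₁ λ h₁ → vertex v₁ v₂ h₁ c₂ λ h₁′ d → boundary v₂ d λ h₂ → Y h₁′ h₂) b₁ b₂
      ≈ boundary v₂ b₁ (λ h₁ → vertex v₂ v₁ h₁ b₂ λ h₁′ d → boundary v₁ d λ h₂ → crossing v₁ v₂ Y h₁′ h₂)
  reflection v₁ v₂ false false Y = Solution.solution (re-plain Y) (q ∷ v₁ ∷ v₂ ∷ []) (re-l false false) (re-r false false) [] refl
  reflection v₁ v₂ false true Y = Solution.solution (re-plain Y) (q ∷ v₁ ∷ v₂ ∷ []) (re-l false true) (re-r false true) [] refl
  reflection v₁ v₂ true false Y = Solution.solution (re-plain Y) (q ∷ v₁ ∷ v₂ ∷ []) (re-l true false) (re-r true false) [] refl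
  reflection v₁ v₂ true true Y = Solution.solution (re-plain Y) (q ∷ v₁ ∷ v₂ ∷ []) (re-l true true) (re-r true true) [] refl

-- Symmetry of the partition function

module Exchange (K : CommutativeRing 0ℓ 0ℓ) (P : Parameters K) where
  open Ring K
  open Parameters P
  open Vertex K P

  -- Operators acting on disjoint edges commute because each of them is linear in its continuation;
  -- this record carries the linearity through whole rows.
  record Linear {I : Set} (F : (I → Carrier) → Carrier) : Set where
    field
      cong  : ∀ {g g′} → (∀ i → g i ≈ g′ i) → F g ≈ F g′
      add   : ∀ g g′ → F (λ i → g i + g′ i) ≈ F g + F g′
      scale : ∀ c g → F (λ i → c * g i) ≈ c * F g

    add₂ : ∀ c c′ g g′ → F (λ i → c * g i + c′ * g′ i) ≈ c * F g + c′ * F g′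
    add₂ c c′ g g′ = ≈-trans (add _ _) (+-cong (scale c g) (scale c′ g′))

  *-add₂ : ∀ c a a′ x x′ → a * (c * x) + a′ * (c * x′) ≈ c * (a * x + a′ * x′)
  *-add₂ c a a′ x x′ = ≈-trans (+-cong (*-swap _ _ _) (*-swap _ _ _)) (≈-sym (distribˡ _ _ _))

  +-add₂ : ∀ a a′ x x′ y y′ → a * (x + y) + a′ * (x′ + y′) ≈ (a * x + a′ * x′) + (a * y + a′ * y′)
  +-add₂ a a′ x x′ y y′ = ≈-trans (+-cong (distribˡ _ _ _) (distribˡ _ _ _)) (+-interchange _ _ _ _)

  vertex-cong : ∀ w v h b {g g′} → (∀ h b → g h b ≈ g′ h b) → vertex w v h b g ≈ vertex w v h b g′
  vertex-cong w v false false e = *-congˡ (e _ _)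
  vertex-cong w v false true  e = +-cong (*-congˡ (e _ _)) (*-congˡ (e _ _))
  vertex-cong w v true  false e = +-cong (*-congˡ (e _ _)) (*-congˡ (e _ _))
  vertex-cong w v true  true  e = *-congˡ (e _ _)

  vertex-add : ∀ w v h b g g′ →
    vertex w v h b (λ i j → g i j + g′ i j) ≈ vertex w v h b g + vertex w v h b g′
  vertex-add w v false false g g′ = distribˡ _ _ _
  vertex-add w v false true  g g′ = +-add₂ _ _ _ _ _ _
  vertex-add w v true  false g g′ = +-add₂ _ _ _ _ _ _
  vertex-add w v true  true  g g′ = distribˡ _ _ _

  vertex-scale : ∀ w v h b c g → vertex w v h b (λ i j → c * g i j) ≈ c * vertex w v h b g
  vertex-scale w v false false c g = *-swap _ _ _
  vertex-scale w v false true  c g = *-add₂ _ _ _ _ _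
  vertex-scale w v true  false c g = *-add₂ _ _ _ _ _
  vertex-scale w v true  true  c g = *-swap _ _ _

  boundary-cong : ∀ u b {g g′} → (∀ h → g h ≈ g′ h) → boundary u b g ≈ boundary u b g′
  boundary-cong u b e = +-cong (*-congˡ (e _)) (*-congˡ (e _))

  boundary-scale : ∀ u b c g → boundary u b (λ h → c * g h) ≈ c * boundary u b g
  boundary-scale u b c g = *-add₂ _ _ _ _ _

  crossing-linear : ∀ v w b₁ b₂ → Linear λ g → crossing v w (λ c₁ c₂ → g (c₁ , c₂)) b₁ b₂
  crossing-linear v w false false = record
    { cong = λ e → *-congˡ (e _) ; add = λ g g′ → distribˡ _ _ _ ; scale = λ c g → *-swap _ _ _ }
  crossing-linear v w false true = record
    { cong = λ e → +-cong (*-congˡ (e _)) (*-congˡ (e _))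
    ; add = λ g g′ → +-add₂ _ _ _ _ _ _ ; scale = λ c g → *-add₂ _ _ _ _ _ }
  crossing-linear v w true false = record
    { cong = λ e → +-cong (*-congˡ (e _)) (*-congˡ (e _))
    ; add = λ g g′ → +-add₂ _ _ _ _ _ _ ; scale = λ c g → *-add₂ _ _ _ _ _ }
  crossing-linear v w true true = record
    { cong = λ e → *-congˡ (e _) ; add = λ g g′ → distribˡ _ _ _ ; scale = λ c g → *-swap _ _ _ }

  crossing-cong : ∀ v w b₁ b₂ {g g′} → (∀ b c → g b c ≈ g′ b c) → crossing v w g b₁ b₂ ≈ crossing v w g′ b₁ b₂
  crossing-cong v w b₁ b₂ e = Linear.cong (crossing-linear v w b₁ b₂) λ (b , c) → e b c

  row-linear : ∀ {n} w h (vs : Vec U n) bs → Linear (row w h vs bs)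
  row-linear w false []       []       = record { cong = λ e → e _ ; add = λ g g′ → ≈-refl ; scale = λ c g → ≈-refl }
  row-linear w true  []       []       = record
    { cong = λ e → ≈-refl ; add = λ g g′ → ≈-sym (+-identityˡ _) ; scale = λ c g → ≈-sym (zeroʳ _) }
  row-linear w h (v ∷ vs) (b ∷ bs) = record
    { cong  = λ e → vertex-cong w v h b λ i j → Linear.cong (row-linear w i vs bs) λ x → e (j ∷ x)
    ; add   = λ g g′ → ≈-trans (vertex-cong w v h b λ i j → Linear.add (row-linear w i vs bs) _ _)
                               (vertex-add w v h b _ _)
    ; scale = λ c g → ≈-trans (vertex-cong w v h b λ i j → Linear.scale (row-linear w i vs bs) _ _)
                              (vertex-scale w v h b _ _) }

  row-cong : ∀ {n} w h (vs : Vec U n) bs {k k′} → (∀ x → k x ≈ k′ x) → row w h vs bs k ≈ row w h vs bs k′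
  row-cong w h vs bs = Linear.cong (row-linear w h vs bs)

  module _ {I : Set} {F : (I → Carrier) → Carrier} (L : Linear F) where
    open Linear L

    linear-vertex : ∀ w v h b (g : I → Bool → Bool → Carrier) →
      F (λ x → vertex w v h b (g x)) ≈ vertex w v h b λ i j → F λ x → g x i j
    linear-vertex w v false false g = scale _ _
    linear-vertex w v false true  g = add₂ _ _ _ _
    linear-vertex w v true  false g = add₂ _ _ _ _
    linear-vertex w v true  true  g = scale _ _

    linear-boundary : ∀ u b (g : I → Bool → Carrier) →
      F (λ x → boundary u b (g x)) ≈ boundary u b λ i → F λ x → g x i
    linear-boundary u b g = add₂ _ _ _ _

    linear-crossing : ∀ v w b₁ b₂ (g : I → Bool → Bool → Carrier) →
      F (λ x → crossing v w (g x) b₁ b₂) ≈ crossing v w (λ i j → F λ x → g x i j) b₁ b₂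
    linear-crossing v w false false g = scale _ _
    linear-crossing v w false true  g = add₂ _ _ _ _
    linear-crossing v w true  false g = add₂ _ _ _ _
    linear-crossing v w true  true  g = scale _ _

  -- The crossing descends through one row by the Yang-Baxter equation. The hypothesis says that
  -- everything below the row absorbs it.
  row-exchange : ∀ {m n} (ps : Vec U m) (vs : Vec U n) w v₁ v₂ h as b₁ b₂ bs {k k′} →
    (∀ ds d₁ d₂ es → crossing v₁ v₂ (λ c₁ c₂ → k (ds ++ᵥ c₁ ∷ c₂ ∷ es)) d₁ d₂ ≈ ra v₁ v₂ * k′ (ds ++ᵥ d₁ ∷ d₂ ∷ es)) →
    crossing v₁ v₂ (λ c₁ c₂ → row w h (ps ++ᵥ v₁ ∷ v₂ ∷ vs) (as ++ᵥ c₁ ∷ c₂ ∷ bs) k) b₁ b₂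
      ≈ ra v₁ v₂ * row w h (ps ++ᵥ v₂ ∷ v₁ ∷ vs) (as ++ᵥ b₁ ∷ b₂ ∷ bs) k′
  row-exchange [] vs w v₁ v₂ h [] b₁ b₂ bs {k} {k′} e = begin
    crossing v₁ v₂ (λ c₁ c₂ → row w h (v₁ ∷ v₂ ∷ vs) (c₁ ∷ c₂ ∷ bs) k) b₁ b₂
      ≈⟨ ybe w v₁ v₂ h b₁ b₂ (λ h″ d₁ d₂ → row w h″ vs bs λ es → k (d₁ ∷ d₂ ∷ es)) ⟩
    vertex w v₂ h b₁ (λ h′ d₁ → vertex w v₁ h′ b₂ λ h″ d₂ →
      crossing v₁ v₂ (λ c₁ c₂ → row w h″ vs bs λ es → k (c₁ ∷ c₂ ∷ es)) d₁ d₂)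
      ≈⟨ (vertex-cong w v₂ h b₁ λ h′ d₁ → vertex-cong w v₁ h′ b₂ λ h″ d₂ → step h″ d₁ d₂) ⟩
    vertex w v₂ h b₁ (λ h′ d₁ → vertex w v₁ h′ b₂ λ h″ d₂ → ra v₁ v₂ * row w h″ vs bs λ es → k′ (d₁ ∷ d₂ ∷ es))
      ≈⟨ (vertex-cong w v₂ h b₁ λ h′ d₁ → vertex-scale w v₁ h′ b₂ _ _) ⟩
    vertex w v₂ h b₁ (λ h′ d₁ → ra v₁ v₂ * vertex w v₁ h′ b₂ λ h″ d₂ → row w h″ vs bs λ es → k′ (d₁ ∷ d₂ ∷ es))
      ≈⟨ vertex-scale w v₂ h b₁ _ _ ⟩
    ra v₁ v₂ * row w h (v₂ ∷ v₁ ∷ vs) (b₁ ∷ b₂ ∷ bs) k′ ∎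
    where
    step : ∀ h″ d₁ d₂ → crossing v₁ v₂ (λ c₁ c₂ → row w h″ vs bs λ es → k (c₁ ∷ c₂ ∷ es)) d₁ d₂
      ≈ ra v₁ v₂ * row w h″ vs bs λ es → k′ (d₁ ∷ d₂ ∷ es)
    step h″ d₁ d₂ = ≈-trans (≈-sym (linear-crossing L v₁ v₂ d₁ d₂ _))
      (≈-trans (Linear.cong L λ es → e [] d₁ d₂ es) (Linear.scale L _ _))
      where L = row-linear w h″ vs bs
  row-exchange (p ∷ ps) vs w v₁ v₂ h (a ∷ as) b₁ b₂ bs e = ≈-trans
    (linear-vertex (crossing-linear v₁ v₂ b₁ b₂) w p h a _)
    (≈-trans
      (vertex-cong w p h a λ h′ a′ → row-exchange ps vs w v₁ v₂ h′ as b₁ b₂ bs λ ds → e (a′ ∷ ds))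
      (vertex-scale w p h a _ _))

  rows : ∀ {n} → U → U → Bool → Bool → Vec U n → Vec Bool n → (Vec Bool n → Carrier) → Carrier
  rows v₁ v₂ h₁ h₂ vs bs k = row v₁ h₁ vs bs λ x → row v₂ h₂ vs x k

  -- A vertex is unchanged by reflection in the diagonal. Hence `ybe`, stated for two columns
  -- crossing a row, also serves for two rows crossing a column.
  vertex-transpose : ∀ w v h b g → vertex w v h b g ≈ vertex v w b h (λ i j → g j i)
  vertex-transpose w v false false g = *-congʳ (*-congʳ (+-cong
    (≈-trans (*-assoc _ _ _) (≈-trans (*-congˡ (*-comm _ _)) (≈-sym (*-assoc _ _ _))))
    (-‿cong (≈-trans (*-assoc _ _ _) (≈-trans (*-congˡ (*-comm _ _)) (≈-sym (*-assoc _ _ _)))))))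
  vertex-transpose w v true true g = *-congʳ (*-congʳ (+-cong
    (≈-trans (*-assoc _ _ _) (≈-trans (*-congˡ (*-comm _ _)) (≈-sym (*-assoc _ _ _))))
    (-‿cong (≈-trans (*-assoc _ _ _) (≈-trans (*-congˡ (*-comm _ _)) (≈-sym (*-assoc _ _ _)))))))
  vertex-transpose w v false true g = +-congʳ (*-congʳ (*-congʳ (+-cong
    (≈-trans (*-assoc _ _ _) (≈-trans (*-congˡ (*-comm _ _)) (≈-sym (*-assoc _ _ _))))
    (-‿cong (≈-trans (*-assoc _ _ _) (≈-trans (*-congˡ (*-comm _ _)) (≈-sym (*-assoc _ _ _))))))))
  vertex-transpose w v true false g = +-congʳ (*-congʳ (*-congʳ (+-cong
    (≈-trans (*-assoc _ _ _) (≈-trans (*-congˡ (*-comm _ _)) (≈-sym (*-assoc _ _ _))))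
    (-‿cong (≈-trans (*-assoc _ _ _) (≈-trans (*-congˡ (*-comm _ _)) (≈-sym (*-assoc _ _ _))))))))

  rows-unfold : ∀ {n} v₁ v₂ h₁ h₂ v b (vs : Vec U n) bs k →
    rows v₁ v₂ h₁ h₂ (v ∷ vs) (b ∷ bs) k
      ≈ vertex v v₁ b h₁ (λ b′ h₁′ → vertex v v₂ b′ h₂ λ b″ h₂′ → rows v₁ v₂ h₁′ h₂′ vs bs λ x → k (b″ ∷ x))
  rows-unfold v₁ v₂ h₁ h₂ v b vs bs k = ≈-trans
    (vertex-cong v₁ v h₁ b λ h₁′ b′ → ≈-trans (linear-vertex (row-linear v₁ h₁′ vs bs) v₂ v h₂ b′ _)
      (vertex-transpose v₂ v h₂ b′ _))
    (vertex-transpose v₁ v h₁ b _)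

  -- The crossing travels to the right along two rows. At the right boundary both arrows must point
  -- left or the sum is zero, and on that state it acts as the scalar `ra`.
  rows-exchange : ∀ {n} v₁ v₂ h₁ h₂ (vs : Vec U n) bs k →
    crossing v₁ v₂ (λ h₁ h₂ → rows v₁ v₂ h₁ h₂ vs bs k) h₁ h₂ ≈ ra v₁ v₂ * rows v₂ v₁ h₁ h₂ vs bs k
  rows-exchange v₁ v₂ false false [] [] k = ≈-refl
  rows-exchange v₁ v₂ false true  [] [] k = ≈-trans (+-cong (zeroʳ _) (zeroʳ _)) (≈-trans (+-identityˡ _) (≈-sym (zeroʳ _)))
  rows-exchange v₁ v₂ true  false [] [] k = ≈-trans (+-cong (zeroʳ _) (zeroʳ _)) (≈-trans (+-identityˡ _) (≈-sym (zeroʳ _)))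
  rows-exchange v₁ v₂ true  true  [] [] k = ≈-refl
  rows-exchange v₁ v₂ h₁ h₂ (v ∷ vs) (b ∷ bs) k = begin
    crossing v₁ v₂ (λ h₁ h₂ → rows v₁ v₂ h₁ h₂ (v ∷ vs) (b ∷ bs) k) h₁ h₂
      ≈⟨ crossing-cong v₁ v₂ h₁ h₂ (λ h₁ h₂ → rows-unfold v₁ v₂ h₁ h₂ v b vs bs k) ⟩
    crossing v₁ v₂ (λ h₁ h₂ → vertex v v₁ b h₁ λ b′ h₁′ → vertex v v₂ b′ h₂ λ b″ h₂′ →
      rows v₁ v₂ h₁′ h₂′ vs bs λ x → k (b″ ∷ x)) h₁ h₂
      ≈⟨ ybe v v₁ v₂ b h₁ h₂ (λ b″ h₁′ h₂′ → rows v₁ v₂ h₁′ h₂′ vs bs λ x → k (b″ ∷ x)) ⟩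
    vertex v v₂ b h₁ (λ b′ d₁ → vertex v v₁ b′ h₂ λ b″ d₂ →
      crossing v₁ v₂ (λ c₁ c₂ → rows v₁ v₂ c₁ c₂ vs bs λ x → k (b″ ∷ x)) d₁ d₂)
      ≈⟨ (vertex-cong v v₂ b h₁ λ b′ d₁ → ≈-trans
           (vertex-cong v v₁ b′ h₂ λ b″ d₂ → rows-exchange v₁ v₂ d₁ d₂ vs bs _) (vertex-scale v v₁ b′ h₂ _ _)) ⟩
    vertex v v₂ b h₁ (λ b′ d₁ → ra v₁ v₂ * vertex v v₁ b′ h₂ λ b″ d₂ → rows v₂ v₁ d₁ d₂ vs bs λ x → k (b″ ∷ x))
      ≈⟨ vertex-scale v v₂ b h₁ _ _ ⟩
    ra v₁ v₂ * vertex v v₂ b h₁ (λ b′ d₁ → vertex v v₁ b′ h₂ λ b″ d₂ → rows v₂ v₁ d₁ d₂ vs bs λ x → k (b″ ∷ x))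
      ≈⟨ *-congˡ (rows-unfold v₂ v₁ h₁ h₂ v b vs bs k) ⟨
    ra v₁ v₂ * rows v₂ v₁ h₁ h₂ (v ∷ vs) (b ∷ bs) k ∎

  Ψ-unfold : ∀ {n} v₁ v₂ b₁ b₂ (vs : Vec U n) bs → Ψ (v₁ ∷ v₂ ∷ vs) (b₁ ∷ b₂ ∷ bs)
    ≈ boundary v₁ b₁ (λ h₁ → vertex v₁ v₂ h₁ b₂ λ h₁′ d → boundary v₂ d λ h₂ → rows v₁ v₂ h₁′ h₂ vs bs (Ψ vs))
  Ψ-unfold v₁ v₂ b₁ b₂ vs bs = boundary-cong v₁ b₁ λ h₁ → vertex-cong v₁ v₂ h₁ b₂ λ h₁′ d →
    linear-boundary (row-linear v₁ h₁′ vs bs) v₂ d λ x h₂ → row v₂ h₂ vs x (Ψ vs)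

  -- The crossing enters at the top of two neighbouring columns, descends through the rows above
  -- their turning points, is reflected where both columns become rows, and leaves at the right
  -- boundary.
  Ψ-exchange : ∀ {m n} (ps : Vec U m) (vs : Vec U n) v₁ v₂ as b₁ b₂ bs →
    crossing v₁ v₂ (λ c₁ c₂ → Ψ (ps ++ᵥ v₁ ∷ v₂ ∷ vs) (as ++ᵥ c₁ ∷ c₂ ∷ bs)) b₁ b₂
      ≈ ra v₁ v₂ * Ψ (ps ++ᵥ v₂ ∷ v₁ ∷ vs) (as ++ᵥ b₁ ∷ b₂ ∷ bs)
  Ψ-exchange [] vs v₁ v₂ [] b₁ b₂ bs = begin
    crossing v₁ v₂ (λ c₁ c₂ → Ψ (v₁ ∷ v₂ ∷ vs) (c₁ ∷ c₂ ∷ bs)) b₁ b₂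
      ≈⟨ crossing-cong v₁ v₂ b₁ b₂ (λ c₁ c₂ → Ψ-unfold v₁ v₂ c₁ c₂ vs bs) ⟩
    crossing v₁ v₂ (λ c₁ c₂ → boundary v₁ c₁ λ h₁ → vertex v₁ v₂ h₁ c₂ λ h₁′ d → boundary v₂ d λ h₂ →
      rows v₁ v₂ h₁′ h₂ vs bs (Ψ vs)) b₁ b₂
      ≈⟨ reflection v₁ v₂ b₁ b₂ (λ h₁ h₂ → rows v₁ v₂ h₁ h₂ vs bs (Ψ vs)) ⟩
    boundary v₂ b₁ (λ h₁ → vertex v₂ v₁ h₁ b₂ λ h₁′ d → boundary v₁ d λ h₂ →
      crossing v₁ v₂ (λ h₁ h₂ → rows v₁ v₂ h₁ h₂ vs bs (Ψ vs)) h₁′ h₂)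
      ≈⟨ (boundary-cong v₂ b₁ λ h₁ → ≈-trans
           (vertex-cong v₂ v₁ h₁ b₂ λ h₁′ d → ≈-trans
             (boundary-cong v₁ d λ h₂ → rows-exchange v₁ v₂ h₁′ h₂ vs bs (Ψ vs))
             (boundary-scale v₁ d _ λ h₂ → rows v₂ v₁ h₁′ h₂ vs bs (Ψ vs)))
           (vertex-scale v₂ v₁ h₁ b₂ _ _)) ⟩
    boundary v₂ b₁ (λ h₁ → ra v₁ v₂ * vertex v₂ v₁ h₁ b₂ λ h₁′ d → boundary v₁ d λ h₂ →
      rows v₂ v₁ h₁′ h₂ vs bs (Ψ vs))
      ≈⟨ boundary-scale v₂ b₁ _ (λ h₁ → vertex v₂ v₁ h₁ b₂ λ h₁′ d → boundary v₁ d λ h₂ → rows v₂ v₁ h₁′ h₂ vs bs (Ψ vs)) ⟩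
    ra v₁ v₂ * boundary v₂ b₁ (λ h₁ → vertex v₂ v₁ h₁ b₂ λ h₁′ d → boundary v₁ d λ h₂ →
      rows v₂ v₁ h₁′ h₂ vs bs (Ψ vs))
      ≈⟨ *-congˡ (Ψ-unfold v₂ v₁ b₁ b₂ vs bs) ⟨
    ra v₁ v₂ * Ψ (v₂ ∷ v₁ ∷ vs) (b₁ ∷ b₂ ∷ bs) ∎
  Ψ-exchange (p ∷ ps) vs v₁ v₂ (a ∷ as) b₁ b₂ bs = ≈-trans
    (linear-boundary (crossing-linear v₁ v₂ b₁ b₂) p a
      λ (c₁ , c₂) h → row p h (ps ++ᵥ v₁ ∷ v₂ ∷ vs) (as ++ᵥ c₁ ∷ c₂ ∷ bs) (Ψ (ps ++ᵥ v₁ ∷ v₂ ∷ vs)))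
    (≈-trans
      (boundary-cong p a λ h → row-exchange ps vs p v₁ v₂ h as b₁ b₂ bs λ ds d₁ d₂ es →
        Ψ-exchange ps vs v₁ v₂ ds d₁ d₂ es)
      (boundary-scale p a _ λ h → row p h (ps ++ᵥ v₂ ∷ v₁ ∷ vs) (as ++ᵥ b₁ ∷ b₂ ∷ bs) (Ψ (ps ++ᵥ v₂ ∷ v₁ ∷ vs))))

  replicate-++ : ∀ m n → Vec.replicate (m ℕ.+ suc (suc n)) false
    ≡ Vec.replicate m false ++ᵥ false ∷ false ∷ Vec.replicate n false
  replicate-++ zero    n = refl
  replicate-++ (suc m) n = ≡.cong (false ∷_) (replicate-++ m n)

  -- On two upward arrows the crossing is the scalar `ra`. The scalar stays on both sides, since it
  -- may be a zero divisor in `K`.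
  Z-exchange : ∀ {m n} (ps : Vec U m) (vs : Vec U n) v₁ v₂ →
    ra v₁ v₂ * Z (ps ++ᵥ v₁ ∷ v₂ ∷ vs) ≈ ra v₁ v₂ * Z (ps ++ᵥ v₂ ∷ v₁ ∷ vs)
  Z-exchange {m} {n} ps vs v₁ v₂ rewrite replicate-++ m n =
    Ψ-exchange ps vs v₁ v₂ (Vec.replicate m false) false false (Vec.replicate n false)

-- Ring homomorphisms, units and regular elements

record Hom (A B : CommutativeRing 0ℓ 0ℓ) : Set where
  private
    module A = CommutativeRing A
    module B = CommutativeRing B
  field
    ⟦_⟧    : A.Carrier → B.Carrier
    ⟦⟧-cong : ∀ {x y} → x A.≈ y → ⟦ x ⟧ B.≈ ⟦ y ⟧
    +-homo : ∀ x y → ⟦ x A.+ y ⟧ B.≈ ⟦ x ⟧ B.+ ⟦ y ⟧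
    *-homo : ∀ x y → ⟦ x A.* y ⟧ B.≈ ⟦ x ⟧ B.* ⟦ y ⟧
    -‿homo : ∀ x → ⟦ A.- x ⟧ B.≈ B.- ⟦ x ⟧
    0-homo : ⟦ A.0# ⟧ B.≈ B.0#
    1-homo : ⟦ A.1# ⟧ B.≈ B.1#

  mapUnit : Invertible A → Invertible B
  mapUnit u = unit ⟦ val u ⟧ ⟦ inv u ⟧ (B.trans (B.sym (*-homo _ _)) (B.trans (⟦⟧-cong (val*inv u)) 1-homo))

module Inv (K : CommutativeRing 0ℓ 0ℓ) where
  open Ring K

  infixl 7 _·_
  _·_ : Invertible K → Invertible K → Invertible K
  u · v = unit (val u * val v) (inv u * inv v)
    (≈-trans (*-interchange _ _ _ _) (≈-trans (*-cong (val*inv u) (val*inv v)) (*-identityˡ _)))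

  _⁻¹ : Invertible K → Invertible K
  u ⁻¹ = unit (inv u) (val u) (≈-trans (*-comm _ _) (val*inv u))

  -- Non-zero-divisors take the place of nonzero elements, as the ring may contain nilpotents.
  record Regular (r : Carrier) : Set where
    constructor regular
    field annihilator : ∀ p → r * p ≈ 0# → p ≈ 0#
  open Regular

  Regular-cong : ∀ {r t} → r ≈ t → Regular r → Regular t
  Regular-cong e f = regular λ p h → annihilator f p (≈-trans (*-congʳ e) h)

  Regular-* : ∀ {r t} → Regular r → Regular t → Regular (r * t)
  Regular-* f g = regular λ p h → annihilator g p (annihilator f _ (≈-trans (≈-sym (*-assoc _ _ _)) h))

  Regular-unit : (u : Invertible K) → Regular (val u)
  Regular-unit u = regular λ p h → begin
    p                     ≈⟨ *-identityˡ p ⟨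
    1# * p                ≈⟨ *-congʳ (≈-trans (*-comm _ _) (val*inv u)) ⟨
    inv u * val u * p     ≈⟨ *-assoc _ _ _ ⟩
    inv u * (val u * p)   ≈⟨ *-congˡ h ⟩
    inv u * 0#            ≈⟨ zeroʳ _ ⟩
    0#                    ∎

  Regular-neg : ∀ {r} → Regular r → Regular (- r)
  Regular-neg {r} f = regular λ p h → annihilator f p (≈-trans (≈-sym (-‿involutive _))
    (≈-trans (-‿cong (≈-trans (-‿distribˡ-* r p) h)) -0#≈0#))

  cancel : ∀ {r x y} → Regular r → r * x ≈ r * y → x ≈ y
  cancel {r} {x} {y} f h = begin
    x               ≈⟨ +-identityʳ x ⟨
    x + 0#          ≈⟨ +-congˡ (-‿inverseˡ y) ⟨
    x + (- y + y)   ≈⟨ +-assoc _ _ _ ⟨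
    x + - y + y     ≈⟨ +-congʳ (annihilator f (x + - y) (≈-trans (distribˡ _ _ _) (≈-trans (+-congˡ (≈-sym (-‿distribʳ-* _ _)))
                          (≈-trans (+-congʳ h) (-‿inverseʳ _))))) ⟩
    0# + y          ≈⟨ +-identityˡ y ⟩
    y               ∎

-- Laurent polynomials

-- Laurent polynomials in t over K as lists of (exponent, coefficient), two lists
-- being identified when every K-linear functional on monomials agrees on them.
module LaurentPolynomials (K : CommutativeRing 0ℓ 0ℓ) where
  open Ring K

  LPoly : Set
  LPoly = List (ℤ × Carrier)

  pair : LPoly → (ℤ → Carrier) → Carrier
  pair []            φ = 0#
  pair ((e , c) ∷ p) φ = c * φ e + pair p φ

  infix 4 _∼_
  record _∼_ (p q : LPoly) : Set where
    constructor agree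
    field on : ∀ φ → pair p φ ≈ pair q φ
  open _∼_

  shift : ℤ → Carrier → LPoly → LPoly
  shift e c = List.map λ (f , d) → (e ℤ.+ f) , (c * d)

  mul : LPoly → LPoly → LPoly
  mul []            q = []
  mul ((e , c) ∷ p) q = shift e c q ++ mul p q

  neg : LPoly → LPoly
  neg = List.map λ (e , c) → e , - c

  pair-cong : ∀ p {φ ψ} → (∀ e → φ e ≈ ψ e) → pair p φ ≈ pair p ψ
  pair-cong []            h = ≈-refl
  pair-cong ((e , c) ∷ p) h = +-cong (*-congˡ (h e)) (pair-cong p h)

  pair-++ : ∀ p q φ → pair (p ++ q) φ ≈ pair p φ + pair q φ
  pair-++ []            q φ = ≈-sym (+-identityˡ _)
  pair-++ ((e , c) ∷ p) q φ = ≈-trans (+-congˡ (pair-++ p q φ)) (≈-sym (+-assoc _ _ _))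

  pair-shift : ∀ e c q φ → pair (shift e c q) φ ≈ c * pair q λ f → φ (e ℤ.+ f)
  pair-shift e c []            φ = ≈-sym (zeroʳ _)
  pair-shift e c ((f , d) ∷ q) φ =
    ≈-trans (+-cong (*-assoc _ _ _) (pair-shift e c q φ)) (≈-sym (distribˡ _ _ _))

  -- Multiplication is convolution, seen through functionals. The ring laws then amount to
  -- regrouping and interchanging iterated pairings.
  pair-mul : ∀ p q φ → pair (mul p q) φ ≈ pair p λ e → pair q λ f → φ (e ℤ.+ f)
  pair-mul []            q φ = ≈-refl
  pair-mul ((e , c) ∷ p) q φ =
    ≈-trans (pair-++ (shift e c q) (mul p q) φ) (+-cong (pair-shift e c q φ) (pair-mul p q φ))

  pair-neg : ∀ p φ → pair (neg p) φ ≈ - pair p φ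
  pair-neg []            φ = ≈-sym -0#≈0#
  pair-neg ((e , c) ∷ p) φ = ≈-trans (+-cong (≈-sym (-‿distribˡ-* _ _)) (pair-neg p φ)) (-‿+-comm _ _)

  pair-zero : ∀ p → pair p (λ _ → 0#) ≈ 0#
  pair-zero []            = ≈-refl
  pair-zero ((e , c) ∷ p) = ≈-trans (+-cong (zeroʳ _) (pair-zero p)) (+-identityˡ _)

  pair-add : ∀ p φ ψ → pair p (λ e → φ e + ψ e) ≈ pair p φ + pair p ψ
  pair-add []            φ ψ = ≈-sym (+-identityˡ _)
  pair-add ((e , c) ∷ p) φ ψ = begin
    c * (φ e + ψ e) + pair p (λ e → φ e + ψ e)        ≈⟨ +-cong (distribˡ _ _ _) (pair-add p φ ψ) ⟩
    (c * φ e + c * ψ e) + (pair p φ + pair p ψ)       ≈⟨ +-interchange _ _ _ _ ⟩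
    (c * φ e + pair p φ) + (c * ψ e + pair p ψ)       ∎
  pair-scale : ∀ p a φ → pair p (λ e → a * φ e) ≈ a * pair p φ
  pair-scale []            a φ = ≈-sym (zeroʳ _)
  pair-scale ((e , c) ∷ p) a φ = ≈-trans (+-cong (*-swap _ _ _) (pair-scale p a φ)) (≈-sym (distribˡ _ _ _))

  pair-swap : ∀ p q (χ : ℤ → ℤ → Carrier) →
    pair p (λ e → pair q λ f → χ e f) ≈ pair q λ f → pair p λ e → χ e f
  pair-swap []            q χ = ≈-sym (pair-zero q)
  pair-swap ((e , c) ∷ p) q χ = ≈-trans (+-cong (≈-sym (pair-scale q c _)) (pair-swap p q χ))
    (≈-sym (pair-add q _ _))

  mul-cong : ∀ {p p′ q q′} → p ∼ p′ → q ∼ q′ → mul p q ∼ mul p′ q′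
  mul-cong {p} {p′} {q} {q′} h k = agree λ φ → begin
    pair (mul p q) φ                            ≈⟨ pair-mul p q φ ⟩
    pair p (λ e → pair q λ f → φ (e ℤ.+ f))      ≈⟨ on h _ ⟩
    pair p′ (λ e → pair q λ f → φ (e ℤ.+ f))     ≈⟨ pair-cong p′ (λ e → on k _) ⟩
    pair p′ (λ e → pair q′ λ f → φ (e ℤ.+ f))    ≈⟨ pair-mul p′ q′ φ ⟨
    pair (mul p′ q′) φ                          ∎

  mul-assoc : ∀ p q r → mul (mul p q) r ∼ mul p (mul q r)
  mul-assoc p q r = agree λ φ → begin
    pair (mul (mul p q) r) φ                                       ≈⟨ pair-mul (mul p q) r φ ⟩
    pair (mul p q) (λ a → pair r λ g → φ (a ℤ.+ g))                 ≈⟨ pair-mul p q _ ⟩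
    pair p (λ e → pair q λ f → pair r λ g → φ ((e ℤ.+ f) ℤ.+ g))
      ≈⟨ (pair-cong p λ e → pair-cong q λ f → pair-cong r λ g → reflexive (≡.cong φ (ℤP.+-assoc e f g))) ⟩
    pair p (λ e → pair q λ f → pair r λ g → φ (e ℤ.+ (f ℤ.+ g)))    ≈⟨ (pair-cong p λ e → pair-mul q r _) ⟨
    pair p (λ e → pair (mul q r) λ a → φ (e ℤ.+ a))                 ≈⟨ pair-mul p (mul q r) φ ⟨
    pair (mul p (mul q r)) φ                                       ∎

  mul-comm : ∀ p q → mul p q ∼ mul q p
  mul-comm p q = agree λ φ → begin
    pair (mul p q) φ                            ≈⟨ pair-mul p q φ ⟩
    pair p (λ e → pair q λ f → φ (e ℤ.+ f))      ≈⟨ pair-swap p q _ ⟩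
    pair q (λ f → pair p λ e → φ (e ℤ.+ f))
      ≈⟨ (pair-cong q λ f → pair-cong p λ e → reflexive (≡.cong φ (ℤP.+-comm e f))) ⟩
    pair q (λ f → pair p λ e → φ (f ℤ.+ e))      ≈⟨ pair-mul q p φ ⟨
    pair (mul q p) φ                            ∎

  monomial : Carrier → ℤ → LPoly
  monomial c k = (k , c) ∷ []

  mul-identityˡ : ∀ p → mul (monomial 1# (+ 0)) p ∼ p
  mul-identityˡ p = agree λ φ → begin
    pair (mul (monomial 1# (+ 0)) p) φ          ≈⟨ pair-mul (monomial 1# (+ 0)) p φ ⟩
    1# * pair p (λ f → φ (+ 0 ℤ.+ f)) + 0#      ≈⟨ ≈-trans (+-identityʳ _) (*-identityˡ _) ⟩
    pair p (λ f → φ (+ 0 ℤ.+ f))                ≈⟨ pair-cong p (λ f → reflexive (≡.cong φ (ℤP.+-identityˡ f))) ⟩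
    pair p φ                                    ∎

  mul-distribʳ : ∀ r p q → mul (p ++ q) r ∼ mul p r ++ mul q r
  mul-distribʳ r p q = agree λ φ → ≈-trans (pair-mul (p ++ q) r φ) (≈-trans (pair-++ p q _)
    (≈-sym (≈-trans (pair-++ (mul p r) (mul q r) φ) (+-cong (pair-mul p r φ) (pair-mul q r φ)))))

  ∼-refl : ∀ {p} → p ∼ p
  ∼-refl = agree λ φ → ≈-refl
  ∼-sym : ∀ {p q} → p ∼ q → q ∼ p
  ∼-sym h = agree λ φ → ≈-sym (on h φ)
  ∼-trans : ∀ {p q r} → p ∼ q → q ∼ r → p ∼ r
  ∼-trans h k = agree λ φ → ≈-trans (on h φ) (on k φ)

  ++-cong : ∀ {p p′ q q′} → p ∼ p′ → q ∼ q′ → p ++ q ∼ p′ ++ q′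
  ++-cong {p} {p′} {q} {q′} h k = agree λ φ →
    ≈-trans (pair-++ p q φ) (≈-trans (+-cong (on h φ) (on k φ)) (≈-sym (pair-++ p′ q′ φ)))

  ++-commutes : ∀ p q → p ++ q ∼ q ++ p
  ++-commutes p q = agree λ φ → ≈-trans (pair-++ p q φ) (≈-trans (+-comm _ _) (≈-sym (pair-++ q p φ)))

  neg-inverseˡ : ∀ p → neg p ++ p ∼ []
  neg-inverseˡ p = agree λ φ → ≈-trans (pair-++ (neg p) p φ) (≈-trans (+-congʳ (pair-neg p φ)) (-‿inverseˡ _))

  laurentRing : CommutativeRing 0ℓ 0ℓ
  laurentRing = record
    { Carrier = LPoly ; _≈_ = _∼_ ; _+_ = _++_ ; _*_ = mul ; -_ = neg ; 0# = [] ; 1# = monomial 1# (+ 0)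
    ; isCommutativeRing = record
      { isRing = record
        { +-isAbelianGroup = record
          { isGroup = record
            { isMonoid = record
              { isSemigroup = record
                { isMagma = record
                  { isEquivalence = record { refl = ∼-refl ; sym = ∼-sym ; trans = ∼-trans }
                  ; ∙-cong = λ {p} {p′} {q} {q′} → ++-cong {p} {p′} {q} {q′} }
                ; assoc = λ p q r → agree λ φ → reflexive (≡.cong (λ l → pair l φ) (++-assoc p q r)) }
              ; identity = (λ p → ∼-refl) , λ p → ∼-trans (++-commutes p []) ∼-refl }
            ; inverse = neg-inverseˡ , λ p → ∼-trans (++-commutes p (neg p)) (neg-inverseˡ p)
            ; ⁻¹-cong = λ {p} {q} h → agree λ φ →
                ≈-trans (pair-neg p φ) (≈-trans (-‿cong (on h φ)) (≈-sym (pair-neg q φ))) }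
          ; comm = ++-commutes }
        ; *-cong = mul-cong
        ; *-assoc = mul-assoc
        ; *-identity = mul-identityˡ , λ p → ∼-trans (mul-comm p _) (mul-identityˡ p)
        ; distrib = (λ r p q → ∼-trans (mul-comm r (p ++ q)) (∼-trans (mul-distribʳ r p q)
                      (++-cong {mul p r} {mul r p} {mul q r} {mul r q} (mul-comm p r) (mul-comm q r))))
                  , mul-distribʳ }
      ; *-comm = mul-comm } }

  atOne : Hom laurentRing K
  atOne = record
    { ⟦_⟧ = λ p → pair p λ _ → 1#
    ; ⟦⟧-cong = λ h → on h _
    ; +-homo = λ p q → pair-++ p q _
    ; *-homo = λ p q → ≈-trans (pair-mul p q _) (≈-trans
        (pair-cong p λ e → ≈-sym (*-identityʳ _)) (≈-trans (pair-scale p _ _) (*-comm _ _)))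
    ; -‿homo = λ p → pair-neg p _
    ; 0-homo = ≈-refl
    ; 1-homo = ≈-trans (+-identityʳ _) (*-identityˡ _) }

  constant : Hom K laurentRing
  constant = record
    { ⟦_⟧ = λ c → monomial c (+ 0)
    ; ⟦⟧-cong = λ h → agree λ φ → +-congʳ (*-congʳ h)
    ; +-homo = λ c d → agree λ φ → ≈-trans (+-identityʳ _) (≈-trans (distribʳ _ _ _) (+-congˡ (≈-sym (+-identityʳ _))))
    ; *-homo = λ c d → ∼-refl
    ; -‿homo = λ c → ∼-refl
    ; 0-homo = agree λ φ → ≈-trans (+-identityʳ _) (zeroˡ _)
    ; 1-homo = ∼-refl }

  monomialUnit : Invertible K → ℤ → Invertible laurentRing
  monomialUnit u k = unit (monomial (val u) k) (monomial (inv u) (ℤ.- k)) (agree λ φ →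
    +-congʳ (*-cong (val*inv u) (reflexive (≡.cong φ (ℤP.+-inverseʳ k)))))

  atOne-monomial : ∀ c k → Hom.⟦_⟧ atOne (monomial c k) ≈ c
  atOne-monomial c k = ≈-trans (+-identityʳ _) (*-identityʳ _)

  Bounded : ℕ → LPoly → Set
  Bounded B = All λ (e , _) → ℤ.∣ e ∣ ℕ.≤ B

  bounded : ∀ p → ∃ λ B → Bounded B p
  bounded []            = 0 , []
  bounded ((e , c) ∷ p) with bounded p
  ... | B , h = ℤ.∣ e ∣ ℕ.⊔ B , ℕP.m≤m⊔n _ _ ∷ All.map (λ k → ℕP.≤-trans k (ℕP.m≤n⊔m _ _)) h

  pair-bounded : ∀ {B p φ ψ} → Bounded B p → (∀ e → ℤ.∣ e ∣ ℕ.≤ B → φ e ≈ ψ e) → pair p φ ≈ pair p ψ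
  pair-bounded []       h = ≈-refl
  pair-bounded (b ∷ bs) h = +-cong (*-congˡ (h _ b)) (pair-bounded bs h)

  -- Only large positive exponents are cut off, because the shifts in `self-similar-zero` all go
  -- upwards.
  truncate : ℕ → (ℤ → Carrier) → ℤ → Carrier
  truncate B ψ (+ a)    = if a ℕ.≤ᵇ B then ψ (+ a) else 0#
  truncate B ψ -[1+ a ] = ψ -[1+ a ]

  truncate-inside : ∀ B ψ e → ℤ.∣ e ∣ ℕ.≤ B → truncate B ψ e ≈ ψ e
  truncate-inside B ψ (+ a) h with a ℕ.≤ᵇ B | ℕP.≤⇒≤ᵇ h
  ... | true | _ = ≈-refl
  truncate-inside B ψ -[1+ a ] h = ≈-refl

  truncate-large : ∀ B ψ a → B ℕ.< a → truncate B ψ (+ a) ≈ 0#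
  truncate-large B ψ a h with a ℕ.≤ᵇ B | ℕP.≤ᵇ⇒≤ a B
  ... | true  | f = ⊥-elim (ℕP.<⇒≱ h (f tt))
  ... | false | _ = ≈-refl

  truncate-outside : ∀ B ψ N e → B ℕ.+ B ℕ.< N → ℤ.∣ e ∣ ℕ.≤ B → truncate B ψ (+ N ℤ.+ e) ≈ 0#
  truncate-outside B ψ N (+ a) h k =
    truncate-large B ψ (N ℕ.+ a) (ℕP.<-≤-trans (ℕP.≤-<-trans (ℕP.m≤m+n B B) h) (ℕP.m≤m+n N a))
  truncate-outside B ψ N -[1+ a ] h k = ≈-trans
    (reflexive (≡.cong (truncate B ψ) (ℤP.⊖-≥ (ℕP.≤-trans k (ℕP.≤-trans (ℕP.m≤m+n B B) (ℕP.<⇒≤ h))))))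
    (truncate-large B ψ (N ∸ suc a) (ℕP.≤-trans (ℕP.m+n≤o⇒m≤o∸n (suc B) (ℕP.≤-trans (ℕP.+-monoʳ-≤ (suc B) k) h)) ℕP.≤-refl))

  -- If p equals c tⁿ⁺¹ p, iterating the relation moves the finite support of p
  -- beyond its own bound.
  self-similar-zero : ∀ p c n → (∀ φ → pair p φ ≈ c * pair p λ e → φ (+ suc n ℤ.+ e)) → p ∼ []
  self-similar-zero p c n h = agree λ ψ → begin
    pair p ψ                                        ≈⟨ pair-bounded b (truncate-inside B ψ) ⟨
    pair p (truncate B ψ)                           ≈⟨ iterate M (truncate B ψ) ⟩
    pow K c M * pair p (λ e → truncate B ψ (+ (M ℕ.* suc n) ℤ.+ e))
      ≈⟨ *-congˡ (≈-trans (pair-bounded b λ e → truncate-outside B ψ (M ℕ.* suc n) e large) (pair-zero p)) ⟩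
    pow K c M * 0#                                  ≈⟨ zeroʳ _ ⟩
    0#                                              ∎
    where
    B = proj₁ (bounded p)
    b = proj₂ (bounded p)
    M = suc (B ℕ.+ B)
    large : B ℕ.+ B ℕ.< M ℕ.* suc n
    large = ℕP.m≤m*n M (suc n)
    iterate : ∀ M φ → pair p φ ≈ pow K c M * pair p λ e → φ (+ (M ℕ.* suc n) ℤ.+ e)
    iterate zero    φ = ≈-sym (≈-trans (*-identityˡ _)
      (pair-cong p λ e → reflexive (≡.cong φ (ℤP.+-identityˡ e))))
    iterate (suc M) φ = begin
      pair p φ                                                        ≈⟨ h φ ⟩
      c * pair p (λ e → φ (+ suc n ℤ.+ e))                            ≈⟨ *-congˡ (iterate M _) ⟩
      c * (pow K c M * pair p λ e → φ (+ suc n ℤ.+ (+ (M ℕ.* suc n) ℤ.+ e)))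
        ≈⟨ *-assoc _ _ _ ⟨
      pow K c (suc M) * pair p (λ e → φ (+ suc n ℤ.+ (+ (M ℕ.* suc n) ℤ.+ e)))
        ≈⟨ *-congˡ (pair-cong p λ e → reflexive (≡.cong φ (≡.sym (ℤP.+-assoc (+ suc n) (+ (M ℕ.* suc n)) e)))) ⟩
      pow K c (suc M) * pair p (λ e → φ (+ (suc M ℕ.* suc n) ℤ.+ e)) ∎

  open Inv laurentRing using (Regular; regular; Regular-neg; Regular-cong)

  private module L = CommutativeRing laurentRing

  -- Multiplying the hypothesis by u tⁿ⁺¹ gives p = u² t²ⁿ⁺² p, the self-similarity that forces p to
  -- vanish.
  σ-annihilated : ∀ (u : Invertible K) n p →
    mul (monomial (val u) (+ suc n) ++ neg (monomial (inv u) (ℤ.- (+ suc n)))) p ∼ [] →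
    ∀ φ → pair p φ ≈ (val u * val u) * pair p λ e → φ (+ suc (n ℕ.+ suc n) ℤ.+ e)
  σ-annihilated u n p h φ = begin
    pair p φ                                                       ≈⟨ *-identityˡ _ ⟨
    1# * pair p φ                                                  ≈⟨ *-congʳ (val*inv u) ⟨
    (val u * inv u) * pair p φ                                     ≈⟨ *-assoc _ _ _ ⟩
    val u * (inv u * pair p φ)                                     ≈⟨ *-congˡ key ⟨
    val u * (val u * pair p λ e → φ (+ suc (n ℕ.+ suc n) ℤ.+ e))   ≈⟨ *-assoc _ _ _ ⟨
    (val u * val u) * pair p (λ e → φ (+ suc (n ℕ.+ suc n) ℤ.+ e)) ∎
    where
    key : val u * pair p (λ e → φ (+ suc (n ℕ.+ suc n) ℤ.+ e)) ≈ inv u * pair p φ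
    key = begin
      x                   ≈⟨ +-identityʳ x ⟨
      x + 0#              ≈⟨ +-congˡ (-‿inverseˡ y) ⟨
      x + (- y + y)       ≈⟨ +-assoc _ _ _ ⟨
      (x + - y) + y       ≈⟨ +-congʳ zero-sum ⟩
      0# + y              ≈⟨ +-identityˡ y ⟩
      y                   ∎
      where
      x = val u * pair p λ e → φ (+ suc (n ℕ.+ suc n) ℤ.+ e)
      y = inv u * pair p φ
      φ′ : ℤ → Carrier
      φ′ e = φ (+ suc n ℤ.+ e)
      zero-sum : x + - y ≈ 0#
      zero-sum = begin
        x + - y
          ≈⟨ +-cong
               (*-congˡ (pair-cong p λ e → reflexive (≡.cong φ (ℤP.+-assoc (+ suc n) (+ suc n) e))))
               (≈-trans (-‿distribˡ-* _ _) (≈-trans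
                 (*-congˡ (pair-cong p λ e → reflexive (≡.cong φ (≡.trans (≡.sym (ℤP.+-identityˡ e))
                   (≡.trans (≡.cong (ℤ._+ e) (≡.sym (ℤP.+-inverseʳ (+ suc n))))
                     (ℤP.+-assoc (+ suc n) (ℤ.- (+ suc n)) e))))))
                 (≈-sym (+-identityʳ _)))) ⟩
        val u * pair p (λ e → φ′ (+ suc n ℤ.+ e)) + (- inv u * pair p (λ e → φ′ (ℤ.- (+ suc n) ℤ.+ e)) + 0#)
          ≈⟨ pair-mul (monomial (val u) (+ suc n) ++ neg (monomial (inv u) (ℤ.- (+ suc n)))) p φ′ ⟨
        pair (mul (monomial (val u) (+ suc n) ++ neg (monomial (inv u) (ℤ.- (+ suc n)))) p) φ′
          ≈⟨ on h φ′ ⟩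
        0# ∎

  σ-regular-positive : ∀ (u : Invertible K) n →
    Regular (monomial (val u) (+ suc n) ++ neg (monomial (inv u) (ℤ.- (+ suc n))))
  σ-regular-positive u n = regular λ p h →
    self-similar-zero p (val u * val u) (n ℕ.+ suc n) (σ-annihilated u n p h)

  -- The degree in t alone gives regularity, so the coefficients may have zero divisors. A negative
  -- exponent reduces to a positive one by σ(x⁻¹) = -σ(x).
  σ-regular : ∀ (u : Invertible K) k → k ≢ + 0 → Regular (val (monomialUnit u k) L.+ L.- inv (monomialUnit u k))
  σ-regular u (+ zero)  k≢0 = ⊥-elim (k≢0 refl)
  σ-regular u +[1+ n ]  k≢0 = σ-regular-positive u n
  σ-regular u -[1+ n ]  k≢0 = Regular-cong
    (agree λ φ → begin
      - inv u * φ (+ suc n) + (- - val u * φ -[1+ n ] + 0#)   ≈⟨ +-cong ≈-refl (+-congʳ (*-congʳ (-‿involutive _))) ⟩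
      - inv u * φ (+ suc n) + (val u * φ -[1+ n ] + 0#)       ≈⟨ +-assoc _ _ _ ⟨
      (- inv u * φ (+ suc n) + val u * φ -[1+ n ]) + 0#       ≈⟨ +-congʳ (+-comm _ _) ⟩
      (val u * φ -[1+ n ] + - inv u * φ (+ suc n)) + 0#       ≈⟨ +-assoc _ _ _ ⟩
      val u * φ -[1+ n ] + (- inv u * φ (+ suc n) + 0#)       ∎)
    (Regular-neg (σ-regular-positive (Inv._⁻¹ K u) n))

-- Naturality under homomorphisms, and generic extensions

module Naturality {A B : CommutativeRing 0ℓ 0ℓ} (f : Hom A B) where
  private module A = CommutativeRing A
  open Ring B
  open Hom f

  -- As a relation, naturality of a compound expression is assembled from that of its parts,
  -- following the shape of the expression.
  record Maps (x : A.Carrier) (y : Carrier) : Set where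
    constructor maps
    field image : ⟦ x ⟧ ≈ y
  open Maps public

  maps-+ : ∀ {x y x′ y′} → Maps x x′ → Maps y y′ → Maps (x A.+ y) (x′ + y′)
  maps-+ h k = maps (≈-trans (+-homo _ _) (+-cong (image h) (image k)))

  maps-* : ∀ {x y x′ y′} → Maps x x′ → Maps y y′ → Maps (x A.* y) (x′ * y′)
  maps-* h k = maps (≈-trans (*-homo _ _) (*-cong (image h) (image k)))

  maps-neg : ∀ {x x′} → Maps x x′ → Maps (A.- x) (- x′)
  maps-neg h = maps (≈-trans (-‿homo _) (-‿cong (image h)))

  record MapsUnit (u : Invertible A) (v : Invertible B) : Set where
    constructor mapsUnit
    field
      maps-val : Maps (val u) (val v)
      maps-inv : Maps (inv u) (inv v)
  open MapsUnit public

  record MapsParameters (P : Parameters A) (Q : Parameters B) : Set where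
    private
      module P = Parameters P
      module Q = Parameters Q
    field
      maps-q   : MapsUnit P.q Q.q
      maps-s   : Maps P.s Q.s
      maps-sq  : Maps P.sq Q.sq
      maps-sq4 : Maps P.sq4 Q.sq4

  module _ {P : Parameters A} {Q : Parameters B} (PQ : MapsParameters P Q) where
    open MapsParameters PQ
    private
      module PA = Vertex A P
      module QB = Vertex B Q
      module PP = Parameters P
      module QP = Parameters Q
      q₁ = maps-val maps-q
      q₂ = maps-inv maps-q

    maps-wA : ∀ {w v w′ v′} → MapsUnit w w′ → MapsUnit v v′ → Maps (PA.wA w v) (QB.wA w′ v′)
    maps-wA w v = maps-* (maps-+ (maps-* (maps-* (maps-* q₁ q₁) (maps-inv w)) (maps-inv v))
      (maps-neg (maps-* (maps-* (maps-* q₂ q₂) (maps-val w)) (maps-val v)))) maps-sq4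

    maps-wB : ∀ {w v w′ v′} → MapsUnit w w′ → MapsUnit v v′ → Maps (PA.wB w v) (QB.wB w′ v′)
    maps-wB w v = maps-* (maps-+ (maps-* (maps-* (maps-* q₁ q₁) (maps-val w)) (maps-val v))
      (maps-neg (maps-* (maps-* (maps-* q₂ q₂) (maps-inv w)) (maps-inv v)))) maps-sq4

    maps-wC : Maps PA.wC QB.wC
    maps-wC = maps-* (maps-+ (maps-* (maps-* (maps-* q₁ q₁) q₁) q₁)
      (maps-neg (maps-* (maps-* (maps-* q₂ q₂) q₂) q₂))) maps-sq4

    maps-κ : ∀ {u u′} → MapsUnit u u′ → Maps (PA.κ u) (QB.κ u′)
    maps-κ u = maps-* (maps-+ (maps-* q₁ (maps-val u)) (maps-neg (maps-* q₂ (maps-inv u)))) maps-sq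

    maps-vertex : ∀ {w v w′ v′} → MapsUnit w w′ → MapsUnit v v′ → ∀ h b {g g′} →
      (∀ h b → Maps (g h b) (g′ h b)) → Maps (PA.vertex w v h b g) (QB.vertex w′ v′ h b g′)
    maps-vertex w v false false e = maps-* (maps-wA w v) (e _ _)
    maps-vertex w v true  true  e = maps-* (maps-wA w v) (e _ _)
    maps-vertex w v false true  e = maps-+ (maps-* (maps-wB w v) (e _ _)) (maps-* maps-wC (e _ _))
    maps-vertex w v true  false e = maps-+ (maps-* (maps-wB w v) (e _ _)) (maps-* maps-wC (e _ _))

    maps-boundary : ∀ {u u′} → MapsUnit u u′ → ∀ b {g g′} →
      (∀ h → Maps (g h) (g′ h)) → Maps (PA.boundary u b g) (QB.boundary u′ b g′)
    maps-boundary u b e = maps-+ (maps-* maps-s (e _)) (maps-* (maps-κ u) (e _))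

    maps-row : ∀ {w w′} → MapsUnit w w′ → ∀ h {n} {vs : Vec _ n} {vs′} → VecPointwise MapsUnit vs vs′ → ∀ bs {k k′} →
      (∀ x → Maps (k x) (k′ x)) → Maps (PA.row w h vs bs k) (QB.row w′ h vs′ bs k′)
    maps-row w false []       []       e = e []
    maps-row w true  []       []       e = maps 0-homo
    maps-row w h     (v ∷ vs) (b ∷ bs) e = maps-vertex w v h b λ h′ b′ → maps-row w h′ vs bs λ x → e (b′ ∷ x)

    maps-Ψ : ∀ {n} {us : Vec _ n} {us′} → VecPointwise MapsUnit us us′ → ∀ bs → Maps (PA.Ψ us bs) (QB.Ψ us′ bs)
    maps-Ψ []       []       = maps 1-homo
    maps-Ψ (u ∷ us) (b ∷ bs) = maps-boundary u b λ h → maps-row u h us bs (maps-Ψ us)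

    maps-Z : ∀ {n} {us : Vec _ n} {us′} → VecPointwise MapsUnit us us′ → Maps (PA.Z us) (QB.Z us′)
    maps-Z us = maps-Ψ us _

mapParameters : ∀ {A B} → Hom A B → Parameters A → Parameters B
mapParameters f P = record { q = mapUnit q ; s = ⟦ s ⟧ ; sq = ⟦ sq ⟧ ; sq4 = ⟦ sq4 ⟧ }
  where open Hom f
        open Parameters P

-- An extension of K by generic monomials, with the specialisation t = 1.
record Extension (K : CommutativeRing 0ℓ 0ℓ) : Set₁ where
  open CommutativeRing K using (_≈_)
  field
    L            : CommutativeRing 0ℓ 0ℓ
    atOne        : Hom L K
    constant     : Hom K L
    monomialUnit : Invertible K → ℤ → Invertible L
    at-const     : ∀ c → Hom.⟦_⟧ atOne (Hom.⟦_⟧ constant c) ≈ c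
    at-val       : ∀ u k → Hom.⟦_⟧ atOne (val (monomialUnit u k)) ≈ val u
    at-inv       : ∀ u k → Hom.⟦_⟧ atOne (inv (monomialUnit u k)) ≈ inv u
  module L = CommutativeRing L
  module I = Inv L
  open Hom constant using () renaming (⟦_⟧ to const; mapUnit to constUnit) public
  field
    -- `Like X k` says that X is a monomial of degree k in t. Degrees add under products, and a
    -- nonzero degree makes σ(X) regular.
    Like         : Invertible L → ℤ → Set
    like-mono    : ∀ u k → Like (monomialUnit u k) k
    like-const   : ∀ u → Like (constUnit u) (+ 0)
    like-·       : ∀ {X Y i j} → Like X i → Like Y j → Like (X I.· Y) (i ℤ.+ j)
    like-⁻¹      : ∀ {X i} → Like X i → Like (X I.⁻¹) (ℤ.- i)
    like-regular : ∀ {X k} → Like X k → k ≡.≢ + 0 → I.Regular (val X L.+ L.- inv X)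
  open Naturality atOne public

  maps-const : ∀ c → Maps (const c) c
  maps-const c = maps (at-const c)

  maps-constUnit : ∀ u → MapsUnit (constUnit u) u
  maps-constUnit u = mapsUnit (maps-const _) (maps-const _)

  maps-monomialUnit : ∀ u k → MapsUnit (monomialUnit u k) u
  maps-monomialUnit u k = mapsUnit (maps (at-val u k)) (maps (at-inv u k))

  maps-constParameters : ∀ P → MapsParameters (mapParameters constant P) P
  maps-constParameters P = record
    { maps-q = maps-constUnit _ ; maps-s = maps-const _ ; maps-sq = maps-const _ ; maps-sq4 = maps-const _ }

module _ (K : CommutativeRing 0ℓ 0ℓ) where
  open Ring K
  open LaurentPolynomials K
  private
    module I = Inv laurentRing
    module J = Inv K
    module LR = CommutativeRing laurentRing

  record Monomial-like (X : Invertible laurentRing) (k : ℤ) : Set where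
    constructor monomial-like
    field
      coefficient : Invertible K
      val-∼ : val X ∼ val (monomialUnit coefficient k)
      inv-∼ : inv X ∼ inv (monomialUnit coefficient k)

  laurentExtension : Extension K
  laurentExtension = record
    { L = laurentRing ; atOne = atOne ; constant = constant ; monomialUnit = monomialUnit
    ; at-const = λ c → atOne-monomial c (+ 0)
    ; at-val = λ u k → atOne-monomial (val u) k
    ; at-inv = λ u k → atOne-monomial (inv u) (ℤ.- k)
    ; Like = Monomial-like
    ; like-mono = λ u k → monomial-like u ∼-refl ∼-refl
    ; like-const = λ u → monomial-like u ∼-refl ∼-refl
    ; like-· = λ { {i = i} {j} (monomial-like c a b) (monomial-like d a′ b′) → monomial-like (c J.· d)
        (mul-cong a a′) (∼-trans (mul-cong b b′) (agree λ φ →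
          +-congʳ (*-congˡ (reflexive (≡.cong φ (≡.sym (ℤP.neg-distrib-+ i j))))))) }
    ; like-⁻¹ = λ { {i = i} (monomial-like c a b) → monomial-like (c J.⁻¹) b
        (∼-trans a (agree λ φ → +-congʳ (*-congˡ (reflexive (≡.cong φ (≡.sym (ℤP.neg-involutive i))))))) }
    ; like-regular = λ { {X} {k} (monomial-like c a b) k≢0 → I.Regular-cong
        (LR.sym (LR.+-cong {val X} {_} {LR.- inv X} a (LR.-‿cong {inv X} b))) (σ-regular c k k≢0) } }

-- Invariance of the partition function under permutations

module Permuting (K : CommutativeRing 0ℓ 0ℓ) (P : Parameters K) where
  open Ring K
  open Parameters P
  open Vertex K P
  open Exchange K P

  private
    -- With v₂ t in place of `v₂`, the factor `ra` is σ of a monomial of degree 1, hence regular. It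
    -- is cancelled there, and t = 1 returns to `K`.
    Z-swap′ : Extension K → ∀ {m n} (ps : Vec U m) (vs : Vec U n) v₁ v₂ →
      Z (ps ++ᵥ v₁ ∷ v₂ ∷ vs) ≈ Z (ps ++ᵥ v₂ ∷ v₁ ∷ vs)
    Z-swap′ X ps vs v₁ v₂ = begin
      Z (ps ++ᵥ v₁ ∷ v₂ ∷ vs)                 ≈⟨ image (maps-Z PQ (PW.++⁺ (const* ps) (V₁ ∷ V₂ ∷ const* vs))) ⟨
      Hom.⟦_⟧ atOne (ZL (map ps ++ᵥ x₁ ∷ x₂ ∷ map vs))
        ≈⟨ Hom.⟦⟧-cong atOne (I.cancel regular-ra (Exchange.Z-exchange L PL (map ps) (map vs) x₁ x₂)) ⟩
      Hom.⟦_⟧ atOne (ZL (map ps ++ᵥ x₂ ∷ x₁ ∷ map vs))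
        ≈⟨ image (maps-Z PQ (PW.++⁺ (const* ps) (V₂ ∷ V₁ ∷ const* vs))) ⟩
      Z (ps ++ᵥ v₂ ∷ v₁ ∷ vs)                 ∎
      where
      open Extension X
      PL = mapParameters constant P
      PQ = maps-constParameters P
      ZL : ∀ {n} → Vec (Invertible L) n → L.Carrier
      ZL = Vertex.Z L PL
      map : ∀ {n} → Vec U n → Vec (Invertible L) n
      map = Vec.map constUnit
      const* : ∀ {n} (us : Vec U n) → VecPointwise MapsUnit (map us) us
      const* []       = []
      const* (u ∷ us) = maps-constUnit u ∷ const* us
      x₁ = constUnit v₁
      x₂ = monomialUnit v₂ (+ 1)
      V₁ = maps-constUnit v₁
      V₂ = maps-monomialUnit v₂ (+ 1)
      q₀ = like-const q
      regular-ra : I.Regular (Vertex.ra L PL x₁ x₂)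
      regular-ra = like-regular
        (like-· (like-· (like-· (like-· (like-· q₀ q₀) q₀) q₀) (like-mono v₂ (+ 1))) (like-⁻¹ (like-const v₁))) λ ()

  Z-swap : ∀ {m n} (ps : Vec U m) (vs : Vec U n) v₁ v₂ → Z (ps ++ᵥ v₁ ∷ v₂ ∷ vs) ≈ Z (ps ++ᵥ v₂ ∷ v₁ ∷ vs)
  Z-swap = Z-swap′ (laurentExtension K)

  Zₗ : List U → Carrier
  Zₗ us = Z (Vec.fromList us)

  private
    ZΣ : Σ ℕ (Vec U) → Carrier
    ZΣ (n , us) = Z us

    cons : U → Σ ℕ (Vec U) → Σ ℕ (Vec U)
    cons u (n , us) = suc n , u ∷ us

    fromList-++ : ∀ ps {n} (vs : Vec U n) us → (_ , Vec.fromList us) ≡ (n , vs) →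
      _≡_ {A = Σ ℕ (Vec U)} (_ , Vec.fromList (ps ++ us)) (_ , Vec.fromList ps ++ᵥ vs)
    fromList-++ []       vs us e = e
    fromList-++ (p ∷ ps) vs us e = ≡.cong (cons p) (fromList-++ ps vs us e)

  Zₗ-swap : ∀ ps vs v₁ v₂ → Zₗ (ps ++ v₁ ∷ v₂ ∷ vs) ≈ Zₗ (ps ++ v₂ ∷ v₁ ∷ vs)
  Zₗ-swap ps vs v₁ v₂ = ≈-trans (reflexive (≡.cong ZΣ (fromList-++ ps _ (v₁ ∷ v₂ ∷ vs) refl)))
    (≈-trans (Z-swap (Vec.fromList ps) (Vec.fromList vs) v₁ v₂)
      (reflexive (≡.sym (≡.cong ZΣ (fromList-++ ps _ (v₂ ∷ v₁ ∷ vs) refl)))))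

  -- The prefix is carried along because a permutation may swap neighbours anywhere in the list.
  Zₗ-↭-prefix : ∀ ps {us vs} → us ↭ vs → Zₗ (ps ++ us) ≈ Zₗ (ps ++ vs)
  Zₗ-↭-prefix ps Perm.refl = ≈-refl
  Zₗ-↭-prefix ps (Perm.prep {us} {vs} u h) = ≈-trans
    (reflexive (≡.cong Zₗ (≡.sym (++-assoc ps (u ∷ []) us))))
    (≈-trans (Zₗ-↭-prefix (ps ++ u ∷ []) h) (reflexive (≡.cong Zₗ (++-assoc ps (u ∷ []) vs))))
  Zₗ-↭-prefix ps (Perm.swap {us} {vs} u v h) = ≈-trans (Zₗ-swap ps us u v)
    (≈-trans (reflexive (≡.cong Zₗ (≡.sym (++-assoc ps (v ∷ u ∷ []) us))))
    (≈-trans (Zₗ-↭-prefix (ps ++ v ∷ u ∷ []) h) (reflexive (≡.cong Zₗ (++-assoc ps (v ∷ u ∷ []) vs)))))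
  Zₗ-↭-prefix ps (Perm.trans h k) = ≈-trans (Zₗ-↭-prefix ps h) (Zₗ-↭-prefix ps k)

  Zₗ-↭ : ∀ {us vs} → us ↭ vs → Zₗ us ≈ Zₗ vs
  Zₗ-↭ = Zₗ-↭-prefix []

-- Lagrange interpolation

-- Degree d f: f is homogeneous of degree d in (u, u⁻¹), in Horner form.
module Interpolation (K : CommutativeRing 0ℓ 0ℓ) where
  open Ring K
  open Inv K

  Degree : ℕ → (Invertible K → Carrier) → Set
  Degree zero    f = Σ[ c ∈ Carrier ] ∀ u → f u ≈ c
  Degree (suc d) f = Σ[ (g , c) ∈ (Invertible K → Carrier) × Carrier ]
    Degree d g × ∀ u → f u ≈ val u * g u + c * pow K (inv u) (suc d)

  Degree-cong : ∀ d {f g} → (∀ u → f u ≈ g u) → Degree d g → Degree d f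
  Degree-cong zero    e (c , h)           = c , λ u → ≈-trans (e u) (h u)
  Degree-cong (suc d) e ((g , c) , D , h) = (g , c) , D , λ u → ≈-trans (e u) (h u)

  Degree-zero : ∀ d → Degree d λ _ → 0#
  Degree-zero zero    = 0# , λ u → ≈-refl
  Degree-zero (suc d) = ((λ _ → 0#) , 0#) , Degree-zero d , λ u →
    ≈-sym (≈-trans (+-cong (zeroʳ _) (zeroˡ _)) (+-identityˡ _))

  Degree-+ : ∀ d {f g} → Degree d f → Degree d g → Degree d λ u → f u + g u
  Degree-+ zero    (c , h) (c′ , h′) = c + c′ , λ u → +-cong (h u) (h′ u)
  Degree-+ (suc d) {f} {f′} ((g , c) , D , h) ((g′ , c′) , D′ , h′) = ((λ u → g u + g′ u) , c + c′) , Degree-+ d D D′ , λ u →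
    ≈-trans (+-cong (h u) (h′ u)) (lemma (val u) (g u) c (pow K (inv u) (suc d)) (g′ u) c′)
    where
    lemma : ∀ x a c p a′ c′ → (x * a + c * p) + (x * a′ + c′ * p) ≈ x * (a + a′) + (c + c′) * p
    lemma = solve 6 0 (λ x a c p a′ c′ →
        x :* a :+ c :* p :+ (x :* a′ :+ c′ :* p) := x :* (a :+ a′) :+ (c :+ c′) :* p) refl

  Degree-scale : ∀ d a {f} → Degree d f → Degree d λ u → a * f u
  Degree-scale zero    a (c , h)           = a * c , λ u → *-congˡ (h u)
  Degree-scale (suc d) a ((g , c) , D , h) = ((λ u → a * g u) , a * c) , Degree-scale d a D , λ u →
    ≈-trans (*-congˡ (h u)) (≈-trans (distribˡ _ _ _) (+-cong (*-swap _ _ _) (≈-sym (*-assoc _ _ _))))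

  Degree-val : ∀ d {f} → Degree d f → Degree (suc d) λ u → val u * f u
  Degree-val d {f} D = (f , 0#) , D , λ u → ≈-sym (≈-trans (+-congˡ (zeroˡ _)) (+-identityʳ _))

  Degree-inv : ∀ d {f} → Degree d f → Degree (suc d) λ u → inv u * f u
  Degree-inv zero    (c , h) = ((λ _ → 0#) , c) , Degree-zero 0 , λ u →
    ≈-trans (*-congˡ (h u)) (lemma (inv u) (val u) c)
    where
    lemma : ∀ i v c → i * c ≈ v * 0# + c * (i * 1#)
    lemma = solve 3 0 (λ i v c → i :* c := v :* :0 :+ c :* (i :* :1)) refl
  Degree-inv (suc d) {f} ((g , c) , D , h) = ((λ u → inv u * g u) , c) , Degree-inv d D , λ u →
    ≈-trans (*-congˡ (h u)) (≈-trans (distribˡ _ _ _) (+-cong (*-swap _ _ _) (*-swap _ _ _)))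

  Degree-linear : ∀ d a b {f} → Degree d f → Degree (suc d) λ u → (a * val u + b * inv u) * f u
  Degree-linear d a b {f} D = Degree-cong (suc d) (λ u → lemma (val u) (inv u) (f u))
    (Degree-+ (suc d) (Degree-scale (suc d) a (Degree-val d D)) (Degree-scale (suc d) b (Degree-inv d D)))
    where
    lemma : ∀ x y z → (a * x + b * y) * z ≈ a * (x * z) + b * (y * z)
    lemma x y z = solve 5 0 (λ a x b y z →
        (a :* x :+ b :* y) :* z := a :* (x :* z) :+ b :* (y :* z)) refl a x b y z

  -- Multiplication by u u⁻¹ = 1 raises the formal degree by two, so only its parity is rigid.
  Degree-lift : ∀ d {f} → Degree d f → Degree (suc (suc d)) f
  Degree-lift d {f} D = Degree-cong (2 ℕ.+ d) (λ u → lemma u (f u)) (Degree-val (suc d) (Degree-inv d D))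
    where
    lemma : ∀ (u : Invertible K) z → z ≈ val u * (inv u * z)
    lemma u z = solve 1 1 (λ z u ū → z := u :* (ū :* z)) refl z u

  -- σ(u/p), in the role of the linear factor with root p.
  δ : Invertible K → Invertible K → Carrier
  δ p u = val u * inv p + - (inv u * val p)

  Degree-pow : ∀ d (p : Invertible K) → Degree d λ u → pow K (inv u * val p) d
  Degree-pow zero    p = 1# , λ u → ≈-refl
  Degree-pow (suc d) p = Degree-cong (suc d) (λ u → lemma (inv u) (val p) (pow K (inv u * val p) d))
    (Degree-scale (suc d) (val p) (Degree-inv d (Degree-pow d p)))
    where
    lemma : ∀ a b c → (a * b) * c ≈ b * (a * c)
    lemma = solve 3 0 (λ a b c → a :* b :* c := b :* (a :* c)) refl

  pow-* : ∀ a b d → pow K (a * b) d ≈ pow K a d * pow K b d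
  pow-* a b zero    = ≈-sym (*-identityˡ _)
  pow-* a b (suc d) = ≈-trans (*-congˡ (pow-* a b d)) (*-interchange _ _ _ _)

  pow-one : ∀ d → pow K 1# d ≈ 1#
  pow-one zero    = ≈-refl
  pow-one (suc d) = ≈-trans (*-identityˡ _) (pow-one d)

  pow-cong : ∀ d {a b} → a ≈ b → pow K a d ≈ pow K b d
  pow-cong zero    e = ≈-refl
  pow-cong (suc d) e = *-cong e (pow-cong d e)

  pow-shift : ∀ (p u : Invertible K) d → pow K (inv p) d * pow K (inv u * val p) d ≈ pow K (inv u) d
  pow-shift p u d = begin
    pow K (inv p) d * pow K (inv u * val p) d       ≈⟨ pow-* (inv p) (inv u * val p) d ⟨
    pow K (inv p * (inv u * val p)) d               ≈⟨ pow-cong d (solve 0 2 (λ p p̄ u ū → p̄ :* (ū :* p) := ū) refl p u) ⟩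
    pow K (inv u) d                                 ∎

  -- Division with remainder by `δ p`. The remainder carries (p/u)ᵈ⁺¹, which is 1 at p, in order to
  -- stay homogeneous.
  factor : ∀ d {f} → Degree (suc d) f → ∀ p →
    Σ[ h ∈ (Invertible K → Carrier) ] Degree d h × ∀ u → f u ≈ f p * pow K (inv u * val p) (suc d) + δ p u * h u
  factor zero {f} ((g , c) , (a , e) , h) p = (λ _ → a * val p) , (a * val p , λ _ → ≈-refl) , λ u → begin
    f u                                                                   ≈⟨ f≈ u ⟩
    val u * a + c * (inv u * 1#)                                          ≈⟨ lemma u ⟩
    (val p * a + c * (inv p * 1#)) * ((inv u * val p) * 1#) + δ p u * (a * val p) ≈⟨ +-congʳ (*-congʳ (f≈ p)) ⟨
    f p * ((inv u * val p) * 1#) + δ p u * (a * val p)                    ∎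
    where
    f≈ : ∀ u → f u ≈ val u * a + c * (inv u * 1#)
    f≈ u = ≈-trans (h u) (+-congʳ (*-congˡ (e u)))
    lemma : ∀ u → val u * a + c * (inv u * 1#)
      ≈ (val p * a + c * (inv p * 1#)) * ((inv u * val p) * 1#) + δ p u * (a * val p)
    lemma u = solve 2 2 (λ a c u ū p p̄ →
        u :* a :+ c :* (ū :* :1)
          := (p :* a :+ c :* (p̄ :* :1)) :* (ū :* p :* :1) :+ (u :* p̄
          :+ :- (ū :* p)) :* (a :* p)) refl a c u p
  factor (suc d) {f} ((g , c) , D , h) p with factor d D p
  ... | k , E , e =
    (λ u → (g p * val p) * pow K (inv u * val p) (suc d) + val u * k u)
    , Degree-+ (suc d) (Degree-scale (suc d) _ (Degree-pow (suc d) p)) (Degree-val d E)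
    , λ u → let w = pow K (inv u * val p) (suc d); r = pow K (inv p) (suc (suc d)) in begin
    f u                                                       ≈⟨ h u ⟩
    val u * g u + c * pow K (inv u) (suc (suc d))             ≈⟨ +-cong (*-congˡ (e u)) (*-congˡ (≈-sym (pow-shift p u (suc (suc d))))) ⟩
    val u * (g p * w + δ p u * k u) + c * (r * ((inv u * val p) * w))   ≈⟨ lemma u w (g p) (k u) r ⟩
    (val p * g p + c * r) * ((inv u * val p) * w) + δ p u * ((g p * val p) * w + val u * k u)
      ≈⟨ +-congʳ (*-congʳ (h p)) ⟨
    f p * ((inv u * val p) * w) + δ p u * ((g p * val p) * w + val u * k u) ∎
    where
    lemma : ∀ u w y z r → val u * (y * w + δ p u * z) + c * (r * ((inv u * val p) * w))
      ≈ (val p * y + c * r) * ((inv u * val p) * w) + δ p u * ((y * val p) * w + val u * z)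
    lemma u w y z r = solve 5 2 (λ y w z c r u ū p p̄ →
        u :* (y :* w :+ (u :* p̄ :+ :- (ū :* p)) :* z) :+ c :* (r :* (ū :* p :* w))
          := (p :* y :+ c :* r) :* (ū :* p :* w) :+ (u :* p̄ :+ :- (ū :* p)) :* (y :* p :* w
          :+ u :* z)) refl y w z c r u p

  Separated : List (Invertible K) → Set
  Separated = AllPairs λ p p′ → Regular (δ p p′)

  -- Each zero splits off a factor `δ`, which is regular at the other points, so these remain zeros
  -- of the quotient. With d + 1 zeros the degree is exhausted.
  vanishing : ∀ d {f} p ps → Degree d f → length ps ≡ d → Separated (p ∷ ps) →
    All (λ p → f p ≈ 0#) (p ∷ ps) → ∀ u → f u ≈ 0#
  vanishing zero    p [] (c , h) refl _ (z ∷ _) u = ≈-trans (h u) (≈-trans (≈-sym (h p)) z)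
  vanishing (suc d) {f} p (p′ ∷ ps) D l (s ∷ S) (z ∷ zs) u with factor d D p
  ... | k , E , e = ≈-trans (f≈ u) (≈-trans (*-congˡ (vanishing d p′ ps E (ℕP.suc-injective l) S (zeros s zs) u)) (zeroʳ _))
    where
    f≈ : ∀ u → f u ≈ δ p u * k u
    f≈ u = ≈-trans (e u) (≈-trans (+-congʳ (≈-trans (*-congʳ z) (zeroˡ _))) (+-identityˡ _))
    zeros : ∀ {qs} → All (λ p′ → Regular (δ p p′)) qs → All (λ p → f p ≈ 0#) qs → All (λ p → k p ≈ 0#) qs
    zeros []       []       = []
    zeros (r ∷ rs) (z ∷ zs) = Regular.annihilator r _ (≈-trans (≈-sym (f≈ _)) z) ∷ zeros rs zs

  agreement : ∀ d {f g} p ps → Degree d f → Degree d g → length ps ≡ d → Separated (p ∷ ps) →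
    All (λ p → f p ≈ g p) (p ∷ ps) → ∀ u → f u ≈ g u
  agreement d {f} {g} p ps D E l S h u = begin
    f u                       ≈⟨ +-identityʳ _ ⟨
    f u + 0#                  ≈⟨ +-congˡ (zeroˡ _) ⟨
    f u + 0# * g u            ≈⟨ lemma (f u) (g u) ⟩
    (f u + - 1# * g u) + g u  ≈⟨ +-congʳ (vanishing d p ps (Degree-+ d D (Degree-scale d (- 1#) E)) l S
                                   (All.map (λ e → ≈-trans (+-congʳ e) (cancels _)) h) u) ⟩
    0# + g u                  ≈⟨ +-identityˡ _ ⟩
    g u                       ∎
    where
    lemma : ∀ a b → a + 0# * b ≈ (a + - 1# * b) + b
    lemma = solve 2 0 (λ a b → a :+ :0 :* b := a :+ :- :1 :* b :+ b) refl
    cancels : ∀ b → b + - 1# * b ≈ 0#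
    cancels = solve 1 0 (λ b → b :+ :- :1 :* b := :0) refl

module Products (K : CommutativeRing 0ℓ 0ℓ) where
  open Ring K

  ∏ : ∀ {A : Set} → (A → Carrier) → List A → Carrier
  ∏ f []       = 1#
  ∏ f (x ∷ xs) = f x * ∏ f xs

  ∏-cong : ∀ {A : Set} {f g : A → Carrier} → (∀ x → f x ≈ g x) → ∀ xs → ∏ f xs ≈ ∏ g xs
  ∏-cong e []       = ≈-refl
  ∏-cong e (x ∷ xs) = *-cong (e x) (∏-cong e xs)

  ∏-* : ∀ {A : Set} (f g : A → Carrier) xs → ∏ (λ x → f x * g x) xs ≈ ∏ f xs * ∏ g xs
  ∏-* f g []       = ≈-sym (*-identityˡ _)
  ∏-* f g (x ∷ xs) = ≈-trans (*-congˡ (∏-* f g xs)) (*-interchange _ _ _ _)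

  ∏-↭ : ∀ {A : Set} (f : A → Carrier) {xs ys} → xs ↭ ys → ∏ f xs ≈ ∏ f ys
  ∏-↭ f Perm.refl         = ≈-refl
  ∏-↭ f (Perm.prep x h)   = *-congˡ (∏-↭ f h)
  ∏-↭ f (Perm.swap x y h) = ≈-trans (*-swap _ _ _) (*-congˡ (*-congˡ (∏-↭ f h)))
  ∏-↭ f (Perm.trans h k)  = ≈-trans (∏-↭ f h) (∏-↭ f k)

record Lawful {K : CommutativeRing 0ℓ 0ℓ} (P : Parameters K) : Set where
  open CommutativeRing K
  open Parameters P
  open Vertex K P
  field
    s*s≈0 : s * s ≈ 0#
    wC≈1  : wC ≈ 1#

-- Recursions of the partition function

module Recursions (K : CommutativeRing 0ℓ 0ℓ) (P : Parameters K) where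
  open Ring K
  open Parameters P
  open Vertex K P
  open Exchange K P
  open Permuting K P
  open Inv K
  open Interpolation K
  open Products K public

  up : ∀ n → Vec Bool n
  up n = Vec.replicate n false

  rowUp : Bool → U → (vs : List U) → (Vec Bool (length vs) → Carrier) → Carrier
  rowUp h w vs = row w h (Vec.fromList vs) (up _)

  -- Below upward arrows, a leftward arrow leaves each vertex a single state, so the whole row is
  -- frozen.
  row-left : ∀ w vs k → rowUp false w vs k ≈ ∏ (wA w) vs * k (up _)
  row-left w []       k = ≈-sym (*-identityˡ _)
  row-left w (v ∷ vs) k = ≈-trans (*-congˡ (row-left w vs _)) (≈-sym (*-assoc _ _ _))

  -- The two parameters of the first vertex are tied by u v = q⁻².
  tied : U → U
  tied v = ((q · q) · v) ⁻¹

  module _ (lawful : Lawful P) where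
    open Lawful lawful

    -- At u v = q⁻² the weight `wB` vanishes: a rightward arrow must turn at the first vertex, and
    -- the rest of the row is frozen. Of the four products of boundary weights, the two mixed ones
    -- cancel by κ(u) + κ(v) = 0 and the pure one in `s` by s² = 0.
    Z-tied : ∀ v vs → Zₗ (tied v ∷ v ∷ vs)
      ≈ κ (tied v) * κ v * (∏ (wA (tied v)) vs * ∏ (wA v) vs * Zₗ vs)
    Z-tied v vs = begin
      s * (wA u v * rowUp false u vs λ x → Ψ V (false ∷ x))
        + κ u * (wB u v * (rowUp true u vs λ x → Ψ V (false ∷ x)) + wC * rowUp false u vs λ x → Ψ V (true ∷ x))
        ≈⟨ +-cong (*-congˡ (*-congˡ (row-left u vs _))) (*-congˡ (+-congˡ (*-congˡ (row-left u vs _)))) ⟩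
      s * (wA u v * (a * (s * r₀ + κ v * r₁))) + κ u * (wB u v * t + wC * (a * (s * r₁ + κ v * r₀)))
        ≈⟨ +-cong (*-congˡ (*-congʳ wA≈wC)) (*-congˡ (+-congʳ (≈-trans (*-congʳ wB≈0) (zeroˡ _)))) ⟩
      s * (wC * (a * (s * r₀ + κ v * r₁))) + κ u * (0# + wC * (a * (s * r₁ + κ v * r₀)))
        ≈⟨ collect s wC a r₀ r₁ (κ u) (κ v) s*s≈0 wC≈1 κu+κv≈0 ⟩
      κ u * κ v * (a * r₀)
        ≈⟨ *-congˡ (*-congˡ (row-left v vs _)) ⟩
      κ u * κ v * (a * (∏ (wA v) vs * Zₗ vs))
        ≈⟨ *-congˡ (*-assoc _ _ _) ⟨
      κ u * κ v * (a * ∏ (wA v) vs * Zₗ vs) ∎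
      where
      u = tied v
      V = Vec.fromList (v ∷ vs)
      a = ∏ (wA u) vs
      r₀ = rowUp false v vs (Ψ (Vec.fromList vs))
      r₁ = rowUp true v vs (Ψ (Vec.fromList vs))
      t = rowUp true u vs λ x → Ψ V (false ∷ x)
      wA≈wC : wA u v ≈ wC
      wA≈wC = solve 1 2 (λ sq4 q q̄ v v̄ →
          (q :* q :* (q :* q :* v) :* v̄ :+ :- (q̄ :* q̄ :* (q̄ :* q̄ :* v̄) :* v)) :* sq4
            := (q :* q :* q :* q :+ :- (q̄ :* q̄ :* q̄ :* q̄)) :* sq4) refl sq4 q v
      wB≈0 : wB u v ≈ 0#
      wB≈0 = solve 1 2 (λ sq4 q q̄ v v̄ →
          (q :* q :* (q̄ :* q̄ :* v̄) :* v :+ :- (q̄ :* q̄ :* (q :* q :* v) :* v̄)) :* sq4 := :0) refl sq4 q v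
      κu+κv≈0 : κ u + κ v ≈ 0#
      κu+κv≈0 = solve 1 2 (λ sq q q̄ v v̄ →
          (q :* (q̄ :* q̄ :* v̄) :+ :- (q̄ :* (q :* q :* v))) :* sq :+ (q :* v :+ :- (q̄ :* v̄)) :* sq
            := :0) refl sq q v
      collect : ∀ s c a r₀ r₁ x y → s * s ≈ 0# → c ≈ 1# → x + y ≈ 0# →
        s * (c * (a * (s * r₀ + y * r₁))) + x * (0# + c * (a * (s * r₁ + y * r₀))) ≈ x * y * (a * r₀)
      collect s c a r₀ r₁ x y hs hc hx = solve-by 7 0 (λ s c a r₀ y r₁ x →
          s :* (c :* (a :* (s :* r₀ :+ y :* r₁))) :+ x :* (:0 :+ c :* (a :* (s :* r₁ :+ y :* r₀)))
            := x :* y :* (a :* r₀) ,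
          (c :* a :* r₀ , s :* s := :0) ∷
          (s :* c :* a :* r₁ , x :+ y := :0) ∷
          (x :* y :* a :* r₀ , c := :1) ∷ []) refl s c a r₀ y r₁ x hs hx hc

  Z-q⁻¹ : ∀ vs → Zₗ (q ⁻¹ ∷ vs) ≈ s * (∏ (wA (q ⁻¹)) vs * Zₗ vs)
  Z-q⁻¹ vs = begin
    s * rowUp false (q ⁻¹) vs (Ψ V) + κ (q ⁻¹) * rowUp true (q ⁻¹) vs (Ψ V)
      ≈⟨ +-cong (*-congˡ (row-left (q ⁻¹) vs _)) (≈-trans (*-congʳ κ≈0) (zeroˡ _)) ⟩
    s * (∏ (wA (q ⁻¹)) vs * Zₗ vs) + 0# ≈⟨ +-identityʳ _ ⟩
    s * (∏ (wA (q ⁻¹)) vs * Zₗ vs) ∎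
    where
    V = Vec.fromList vs
    κ≈0 : κ (q ⁻¹) ≈ 0#
    κ≈0 = solve 1 1 (λ sq q q̄ → (q :* q̄ :+ :- (q̄ :* q)) :* sq := :0) refl sq q

  Degree-wA : ∀ d v {f} → Degree d f → Degree (suc d) λ w → wA w v * f w
  Degree-wA d v {f} D = Degree-cong (suc d) (λ w → lemma w (f w))
    (Degree-linear d (- (inv q * inv q * val v * sq4)) (val q * val q * inv v * sq4) D)
    where
    lemma : ∀ w z → wA w v * z ≈ (- (inv q * inv q * val v * sq4) * val w + val q * val q * inv v * sq4 * inv w) * z
    lemma w z = solve 2 3 (λ sq4 z q q̄ w w̄ v v̄ →
        (q :* q :* w̄ :* v̄ :+ :- (q̄ :* q̄ :* w :* v)) :* sq4 :* z
          := (:- (q̄ :* q̄ :* v :* sq4) :* w :+ q :* q :* v̄ :* sq4 :* w̄) :* z) refl sq4 z q w v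

  Degree-wB : ∀ d v {f} → Degree d f → Degree (suc d) λ w → wB w v * f w
  Degree-wB d v {f} D = Degree-cong (suc d) (λ w → lemma w (f w))
    (Degree-linear d (val q * val q * val v * sq4) (- (inv q * inv q * inv v * sq4)) D)
    where
    lemma : ∀ w z → wB w v * z ≈ (val q * val q * val v * sq4 * val w + - (inv q * inv q * inv v * sq4) * inv w) * z
    lemma w z = solve 2 3 (λ sq4 z q q̄ w w̄ v v̄ →
        (q :* q :* w :* v :+ :- (q̄ :* q̄ :* w̄ :* v̄)) :* sq4 :* z
          := (q :* q :* v :* sq4 :* w :+ :- (q̄ :* q̄ :* v̄ :* sq4) :* w̄) :* z) refl sq4 z q w v

  Degree-κ : ∀ d {f} → Degree d f → Degree (suc d) λ w → κ w * f w
  Degree-κ d {f} D = Degree-cong (suc d) (λ w → lemma w (f w))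
    (Degree-linear d (val q * sq) (- (inv q * sq)) D)
    where
    lemma : ∀ w z → κ w * z ≈ (val q * sq * val w + - (inv q * sq) * inv w) * z
    lemma w z = solve 2 2 (λ sq z q q̄ w w̄ →
        (q :* w :+ :- (q̄ :* w̄)) :* sq :* z := (q :* sq :* w :+ :- (q̄ :* sq) :* w̄) :* z) refl sq z q w

  Degree-row-left : ∀ vs k → Degree (length vs) λ w → rowUp false w vs k
  Degree-row-left []       k = k [] , λ w → ≈-refl
  Degree-row-left (v ∷ vs) k = Degree-wA (length vs) v (Degree-row-left vs _)

  -- A rightward arrow has to turn at exactly one vertex, after which the row is frozen. The turning
  -- vertex has a constant weight, and the degree missing there is supplied by κ.
  Degree-κ-row-right : ∀ vs k → Degree (length vs) λ w → κ w * rowUp true w vs k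
  Degree-κ-row-right []       k = 0# , λ w → zeroʳ _
  Degree-κ-row-right (v ∷ vs) k = Degree-cong (suc (length vs))
    (λ w → lemma (κ w) (wB w v) _ wC _)
    (Degree-+ (suc (length vs))
      (Degree-wB (length vs) v (Degree-κ-row-right vs (λ x → k (false ∷ x))))
      (Degree-scale (suc (length vs)) wC (Degree-κ (length vs) (Degree-row-left vs (λ x → k (true ∷ x))))))
    where
    lemma : ∀ κκ b r c r′ → κκ * (b * r + c * r′) ≈ b * (κκ * r) + c * (κκ * r′)
    lemma = solve 5 0 (λ κκ b r c r′ → κκ :* (b :* r :+ c :* r′) := b :* (κκ :* r) :+ c :* (κκ :* r′)) refl

  -- The first parameter occurs in the first row only.
  Degree-Z : ∀ vs → Degree (length vs) λ u → Zₗ (u ∷ vs)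
  Degree-Z vs = Degree-+ (length vs) (Degree-scale (length vs) s (Degree-row-left vs _)) (Degree-κ-row-right vs _)

module NaturalityOfProducts {A B : CommutativeRing 0ℓ 0ℓ} (f : Hom A B) where
  open Hom f
  open Naturality f
  private
    module RA = Products A
    module RB = Products B

  maps-∏ : ∀ {I J : Set} {R : I → J → Set} {g h} → (∀ {i j} → R i j → Maps (g i) (h j)) →
    ∀ {is js} → ListPointwise R is js → Maps (RA.∏ g is) (RB.∏ h js)
  maps-∏ e []       = maps 1-homo
  maps-∏ e (r ∷ rs) = maps-* (e r) (maps-∏ e rs)

module NaturalityOfLists {A B : CommutativeRing 0ℓ 0ℓ} (f : Hom A B) {P : Parameters A} {Q : Parameters B}
  (PQ : Naturality.MapsParameters f P Q) where
  open Ring B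
  open Hom f
  open Naturality f
  private
    module PA = Permuting A P
    module QB = Permuting B Q

  private
    toVec : ∀ {us us′} → ListPointwise MapsUnit us us′ → Σ[ vs ∈ Vec (Invertible B) (length us) ]
      (_≡_ {A = Σ ℕ (Vec (Invertible B))} (_ , vs) (_ , Vec.fromList us′)) × VecPointwise MapsUnit (Vec.fromList us) vs
    toVec []       = [] , refl , []
    toVec {us′ = u′ ∷ us′} (h ∷ hs) with toVec hs
    ... | vs , e , p = u′ ∷ vs , ≡.cong (λ (n , ws) → suc n , u′ ∷ ws) e , h ∷ p

  maps-Zₗ : ∀ {us us′} → ListPointwise MapsUnit us us′ → Maps (PA.Zₗ us) (QB.Zₗ us′)
  maps-Zₗ hs with toVec hs
  ... | vs , e , p = ≡.subst (λ (n , ws) → Maps _ (Vertex.Z B Q ws)) e (maps-Z PQ p)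

module _ {A B : CommutativeRing 0ℓ 0ℓ} (f : Hom A B) (P : Parameters A) where
  open Ring B
  open Hom f
  open Naturality f

  maps-mapParameters : MapsParameters P (mapParameters f P)
  maps-mapParameters = record
    { maps-q = mapsUnit (maps ≈-refl) (maps ≈-refl) ; maps-s = maps ≈-refl ; maps-sq = maps ≈-refl ; maps-sq4 = maps ≈-refl }

  lawful-map : Lawful P → Lawful (mapParameters f P)
  lawful-map l = record
    { s*s≈0 = ≈-trans (≈-sym (*-homo _ _)) (≈-trans (⟦⟧-cong (Lawful.s*s≈0 l)) 0-homo)
    ; wC≈1 = ≈-trans (≈-sym (image (maps-wC maps-mapParameters))) (≈-trans (⟦⟧-cong (Lawful.wC≈1 l)) 1-homo) }

∈⇒↭ : ∀ {A : Set} {x : A} {xs} → x ∈ xs → ∃[ ys ] xs ↭ x ∷ ys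
∈⇒↭ {x = x} h with ∈-∃++ h
... | ys , zs , refl = ys ++ zs , PermP.shift x ys zs

module Generic {K : CommutativeRing 0ℓ 0ℓ} (X : Extension K) where
  open Extension X
  open Interpolation L using (δ; Separated)

  AllLike : List (Invertible L) → List ℤ → Set
  AllLike = ListPointwise Like

  like-δ : ∀ {p p′ k k′} → Like p k → Like p′ k′ → k ≢ k′ → I.Regular (δ p p′)
  like-δ {k = k} {k′} h h′ k≢k′ = like-regular (like-· h′ (like-⁻¹ h)) λ e → k≢k′ (≡.sym (ℤP.i-j≡0⇒i≡j k′ k e))

  separated : ∀ {ps ks} → AllLike ps ks → AllPairs _≢_ ks → Separated ps
  separated []       []       = []
  separated (h ∷ hs) (d ∷ ds) = heads h hs d ∷ separated hs ds
    where
    heads : ∀ {p k ps ks} → Like p k → AllLike ps ks → All (k ≢_) ks → All (λ p′ → I.Regular (δ p p′)) ps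
    heads h []       []       = []
    heads h (k ∷ ks) (d ∷ ds) = like-δ h k d ∷ heads h ks ds

  -- Distinct positive powers of t make a list of units generic.
  spread : ℕ → List (Invertible K) → List (Invertible L)
  spread k []       = []
  spread k (u ∷ us) = monomialUnit u (+ suc k) ∷ spread (suc k) us

  maps-spread : ∀ k us → ListPointwise MapsUnit (spread k us) us
  maps-spread k []       = []
  maps-spread k (u ∷ us) = maps-monomialUnit u (+ suc k) ∷ maps-spread (suc k) us

negatives : {A : Set} → ℕ → List A → List ℤ
negatives k []       = []
negatives k (_ ∷ us) = -[1+ k ] ∷ negatives (suc k) us

negatives-≢ : ∀ {A : Set} j k (us : List A) → j ℕ.< k → All (-[1+ j ] ≢_) (negatives k us)
negatives-≢ j k []       h = []
negatives-≢ j k (_ ∷ us) h = (λ { refl → ℕP.<-irrefl refl h }) ∷ negatives-≢ j (suc k) us (ℕP.m≤n⇒m≤1+n h)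

negatives-distinct : ∀ {A : Set} k (us : List A) → AllPairs _≢_ (negatives k us)
negatives-distinct k []       = []
negatives-distinct k (_ ∷ us) = negatives-≢ k (suc k) us ℕP.≤-refl ∷ negatives-distinct (suc k) us

negatives-≢+ : ∀ {A : Set} i k (us : List A) → All (+ i ≢_) (negatives k us)
negatives-≢+ i k []       = []
negatives-≢+ i k (_ ∷ us) = (λ ()) ∷ negatives-≢+ i (suc k) us

-- The recursion at u v = q²

module CotiedDefinition (K : CommutativeRing 0ℓ 0ℓ) (P : Parameters K) where
  open Ring K
  open Parameters P
  open Vertex K P
  open Permuting K P
  open Inv K
  open Recursions K P

  -- The inverse of `tied (v ⁻¹)`: inverting all parameters exchanges the relations u v = q⁻² and u
  -- v = q².
  cotied : U → U
  cotied v = (q · q) · (v ⁻¹)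

  -- Here `wA` vanishes at the first vertex in place of `wB`, so the first row does not freeze and
  -- expanding it gives no recursion at once. The proof interpolates in a third parameter.
  CotiedRecursion : U → List U → Set
  CotiedRecursion v vs = Zₗ (cotied v ∷ v ∷ vs)
    ≈ κ (cotied v) * κ v * (∏ (wB (cotied v)) vs * ∏ (wB v) vs * Zₗ vs)

module GenericCotied (K : CommutativeRing 0ℓ 0ℓ) (P : Parameters K) (lawful : Lawful P) where
  open Ring K
  open Parameters P
  open Vertex K P
  open Permuting K P
  open Inv K
  open Interpolation K
  open Recursions K P
  open CotiedDefinition K P public
  open Lawful lawful
  cotied-base : ∀ v → CotiedRecursion v []
  cotied-base v = begin
    s * (wA u v * (s * 1# + κ v * 0#)) + κ u * (wB u v * 0# + wC * (s * 0# + κ v * 1#))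
      ≈⟨ lemma s (wA u v) (κ v) (κ u) (wB u v) wC s*s≈0 wC≈1 ⟩
    κ u * κ v * (1# * 1# * 1#) ∎
    where
    u = cotied v
    lemma : ∀ s a k k′ b c → s * s ≈ 0# → c ≈ 1# →
      s * (a * (s * 1# + k * 0#)) + k′ * (b * 0# + c * (s * 0# + k * 1#)) ≈ k′ * k * (1# * 1# * 1#)
    lemma = solve-by 6 0 (λ s a k k′ b c →
        s :* (a :* (s :* :1 :+ k :* :0)) :+ k′ :* (b :* :0 :+ c :* (s :* :0 :+ k :* :1))
          := k′ :* k :* (:1 :* :1 :* :1) ,
        (a , s :* s := :0) ∷
        (k′ :* k , c := :1) ∷ []) refl

  wA-cotied : ∀ v → wA (cotied v) v ≈ 0#
  wA-cotied v = solve 1 2 (λ sq4 q q̄ v v̄ →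
      (q :* q :* (q̄ :* q̄ :* v) :* v̄ :+ :- (q̄ :* q̄ :* (q :* q :* v̄) :* v)) :* sq4 := :0) refl sq4 q v

  wA-sym : ∀ u v → wA u v ≈ wA v u
  wA-sym u v = solve 1 3 (λ sq4 q q̄ u ū v v̄ →
      (q :* q :* ū :* v̄ :+ :- (q̄ :* q̄ :* u :* v)) :* sq4
        := (q :* q :* v̄ :* ū :+ :- (q̄ :* q̄ :* v :* u)) :* sq4) refl sq4 q u v

  wB-sym : ∀ u v → wB u v ≈ wB v u
  wB-sym u v = solve 1 3 (λ sq4 q q̄ u ū v v̄ →
      (q :* q :* u :* v :+ :- (q̄ :* q̄ :* ū :* v̄)) :* sq4
        := (q :* q :* v :* u :+ :- (q̄ :* q̄ :* v̄ :* ū)) :* sq4) refl sq4 q u v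

  wB-tied : ∀ u → wB u (tied u) ≈ 0#
  wB-tied u = solve 1 2 (λ sq4 q q̄ u ū →
      (q :* q :* u :* (q̄ :* q̄ :* ū) :+ :- (q̄ :* q̄ :* ū :* (q :* q :* u))) :* sq4 := :0) refl sq4 q u

  module _ (v : U) (vs : List U)
    (ih : ∀ vs′ → length vs′ ℕ.≤ length vs → CotiedRecursion v vs′) where
    private
      u = cotied v
      c = κ u * κ v * (∏ (wB u) vs * ∏ (wB v) vs)
      f g : U → Carrier
      f w = Zₗ (u ∷ v ∷ w ∷ vs)
      g w = κ u * κ v * (∏ (wB u) (w ∷ vs) * ∏ (wB v) (w ∷ vs) * Zₗ (w ∷ vs))

      to-front : ∀ w ws → u ∷ v ∷ w ∷ ws ↭ w ∷ u ∷ v ∷ ws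
      to-front w ws = PermP.shift w (u ∷ v ∷ []) ws

      -- Symmetry of Z brings `w` to the front, where the degree is known.
      f-degree : Degree (2 ℕ.+ length vs) f
      f-degree = Degree-cong (2 ℕ.+ length vs) (λ w → Zₗ-↭ (to-front w vs)) (Degree-Z (u ∷ v ∷ vs))

      g-degree : Degree (2 ℕ.+ length vs) g
      g-degree = Degree-cong (2 ℕ.+ length vs)
        (λ w → ≈-trans (*-congˡ (*-congʳ (*-cong (*-congʳ (wB-sym u w)) (*-congʳ (wB-sym v w)))))
          (lemma (κ u * κ v) (wB w u) (∏ (wB u) vs) (wB w v) (∏ (wB v) vs) (Zₗ (w ∷ vs))))
        (Degree-scale (2 ℕ.+ length vs) c (Degree-wB (suc (length vs)) u (Degree-wB (length vs) v (Degree-Z vs))))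
        where
        lemma : ∀ k a x b y z → k * (a * x * (b * y) * z) ≈ k * (x * y) * (a * (b * z))
        lemma = solve 6 0 (λ k a x b y z →
            k :* (a :* x :* (b :* y) :* z) := k :* (x :* y) :* (a :* (b :* z))) refl

      at-q⁻¹ : f (q ⁻¹) ≈ g (q ⁻¹)
      at-q⁻¹ = begin
        Zₗ (u ∷ v ∷ w ∷ vs)                                      ≈⟨ Zₗ-↭ (to-front w vs) ⟩
        Zₗ (w ∷ u ∷ v ∷ vs)                                      ≈⟨ Z-q⁻¹ (u ∷ v ∷ vs) ⟩
        s * ((wA w u * (wA w v * a)) * Zₗ (u ∷ v ∷ vs))          ≈⟨ *-congˡ (*-congˡ (ih vs ℕP.≤-refl)) ⟩
        s * ((wA w u * (wA w v * a)) * (k * (x * y * z)))        ≈⟨ lemma s (wA w u) (wA w v) a k x y z _ _ scalar ⟩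
        k * (wB u w * x * (wB v w * y) * (s * (a * z)))          ≈⟨ *-congˡ (*-congˡ (Z-q⁻¹ vs)) ⟨
        k * (wB u w * x * (wB v w * y) * Zₗ (w ∷ vs))            ∎
        where
        w = q ⁻¹
        a = ∏ (wA w) vs
        k = κ u * κ v
        x = ∏ (wB u) vs
        y = ∏ (wB v) vs
        z = Zₗ vs
        scalar : wA w u * wA w v ≈ wB u w * wB v w
        scalar = solve 1 2 (λ sq4 q q̄ v v̄ →
            (q :* q :* q :* (q̄ :* q̄ :* v)
              :+ :- (q̄ :* q̄ :* q̄ :* (q :* q :* v̄))) :* sq4 :* ((q :* q :* q :* v̄
              :+ :- (q̄ :* q̄ :* q̄ :* v)) :* sq4)
              := (q :* q :* (q :* q :* v̄) :* q̄
              :+ :- (q̄ :* q̄ :* (q̄ :* q̄ :* v) :* q)) :* sq4 :* ((q :* q :* v :* q̄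
              :+ :- (q̄ :* q̄ :* v̄ :* q)) :* sq4)) refl sq4 q v
        lemma : ∀ s a₁ a₂ a k x y z b₁ b₂ → a₁ * a₂ ≈ b₁ * b₂ →
          s * ((a₁ * (a₂ * a)) * (k * (x * y * z))) ≈ k * (b₁ * x * (b₂ * y) * (s * (a * z)))
        lemma = solve-by 10 0 (λ s a₁ a₂ a k x y z b₁ b₂ →
            s :* (a₁ :* (a₂ :* a) :* (k :* (x :* y :* z))) := k :* (b₁ :* x :* (b₂ :* y) :* (s :* (a :* z))) ,
            (s :* a :* k :* x :* y :* z , a₁ :* a₂ := b₁ :* b₂) ∷ []) refl

      -- Both sides vanish: the left one through `wA u v` at u v = q², the right one through
      -- `wB u w` at u w = q⁻².
      at-tied-u : f (tied u) ≈ g (tied u)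
      at-tied-u = begin
        Zₗ (u ∷ v ∷ w ∷ vs)            ≈⟨ Zₗ-↭ (to-front w vs) ⟩
        Zₗ (w ∷ u ∷ v ∷ vs)            ≈⟨ Z-tied lawful u (v ∷ vs) ⟩
        κ w * κ u * (∏ (wA w) (v ∷ vs) * (wA u v * ∏ (wA u) vs) * Zₗ (v ∷ vs))
          ≈⟨ lemma (κ w * κ u) (wA u v) _ _ _ (wA-cotied v) ⟩
        0#                             ≈⟨ lemma′ (κ u * κ v) (wB u w) _ _ _ (wB-tied u) ⟨
        g w                            ∎
        where
        w = tied u
        lemma : ∀ k a b x z → a ≈ 0# → k * (b * (a * x) * z) ≈ 0#
        lemma = solve-by 5 0 (λ k a b x z →
            k :* (b :* (a :* x) :* z) := :0 ,
            (k :* b :* x :* z , a := :0) ∷ []) refl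
        lemma′ : ∀ k a b x z → a ≈ 0# → k * ((a * x) * b * z) ≈ 0#
        lemma′ = solve-by 5 0 (λ k a b x z →
            k :* (a :* x :* b :* z) := :0 ,
            (k :* b :* x :* z , a := :0) ∷ []) refl

      at-tied-v : f (tied v) ≈ g (tied v)
      at-tied-v = begin
        Zₗ (u ∷ v ∷ w ∷ vs)            ≈⟨ Zₗ-↭ (↭-trans (to-front w vs) (Perm.prep w (Perm.swap u v ↭-refl))) ⟩
        Zₗ (w ∷ v ∷ u ∷ vs)            ≈⟨ Z-tied lawful v (u ∷ vs) ⟩
        κ w * κ v * (∏ (wA w) (u ∷ vs) * (wA v u * ∏ (wA v) vs) * Zₗ (u ∷ vs))
          ≈⟨ lemma (κ w * κ v) (wA v u) _ _ _ (≈-trans (wA-sym v u) (wA-cotied v)) ⟩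
        0#                             ≈⟨ lemma (κ u * κ v) (wB v w) _ _ _ (wB-tied v) ⟨
        g w                            ∎
        where
        w = tied v
        lemma : ∀ k a b x z → a ≈ 0# → k * (b * (a * x) * z) ≈ 0#
        lemma = solve-by 5 0 (λ k a b x z →
            k :* (b :* (a :* x) :* z) := :0 ,
            (k :* b :* x :* z , a := :0) ∷ []) refl

      -- Removing the tied pair (w, x) reduces both sides to the shorter list. The bulk weights
      -- between this pair and (u, v) have the same product on the two sides.
      at-tied : ∀ {x} → x ∈ vs → f (tied x) ≈ g (tied x)
      at-tied {x} h with ∈⇒↭ h
      ... | vs′ , p = begin
        Zₗ (u ∷ v ∷ w ∷ vs)
          ≈⟨ Zₗ-↭ (↭-trans (to-front w vs) (Perm.prep w (↭-trans (Perm.prep u (Perm.prep v p)) (to-front x vs′)))) ⟩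
        Zₗ (w ∷ x ∷ u ∷ v ∷ vs′)       ≈⟨ Z-tied lawful x (u ∷ v ∷ vs′) ⟩
        κ w * κ x * ((wA w u * (wA w v * a)) * (wA x u * (wA x v * a′)) * Zₗ (u ∷ v ∷ vs′))
          ≈⟨ *-congˡ (*-congˡ (ih vs′ (ℕP.<⇒≤ (ℕP.≤-reflexive (≡.sym (↭-length p)))))) ⟩
        κ w * κ x * ((wA w u * (wA w v * a)) * (wA x u * (wA x v * a′)) * (κ u * κ v * (b * b′ * z)))
          ≈⟨ lemma (κ w * κ x) _ _ _ _ a a′ (κ u * κ v) b b′ z _ _ _ _ scalar ⟩
        κ u * κ v * ((wB u w * (wB u x * b)) * (wB v w * (wB v x * b′)) * (κ w * κ x * (a * a′ * z)))
          ≈⟨ *-congˡ (*-cong (*-cong (*-congˡ (∏-↭ (wB u) p)) (*-congˡ (∏-↭ (wB v) p)))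
               (≈-trans (Zₗ-↭ (Perm.prep w p)) (Z-tied lawful x vs′))) ⟨
        g w ∎
        where
        w = tied x
        a = ∏ (wA w) vs′
        a′ = ∏ (wA x) vs′
        b = ∏ (wB u) vs′
        b′ = ∏ (wB v) vs′
        z = Zₗ vs′
        scalar : wA w u * wA w v * (wA x u * wA x v) ≈ wB u w * wB u x * (wB v w * wB v x)
        scalar = solve 1 3 (λ sq4 q q̄ x x̄ v v̄ →
            (q :* q :* (q :* q :* x) :* (q̄ :* q̄ :* v)
              :+ :- (q̄ :* q̄ :* (q̄ :* q̄ :* x̄) :* (q :* q :* v̄))) :* sq4 :* ((q :* q :* (q :* q
              :* x) :* v̄ :+ :- (q̄ :* q̄ :* (q̄ :* q̄ :* x̄) :* v)) :* sq4) :* ((q :* q :* x̄ :* (q̄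
              :* q̄ :* v) :+ :- (q̄ :* q̄ :* x :* (q :* q :* v̄))) :* sq4 :* ((q :* q :* x̄ :* v̄
              :+ :- (q̄ :* q̄ :* x :* v)) :* sq4))
              := (q :* q :* (q :* q :* v̄) :* (q̄ :* q̄ :* x̄)
              :+ :- (q̄ :* q̄ :* (q̄ :* q̄ :* v) :* (q :* q :* x))) :* sq4 :* ((q :* q :* (q :* q
              :* v̄) :* x :+ :- (q̄ :* q̄ :* (q̄ :* q̄ :* v) :* x̄)) :* sq4) :* ((q :* q :* v :* (q̄
              :* q̄ :* x̄) :+ :- (q̄ :* q̄ :* v̄ :* (q :* q :* x))) :* sq4 :* ((q :* q :* v :* x
              :+ :- (q̄ :* q̄ :* v̄ :* x̄)) :* sq4))) refl sq4 q x v
        lemma : ∀ k a₁ a₂ a₃ a₄ a a′ k′ b b′ z b₁ b₂ b₃ b₄ → a₁ * a₂ * (a₃ * a₄) ≈ b₁ * b₂ * (b₃ * b₄) →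
          k * ((a₁ * (a₂ * a)) * (a₃ * (a₄ * a′)) * (k′ * (b * b′ * z)))
            ≈ k′ * ((b₁ * (b₂ * b)) * (b₃ * (b₄ * b′)) * (k * (a * a′ * z)))
        lemma = solve-by 15 0 (λ k a₁ a₂ a₃ a₄ a a′ k′ b b′ z b₁ b₂ b₃ b₄ →
            k :* (a₁ :* (a₂ :* a) :* (a₃ :* (a₄ :* a′)) :* (k′ :* (b :* b′ :* z)))
              := k′ :* (b₁ :* (b₂ :* b) :* (b₃ :* (b₄ :* b′)) :* (k :* (a :* a′ :* z))) ,
            (k :* a :* a′ :* k′ :* b :* b′ :* z , a₁ :* a₂ :* (a₃ :* a₄) := b₁ :* b₂ :* (b₃ :* b₄)) ∷ []) refl

    -- Degree |vs| + 2 in `w`, against the |vs| + 3 points q⁻¹, `tied u`, `tied v` and one tied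
    -- point for each element of `vs`.
    cotied-step : Separated (q ⁻¹ ∷ tied u ∷ tied v ∷ List.map tied vs) → ∀ w → f w ≈ g w
    cotied-step S = agreement (2 ℕ.+ length vs) (q ⁻¹) (tied u ∷ tied v ∷ List.map tied vs)
      f-degree g-degree (≡.cong (2 ℕ.+_) (length-map tied vs)) S
      (at-q⁻¹ ∷ at-tied-u ∷ at-tied-v ∷ AllP.map⁺ (All.tabulate at-tied))

-- Quantified over all rings, since the inductive step applies the hypothesis to an extension of the
-- given one.
CotiedBelow : ℕ → Set₁
CotiedBelow n = ∀ (K : CommutativeRing 0ℓ 0ℓ) (P : Parameters K) → Lawful P → ∀ v vs → length vs ℕ.≤ n →
  CotiedDefinition.CotiedRecursion K P v vs

module _ {K : CommutativeRing 0ℓ 0ℓ} (X : Extension K) (P : Parameters K) (lawful : Lawful P) where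
  open Ring K
  open Parameters P
  open Vertex K P using (U)
  open Extension X
  open Generic X
  private
    PL = mapParameters constant P
    lawfulL = lawful-map constant P lawful
    module G = GenericCotied L PL lawfulL
    module R = Recursions L PL
    PQ = maps-constParameters P
    open NaturalityOfLists atOne PQ
    open NaturalityOfProducts atOne

  generic-cotied : ∀ {n} → CotiedBelow n → ∀ v w vs → length vs ℕ.≤ n →
    CotiedDefinition.CotiedRecursion K P v (w ∷ vs)
  generic-cotied {n} ih v w vs l = ≈-trans (≈-sym (image lhs))
    (≈-trans (Hom.⟦⟧-cong atOne (G.cotied-step v′ vs′ (λ ws l′ → ih L PL lawfulL v′ ws (ℕP.≤-trans l′ l″)) S w′)) (image rhs))
    where
    v′ = monomialUnit v (+ 1)
    w′ = constUnit w
    vs′ = spread 1 vs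
    q₀ = like-const q
    l″ : length vs′ ℕ.≤ n
    l″ = ≡.subst (ℕ._≤ n) (≡.sym (LPW.Pointwise-length (maps-spread 1 vs))) l
    like-tied : ∀ k us → AllLike (List.map R.tied (spread k us)) (negatives k us)
    like-tied k []       = []
    like-tied k (u ∷ us) = like-⁻¹ (like-· (like-· q₀ q₀) (like-mono u (+ suc k))) ∷ like-tied (suc k) us
    -- The points have the degrees 0, 1, -1, -2, -3, ... in t. The degree 1 belongs to `tied u`, as
    -- u = q²/v′ has degree -1.
    S = separated
      (like-⁻¹ q₀ ∷ like-⁻¹ (like-· (like-· q₀ q₀) (like-· (like-· q₀ q₀) (like-⁻¹ (like-mono v (+ 1)))))
        ∷ like-⁻¹ (like-· (like-· q₀ q₀) (like-mono v (+ 1))) ∷ like-tied 1 vs)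
      (((λ ()) ∷ (λ ()) ∷ negatives-≢+ 0 1 vs) ∷ ((λ ()) ∷ negatives-≢+ 1 1 vs)
        ∷ negatives-≢ 0 1 vs ℕP.≤-refl ∷ negatives-distinct 1 vs)
    V = maps-monomialUnit v (+ 1)
    maps-cotied : MapsUnit (G.cotied v′) (CotiedDefinition.cotied K P v)
    maps-cotied = mapsUnit
      (maps-* (maps-* (maps-const _) (maps-const _)) (maps-inv V))
      (maps-* (maps-* (maps-const _) (maps-const _)) (maps-val V))
    ws : ListPointwise MapsUnit (w′ ∷ vs′) (w ∷ vs)
    ws = maps-constUnit w ∷ maps-spread 1 vs
    lhs = maps-Zₗ (maps-cotied ∷ V ∷ ws)
    rhs = maps-* (maps-* (maps-κ PQ maps-cotied) (maps-κ PQ V))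
      (maps-* (maps-* (maps-∏ (maps-wB PQ maps-cotied) ws) (maps-∏ (maps-wB PQ V) ws)) (maps-Zₗ ws))

cotied-below : ∀ n → CotiedBelow n
cotied-below n       K P lawful v []       l         = GenericCotied.cotied-base K P lawful v
cotied-below (suc n) K P lawful v (w ∷ vs) (ℕ.s≤s l) =
  generic-cotied (laurentExtension K) P lawful (cotied-below n) v w vs l

Z-cotied : ∀ (K : CommutativeRing 0ℓ 0ℓ) P → Lawful P → ∀ v vs → CotiedDefinition.CotiedRecursion K P v vs
Z-cotied K P lawful v vs = cotied-below (length vs) K P lawful v vs ℕP.≤-refl

-- No laws are imposed, so that syntactic expressions form an instance and one construction yields
-- both the expression of the character and its values.
record Operations (C : Set) : Set where
  field
    add mul : C → C → C
    neg     : C → C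
    nil one : C

-- Determinants and the symplectic character

-- The exterior algebra on n generators: (x , y) stands for x + e₀ ∧ y.
module ExteriorAlgebra {C : Set} (O : Operations C) where
  open Operations O

  Λ : ℕ → Set
  Λ zero    = C
  Λ (suc n) = Λ n × Λ n

  0Λ : ∀ n → Λ n
  0Λ zero    = nil
  0Λ (suc n) = 0Λ n , 0Λ n

  1Λ : ∀ n → Λ n
  1Λ zero    = one
  1Λ (suc n) = 1Λ n , 0Λ n

  addΛ : ∀ {n} → Λ n → Λ n → Λ n
  addΛ {zero}  x       y         = add x y
  addΛ {suc n} (x , y) (x′ , y′) = addΛ x x′ , addΛ y y′

  scaleΛ : ∀ {n} → C → Λ n → Λ n
  scaleΛ {zero}  c x       = mul c x
  scaleΛ {suc n} c (x , y) = scaleΛ c x , scaleΛ c y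

  -- (a e₀ + v) ∧ (x + e₀ ∧ y) = v ∧ x + e₀ ∧ (a x - v ∧ y).
  wedge : ∀ {n} → Vec C n → Λ n → Λ n
  wedge []      x       = nil
  wedge (a ∷ v) (x , y) = wedge v x , addΛ (scaleΛ a x) (scaleΛ (neg one) (wedge v y))

  top : ∀ {n} → Λ n → C
  top {zero}  x       = x
  top {suc n} (x , y) = top y

  wedges : ∀ {n} → List (Vec C n) → Λ n → Λ n
  wedges []       ξ = ξ
  wedges (v ∷ vs) ξ = wedge v (wedges vs ξ)

  -- The coefficient of the top form, which for n rows is the determinant.
  volume : ∀ {n} → List (Vec C n) → C
  volume vs = top (wedges vs (1Λ _))

operations : (K : CommutativeRing 0ℓ 0ℓ) → Operations (CommutativeRing.Carrier K)
operations K = record { add = _+_ ; mul = _*_ ; neg = -_ ; nil = 0# ; one = 1# }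
  where open CommutativeRing K

module Exterior (K : CommutativeRing 0ℓ 0ℓ) where
  open Ring K
  open ExteriorAlgebra (operations K) public

  infix 4 _≋_
  _≋_ : ∀ {n} → Λ n → Λ n → Set
  _≋_ {zero}  x       y         = x ≈ y
  _≋_ {suc n} (x , y) (x′ , y′) = (x ≋ x′) × (y ≋ y′)

  ≋-refl : ∀ {n} {x : Λ n} → x ≋ x
  ≋-refl {zero}  = ≈-refl
  ≋-refl {suc n} = ≋-refl {n} , ≋-refl {n}

  ≋-sym : ∀ {n} {x y : Λ n} → x ≋ y → y ≋ x
  ≋-sym {zero}  h       = ≈-sym h
  ≋-sym {suc n} (h , k) = ≋-sym {n} h , ≋-sym {n} k

  ≋-trans : ∀ {n} {x y z : Λ n} → x ≋ y → y ≋ z → x ≋ z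
  ≋-trans {zero}  h        k         = ≈-trans h k
  ≋-trans {suc n} (h , h′) (k , k′) = ≋-trans {n} h k , ≋-trans {n} h′ k′

  addΛ-cong : ∀ {n} {x x′ y y′ : Λ n} → x ≋ x′ → y ≋ y′ → addΛ x y ≋ addΛ x′ y′
  addΛ-cong {zero}  h        k        = +-cong h k
  addΛ-cong {suc n} (h , h′) (k , k′) = addΛ-cong {n} h k , addΛ-cong {n} h′ k′

  scaleΛ-cong : ∀ {n} {a b} {x y : Λ n} → a ≈ b → x ≋ y → scaleΛ a x ≋ scaleΛ b y
  scaleΛ-cong {zero}  e h       = *-cong e h
  scaleΛ-cong {suc n} e (h , k) = scaleΛ-cong {n} e h , scaleΛ-cong {n} e k

  top-cong : ∀ {n} {x y : Λ n} → x ≋ y → top x ≈ top y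
  top-cong {zero}  h       = h
  top-cong {suc n} (h , k) = top-cong {n} k

  top-add : ∀ {n} (x y : Λ n) → top (addΛ x y) ≈ top x + top y
  top-add {zero}  x       y         = ≈-refl
  top-add {suc n} (x , y) (x′ , y′) = top-add {n} y y′

  top-scale : ∀ {n} c (x : Λ n) → top (scaleΛ c x) ≈ c * top x
  top-scale {zero}  c x       = ≈-refl
  top-scale {suc n} c (x , y) = top-scale {n} c y

  scale-add : ∀ {n} c (x y : Λ n) → scaleΛ c (addΛ x y) ≋ addΛ (scaleΛ c x) (scaleΛ c y)
  scale-add {zero}  c x       y         = distribˡ _ _ _
  scale-add {suc n} c (x , y) (x′ , y′) = scale-add {n} c x x′ , scale-add {n} c y y′

  add-scale : ∀ {n} c d (x : Λ n) → scaleΛ (c + d) x ≋ addΛ (scaleΛ c x) (scaleΛ d x)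
  add-scale {zero}  c d x       = distribʳ _ _ _
  add-scale {suc n} c d (x , y) = add-scale {n} c d x , add-scale {n} c d y

  scale-scale : ∀ {n} c d (x : Λ n) → scaleΛ c (scaleΛ d x) ≋ scaleΛ (c * d) x
  scale-scale {zero}  c d x       = ≈-sym (*-assoc _ _ _)
  scale-scale {suc n} c d (x , y) = scale-scale {n} c d x , scale-scale {n} c d y

  scale-swap : ∀ {n} c d (x : Λ n) → scaleΛ c (scaleΛ d x) ≋ scaleΛ d (scaleΛ c x)
  scale-swap {zero}  c d x       = *-swap _ _ _
  scale-swap {suc n} c d (x , y) = scale-swap {n} c d x , scale-swap {n} c d y

  scale-one : ∀ {n} (x : Λ n) → scaleΛ 1# x ≋ x
  scale-one {zero}  x       = *-identityˡ _
  scale-one {suc n} (x , y) = scale-one {n} x , scale-one {n} y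

  scale-zero : ∀ {n} {c} (x : Λ n) → c ≈ 0# → scaleΛ c x ≋ 0Λ n
  scale-zero {zero}  x       e = ≈-trans (*-congʳ e) (zeroˡ _)
  scale-zero {suc n} (x , y) e = scale-zero {n} x e , scale-zero {n} y e

  scale-0Λ : ∀ n c → scaleΛ c (0Λ n) ≋ 0Λ n
  scale-0Λ zero    c = zeroʳ _
  scale-0Λ (suc n) c = scale-0Λ n c , scale-0Λ n c

  add-0Λ : ∀ {n} (x : Λ n) → addΛ x (0Λ n) ≋ x
  add-0Λ {zero}  x       = +-identityʳ _
  add-0Λ {suc n} (x , y) = add-0Λ {n} x , add-0Λ {n} y

  0Λ-add : ∀ {n} (x : Λ n) → addΛ (0Λ n) x ≋ x
  0Λ-add {zero}  x       = +-identityˡ _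
  0Λ-add {suc n} (x , y) = 0Λ-add {n} x , 0Λ-add {n} y

  add-interchange : ∀ {n} (x y z w : Λ n) → addΛ (addΛ x y) (addΛ z w) ≋ addΛ (addΛ x z) (addΛ y w)
  add-interchange {zero}  x y z w = solve 4 0 (λ x y z w → x :+ y :+ (z :+ w) := x :+ z :+ (y :+ w)) refl x y z w
  add-interchange {suc n} (x , x′) (y , y′) (z , z′) (w , w′) = add-interchange {n} x y z w , add-interchange {n} x′ y′ z′ w′

  data AllEq : ∀ {n} → Vec Carrier n → Vec Carrier n → Set where
    []  : AllEq [] []
    _∷_ : ∀ {n a b} {v w : Vec Carrier n} → a ≈ b → AllEq v w → AllEq (a ∷ v) (b ∷ w)

  wedge-cong : ∀ {n} {v w : Vec Carrier n} {x y : Λ n} → AllEq v w → x ≋ y → wedge v x ≋ wedge w y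
  wedge-cong []       h = ≈-refl
  wedge-cong {suc n} (e ∷ es) (h , k) = wedge-cong es h ,
    addΛ-cong {n} (scaleΛ-cong {n} e h) (scaleΛ-cong {n} ≈-refl (wedge-cong es k))

  AllEq-refl : ∀ {n} {v : Vec Carrier n} → AllEq v v
  AllEq-refl {v = []}    = []
  AllEq-refl {v = _ ∷ _} = ≈-refl ∷ AllEq-refl

  wedge-congʳ : ∀ {n} (v : Vec Carrier n) {x y : Λ n} → x ≋ y → wedge v x ≋ wedge v y
  wedge-congʳ {n} v {x} {y} = wedge-cong {n} {v} {v} {x} {y} AllEq-refl

  wedge-add : ∀ {n} (v : Vec Carrier n) x y → wedge v (addΛ x y) ≋ addΛ (wedge v x) (wedge v y)
  wedge-add []      x y = ≈-sym (+-identityˡ _)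
  wedge-add {suc n} (a ∷ v) (x , y) (x′ , y′) = wedge-add v x x′ ,
    ≋-trans {n} (addΛ-cong {n} (scale-add {n} a x x′)
      (≋-trans {n} (scaleΛ-cong {n} ≈-refl (wedge-add v y y′)) (scale-add {n} _ _ _)))
      (add-interchange {n} _ _ _ _)

  wedge-scale : ∀ {n} (v : Vec Carrier n) c x → wedge v (scaleΛ c x) ≋ scaleΛ c (wedge v x)
  wedge-scale []      c x = ≈-sym (zeroʳ _)
  wedge-scale {suc n} (a ∷ v) c (x , y) = wedge-scale v c x ,
    ≋-trans {n} (addΛ-cong {n} (scale-swap {n} a c x)
      (≋-trans {n} (scaleΛ-cong {n} ≈-refl (wedge-scale v c y)) (scale-swap {n} _ _ _)))
      (≋-sym {n} (scale-add {n} _ _ _))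

  wedge-0Λ : ∀ {n} (v : Vec Carrier n) → wedge v (0Λ n) ≋ 0Λ n
  wedge-0Λ []      = ≈-refl
  wedge-0Λ {suc n} (a ∷ v) = wedge-0Λ v ,
    ≋-trans {n} (addΛ-cong {n} (scale-0Λ n a) (≋-trans {n} (scaleΛ-cong {n} ≈-refl (wedge-0Λ v)) (scale-0Λ n _))) (0Λ-add {n} _)

  _+ᵥ_ : ∀ {n} → Vec Carrier n → Vec Carrier n → Vec Carrier n
  _+ᵥ_ = Vec.zipWith _+_

  _*ᵥ_ : ∀ {n} → Carrier → Vec Carrier n → Vec Carrier n
  c *ᵥ v = Vec.map (c *_) v

  wedge-+ᵥ : ∀ {n} (v w : Vec Carrier n) x → wedge (v +ᵥ w) x ≋ addΛ (wedge v x) (wedge w x)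
  wedge-+ᵥ []      []      x = ≈-sym (+-identityˡ _)
  wedge-+ᵥ {suc n} (a ∷ v) (b ∷ w) (x , y) = wedge-+ᵥ v w x ,
    ≋-trans {n} (addΛ-cong {n} (add-scale {n} a b x)
      (≋-trans {n} (scaleΛ-cong {n} ≈-refl (wedge-+ᵥ v w y)) (scale-add {n} _ _ _)))
      (add-interchange {n} _ _ _ _)

  wedge-*ᵥ : ∀ {n} c (v : Vec Carrier n) x → wedge (c *ᵥ v) x ≋ scaleΛ c (wedge v x)
  wedge-*ᵥ c []      x = ≈-sym (zeroʳ _)
  wedge-*ᵥ {suc n} c (a ∷ v) (x , y) = wedge-*ᵥ c v x ,
    ≋-trans {n} (addΛ-cong {n} (≋-sym {n} (scale-scale {n} c a x))
      (≋-trans {n} (scaleΛ-cong {n} ≈-refl (wedge-*ᵥ c v y)) (scale-swap {n} _ _ _)))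
      (≋-sym {n} (scale-add {n} _ _ _))

  add-inverse : ∀ {n} (x : Λ n) → addΛ x (scaleΛ (- 1#) x) ≋ 0Λ n
  add-inverse {zero}  x       = solve 1 0 (λ x → x :+ :- :1 :* x := :0) refl x
  add-inverse {suc n} (x , y) = add-inverse {n} x , add-inverse {n} y

  -- Proved by itself, since deducing it from `wedge-anticommute` would mean cancelling 2.
  wedge-self : ∀ {n} (v : Vec Carrier n) x → wedge v (wedge v x) ≋ 0Λ n
  wedge-self []      x = ≈-refl
  wedge-self {suc n} (a ∷ v) (x , y) = wedge-self v x ,
    ≋-trans {n} (addΛ-cong {n} ≋-refl′ (≋-trans {n} (scaleΛ-cong {n} ≈-refl (≋-trans {n} (wedge-add v _ _)
        (≋-trans {n} (addΛ-cong {n} (wedge-scale v a x) (≋-trans {n} (wedge-scale v _ _)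
          (≋-trans {n} (scaleΛ-cong {n} ≈-refl (wedge-self v y)) (scale-0Λ n _)))) (add-0Λ {n} _)))) ≋-refl′))
      (add-inverse {n} _)
    where
    ≋-refl′ : ∀ {x : Λ n} → x ≋ x
    ≋-refl′ = ≋-refl {n}

  wedge-anticommute : ∀ {n} (v w : Vec Carrier n) x → wedge v (wedge w x) ≋ scaleΛ (- 1#) (wedge w (wedge v x))
  wedge-anticommute []      []      x = ≈-sym (zeroʳ _)
  wedge-anticommute {suc n} (a ∷ v) (b ∷ w) (x , y) = wedge-anticommute v w x ,
    ≋-trans {n} (addΛ-cong {n} ≋-refl′ (scaleΛ-cong {n} ≈-refl (expand v b w)))
    (≋-trans {n} (addΛ-cong {n} ≋-refl′ (scaleΛ-cong {n} ≈-refl (addΛ-cong {n} ≋-refl′ (scaleΛ-cong {n} ≈-refl (wedge-anticommute v w y)))))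
    (≋-trans {n} (shuffle n a b (wedge w x) (wedge v x) (wedge w (wedge v y)))
      (≋-sym {n} (scaleΛ-cong {n} ≈-refl (addΛ-cong {n} ≋-refl′ (scaleΛ-cong {n} ≈-refl (expand w a v)))))))
    where
    ≋-refl′ : ∀ {x : Λ n} → x ≋ x
    ≋-refl′ = ≋-refl {n}
    expand : ∀ v b w → wedge v (addΛ (scaleΛ b x) (scaleΛ (- 1#) (wedge w y)))
      ≋ addΛ (scaleΛ b (wedge v x)) (scaleΛ (- 1#) (wedge v (wedge w y)))
    expand v b w = ≋-trans {n} (wedge-add v _ _) (addΛ-cong {n} (wedge-scale v b x) (wedge-scale v _ _))
    shuffle : ∀ n a b (p r t : Λ n) →
      addΛ (scaleΛ a p) (scaleΛ (- 1#) (addΛ (scaleΛ b r) (scaleΛ (- 1#) (scaleΛ (- 1#) t))))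
        ≋ scaleΛ (- 1#) (addΛ (scaleΛ b r) (scaleΛ (- 1#) (addΛ (scaleΛ a p) (scaleΛ (- 1#) t))))
    shuffle zero    a b p r t = solve 5 0 (λ a p b r t →
        a :* p :+ :- :1 :* (b :* r :+ :- :1 :* (:- :1 :* t))
          := :- :1 :* (b :* r :+ :- :1 :* (a :* p :+ :- :1 :* t))) refl a p b r t
    shuffle (suc n) a b (p , p′) (r , r′) (t , t′) = shuffle n a b p r t , shuffle n a b p′ r′ t′

  wedges-cong : ∀ {n} (vs : List (Vec Carrier n)) {x y} → x ≋ y → wedges vs x ≋ wedges vs y
  wedges-cong []       h = h
  wedges-cong (v ∷ vs) h = wedge-congʳ v (wedges-cong vs h)

  -- The algebra map that sets the generator e_j to 0 and renumbers the others; on rows it deletes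
  -- column j.
  restrict : ∀ {n} → Fin (suc n) → Λ (suc n) → Λ n
  restrict         zero    (x , y) = x
  restrict {suc n} (suc j) (x , y) = restrict j x , restrict j y

  restrict-1Λ : ∀ {n} (j : Fin (suc n)) → restrict j (1Λ (suc n)) ≋ 1Λ n
  restrict-0Λ : ∀ {n} (j : Fin (suc n)) → restrict j (0Λ (suc n)) ≋ 0Λ n
  restrict-0Λ {n}     zero    = ≋-refl {n}
  restrict-0Λ {suc n} (suc j) = restrict-0Λ j , restrict-0Λ j
  restrict-1Λ {n}     zero    = ≋-refl {n}
  restrict-1Λ {suc n} (suc j) = restrict-1Λ j , restrict-0Λ j

  restrict-add : ∀ {n} (j : Fin (suc n)) x y → restrict j (addΛ x y) ≋ addΛ (restrict j x) (restrict j y)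
  restrict-add {n}     zero    x y = ≋-refl {n}
  restrict-add {suc n} (suc j) (x , y) (x′ , y′) = restrict-add j x x′ , restrict-add j y y′

  restrict-scale : ∀ {n} (j : Fin (suc n)) c x → restrict j (scaleΛ c x) ≋ scaleΛ c (restrict j x)
  restrict-scale {n}     zero    c x = ≋-refl {n}
  restrict-scale {suc n} (suc j) c (x , y) = restrict-scale j c x , restrict-scale j c y

  restrict-wedge : ∀ {n} (j : Fin (suc n)) (v : Fin (suc n) → Carrier) ξ →
    restrict j (wedge (tabulate v) ξ) ≋ wedge (tabulate (v ∘ punchIn j)) (restrict j ξ)
  restrict-wedge {n}     zero    v (x , y) = ≋-refl {n}
  restrict-wedge {suc n} (suc j) v (x , y) = restrict-wedge j (v ∘ suc) x ,
    ≋-trans {n} (restrict-add j _ _) (addΛ-cong {n} (restrict-scale j _ x)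
      (≋-trans {n} (restrict-scale j _ _) (scaleΛ-cong {n} ≈-refl (restrict-wedge j (v ∘ suc) y))))

  rowsOf : ∀ {m n} → (Fin m → Fin n → Carrier) → List (Vec Carrier n)
  rowsOf {zero}  A = []
  rowsOf {suc m} A = tabulate (A zero) ∷ rowsOf (A ∘ suc)

  restrict-rows : ∀ {m n} (j : Fin (suc n)) (A : Fin m → Fin (suc n) → Carrier) →
    restrict j (wedges (rowsOf A) (1Λ _)) ≋ wedges (rowsOf λ r c → A r (punchIn j c)) (1Λ n)
  restrict-rows {zero}      j A = restrict-1Λ j
  restrict-rows {suc m} {n} j A = ≋-trans {n} (restrict-wedge j (A zero) _)
    (wedge-congʳ (tabulate (A zero ∘ punchIn j)) (restrict-rows j (A ∘ suc)))

  sumFin-cong : ∀ k {f g : Fin k → Carrier} → (∀ i → f i ≈ g i) → sumFin K k f ≈ sumFin K k g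
  sumFin-cong zero    e = ≈-refl
  sumFin-cong (suc k) e = +-cong (e zero) (sumFin-cong k (e ∘ suc))

  sumFin-scale : ∀ k c (f : Fin k → Carrier) → c * sumFin K k f ≈ sumFin K k λ i → c * f i
  sumFin-scale zero    c f = zeroʳ _
  sumFin-scale (suc k) c f = ≈-trans (distribˡ _ _ _) (+-congˡ (sumFin-scale k c (f ∘ suc)))

  -- Laplace expansion along the first row.
  top-wedge : ∀ {n} (v : Fin (suc n) → Carrier) (ξ : Λ (suc n)) →
    top (wedge (tabulate v) ξ) ≈ sumFin K (suc n) λ j → pow K (- 1#) (toℕ j) * (v j * top (restrict j ξ))
  top-wedge {zero} v (x , y) = solve 2 0 (λ v0 x → v0 :* x :+ :- :1 :* :0 := :1 :* (v0 :* x) :+ :0) refl v0 x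
    where v0 = v zero
  top-wedge {suc n} v (x , y) = begin
    top (addΛ (scaleΛ (v zero) x) (scaleΛ (- 1#) (wedge (tabulate (v ∘ suc)) y)))
      ≈⟨ ≈-trans (top-add {suc n} (scaleΛ (v zero) x) (scaleΛ (- 1#) t)) (+-cong (top-scale {suc n} _ x) (top-scale {suc n} _ t)) ⟩
    v zero * top {suc n} x + - 1# * top (wedge (tabulate (v ∘ suc)) y)
      ≈⟨ +-cong (≈-sym (*-identityˡ _)) (*-congˡ (top-wedge (v ∘ suc) y)) ⟩
    1# * (v zero * top {suc n} x) + - 1# * sumFin K (suc n) f
      ≈⟨ +-congˡ (≈-trans (sumFin-scale (suc n) (- 1#) f) (sumFin-cong (suc n) {λ j → - 1# * f j} {g} λ j → ≈-sym (*-assoc _ _ _))) ⟩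
    1# * (v zero * top {suc n} x) + sumFin K (suc n) g ∎
    where
    t = wedge (tabulate (v ∘ suc)) y
    f g : Fin (suc n) → Carrier
    f j = pow K (- 1#) (toℕ j) * (v (suc j) * top (restrict j y))
    g j = pow K (- 1#) (suc (toℕ j)) * (v (suc j) * top (restrict j y))

  det-volume : ∀ k (A : Fin k → Fin k → Carrier) → det K k A ≈ volume (rowsOf A)
  det-volume zero    A = ≈-refl
  det-volume (suc k) A = begin
    det K (suc k) A     ≈⟨ (sumFin-cong (suc k) {f} {g} λ j → *-congˡ {pow K (- 1#) (toℕ j)} (*-congˡ {A zero j}
      (≈-trans (det-volume k (λ r c → A (suc r) (punchIn j c))) (≈-sym (top-cong {k} {restrict j (wedges (rowsOf (A ∘ suc)) (1Λ _))} (restrict-rows j (A ∘ suc))))))) ⟩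
    sumFin K (suc k) g  ≈⟨ top-wedge (A zero) (wedges (rowsOf (A ∘ suc)) (1Λ _)) ⟨
    volume (rowsOf A)   ∎
    where
    f g : Fin (suc k) → Carrier
    f j = pow K (- 1#) (toℕ j) * (A zero j * det K k λ r c → A (suc r) (punchIn j c))
    g j = pow K (- 1#) (toℕ j) * (A zero j * top (restrict j (wedges (rowsOf (A ∘ suc)) (1Λ _))))

-- F e [y₁, …, y_k] is the divided difference at y₁, …, y_k of the Chebyshev-type
-- polynomial U_e with U_e(x + x⁻¹) = (xᵉ − x⁻ᵉ)/(x − x⁻¹).  The symplectic
-- character is the quotient of two alternants in these polynomials, hence a
-- determinant of divided differences.
module DividedDifferences {C : Set} (O : Operations C) where
  open Operations O
  open ExteriorAlgebra O

  F : ℕ → List C → C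
  F e             []           = nil
  F zero          (y ∷ ys)     = nil
  F (suc zero)    (y ∷ [])     = one
  F (suc zero)    (y ∷ _ ∷ _)  = nil
  -- The Leibniz rule (y·g)[y, ys] = y g[y, ys] + g[ys] for divided differences, applied to U_{e+2}
  -- = y U_{e+1} - U_e.
  F (suc (suc e)) (y ∷ ys)     = add (add (mul y (F (suc e) (y ∷ ys))) (F (suc e) ys)) (neg (F e (y ∷ ys)))

  rowF : ∀ {n} → Vec ℕ n → List C → Vec C n
  rowF []       ys = []
  rowF (e ∷ es) ys = F e ys ∷ rowF es ys

  -- Row k holds the divided differences at the first k points, the newest point in front.
  newton : ∀ {n} → Vec ℕ n → List C → List C → List (Vec C n)
  newton es ps []       = []
  newton es ps (y ∷ ys) = rowF es (y ∷ ps) ∷ newton es (y ∷ ps) ys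

  alternating : ℕ → C
  alternating zero    = one
  alternating (suc n) = mul (neg one) (alternating n)

  -- (-1)^{n(n-1)/2}, the sign of the permutation that reverses the order.
  ε : ℕ → C
  ε zero    = one
  ε (suc n) = mul (alternating n) (ε n)

  -- Numerator and denominator share the factors σ(x) and the Vandermonde product in x + x⁻¹. What
  -- is left of the denominator is the sign `ε n`, so the quotient needs no division.
  character : ∀ {n} → Vec ℕ n → List C → C
  character {n} es ys = mul (ε n) (volume (newton es [] ys))

-- One abstraction theorem serves three times: for homomorphisms, for congruence under `≈`, and for
-- the evaluation of expressions.
module Parametricity {C D : Set} (O : Operations C) (Q : Operations D) (R : C → D → Set) where
  private
    module O = Operations O
    module Q = Operations Q
    module EO = ExteriorAlgebra O
    module EQ = ExteriorAlgebra Q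
    module DO = DividedDifferences O
    module DQ = DividedDifferences Q

  record Respects : Set where
    field
      add : ∀ {a a′ b b′} → R a b → R a′ b′ → R (O.add a a′) (Q.add b b′)
      mul : ∀ {a a′ b b′} → R a b → R a′ b′ → R (O.mul a a′) (Q.mul b b′)
      neg : ∀ {a b} → R a b → R (O.neg a) (Q.neg b)
      nil : R O.nil Q.nil
      one : R O.one Q.one

  module _ (respects : Respects) where
    open Respects respects

    RΛ : ∀ {n} → EO.Λ n → EQ.Λ n → Set
    RΛ {zero}  x       y         = R x y
    RΛ {suc n} (x , y) (x′ , y′) = RΛ {n} x x′ × RΛ {n} y y′

    R-0Λ : ∀ n → RΛ (EO.0Λ n) (EQ.0Λ n)
    R-0Λ zero    = nil
    R-0Λ (suc n) = R-0Λ n , R-0Λ n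

    R-1Λ : ∀ n → RΛ (EO.1Λ n) (EQ.1Λ n)
    R-1Λ zero    = one
    R-1Λ (suc n) = R-1Λ n , R-0Λ n

    R-add : ∀ {n} {x y : EO.Λ n} {x′ y′ : EQ.Λ n} → RΛ x x′ → RΛ y y′ → RΛ (EO.addΛ x y) (EQ.addΛ x′ y′)
    R-add {zero}  h        k        = add h k
    R-add {suc n} (h , h′) (k , k′) = R-add {n} h k , R-add {n} h′ k′

    R-scale : ∀ {n} {a b} {x : EO.Λ n} {y : EQ.Λ n} → R a b → RΛ x y → RΛ (EO.scaleΛ a x) (EQ.scaleΛ b y)
    R-scale {zero}  r h       = mul r h
    R-scale {suc n} r (h , k) = R-scale {n} r h , R-scale {n} r k

    R-wedge : ∀ {n} {v : Vec C n} {w : Vec D n} {x y} → VecPointwise R v w → RΛ x y → RΛ (EO.wedge v x) (EQ.wedge w y)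
    R-wedge []       h = nil
    R-wedge {suc n} (r ∷ rs) (h , k) = R-wedge rs h , R-add {n} (R-scale {n} r h) (R-scale {n} (neg one) (R-wedge rs k))

    R-wedges : ∀ {n} {vs : List (Vec C n)} {ws x y} → ListPointwise (VecPointwise R) vs ws → RΛ x y →
      RΛ (EO.wedges vs x) (EQ.wedges ws y)
    R-wedges []       h = h
    R-wedges (r ∷ rs) h = R-wedge r (R-wedges rs h)

    R-top : ∀ {n} {x : EO.Λ n} {y : EQ.Λ n} → RΛ x y → R (EO.top x) (EQ.top y)
    R-top {zero}  h       = h
    R-top {suc n} (h , k) = R-top {n} k

    R-F : ∀ e {ys zs} → ListPointwise R ys zs → R (DO.F e ys) (DQ.F e zs)
    R-F e             []           = nil
    R-F zero          (r ∷ rs)     = nil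
    R-F (suc zero)    (r ∷ [])     = one
    R-F (suc zero)    (r ∷ _ ∷ _)  = nil
    R-F (suc (suc e)) (r ∷ rs)     = add (add (mul r (R-F (suc e) (r ∷ rs))) (R-F (suc e) rs)) (neg (R-F e (r ∷ rs)))

    R-rowF : ∀ {n} (es : Vec ℕ n) {ys zs} → ListPointwise R ys zs → VecPointwise R (DO.rowF es ys) (DQ.rowF es zs)
    R-rowF []       rs = []
    R-rowF (e ∷ es) rs = R-F e rs ∷ R-rowF es rs

    R-newton : ∀ {n} (es : Vec ℕ n) {ps ps′ ys zs} → ListPointwise R ps ps′ → ListPointwise R ys zs →
      ListPointwise (VecPointwise R) (DO.newton es ps ys) (DQ.newton es ps′ zs)
    R-newton es ps []       = []
    R-newton es ps (r ∷ rs) = R-rowF es (r ∷ ps) ∷ R-newton es (r ∷ ps) rs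

    R-alternating : ∀ n → R (DO.alternating n) (DQ.alternating n)
    R-alternating zero    = one
    R-alternating (suc n) = mul (neg one) (R-alternating n)

    R-ε : ∀ n → R (DO.ε n) (DQ.ε n)
    R-ε zero    = one
    R-ε (suc n) = mul (R-alternating n) (R-ε n)

    R-character : ∀ {n} (es : Vec ℕ n) {ys zs} → ListPointwise R ys zs → R (DO.character es ys) (DQ.character es zs)
    R-character {n} es rs = mul (R-ε n) (R-top {n} (R-wedges (R-newton es [] rs) (R-1Λ n)))

descending : ∀ n → Vec ℕ n
descending zero    = []
descending (suc n) = suc n ∷ descending n

module Alternants (K : CommutativeRing 0ℓ 0ℓ) where
  open Ring K
  open Exterior K
  open DividedDifferences (operations K) public

  Y σᵤ : Invertible K → Carrier
  Y x = val x + inv x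
  σᵤ x = val x + - inv x

  φ : ℕ → Invertible K → Carrier
  φ e x = pow K (val x) e + - pow K (inv x) e

  rowφ : ∀ {n} → Vec ℕ n → Invertible K → Vec Carrier n
  rowφ es x = Vec.map (λ e → φ e x) es

  alternant : ∀ {n} → Vec ℕ n → List (Invertible K) → Carrier
  alternant es xs = volume (List.map (rowφ es) xs)

  -- Both sides satisfy a_{e+2} = (x + x⁻¹) a_{e+1} - a_e.
  φ-F : ∀ e x → φ e x ≈ σᵤ x * F e (Y x ∷ [])
  φ-F zero x = solve 0 1 (λ x x̄ → :1 :+ :- :1 := (x :+ :- x̄) :* :0) refl x
  φ-F (suc zero) x = solve 0 1 (λ x x̄ → x :* :1 :+ :- (x̄ :* :1) := (x :+ :- x̄) :* :1) refl x
  φ-F (suc (suc e)) x = begin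
    φ (suc (suc e)) x
      ≈⟨ solve 2 1 (λ a b x x̄ →
          x :* (x :* a) :+ :- (x̄ :* (x̄ :* b))
            := (x :+ x̄) :* (x :* a :+ :- (x̄ :* b)) :+ :- (a :+ :- b)) refl a b x ⟩
    Y x * φ (suc e) x + - φ e x
      ≈⟨ +-cong (*-congˡ (φ-F (suc e) x)) (-‿cong (φ-F e x)) ⟩
    Y x * (σᵤ x * f) + - (σᵤ x * g)
      ≈⟨ lemma (Y x) (σᵤ x) f g ⟩
    σᵤ x * (Y x * f + 0# + - g) ∎
    where
    a = pow K (val x) e
    b = pow K (inv x) e
    f = F (suc e) (Y x ∷ [])
    g = F e (Y x ∷ [])
    lemma : ∀ y s f g → y * (s * f) + - (s * g) ≈ s * (y * f + 0# + - g)
    lemma = solve 4 0 (λ y s f g → y :* (s :* f) :+ :- (s :* g) := s :* (y :* f :+ :0 :+ :- g)) refl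

  -- The quotient rule that usually defines divided differences; here it follows by induction along
  -- the recurrence of `F`.
  F-newton : ∀ e a b ys → F e (a ∷ ys) ≈ F e (b ∷ ys) + (a + - b) * F e (a ∷ b ∷ ys)
  F-newton zero a b ys = solve 2 0 (λ a b → :0 := :0 :+ (a :+ :- b) :* :0) refl a b
  F-newton (suc zero) a b [] = solve 2 0 (λ a b → :1 := :1 :+ (a :+ :- b) :* :0) refl a b
  F-newton (suc zero) a b (_ ∷ _) = solve 2 0 (λ a b → :0 := :0 :+ (a :+ :- b) :* :0) refl a b
  F-newton (suc (suc e)) a b ys = lemma _ _ (F (suc e) (b ∷ ys)) (F e (b ∷ ys)) (F (suc e) ys) (F (suc e) (a ∷ b ∷ ys)) (F e (a ∷ b ∷ ys))
    (F-newton (suc e) a b ys) (F-newton e a b ys)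
    where
    lemma : ∀ p r p′ r′ t f g → p ≈ p′ + (a + - b) * f → r ≈ r′ + (a + - b) * g →
      a * p + t + - r ≈ (b * p′ + t + - r′) + (a + - b) * (a * f + p′ + - g)
    lemma p r p′ r′ t f g h k = solve-by 9 0 (λ a p t r b p′ r′ f g →
        a :* p :+ t :+ :- r := b :* p′ :+ t :+ :- r′ :+ (a :+ :- b) :* (a :* f :+ p′ :+ :- g) ,
        (a , p := p′ :+ (a :+ :- b) :* f) ∷
        (:- :1 , r := r′ :+ (a :+ :- b) :* g) ∷ []) refl a p t r b p′ r′ f g h k

  row-newton : ∀ {n} (es : Vec ℕ n) a b ys →
    AllEq (rowF es (a ∷ ys)) (rowF es (b ∷ ys) +ᵥ ((a + - b) *ᵥ rowF es (a ∷ b ∷ ys)))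
  row-newton []       a b ys = []
  row-newton (e ∷ es) a b ys = F-newton e a b ys ∷ row-newton es a b ys

  plainRows : ∀ {n} → Vec ℕ n → List Carrier → List Carrier → List (Vec Carrier n)
  plainRows es ps ys = List.map (λ y → rowF es (y ∷ ps)) ys

  differences : Carrier → List Carrier → Carrier
  differences y []       = 1#
  differences y (z ∷ zs) = (z + - y) * differences y zs

  vandermonde : List Carrier → Carrier
  vandermonde []       = 1#
  vandermonde (y ∷ ys) = differences y ys * vandermonde ys

  -- The row at z is the row at y plus z - y times a divided difference, and the first of these dies
  -- against the row at y.
  pull : ∀ {n} (es : Vec ℕ n) y z ps ξ → wedge (rowF es (y ∷ ps)) (wedge (rowF es (z ∷ ps)) ξ)
    ≋ scaleΛ (z + - y) (wedge (rowF es (y ∷ ps)) (wedge (rowF es (z ∷ y ∷ ps)) ξ))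
  pull {n} es y z ps ξ =
    ≋-trans {n} (wedge-congʳ r (≋-trans {n} (wedge-cong (row-newton es z y ps) (≋-refl {n}))
      (≋-trans {n} (wedge-+ᵥ r ((z + - y) *ᵥ r′) ξ) (addΛ-cong {n} (≋-refl {n}) (wedge-*ᵥ (z + - y) r′ ξ)))))
    (≋-trans {n} (wedge-add r _ _) (≋-trans {n} (addΛ-cong {n} (wedge-self r ξ) (wedge-scale r _ _)) (0Λ-add {n} _)))
    where r = rowF es (y ∷ ps)
          r′ = rowF es (z ∷ y ∷ ps)

  pull-all : ∀ {n} (es : Vec ℕ n) y ps zs ξ → wedge (rowF es (y ∷ ps)) (wedges (plainRows es ps zs) ξ)
    ≋ scaleΛ (differences y zs) (wedge (rowF es (y ∷ ps)) (wedges (plainRows es (y ∷ ps) zs) ξ))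
  pull-all {n} es y ps []       ξ = ≋-sym {n} (scale-one {n} _)
  pull-all {n} es y ps (z ∷ zs) ξ =
    ≋-trans {n} (pull es y z ps _)
    (≋-trans {n} (scaleΛ-cong {n} ≈-refl
      -- The row of y is moved past the new row, so that the induction hypothesis applies, and then
      -- back; the two signs cancel.
      (≋-trans {n} (wedge-anticommute r r′ _)
      (≋-trans {n} (scaleΛ-cong {n} ≈-refl (≋-trans {n} (wedge-congʳ r′ (pull-all es y ps zs ξ)) (wedge-scale r′ _ _)))
      (≋-trans {n} (scale-swap {n} _ _ _)
      (scaleΛ-cong {n} ≈-refl (≋-sym {n} (wedge-anticommute r r′ _)))))))
    (scale-scale {n} _ _ _))
    where r = rowF es (y ∷ ps)
          r′ = rowF es (z ∷ y ∷ ps)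

  eliminate : ∀ {n} (es : Vec ℕ n) ps ys ξ →
    wedges (plainRows es ps ys) ξ ≋ scaleΛ (vandermonde ys) (wedges (newton es ps ys) ξ)
  eliminate {n} es ps []       ξ = ≋-sym {n} (scale-one {n} ξ)
  eliminate {n} es ps (y ∷ ys) ξ =
    ≋-trans {n} (pull-all es y ps ys ξ)
    (≋-trans {n} (scaleΛ-cong {n} ≈-refl (≋-trans {n} (wedge-congʳ r (eliminate es (y ∷ ps) ys ξ)) (wedge-scale r _ _)))
    (scale-scale {n} _ _ _))
    where r = rowF es (y ∷ ps)

  σ-product : List (Invertible K) → Carrier
  σ-product []       = 1#
  σ-product (x ∷ xs) = σᵤ x * σ-product xs

  row-φ-F : ∀ {n} (es : Vec ℕ n) x → AllEq (rowφ es x) (σᵤ x *ᵥ rowF es (Y x ∷ []))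
  row-φ-F []       x = []
  row-φ-F (e ∷ es) x = φ-F e x ∷ row-φ-F es x

  wedges-φ : ∀ {n} (es : Vec ℕ n) xs ξ →
    wedges (List.map (rowφ es) xs) ξ ≋ scaleΛ (σ-product xs) (wedges (plainRows es [] (List.map Y xs)) ξ)
  wedges-φ {n} es []       ξ = ≋-sym {n} (scale-one {n} ξ)
  wedges-φ {n} es (x ∷ xs) ξ =
    ≋-trans {n} (wedge-cong (row-φ-F es x) (wedges-φ es xs ξ))
    (≋-trans {n} (wedge-*ᵥ (σᵤ x) r _)
    (≋-trans {n} (scaleΛ-cong {n} ≈-refl (wedge-scale r _ _)) (scale-scale {n} _ _ _)))
    where r = rowF es (Y x ∷ [])

  alternant-newton : ∀ {n} (es : Vec ℕ n) xs →
    alternant es xs ≈ σ-product xs * vandermonde (List.map Y xs) * volume (newton es [] (List.map Y xs))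
  alternant-newton {n} es xs = begin
    alternant es xs
      ≈⟨ top-cong {n} (≋-trans {n} (wedges-φ es xs (1Λ n)) (scaleΛ-cong {n} ≈-refl (eliminate es [] (List.map Y xs) (1Λ n)))) ⟩
    top (scaleΛ (σ-product xs) (scaleΛ v w))      ≈⟨ top-scale {n} (σ-product xs) (scaleΛ v w) ⟩
    σ-product xs * top (scaleΛ v w)               ≈⟨ *-congˡ (top-scale {n} v w) ⟩
    σ-product xs * (v * top w)                    ≈⟨ *-assoc _ _ _ ⟨
    σ-product xs * v * top w                      ∎
    where
    v = vandermonde (List.map Y xs)
    w = wedges (newton es [] (List.map Y xs)) (1Λ n)

  -- U_e has degree e - 1, so its divided differences at more than e points vanish.
  F-below : ∀ e l → e ℕ.< length l → F e l ≈ 0#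
  F-below e             []           ()
  F-below zero          (y ∷ ys)     h = ≈-refl
  F-below (suc zero)    (y ∷ [])     (s≤s ())
  F-below (suc zero)    (y ∷ _ ∷ _)  h = ≈-refl
  F-below (suc (suc e)) (y ∷ ys)     (s≤s h) = lemma (F-below (suc e) (y ∷ ys) (ℕP.m≤n⇒m≤1+n h)) (F-below (suc e) ys h)
    (F-below e (y ∷ ys) (ℕP.m≤n⇒m≤1+n (ℕP.<⇒≤ h)))
    where
    lemma : ∀ {a b c} → a ≈ 0# → b ≈ 0# → c ≈ 0# → y * a + b + - c ≈ 0#
    lemma {a} {b} {c} p r t = solve-by 4 0 (λ y a b c →
        y :* a :+ b :+ :- c := :0 ,
        (y , a := :0) ∷
        (:1 , b := :0) ∷
        (:- :1 , c := :0) ∷ []) refl y a b c p r t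

  -- The divided difference of U_e at e points is its leading coefficient, and U_e is monic.
  F-leading : ∀ y ys → F (suc (length ys)) (y ∷ ys) ≈ 1#
  F-leading y []       = ≈-refl
  F-leading y (z ∷ zs) = lemma (F-below (suc (length zs)) (y ∷ z ∷ zs) ℕP.≤-refl) (F-leading z zs)
    (F-below (length zs) (y ∷ z ∷ zs) (ℕP.m≤n⇒m≤1+n ℕP.≤-refl))
    where
    lemma : ∀ {a b c} → a ≈ 0# → b ≈ 1# → c ≈ 0# → y * a + b + - c ≈ 1#
    lemma {a} {b} {c} p r t = solve-by 4 0 (λ y a b c →
        y :* a :+ b :+ :- c := :1 ,
        (y , a := :0) ∷
        (:1 , b := :1) ∷
        (:- :1 , c := :0) ∷ []) refl y a b c p r t

  row-below : ∀ n l → n ℕ.< length l → AllEq (rowF (descending n) l) (Vec.replicate n 0#)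
  row-below zero    l h = []
  row-below (suc n) l h = F-below (suc n) l h ∷ row-below n l (ℕP.<⇒≤ h)

  wedge-zeros : ∀ n (x : Λ n) → wedge (Vec.replicate n 0#) x ≋ 0Λ n
  wedge-zeros zero    x       = ≈-refl
  wedge-zeros (suc n) (x , y) = wedge-zeros n x ,
    ≋-trans {n} (addΛ-cong {n} (scale-zero {n} x ≈-refl) (≋-trans {n} (scaleΛ-cong {n} ≈-refl (wedge-zeros n y)) (scale-0Λ n _)))
      (0Λ-add {n} _)

  private
    init : Carrier → List Carrier → List Carrier
    init y []       = []
    init y (z ∷ zs) = y ∷ init z zs

    init-length : ∀ y ys → length (init y ys) ≡ length ys
    init-length y []       = refl
    init-length y (z ∷ zs) = ≡.cong suc (init-length z zs)

    -- The rows of the denominator are anti-triangular with ones on the antidiagonal.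
    last-row : ∀ n y ys ps → length ps ℕ.+ length ys ≡ n →
      wedges (newton (descending (suc n)) ps (y ∷ ys)) (1Λ (suc n))
        ≋ (0Λ n , scaleΛ (alternating (length ys)) (wedges (newton (descending n) ps (init y ys)) (1Λ n)))
    last-row n y [] ps refl =
      ≋-trans {n} (wedge-cong below (≋-refl {n})) (wedge-zeros n _) ,
      ≋-trans {n} (addΛ-cong {n} (scaleΛ-cong {n} (≈-trans (reflexive (≡.cong (λ m → F (suc m) (y ∷ ps)) (ℕP.+-identityʳ (length ps)))) (F-leading y ps)) (≋-refl {n}))
        (≋-trans {n} (scaleΛ-cong {n} ≈-refl (wedge-0Λ (rowF (descending n) (y ∷ ps)))) (scale-0Λ n _))) (add-0Λ {n} _)
      where
      below : AllEq (rowF (descending n) (y ∷ ps)) (Vec.replicate n 0#)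
      below = row-below n (y ∷ ps) (s≤s (ℕP.≤-reflexive (ℕP.+-identityʳ (length ps))))
    last-row n y (z ∷ zs) ps h with last-row n z zs (y ∷ ps) (≡.trans (≡.sym (ℕP.+-suc (length ps) (length zs))) h)
    ... | e , e′ = ≋-trans {n} (wedge-congʳ v e) (wedge-0Λ v) ,
      ≋-trans {n} (addΛ-cong {n} (≋-trans {n} (scaleΛ-cong {n} ≈-refl e) (scale-0Λ n _))
        (scaleΛ-cong {n} ≈-refl (≋-trans {n} (wedge-congʳ v e′) (wedge-scale v _ _))))
      (≋-trans {n} (0Λ-add {n} _) (scale-scale {n} _ _ _))
      where v = rowF (descending n) (y ∷ ps)

  volume-descending : ∀ n ys → length ys ≡ n → volume (newton (descending n) [] ys) ≈ ε n
  volume-descending zero    []       refl = ≈-refl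
  volume-descending (suc n) (y ∷ ys) h = begin
    volume (newton (descending (suc n)) [] (y ∷ ys))    ≈⟨ top-cong {n} (proj₂ (last-row n y ys [] l)) ⟩
    top (scaleΛ (alternating (length ys)) w)            ≈⟨ top-scale {n} _ w ⟩
    alternating (length ys) * top w
      ≈⟨ *-cong (reflexive (≡.cong alternating l)) (volume-descending n (init y ys) (≡.trans (init-length y ys) l)) ⟩
    ε (suc n) ∎
    where
    l = ℕP.suc-injective h
    w = wedges (newton (descending n) [] (init y ys)) (1Λ n)

  alternating² : ∀ n → alternating n * alternating n ≈ 1#
  alternating² zero    = *-identityˡ _
  alternating² (suc n) = ≈-trans (lemma (alternating n)) (alternating² n)
    where
    lemma : ∀ a → - 1# * a * (- 1# * a) ≈ a * a
    lemma = solve 1 0 (λ a → :- :1 :* a :* (:- :1 :* a) := a :* a) refl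

  ε² : ∀ n → ε n * ε n ≈ 1#
  ε² zero    = *-identityˡ _
  ε² (suc n) = ≈-trans (*-interchange _ _ _ _) (≈-trans (*-cong (alternating² n) (ε² n)) (*-identityˡ _))

  denominator : ∀ n xs → length xs ≡ n →
    alternant (descending n) xs ≈ σ-product xs * vandermonde (List.map Y xs) * ε n
  denominator n xs h = ≈-trans (alternant-newton (descending n) xs)
    (*-congˡ (volume-descending n (List.map Y xs) (≡.trans (length-map Y xs) h)))

  -- Both alternants are the same product of σ and Vandermonde factors times a Newton determinant,
  -- and that of the denominator is `ε n` with square 1. This holds in every ring, by multiplication
  -- alone.
  character-quotient : ∀ {n} (es : Vec ℕ n) xs → length xs ≡ n →
    character es (List.map Y xs) * alternant (descending n) xs ≈ alternant es xs
  character-quotient {n} es xs h = begin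
    ε n * v * alternant (descending n) xs     ≈⟨ *-congˡ (denominator n xs h) ⟩
    ε n * v * (σ-product xs * Δ * ε n)        ≈⟨ lemma (ε n) v (σ-product xs) Δ (ε² n) ⟩
    σ-product xs * Δ * v                      ≈⟨ alternant-newton es xs ⟨
    alternant es xs                           ∎
    where
    v = volume (newton es [] (List.map Y xs))
    Δ = vandermonde (List.map Y xs)
    lemma : ∀ e v s d → e * e ≈ 1# → e * v * (s * d * e) ≈ s * d * v
    lemma = solve-by 4 0 (λ e v s d →
        e :* v :* (s :* d :* e) := s :* d :* v ,
        (v :* s :* d , e :* e := :1) ∷ []) refl

-- Exponents prime to 3 and the recursion of the alternant

size hi lo : ℕ → ℕ
size zero    = 2
size (suc n) = suc (suc (size n))
hi zero    = 2
hi (suc n) = 3 ℕ.+ hi n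
lo zero    = 1
lo (suc n) = 3 ℕ.+ lo n

-- 3n+2, 3n+1, …, 5, 4, 2, 1: the exponents λ_j + N + 1 − j of the numerator.
exponents : ∀ n → Vec ℕ (size n)
exponents zero    = 2 ∷ 1 ∷ []
exponents (suc n) = hi (suc n) ∷ lo (suc n) ∷ exponents n

module ColumnOperations (K : CommutativeRing 0ℓ 0ℓ) where
  open Ring K
  open Exterior K
  open Alternants K

  dot : ∀ {n} → Vec Carrier n → Vec Carrier n → Carrier
  dot []      []      = 0#
  dot (a ∷ v) (b ∷ w) = a * b + dot v w

  -- The interior product with the linear form l.
  contract : ∀ {n} → Vec Carrier n → Λ n → Λ n
  contract []      x       = 0#
  contract (b ∷ l) (x , y) = addΛ (contract l x) (scaleΛ b y) , scaleΛ (- 1#) (contract l y)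

  contract-cong : ∀ {n} (l : Vec Carrier n) {x y} → x ≋ y → contract l x ≋ contract l y
  contract-cong []      h       = ≈-refl
  contract-cong {suc n} (b ∷ l) (h , k) =
    addΛ-cong {n} (contract-cong l h) (scaleΛ-cong {n} ≈-refl k) , scaleΛ-cong {n} ≈-refl (contract-cong l k)

  contract-add : ∀ {n} (l : Vec Carrier n) x y → contract l (addΛ x y) ≋ addΛ (contract l x) (contract l y)
  contract-add []      x y = ≈-sym (+-identityˡ _)
  contract-add {suc n} (b ∷ l) (x , y) (x′ , y′) =
    ≋-trans {n} (addΛ-cong {n} (contract-add l x x′) (scale-add {n} b y y′)) (add-interchange {n} _ _ _ _) ,
    ≋-trans {n} (scaleΛ-cong {n} ≈-refl (contract-add l y y′)) (scale-add {n} _ _ _)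

  contract-scale : ∀ {n} (l : Vec Carrier n) c x → contract l (scaleΛ c x) ≋ scaleΛ c (contract l x)
  contract-scale []      c x = ≈-sym (zeroʳ _)
  contract-scale {suc n} (b ∷ l) c (x , y) =
    ≋-trans {n} (addΛ-cong {n} (contract-scale l c x) (scale-swap {n} b c y)) (≋-sym {n} (scale-add {n} _ _ _)) ,
    ≋-trans {n} (scaleΛ-cong {n} ≈-refl (contract-scale l c y)) (scale-swap {n} _ _ _)

  contract-0Λ : ∀ {n} (l : Vec Carrier n) → contract l (0Λ n) ≋ 0Λ n
  contract-0Λ []      = ≈-refl
  contract-0Λ {suc n} (b ∷ l) =
    ≋-trans {n} (addΛ-cong {n} (contract-0Λ l) (scale-0Λ n b)) (0Λ-add {n} _) ,
    ≋-trans {n} (scaleΛ-cong {n} ≈-refl (contract-0Λ l)) (scale-0Λ n _)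

  contract-1Λ : ∀ {n} (l : Vec Carrier n) → contract l (1Λ n) ≋ 0Λ n
  contract-1Λ []      = ≈-refl
  contract-1Λ {suc n} (b ∷ l) =
    ≋-trans {n} (addΛ-cong {n} (contract-1Λ l) (scale-0Λ n b)) (0Λ-add {n} _) ,
    ≋-trans {n} (scaleΛ-cong {n} ≈-refl (contract-0Λ l)) (scale-0Λ n _)

  top-contract : ∀ {n} (l : Vec Carrier n) x → top (contract l x) ≈ 0#
  top-contract []      x = ≈-refl
  top-contract {suc n} (b ∷ l) (x , y) = ≈-trans (top-scale {n} _ (contract l y)) (≈-trans (*-congˡ (top-contract l y)) (zeroʳ _))

  private
    first : ∀ n a b d (x y cx wcx wy : Λ n) →
      addΛ (addΛ (scaleΛ d x) (scaleΛ (- 1#) wcx)) (scaleΛ b (addΛ (scaleΛ a x) (scaleΛ (- 1#) wy)))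
        ≋ addΛ (scaleΛ (b * a + d) x) (scaleΛ (- 1#) (addΛ wcx (scaleΛ b wy)))
    first zero a b d x y cx wcx wy = solve 6 0 (λ d x wcx b a wy →
        d :* x :+ :- :1 :* wcx :+ b :* (a :* x :+ :- :1 :* wy)
          := (b :* a :+ d) :* x :+ :- :1 :* (wcx :+ b :* wy)) refl d x wcx b a wy
    first (suc n) a b d (x , x′) (y , y′) (c , c′) (w , w′) (v , v′) = first n a b d x y c w v , first n a b d x′ y′ c′ w′ v′

    second : ∀ n a b d (y cx wcy : Λ n) →
      scaleΛ (- 1#) (addΛ (scaleΛ a cx) (scaleΛ (- 1#) (addΛ (scaleΛ d y) (scaleΛ (- 1#) wcy))))
        ≋ addΛ (scaleΛ (b * a + d) y) (scaleΛ (- 1#) (addΛ (scaleΛ a (addΛ cx (scaleΛ b y))) (scaleΛ (- 1#) (scaleΛ (- 1#) wcy))))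
    second zero a b d y cx wcy = solve 6 0 (λ a cx d y wcy b →
        :- :1 :* (a :* cx :+ :- :1 :* (d :* y :+ :- :1 :* wcy))
          := (b :* a :+ d) :* y :+ :- :1 :* (a :* (cx :+ b :* y)
          :+ :- :1 :* (:- :1 :* wcy))) refl a cx d y wcy b
    second (suc n) a b d (y , y′) (c , c′) (w , w′) = second n a b d y c w , second n a b d y′ c′ w′

  -- The interior product is an antiderivation; `first` and `second` compare the components without
  -- and with e₀.
  contract-wedge : ∀ {n} (l v : Vec Carrier n) x →
    contract l (wedge v x) ≋ addΛ (scaleΛ (dot l v) x) (scaleΛ (- 1#) (wedge v (contract l x)))
  contract-wedge []      []      x = solve 1 0 (λ x → :0 := :0 :* x :+ :- :1 :* :0) refl x
  contract-wedge {suc n} (b ∷ l) (a ∷ v) (x , y) =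
    ≋-trans {n} (addΛ-cong {n} (contract-wedge l v x) (≋-refl {n}))
    (≋-trans {n} (first n a b (dot l v) x y (contract l x) (wedge v (contract l x)) (wedge v y))
      (addΛ-cong {n} (≋-refl {n}) (scaleΛ-cong {n} ≈-refl (≋-sym {n} (≋-trans {n} (wedge-add v _ _)
        (addΛ-cong {n} (≋-refl {n}) (wedge-scale v b y))))))) ,
    ≋-trans {n} (scaleΛ-cong {n} ≈-refl (≋-trans {n} (contract-add l _ _) (addΛ-cong {n} (contract-scale l a x)
      (≋-trans {n} (contract-scale l _ _) (scaleΛ-cong {n} ≈-refl (contract-wedge l v y))))))
    (≋-trans {n} (second n a b (dot l v) y (contract l x) (wedge v (contract l y)))
      (addΛ-cong {n} (≋-refl {n}) (scaleΛ-cong {n} ≈-refl (addΛ-cong {n} (≋-refl {n}) (scaleΛ-cong {n} ≈-refl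
        (≋-sym {n} (wedge-scale v _ _)))))))

  -- Adding to each column a combination of later ones.
  data Triangular : ℕ → Set where
    []  : Triangular 0
    _∷_ : ∀ {n} → Vec Carrier n → Triangular n → Triangular (suc n)

  apply : ∀ {n} → Triangular n → Vec Carrier n → Vec Carrier n
  apply []      []      = []
  apply (l ∷ M) (a ∷ v) = a + dot l v ∷ apply M v

  -- The algebra automorphism induced by the column operations. Each step is exp(e₀ ∧ ι_l), with ι_l
  -- the interior product; the operator e₀ ∧ ι_l has square 0, so the exponential is linear in it.
  θ : ∀ {n} → Triangular n → Λ n → Λ n
  θ []      x       = x
  θ (l ∷ M) (x , y) = θ M x , θ M (addΛ y (contract l x))

  θ-cong : ∀ {n} (M : Triangular n) {x y} → x ≋ y → θ M x ≋ θ M y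
  θ-cong []      h       = h
  θ-cong {suc n} (l ∷ M) (h , k) = θ-cong M h , θ-cong M (addΛ-cong {n} k (contract-cong l h))

  θ-add : ∀ {n} (M : Triangular n) x y → θ M (addΛ x y) ≋ addΛ (θ M x) (θ M y)
  θ-add []      x y = ≈-refl
  θ-add {suc n} (l ∷ M) (x , y) (x′ , y′) = θ-add M x x′ ,
    ≋-trans {n} (θ-cong M (≋-trans {n} (addΛ-cong {n} (≋-refl {n}) (contract-add l x x′)) (add-interchange {n} _ _ _ _)))
      (θ-add M _ _)

  θ-scale : ∀ {n} (M : Triangular n) c x → θ M (scaleΛ c x) ≋ scaleΛ c (θ M x)
  θ-scale []      c x = ≈-refl
  θ-scale {suc n} (l ∷ M) c (x , y) = θ-scale M c x ,
    ≋-trans {n} (θ-cong M (≋-trans {n} (addΛ-cong {n} (≋-refl {n}) (contract-scale l c x)) (≋-sym {n} (scale-add {n} c y _))))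
      (θ-scale M c _)

  θ-0Λ : ∀ {n} (M : Triangular n) → θ M (0Λ n) ≋ 0Λ n
  θ-0Λ []      = ≈-refl
  θ-0Λ {suc n} (l ∷ M) = θ-0Λ M ,
    ≋-trans {n} (θ-cong M (≋-trans {n} (addΛ-cong {n} (≋-refl {n}) (contract-0Λ l)) (0Λ-add {n} _))) (θ-0Λ M)

  θ-1Λ : ∀ {n} (M : Triangular n) → θ M (1Λ n) ≋ 1Λ n
  θ-1Λ []      = ≈-refl
  θ-1Λ {suc n} (l ∷ M) = θ-1Λ M ,
    ≋-trans {n} (θ-cong M (≋-trans {n} (addΛ-cong {n} (≋-refl {n}) (contract-1Λ l)) (0Λ-add {n} _))) (θ-0Λ M)

  private
    regroup : ∀ n a d (x cx wcx wy : Λ n) →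
      addΛ (addΛ (scaleΛ a x) (scaleΛ (- 1#) wy)) (addΛ (scaleΛ d x) (scaleΛ (- 1#) wcx))
        ≋ addΛ (scaleΛ (a + d) x) (scaleΛ (- 1#) (addΛ wy wcx))
    regroup zero a d x cx wcx wy = solve 5 0 (λ a x wy d wcx →
        a :* x :+ :- :1 :* wy :+ (d :* x :+ :- :1 :* wcx)
          := (a :+ d) :* x :+ :- :1 :* (wy :+ wcx)) refl a x wy d wcx
    regroup (suc n) a d (x , x′) (c , c′) (w , w′) (v , v′) = regroup n a d x c w v , regroup n a d x′ c′ w′ v′

  θ-wedge : ∀ {n} (M : Triangular n) v ξ → θ M (wedge v ξ) ≋ wedge (apply M v) (θ M ξ)
  θ-wedge []      []      x = ≈-refl
  θ-wedge {suc n} (l ∷ M) (a ∷ v) (x , y) = θ-wedge M v x ,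
    ≋-trans {n} (θ-cong M (≋-trans {n} (addΛ-cong {n} (≋-refl {n}) (contract-wedge l v x))
      (≋-trans {n} (regroup n a (dot l v) x (contract l x) (wedge v (contract l x)) (wedge v y))
        (addΛ-cong {n} (≋-refl {n}) (scaleΛ-cong {n} ≈-refl (≋-sym {n} (wedge-add v y _)))))))
    (≋-trans {n} (θ-add M _ _) (addΛ-cong {n} (θ-scale M _ x)
      (≋-trans {n} (θ-scale M _ _) (scaleΛ-cong {n} ≈-refl (θ-wedge M v _)))))

  -- Interior products lower the degree, so they add nothing to the top form. This is why column
  -- operations preserve the determinant.
  top-θ : ∀ {n} (M : Triangular n) ξ → top (θ M ξ) ≈ top ξ
  top-θ []      x = ≈-refl
  top-θ {suc n} (l ∷ M) (x , y) = ≈-trans (top-θ M _) (≈-trans (top-add {n} y (contract l x))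
    (≈-trans (+-congˡ (top-contract l x)) (+-identityʳ _)))

  θ-wedges : ∀ {n} (M : Triangular n) vs ξ → θ M (wedges vs ξ) ≋ wedges (List.map (apply M) vs) (θ M ξ)
  θ-wedges {n} M []       ξ = ≋-refl {n}
  θ-wedges {n} M (v ∷ vs) ξ = ≋-trans {n} (θ-wedge M v _) (wedge-congʳ (apply M v) (θ-wedges M vs ξ))

  volume-apply : ∀ {n} (M : Triangular n) vs → volume vs ≈ volume (List.map (apply M) vs)
  volume-apply {n} M vs = ≈-trans (≈-sym (top-θ M (wedges vs (1Λ n))))
    (top-cong {n} (≋-trans {n} (θ-wedges M vs (1Λ n)) (wedges-cong (List.map (apply M) vs) (θ-1Λ M))))

  scalar₂ : Λ 2 → Carrier
  scalar₂ ((a , b) , (c , d)) = a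

  -- Sets the last two generators to 0, which deletes the last two columns.
  π : ∀ n → Λ (size (suc n)) → Λ (size n)
  π zero    ((w , x) , (y , z)) = (scalar₂ w , scalar₂ x) , (scalar₂ y , scalar₂ z)
  π (suc n) ((w , x) , (y , z)) = (π n w , π n x) , (π n y , π n z)

  dropLast₂ : ∀ n → Vec Carrier (size (suc n)) → Vec Carrier (size n)
  dropLast₂ zero    (a ∷ b ∷ v) = a ∷ b ∷ []
  dropLast₂ (suc n) (a ∷ b ∷ v) = a ∷ b ∷ dropLast₂ n v

  padded : ∀ n → Carrier → Carrier → Vec Carrier (size (suc n))
  padded zero    a b = 0# ∷ 0# ∷ a ∷ b ∷ []
  padded (suc n) a b = 0# ∷ 0# ∷ padded n a b

  π-add : ∀ n x y → π n (addΛ x y) ≋ addΛ (π n x) (π n y)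
  π-add zero    x y = (≈-refl , ≈-refl) , (≈-refl , ≈-refl)
  π-add (suc n) ((a , b) , (c , d)) ((a′ , b′) , (c′ , d′)) = (π-add n a a′ , π-add n b b′) , (π-add n c c′ , π-add n d d′)

  π-scale : ∀ n k x → π n (scaleΛ k x) ≋ scaleΛ k (π n x)
  π-scale zero    k x = (≈-refl , ≈-refl) , (≈-refl , ≈-refl)
  π-scale (suc n) k ((a , b) , (c , d)) = (π-scale n k a , π-scale n k b) , (π-scale n k c , π-scale n k d)

  π-0Λ : ∀ n → π n (0Λ _) ≋ 0Λ _
  π-0Λ zero    = (≈-refl , ≈-refl) , (≈-refl , ≈-refl)
  π-0Λ (suc n) = (π-0Λ n , π-0Λ n) , (π-0Λ n , π-0Λ n)

  π-1Λ : ∀ n → π n (1Λ _) ≋ 1Λ _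
  π-1Λ zero    = (≈-refl , ≈-refl) , (≈-refl , ≈-refl)
  π-1Λ (suc n) = (π-1Λ n , π-0Λ n) , (π-0Λ n , π-0Λ n)

  π-wedge : ∀ n v ξ → π n (wedge v ξ) ≋ wedge (dropLast₂ n v) (π n ξ)
  π-wedge zero (a ∷ b ∷ c ∷ d ∷ []) ((w , x) , (y , z)) = (≈-refl , ≈-refl) , (≈-refl , ≈-refl)
  π-wedge (suc n) (a ∷ b ∷ v) ((w , x) , (y , z)) =
    (π-wedge n v w , inner b w x) ,
    (≋-trans {m} (π-add n _ _) (addΛ-cong {m} (π-scale n a w) (≋-trans {m} (π-scale n _ _) (scaleΛ-cong {m} ≈-refl (π-wedge n v y)))) ,
     ≋-trans {m} (π-add n _ _) (addΛ-cong {m} (π-scale n a x) (≋-trans {m} (π-scale n _ _) (scaleΛ-cong {m} ≈-refl (inner b y z)))))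
    where
    m = size n
    inner : ∀ b w x → π n (addΛ (scaleΛ b w) (scaleΛ (- 1#) (wedge v x)))
      ≋ addΛ (scaleΛ b (π n w)) (scaleΛ (- 1#) (wedge (dropLast₂ n v) (π n x)))
    inner b w x = ≋-trans {m} (π-add n _ _) (addΛ-cong {m} (π-scale n b w)
      (≋-trans {m} (π-scale n _ _) (scaleΛ-cong {m} ≈-refl (π-wedge n v x))))

  π-wedges : ∀ n vs → π n (wedges vs (1Λ _)) ≋ wedges (List.map (dropLast₂ n) vs) (1Λ _)
  π-wedges n []       = π-1Λ n
  π-wedges n (v ∷ vs) = ≋-trans {size n} (π-wedge n v _) (wedge-congʳ (dropLast₂ n v) (π-wedges n vs))

  top-two-zeros : ∀ {n} (v w : Vec Carrier n) x y →
    top (wedge (0# ∷ v) (wedge (0# ∷ w) (x , y))) ≈ top (wedge v (wedge w y))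
  top-two-zeros {n} v w x y = top-cong {n} (≋-trans {n} (addΛ-cong {n} (scale-zero {n} _ ≈-refl)
      (scaleΛ-cong {n} ≈-refl (≋-trans {n} (wedge-congʳ v
        (≋-trans {n} (addΛ-cong {n} (scale-zero {n} x ≈-refl) (≋-refl {n})) (0Λ-add {n} _))) (wedge-scale v _ _))))
    (≋-trans {n} (0Λ-add {n} _) (≋-trans {n} (scale-scale {n} _ _ _)
      (≋-trans {n} (scaleΛ-cong {n} (solve 0 0 (:- :1 :* :- :1 := :1) refl) (≋-refl {n})) (scale-one {n} _)))))

  -- Block expansion: two rows supported on the last two columns contribute their 2 by 2 determinant
  -- and delete these columns elsewhere. Two vectors pass each remaining generator together, hence
  -- without a sign.
  top-padded : ∀ n a b c d ξ →
    top (wedge (padded n a b) (wedge (padded n c d) ξ)) ≈ (a * d + - (b * c)) * top (π n ξ)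
  top-padded zero a b c d ((w , x) , (y , ((p , q) , (r , t)))) = ≈-trans
    (top-two-zeros (0# ∷ a ∷ b ∷ []) (0# ∷ c ∷ d ∷ []) (w , x) (y , ((p , q) , (r , t))))
    (≈-trans (top-two-zeros (a ∷ b ∷ []) (c ∷ d ∷ []) y ((p , q) , (r , t)))
      (solve 5 0 (λ a d p b c →
          a :* (d :* p :+ :- :1 :* :0) :+ :- :1 :* (b :* (c :* p :+ :- :1 :* :0) :+ :- :1 :* :0)
            := (a :* d :+ :- (b :* c)) :* p) refl a d p b c))
  top-padded (suc n) a b c d (wx , (y , z)) = ≈-trans
    (top-two-zeros (0# ∷ padded n a b) (0# ∷ padded n c d) wx (y , z))
    (≈-trans (top-two-zeros (padded n a b) (padded n c d) y z) (top-padded n a b c d z))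

  dot-zeros : ∀ {n} (v : Vec Carrier n) → dot (Vec.replicate n 0#) v ≈ 0#
  dot-zeros []      = ≈-refl
  dot-zeros (a ∷ v) = ≈-trans (+-cong (zeroˡ _) (dot-zeros v)) (+-identityˡ _)

  τ : Invertible K → Carrier
  τ x = pow K (val x) 3 + pow K (inv x) 3

  coordinate : Carrier → Carrier → ∀ n → Vec Carrier (size n)
  coordinate a b zero    = a ∷ b ∷ []
  coordinate a b (suc n) = a ∷ b ∷ Vec.replicate _ 0#

  -- (x³ + x⁻³ − t) φ_e = φ_{e+3} + φ_{e−3} − t φ_e, with φ₋₁ = − φ₁ and φ₋₂ = − φ₂.
  recurrence : Carrier → ∀ n → Triangular (size n)
  recurrence t zero          = (0# ∷ []) ∷ [] ∷ []
  recurrence t (suc zero)    = (0# ∷ - t ∷ - 1# ∷ []) ∷ (- 1# ∷ - t ∷ []) ∷ recurrence t zero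
  recurrence t (suc (suc n)) =
    (0# ∷ - t ∷ 0# ∷ coordinate 1# 0# n) ∷ (0# ∷ - t ∷ coordinate 0# 1# n) ∷ recurrence t (suc n)

  rowφ′ : ∀ n → Invertible K → Vec Carrier (size n)
  rowφ′ n = rowφ (exponents n)

  dot-coordinate : ∀ a b n x → dot (coordinate a b n) (rowφ′ n x) ≈ a * φ (hi n) x + b * φ (lo n) x
  dot-coordinate a b zero    x = +-congˡ (+-identityʳ _)
  dot-coordinate a b (suc n) x = +-congˡ (≈-trans (+-congˡ (dot-zeros (rowφ′ n x))) (+-identityʳ _))

  -- The result of the column operations on a row: a multiple of the row one size smaller, followed
  -- by the unchanged φ₂ and φ₁.
  multiplied : Carrier → ∀ n → Invertible K → Vec Carrier (size (suc n))
  multiplied m zero    x = m * φ 2 x ∷ m * φ 1 x ∷ φ 2 x ∷ φ 1 x ∷ []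
  multiplied m (suc n) x = m * φ (hi (suc n)) x ∷ m * φ (lo (suc n)) x ∷ multiplied m n x
  apply-recurrence : ∀ t n x → AllEq (apply (recurrence t (suc n)) (rowφ′ (suc n) x)) (multiplied (τ x + - t) n x)
  apply-recurrence t zero x =
    solve 1 1 (λ t x x̄ →
        x :* (x :* (x :* (x :* (x :* :1)))) :+ :- (x̄ :* (x̄ :* (x̄ :* (x̄ :* (x̄ :* :1)))))
          :+ (:0 :* (x :* (x :* (x :* (x :* :1))) :+ :- (x̄ :* (x̄ :* (x̄ :* (x̄ :* :1)))))
          :+ (:- t :* (x :* (x :* :1) :+ :- (x̄ :* (x̄ :* :1))) :+ (:- :1 :* (x :* :1
          :+ :- (x̄ :* :1)) :+ :0)))
          := (x :* (x :* (x :* :1)) :+ x̄ :* (x̄ :* (x̄ :* :1)) :+ :- t) :* (x :* (x :* :1)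
          :+ :- (x̄ :* (x̄ :* :1)))) refl t x ∷
    (solve 1 1 (λ t x x̄ →
        x :* (x :* (x :* (x :* :1))) :+ :- (x̄ :* (x̄ :* (x̄ :* (x̄ :* :1))))
          :+ (:- :1 :* (x :* (x :* :1) :+ :- (x̄ :* (x̄ :* :1))) :+ (:- t :* (x :* :1
          :+ :- (x̄ :* :1)) :+ :0))
          := (x :* (x :* (x :* :1)) :+ x̄ :* (x̄ :* (x̄ :* :1)) :+ :- t) :* (x :* :1
          :+ :- (x̄ :* :1))) refl t x) ∷
    (solve 0 1 (λ x x̄ →
        x :* (x :* :1) :+ :- (x̄ :* (x̄ :* :1)) :+ (:0 :* (x :* :1 :+ :- (x̄ :* :1)) :+ :0)
          := x :* (x :* :1) :+ :- (x̄ :* (x̄ :* :1))) refl x) ∷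
    (solve 0 1 (λ x x̄ → x :* :1 :+ :- (x̄ :* :1) :+ :0 := x :* :1 :+ :- (x̄ :* :1)) refl x) ∷ []
  apply-recurrence t (suc n) x =
    ≈-trans (+-congˡ (+-congˡ (+-congˡ (+-congˡ (dot-coordinate 1# 0# n x)))))
      (step (φ (lo (2 ℕ.+ n)) x) (φ (lo (1 ℕ.+ n)) x) (φ (lo n) x) (pow K (val x) (hi n)) (pow K (inv x) (hi n))) ∷
    ≈-trans (+-congˡ (+-congˡ (+-congˡ (dot-coordinate 0# 1# n x))))
      (step′ (φ (hi (1 ℕ.+ n)) x) (φ (hi n) x) (pow K (val x) (lo n)) (pow K (inv x) (lo n))) ∷
    apply-recurrence t n x
    where
    step : ∀ c d e a b → (val x * (val x * (val x * (val x * (val x * (val x * a))))) + - (inv x * (inv x * (inv x * (inv x * (inv x * (inv x * b))))))) + (0# * c + (- t * (val x * (val x * (val x * a)) + - (inv x * (inv x * (inv x * b)))) + (0# * d + (1# * (a + - b) + 0# * e))))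
      ≈ (τ x + - t) * (val x * (val x * (val x * a)) + - (inv x * (inv x * (inv x * b))))
    step c d e a b = solve 6 1 (λ a b c t d e x x̄ →
        x :* (x :* (x :* (x :* (x :* (x :* a)))))
          :+ :- (x̄ :* (x̄ :* (x̄ :* (x̄ :* (x̄ :* (x̄ :* b)))))) :+ (:0 :* c
          :+ (:- t :* (x :* (x :* (x :* a)) :+ :- (x̄ :* (x̄ :* (x̄ :* b)))) :+ (:0 :* d :+ (:1 :* (a
          :+ :- b) :+ :0 :* e))))
          := (x :* (x :* (x :* :1)) :+ x̄ :* (x̄ :* (x̄ :* :1)) :+ :- t) :* (x :* (x :* (x :* a))
          :+ :- (x̄ :* (x̄ :* (x̄ :* b))))) refl a b c t d e x
    step′ : ∀ d e a b → (val x * (val x * (val x * (val x * (val x * (val x * a))))) + - (inv x * (inv x * (inv x * (inv x * (inv x * (inv x * b))))))) + (0# * d + (- t * (val x * (val x * (val x * a)) + - (inv x * (inv x * (inv x * b)))) + (0# * e + 1# * (a + - b))))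
      ≈ (τ x + - t) * (val x * (val x * (val x * a)) + - (inv x * (inv x * (inv x * b))))
    step′ d e a b = solve 5 1 (λ a b d t e x x̄ →
        x :* (x :* (x :* (x :* (x :* (x :* a)))))
          :+ :- (x̄ :* (x̄ :* (x̄ :* (x̄ :* (x̄ :* (x̄ :* b)))))) :+ (:0 :* d
          :+ (:- t :* (x :* (x :* (x :* a)) :+ :- (x̄ :* (x̄ :* (x̄ :* b)))) :+ (:0 :* e :+ :1 :* (a
          :+ :- b)))) := (x :* (x :* (x :* :1)) :+ x̄ :* (x̄ :* (x̄ :* :1))
          :+ :- t) :* (x :* (x :* (x :* a)) :+ :- (x̄ :* (x̄ :* (x̄ :* b))))) refl a b d t e x

  AllEq-trans : ∀ {n} {u v w : Vec Carrier n} → AllEq u v → AllEq v w → AllEq u w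
  AllEq-trans []       []       = []
  AllEq-trans (e ∷ es) (f ∷ fs) = ≈-trans e f ∷ AllEq-trans es fs

  multiplied-zero : ∀ {m} n x → m ≈ 0# → AllEq (multiplied m n x) (padded n (φ 2 x) (φ 1 x))
  multiplied-zero zero    x h = ≈-trans (*-congʳ h) (zeroˡ _) ∷ ≈-trans (*-congʳ h) (zeroˡ _) ∷ AllEq-refl
  multiplied-zero (suc n) x h = ≈-trans (*-congʳ h) (zeroˡ _) ∷ ≈-trans (*-congʳ h) (zeroˡ _) ∷ multiplied-zero n x h

  dropLast₂-multiplied : ∀ m n x → AllEq (dropLast₂ n (multiplied m n x)) (m *ᵥ rowφ′ n x)
  dropLast₂-multiplied m zero    x = AllEq-refl
  dropLast₂-multiplied m (suc n) x = ≈-refl ∷ ≈-refl ∷ dropLast₂-multiplied m n x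

  dropLast₂-cong : ∀ n {v w} → AllEq v w → AllEq (dropLast₂ n v) (dropLast₂ n w)
  dropLast₂-cong zero    (e ∷ f ∷ _)  = e ∷ f ∷ []
  dropLast₂-cong (suc n) (e ∷ f ∷ es) = e ∷ f ∷ dropLast₂-cong n es

  factors : (Invertible K → Carrier) → List (Invertible K) → Carrier
  factors f []       = 1#
  factors f (x ∷ xs) = f x * factors f xs

  wedges-multiplied : ∀ t n xs →
    wedges (List.map (dropLast₂ n) (List.map (apply (recurrence t (suc n))) (List.map (rowφ′ (suc n)) xs))) (1Λ (size n))
      ≋ scaleΛ (factors (λ x → τ x + - t) xs) (wedges (List.map (rowφ′ n) xs) (1Λ (size n)))
  wedges-multiplied t n []       = ≋-sym {size n} (scale-one {size n} _)
  wedges-multiplied t n (x ∷ xs) =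
    ≋-trans {m} (wedge-cong (AllEq-trans (dropLast₂-cong n (apply-recurrence t n x)) (dropLast₂-multiplied _ n x))
      (wedges-multiplied t n xs))
    (≋-trans {m} (wedge-*ᵥ _ (rowφ′ n x) _) (≋-trans {m} (scaleΛ-cong {m} ≈-refl (wedge-scale (rowφ′ n x) _ _)) (scale-scale {m} _ _ _)))
    where m = size n

  -- With t = `τ x₁`, the first two rows keep only their last two entries after the column
  -- operations. Every other row, stripped of those entries, is τ(x) - t times the row one size
  -- smaller.
  alternant-recursion : ∀ n x₁ x₂ xs → τ x₂ ≈ τ x₁ →
    alternant (exponents (suc n)) (x₁ ∷ x₂ ∷ xs)
      ≈ (φ 2 x₁ * φ 1 x₂ + - (φ 1 x₁ * φ 2 x₂)) * (factors (λ x → τ x + - τ x₁) xs * alternant (exponents n) xs)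
  alternant-recursion n x₁ x₂ xs h = begin
    alternant (exponents (suc n)) (x₁ ∷ x₂ ∷ xs)
      ≈⟨ volume-apply M (List.map (rowφ′ (suc n)) (x₁ ∷ x₂ ∷ xs)) ⟩
    top (wedge (apply M (rowφ′ (suc n) x₁)) (wedge (apply M (rowφ′ (suc n) x₂)) ξ))
      ≈⟨ top-cong {size (suc n)} (wedge-cong (row₁ x₁ ≈-refl) (wedge-cong (row₁ x₂ h) (≋-refl {size (suc n)}))) ⟩
    top (wedge (padded n (φ 2 x₁) (φ 1 x₁)) (wedge (padded n (φ 2 x₂) (φ 1 x₂)) ξ))
      ≈⟨ top-padded n (φ 2 x₁) (φ 1 x₁) (φ 2 x₂) (φ 1 x₂) ξ ⟩
    c * top (π n ξ)
      ≈⟨ *-congˡ (top-cong {size n} (≋-trans {size n} (π-wedges n (List.map (apply M) (List.map (rowφ′ (suc n)) xs))) (wedges-multiplied t n xs))) ⟩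
    c * top (scaleΛ (factors (λ x → τ x + - t) xs) (wedges (List.map (rowφ′ n) xs) (1Λ (size n))))
      ≈⟨ *-congˡ (top-scale {size n} _ (wedges (List.map (rowφ′ n) xs) (1Λ (size n)))) ⟩
    c * (factors (λ x → τ x + - t) xs * alternant (exponents n) xs) ∎
    where
    t = τ x₁
    c = φ 2 x₁ * φ 1 x₂ + - (φ 1 x₁ * φ 2 x₂)
    M = recurrence t (suc n)
    ξ = wedges (List.map (apply M) (List.map (rowφ′ (suc n)) xs)) (1Λ (size (suc n)))
    row₁ : ∀ x → τ x ≈ t → AllEq (apply M (rowφ′ (suc n) x)) (padded n (φ 2 x) (φ 1 x))
    row₁ x h = AllEq-trans (apply-recurrence t n x) (multiplied-zero n x (≈-trans (+-congʳ h) (-‿inverseʳ _)))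

-- Symmetry, recursion and degree of the symplectic character

module CharacterOf (K : CommutativeRing 0ℓ 0ℓ) where
  open Ring K
  open Alternants K
  open Inv K
  open Exterior K
  open ColumnOperations K

  spOf : ∀ {n} → Vec ℕ n → List (Invertible K) → Carrier
  spOf es xs = character es (List.map Y xs)

  -- σ(w/x) σ(w x) = Y(w)² - Y(x)² is a multiple of the Vandermonde factor Y(w) - Y(x), and both
  -- factors on the left are σ of monomials, for which regularity is known.
  Distinct : Invertible K → Invertible K → Set
  Distinct x w = Regular (σᵤ (w · x ⁻¹)) × Regular (σᵤ (w · x))

  Y-regular : ∀ x w → Distinct x w → Regular (Y w + - Y x)
  Y-regular x w (h , k) = regular λ p z → Regular.annihilator (Regular-* h k) p (begin
    σᵤ (w · x ⁻¹) * σᵤ (w · x) * p                           ≈⟨ lemma p ⟩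
    (val w + inv w + (val x + inv x)) * ((Y w + - Y x) * p)  ≈⟨ *-congˡ z ⟩
    (val w + inv w + (val x + inv x)) * 0#                   ≈⟨ zeroʳ _ ⟩
    0#                                                       ∎)
    where
    lemma : ∀ p → σᵤ (w · x ⁻¹) * σᵤ (w · x) * p ≈ (val w + inv w + (val x + inv x)) * ((Y w + - Y x) * p)
    lemma p = solve 1 2 (λ p w w̄ x x̄ →
        (w :* x̄ :+ :- (w̄ :* x)) :* (w :* x :+ :- (w̄ :* x̄)) :* p
          := (w :+ w̄ :+ (x :+ x̄)) :* ((w :+ w̄ :+ :- (x :+ x̄)) :* p)) refl p w x

  differences-regular : ∀ x xs → All (Distinct x) xs → Regular (differences (Y x) (List.map Y xs))
  differences-regular x []       []       = Regular-unit (unit 1# 1# (*-identityˡ _))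
  differences-regular x (w ∷ ws) (d ∷ ds) = Regular-* (Y-regular x w d) (differences-regular x ws ds)

  vandermonde-regular : ∀ xs → AllPairs Distinct xs → Regular (vandermonde (List.map Y xs))
  vandermonde-regular []       []       = Regular-unit (unit 1# 1# (*-identityˡ _))
  vandermonde-regular (x ∷ xs) (d ∷ ds) = Regular-* (differences-regular x xs d) (vandermonde-regular xs ds)

  σ-product-regular : ∀ xs → All (λ x → Regular (σᵤ x)) xs → Regular (σ-product xs)
  σ-product-regular []       []       = Regular-unit (unit 1# 1# (*-identityˡ _))
  σ-product-regular (x ∷ xs) (r ∷ rs) = Regular-* r (σ-product-regular xs rs)

  denominator-regular : ∀ n xs → length xs ≡ n → All (λ x → Regular (σᵤ x)) xs → AllPairs Distinct xs →
    Regular (alternant (descending n) xs)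
  denominator-regular n xs l r d = Regular-cong (≈-sym (denominator n xs l))
    (Regular-* (Regular-* (σ-product-regular xs r) (vandermonde-regular xs d)) (Regular-unit (unit (ε n) (ε n) (ε² n))))

  alternant-swap : ∀ {n} (es : Vec ℕ n) ps x w xs →
    alternant es (ps ++ w ∷ x ∷ xs) ≈ - 1# * alternant es (ps ++ x ∷ w ∷ xs)
  alternant-swap {n} es ps x w xs = ≈-trans (top-cong {n} (swap ps)) (top-scale {n} (- 1#) (wedges (rows (ps ++ x ∷ w ∷ xs)) (1Λ n)))
    where
    rows = List.map (rowφ es)
    swap : ∀ ps → wedges (rows (ps ++ w ∷ x ∷ xs)) (1Λ n) ≋ scaleΛ (- 1#) (wedges (rows (ps ++ x ∷ w ∷ xs)) (1Λ n))
    swap []       = wedge-anticommute (rowφ es w) (rowφ es x) _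
    swap (p ∷ ps) = ≋-trans {n} (wedge-congʳ (rowφ es p) (swap ps)) (wedge-scale (rowφ es p) _ _)

  -- Numerator and denominator both change sign, and the denominator is regular.
  sp-swap-generic : ∀ {n} (es : Vec ℕ n) ps x w xs → length (ps ++ x ∷ w ∷ xs) ≡ n →
    length (ps ++ w ∷ x ∷ xs) ≡ n → Regular (alternant (descending n) (ps ++ x ∷ w ∷ xs)) →
    spOf es (ps ++ w ∷ x ∷ xs) ≈ spOf es (ps ++ x ∷ w ∷ xs)
  sp-swap-generic {n} es ps x w xs l l′ r = cancel r (begin
    d * P′               ≈⟨ lemma d P′ ⟩
    - 1# * (P′ * (- 1# * d)) ≈⟨ *-congˡ (*-congˡ (alternant-swap (descending n) ps x w xs)) ⟨
    - 1# * (P′ * alternant (descending n) (ps ++ w ∷ x ∷ xs))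
      ≈⟨ *-congˡ (≈-trans (character-quotient es (ps ++ w ∷ x ∷ xs) l′) (alternant-swap es ps x w xs)) ⟩
    - 1# * (- 1# * alternant es (ps ++ x ∷ w ∷ xs)) ≈⟨ *-congˡ (*-congˡ (character-quotient es (ps ++ x ∷ w ∷ xs) l)) ⟨
    - 1# * (- 1# * (P * d)) ≈⟨ lemma′ P d ⟩
    d * P ∎)
    where
    d = alternant (descending n) (ps ++ x ∷ w ∷ xs)
    P = spOf es (ps ++ x ∷ w ∷ xs)
    P′ = spOf es (ps ++ w ∷ x ∷ xs)
    lemma : ∀ d p → d * p ≈ - 1# * (p * (- 1# * d))
    lemma = solve 2 0 (λ d p → d :* p := :- :1 :* (p :* (:- :1 :* d))) refl
    lemma′ : ∀ p d → - 1# * (- 1# * (p * d)) ≈ d * p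
    lemma′ = solve 2 0 (λ p d → :- :1 :* (:- :1 :* (p :* d)) := d :* p) refl

  -- With w a primitive cube root of unity and y₁, y₂, y₃ the values of x + x⁻¹ at
  -- x, (w x)⁻¹ and w⁻¹ x: ∏ (Y − y_i) = (Y³ − 3Y) − (x³ + x⁻³).
  third : Invertible K → Invertible K → Carrier
  third w x = inv w * val x + val w * inv x
  module _ (w : Invertible K) (w-root : val w + inv w + 1# ≈ 0#) where

    private
      w³≈1 : val w * val w * val w ≈ 1#
      w³≈1 = solve-by 0 1 (λ w w̄ →
          w :* w :* w := :1 ,
          ((w :+ :- :1) :* w , w :+ w̄ :+ :1 := :0) ∷ []) refl w w-root

      w̄³≈1 : inv w * inv w * inv w ≈ 1#
      w̄³≈1 = solve-by 0 1 (λ w w̄ →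
          w̄ :* w̄ :* w̄ := :1 ,
          ((w̄ :+ :- :1) :* w̄ , w :+ w̄ :+ :1 := :0) ∷ []) refl w w-root

    -- The product with x is w⁻¹, and as w³ = 1 both have the same x³ + x⁻³.
    partner : Invertible K → Invertible K
    partner x = (w · x) ⁻¹

    τ-partner : ∀ x → τ (partner x) ≈ τ x
    τ-partner x = solve-by 0 2 (λ w w̄ x x̄ →
        w̄ :* x̄ :* (w̄ :* x̄ :* (w̄ :* x̄ :* :1)) :+ w :* x :* (w :* x :* (w :* x :* :1))
          := x :* (x :* (x :* :1)) :+ x̄ :* (x̄ :* (x̄ :* :1)) ,
        (x :* x :* x , w :* w :* w := :1) ∷
        (x̄ :* x̄ :* x̄ , w̄ :* w̄ :* w̄ := :1) ∷ []) refl w x w³≈1 w̄³≈1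

    partner-σ : ∀ x → - σᵤ w ≈ σᵤ (partner x · x)
    partner-σ x = solve 0 2 (λ w w̄ x x̄ → :- (w :+ :- w̄) := w̄ :* x̄ :* x :+ :- (w :* x :* x̄)) refl w x

    cubic-factor : ∀ x z → τ z + - τ x ≈ (Y z + - Y x) * (Y z + - Y (partner x)) * (Y z + - third w x)
    cubic-factor x z = solve-by 0 3 (λ z z̄ x x̄ w w̄ →
        z :* (z :* (z :* :1)) :+ z̄ :* (z̄ :* (z̄ :* :1)) :+ :- (x :* (x :* (x :* :1))
          :+ x̄ :* (x̄ :* (x̄ :* :1)))
          := (z :+ z̄ :+ :- (x :+ x̄)) :* (z :+ z̄ :+ :- (w̄ :* x̄ :+ w :* x)) :* (z :+ z̄
          :+ :- (w̄ :* x :+ w :* x̄)) ,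
        ((x :+ x̄) :* ((z :+ z̄) :* (z :+ z̄)) :+ :- ((x :+ x̄) :* (x :+ x̄) :* (z :+ z̄)) :+ (x :+ x̄
          :+ :- (z :+ z̄)) :* (w :+ w̄ :+ :- :1) , w :+ w̄ :+ :1 := :0) ∷ []) refl z x w w-root

    factors-split : ∀ x zs → factors (λ z → τ z + - τ x) zs
      ≈ differences (Y x) (List.map Y zs) * differences (Y (partner x)) (List.map Y zs) * factors (λ z → Y z + - third w x) zs
    factors-split x []       = solve 0 0 (:1 := :1 :* :1 :* :1) refl
    factors-split x (z ∷ zs) = ≈-trans (*-cong (cubic-factor x z) (factors-split x zs)) (lemma _ _ _ _ _ _)
      where
      lemma : ∀ a b c a′ b′ c′ → a * b * c * (a′ * b′ * c′) ≈ a * a′ * (b * b′) * (c * c′)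
      lemma = solve 6 0 (λ a b c a′ b′ c′ →
          a :* b :* c :* (a′ :* b′ :* c′) := a :* a′ :* (b :* b′) :* (c :* c′)) refl

    -- Of the three factors of τ(z) - τ(x), two are the Vandermonde factors of z with x and its
    -- partner and cancel against the denominator. The third one remains.
    sp-recursion-generic : ∀ n x xs → length xs ≡ size n →
      Regular (alternant (descending (size (suc n))) (x ∷ partner x ∷ xs)) →
      spOf (exponents (suc n)) (x ∷ partner x ∷ xs) ≈ factors (λ z → Y z + - third w x) xs * spOf (exponents n) xs
    sp-recursion-generic n x xs l r = cancel r (begin
      d * spOf (exponents (suc n)) (x ∷ x′ ∷ xs)      ≈⟨ *-comm _ _ ⟩
      spOf (exponents (suc n)) (x ∷ x′ ∷ xs) * d      ≈⟨ character-quotient (exponents (suc n)) (x ∷ x′ ∷ xs) (≡.cong (2 ℕ.+_) l) ⟩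
      alternant (exponents (suc n)) (x ∷ x′ ∷ xs)     ≈⟨ alternant-recursion n x x′ xs (τ-partner x) ⟩
      (φ 2 x * φ 1 x′ + - (φ 1 x * φ 2 x′)) * (factors (λ z → τ z + - τ x) xs * alternant (exponents n) xs)
        ≈⟨ *-cong (block x x′) (*-cong (factors-split x xs) (≈-sym (character-quotient (exponents n) xs l))) ⟩
      σᵤ x * σᵤ x′ * (Y x + - Y x′) * ((a * b * f) * (P * alternant (descending N) xs))
        ≈⟨ *-congˡ (*-congˡ (*-congˡ (denominator N xs l))) ⟩
      σᵤ x * σᵤ x′ * (Y x + - Y x′) * ((a * b * f) * (P * (S * Δ * ε N)))
        -- Going from size N to N + 2 multiplies ε by -(`alternating N`)² = -1, which turns Y(x) -
        -- Y(x′) into the Vandermonde factor Y(x′) - Y(x).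
        ≈⟨ lemma (σᵤ x) (σᵤ x′) (Y x) (Y x′) a b f P S Δ (ε N) (alternating N) (alternating² N) ⟩
      σᵤ x * (σᵤ x′ * S) * ((Y x′ + - Y x) * a * (b * Δ)) * (- 1# * alternating N * (alternating N * ε N)) * (f * P)
        ≈⟨ *-congʳ (denominator (size (suc n)) (x ∷ x′ ∷ xs) (≡.cong (2 ℕ.+_) l)) ⟨
      d * (f * P) ∎)
      where
      N = size n
      x′ = partner x
      d = alternant (descending (size (suc n))) (x ∷ x′ ∷ xs)
      a = differences (Y x) (List.map Y xs)
      b = differences (Y x′) (List.map Y xs)
      f = factors (λ z → Y z + - third w x) xs
      P = spOf (exponents n) xs
      S = σ-product xs
      Δ = vandermonde (List.map Y xs)
      block : ∀ (x z : Invertible K) → φ 2 x * φ 1 z + - (φ 1 x * φ 2 z) ≈ σᵤ x * σᵤ z * (Y x + - Y z)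
      block = solve 0 2 (λ x x̄ z z̄ →
          (x :* (x :* :1) :+ :- (x̄ :* (x̄ :* :1))) :* (z :* :1 :+ :- (z̄ :* :1)) :+ :- ((x :* :1
            :+ :- (x̄ :* :1)) :* (z :* (z :* :1) :+ :- (z̄ :* (z̄ :* :1))))
            := (x :+ :- x̄) :* (z :+ :- z̄) :* (x :+ x̄ :+ :- (z :+ z̄))) refl
      lemma : ∀ s t y z a b f p S Δ e h → h * h ≈ 1# →
        s * t * (y + - z) * ((a * b * f) * (p * (S * Δ * e)))
          ≈ s * (t * S) * ((z + - y) * a * (b * Δ)) * (- 1# * h * (h * e)) * (f * p)
      lemma = solve-by 12 0 (λ s t y z a b f p S Δ e h →
          s :* t :* (y :+ :- z) :* (a :* b :* f :* (p :* (S :* Δ :* e)))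
            := s :* (t :* S) :* ((z :+ :- y) :* a :* (b :* Δ)) :* (:- :1 :* h :* (h :* e)) :* (f :* p) ,
          (:- (s :* t :* (y :+ :- z) :* a :* b :* f :* p :* S :* Δ :* e) , h :* h := :1) ∷ []) refl

module _ {A B : CommutativeRing 0ℓ 0ℓ} (f : Hom A B) where
  open Hom f
  open Naturality f
  private
    module A = CommutativeRing A
    module B = CommutativeRing B
    module AA = Alternants A
    module AB = Alternants B

  maps-respects : Parametricity.Respects (operations A) (operations B) Maps
  maps-respects = record { add = maps-+ ; mul = maps-* ; neg = maps-neg ; nil = maps 0-homo ; one = maps 1-homo }

  maps-Y : ∀ {x y} → MapsUnit x y → Maps (AA.Y x) (AB.Y y)
  maps-Y h = maps-+ (maps-val h) (maps-inv h)

  maps-Ys : ∀ {xs ys} → ListPointwise MapsUnit xs ys → ListPointwise Maps (List.map AA.Y xs) (List.map AB.Y ys)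
  maps-Ys []       = []
  maps-Ys (h ∷ hs) = maps-Y h ∷ maps-Ys hs

  maps-sp : ∀ {n} (es : Vec ℕ n) {xs ys} → ListPointwise MapsUnit xs ys →
    Maps (CharacterOf.spOf A es xs) (CharacterOf.spOf B es ys)
  maps-sp es hs = Parametricity.R-character (operations A) (operations B) Maps maps-respects es (maps-Ys hs)

module GenericDistinct {K : CommutativeRing 0ℓ 0ℓ} (X : Extension K) where
  open Extension X
  open Generic X
  open CharacterOf L
  open Alternants L using (σᵤ)
  open I using (_·_; _⁻¹; Regular)

  like-σ : ∀ {x k} → Like x k → k ≢ + 0 → Regular (σᵤ x)
  like-σ = like-regular

  -- σ(w/x) and σ(w x) have the degrees j - i and j + i, both nonzero when |i| ≠ j.
  distinct : ∀ {x w i j} → Like x i → Like w (+ j) → ℤ.∣ i ∣ ≢ j → Distinct x w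
  distinct {i = i} {j} h k i≢j =
    like-σ (like-· k (like-⁻¹ h)) (λ e → i≢j (≡.sym (≡.cong ℤ.∣_∣ (ℤP.i-j≡0⇒i≡j (+ j) i e)))) ,
    like-σ (like-· k h) (λ e → i≢j (≡.trans (≡.sym (ℤP.∣-i∣≡∣i∣ i)) (≡.sym (≡.cong ℤ.∣_∣ (ℤP.i-j≡0⇒i≡j (+ j) (ℤ.- i)
      (≡.trans (≡.cong (λ i → + j ℤ.+ i) (ℤP.neg-involutive i)) e))))))

  distinct-spread : ∀ {x i} k us → Like x i → ℤ.∣ i ∣ ℕ.≤ k → All (Distinct x) (spread k us)
  distinct-spread k []       h l = []
  distinct-spread k (u ∷ us) h l = distinct h (like-mono u (+ suc k)) (ℕP.<⇒≢ (s≤s l)) ∷ distinct-spread (suc k) us h (ℕP.m≤n⇒m≤1+n l)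

  spread-distinct : ∀ k us → AllPairs Distinct (spread k us)
  spread-distinct k []       = []
  spread-distinct k (u ∷ us) = distinct-spread (suc k) us (like-mono u (+ suc k)) ℕP.≤-refl ∷ spread-distinct (suc k) us

  spread-σ : ∀ k us → All (λ x → Regular (σᵤ x)) (spread k us)
  spread-σ k []       = []
  spread-σ k (u ∷ us) = like-σ (like-mono u (+ suc k)) (λ ()) ∷ spread-σ (suc k) us

  spread-++ : ∀ k ps us → Σ[ j ∈ ℕ ] spread k (ps ++ us) ≡ spread k ps ++ spread j us
  spread-++ k []       us = k , refl
  spread-++ k (p ∷ ps) us with spread-++ (suc k) ps us
  ... | j , e = j , ≡.cong (monomialUnit p (+ suc k) ∷_) e

  spread-length : ∀ k us → length (spread k us) ≡ length us
  spread-length k us = LPW.Pointwise-length (maps-spread k us)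

module _ {K : CommutativeRing 0ℓ 0ℓ} (X : Extension K) where
  open Ring K
  open CharacterOf K
  open ColumnOperations K using (factors)
  open Alternants K using (Y; σᵤ)
  open Extension X
  open Generic X
  open GenericDistinct X
  private
    module C = CharacterOf L

  sp-swap-lifted : ∀ {n} (es : Vec ℕ n) ps x w xs → length (ps ++ x ∷ w ∷ xs) ≡ n →
    spOf es (ps ++ w ∷ x ∷ xs) ≈ spOf es (ps ++ x ∷ w ∷ xs)
  sp-swap-lifted {n} es ps x w xs l with spread-++ 0 ps (x ∷ w ∷ xs)
  ... | j , e = ≈-trans (≈-sym (image (maps-sp atOne es (LPW.++⁺ (maps-spread 0 ps) (mw ∷ mx ∷ mxs)))))
    (≈-trans (Hom.⟦⟧-cong atOne (C.sp-swap-generic es (spread 0 ps) (monomialUnit x (+ suc j)) (monomialUnit w (+ suc (suc j)))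
        (spread (suc (suc j)) xs) l₁ l₂ r))
      (image (maps-sp atOne es (LPW.++⁺ (maps-spread 0 ps) (mx ∷ mw ∷ mxs)))))
    where
    mx = maps-monomialUnit x (+ suc j)
    mw = maps-monomialUnit w (+ suc (suc j))
    mxs = maps-spread (suc (suc j)) xs
    l₁ = ≡.trans (LPW.Pointwise-length (LPW.++⁺ (maps-spread 0 ps) (mx ∷ mw ∷ mxs))) l
    l₂ = ≡.trans (↭-length (swap↭ {monomialUnit x (+ suc j)} {monomialUnit w (+ suc (suc j))} {spread (suc (suc j)) xs} (spread 0 ps))) l₁
      where
      swap↭ : ∀ {a b : Invertible L} {bs} as → as ++ b ∷ a ∷ bs ↭ as ++ a ∷ b ∷ bs
      swap↭ []       = Perm.swap _ _ ↭-refl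
      swap↭ (a ∷ as) = Perm.prep a (swap↭ as)
    r : I.Regular (Alternants.alternant L (descending n) (spread 0 ps ++ spread j (x ∷ w ∷ xs)))
    r = ≡.subst (λ us → I.Regular (Alternants.alternant L (descending n) us)) e
      (C.denominator-regular n (spread 0 (ps ++ x ∷ w ∷ xs)) (≡.trans (spread-length 0 (ps ++ x ∷ w ∷ xs)) l) (spread-σ 0 _) (spread-distinct 0 _))

  sp-recursion-lifted : ∀ (w : Invertible K) (root : val w + inv w + 1# ≈ 0#) t → σᵤ w * t ≈ 1# →
    ∀ n x xs → length xs ≡ size n →
    spOf (exponents (suc n)) (x ∷ partner w root x ∷ xs) ≈ factors (λ z → Y z + - third w x) xs * spOf (exponents n) xs
  sp-recursion-lifted w root t σw n x xs l = ≈-trans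
    (≈-sym (image (maps-sp atOne (exponents (suc n)) (mx ∷ mx′ ∷ mxs))))
    (≈-trans (Hom.⟦⟧-cong atOne (C.sp-recursion-generic wL rootL n xL xsL (≡.trans (spread-length 1 xs) l) r))
      (image (maps-* (maps-factors mxs) (maps-sp atOne (exponents n) mxs))))
    where
    open Hom constant using (⟦⟧-cong; +-homo; *-homo; -‿homo; 1-homo; 0-homo)
    wL = constUnit w
    xL = monomialUnit x (+ 1)
    xsL = spread 1 xs
    mw = maps-constUnit w
    mx = maps-monomialUnit x (+ 1)
    mxs = maps-spread 1 xs
    rootL : val wL L.+ inv wL L.+ L.1# L.≈ L.0#
    rootL = L.trans (L.+-cong (L.sym (+-homo _ _)) (L.sym 1-homo)) (L.trans (L.sym (+-homo _ _)) (L.trans (⟦⟧-cong root) 0-homo))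
    x′ = C.partner wL rootL xL
    mx′ : MapsUnit x′ (partner w root x)
    mx′ = mapsUnit (maps-* (maps-inv mw) (maps-inv mx)) (maps-* (maps-val mw) (maps-val mx))
    like-x = like-mono x (+ 1)
    like-x′ = like-⁻¹ (like-· (like-const w) like-x)
    σ-unit : I.Regular (val wL L.+ L.- inv wL)
    σ-unit = I.Regular-unit (unit (val wL L.+ L.- inv wL) (const t) (L.trans (L.*-congʳ (L.trans (L.+-congˡ (L.sym (-‿homo _))) (L.sym (+-homo _ _))))
      (L.trans (L.sym (*-homo _ _)) (L.trans (⟦⟧-cong σw) 1-homo))))
    -- The product of x and its partner has degree 0 in t; there regularity comes from the given
    -- inverse of σ(w).
    pair-distinct : C.Distinct xL x′
    pair-distinct = like-σ (like-· like-x′ (like-⁻¹ like-x)) (λ ()) ,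
      I.Regular-cong (C.partner-σ wL rootL xL) (I.Regular-neg σ-unit)
    r = C.denominator-regular (size (suc n)) (xL ∷ x′ ∷ xsL) (≡.cong (2 ℕ.+_) (≡.trans (spread-length 1 xs) l))
      (like-σ like-x (λ ()) ∷ like-σ like-x′ (λ ()) ∷ spread-σ 1 xs)
      ((pair-distinct ∷ distinct-spread 1 xs like-x ℕP.≤-refl) ∷ distinct-spread 1 xs like-x′ ℕP.≤-refl ∷ spread-distinct 1 xs)
    maps-factors : ∀ {us us′} → ListPointwise MapsUnit us us′ →
      Maps (ColumnOperations.factors L (λ z → Alternants.Y L z L.+ L.- C.third wL xL) us) (factors (λ z → Y z + - third w x) us′)
    maps-factors []       = maps (Hom.1-homo atOne)
    maps-factors (h ∷ hs) = maps-* (maps-+ (maps-Y atOne h)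
      (maps-neg (maps-+ (maps-* (maps-inv mw) (maps-val mx)) (maps-* (maps-val mw) (maps-inv mx))))) (maps-factors hs)

module CharacterProperties (K : CommutativeRing 0ℓ 0ℓ) where
  open Ring K
  open CharacterOf K
  open ColumnOperations K using (factors)
  open Alternants K

  sp-↭-prefix : ∀ {n} (es : Vec ℕ n) ps {xs ys} → length (ps ++ xs) ≡ n → xs ↭ ys →
    spOf es (ps ++ xs) ≈ spOf es (ps ++ ys)
  sp-↭-prefix es ps l Perm.refl = ≈-refl
  sp-↭-prefix es ps l (Perm.prep {us} {vs} u h) = ≈-trans
    (reflexive (≡.cong (spOf es) (≡.sym (++-assoc ps (u ∷ []) us))))
    (≈-trans (sp-↭-prefix es (ps ++ u ∷ []) (≡.trans (≡.cong length (++-assoc ps (u ∷ []) us)) l) h)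
      (reflexive (≡.cong (spOf es) (++-assoc ps (u ∷ []) vs))))
  sp-↭-prefix es ps l (Perm.swap {us} {vs} u v h) = ≈-trans
    (≈-sym (sp-swap-lifted (laurentExtension K) es ps u v us l))
    (≈-trans (reflexive (≡.cong (spOf es) (≡.sym (++-assoc ps (v ∷ u ∷ []) us))))
    (≈-trans (sp-↭-prefix es (ps ++ v ∷ u ∷ [])
        (≡.trans (≡.cong length (++-assoc ps (v ∷ u ∷ []) us)) (≡.trans (length-++ ps) (≡.trans (≡.sym (length-++ ps)) l))) h)
      (reflexive (≡.cong (spOf es) (++-assoc ps (v ∷ u ∷ []) vs)))))
  sp-↭-prefix es ps {xs} l (Perm.trans {ys = ys} h k) = ≈-trans (sp-↭-prefix es ps l h)
    (sp-↭-prefix es ps (≡.trans (length-++ ps) (≡.trans (≡.cong (length ps ℕ.+_) (≡.sym (↭-length h))) (≡.trans (≡.sym (length-++ ps)) l))) k)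

  sp-↭ : ∀ {n} (es : Vec ℕ n) {xs ys} → length xs ≡ n → xs ↭ ys → spOf es xs ≈ spOf es ys
  sp-↭ es l h = sp-↭-prefix es [] l h

  sp-recursion : ∀ (w : Invertible K) (root : val w + inv w + 1# ≈ 0#) t → σᵤ w * t ≈ 1# →
    ∀ n x xs → length xs ≡ size n →
    spOf (exponents (suc n)) (x ∷ partner w root x ∷ xs) ≈ factors (λ z → Y z + - third w x) xs * spOf (exponents n) xs
  sp-recursion = sp-recursion-lifted (laurentExtension K)

  sp-cong : ∀ {n} (es : Vec ℕ n) {xs ys} → ListPointwise (λ x y → Y x ≈ Y y) xs ys → spOf es xs ≈ spOf es ys
  sp-cong es hs = Parametricity.R-character (operations K) (operations K) _≈_
    (record { add = +-cong ; mul = *-cong ; neg = -‿cong ; nil = ≈-refl ; one = ≈-refl }) es (Ys hs)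
    where
    Ys : ∀ {xs ys} → ListPointwise (λ x y → Y x ≈ Y y) xs ys → ListPointwise _≈_ (List.map Y xs) (List.map Y ys)
    Ys []       = []
    Ys (h ∷ hs) = h ∷ Ys hs

  open Inv K
  open Interpolation K
  open Exterior K

  Degree-const : ∀ d c → Degree (d ℕ.* 2) λ _ → c
  Degree-const zero    c = c , λ _ → ≈-refl
  Degree-const (suc d) c = Degree-lift (d ℕ.* 2) (Degree-const d c)

  Y² : Invertible K → Carrier
  Y² u = Y (u · u)

  Degree-Y² : ∀ d {f} → Degree d f → Degree (2 ℕ.+ d) λ u → Y² u * f u
  Degree-Y² d {f} D = Degree-cong (2 ℕ.+ d) (λ u → lemma u (f u))
    (Degree-+ (2 ℕ.+ d) (Degree-val (suc d) (Degree-val d D)) (Degree-inv (suc d) (Degree-inv d D)))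
    where
    lemma : ∀ (u : Invertible K) z → (val u * val u + inv u * inv u) * z ≈ val u * (val u * z) + inv u * (inv u * z)
    lemma u z = solve 1 1 (λ z u ū → (u :* u :+ ū :* ū) :* z := u :* (u :* z) :+ ū :* (ū :* z)) refl z u

  -- U_e has degree e - 1, and each of the points `ys` lowers it by one. What remains is at most d
  -- in Y(u²), hence 2d in (u, u⁻¹).
  Degree-F : ∀ d e ys → e ℕ.≤ suc d ℕ.+ length ys → Degree (d ℕ.* 2) λ u → F e (Y² u ∷ ys)
  Degree-F d       zero          ys       h       = Degree-const d 0#
  Degree-F d       (suc zero)    []       h       = Degree-const d 1#
  Degree-F d       (suc zero)    (_ ∷ _)  h       = Degree-const d 0#
  Degree-F zero    (suc (suc e)) ys       (s≤s h) = F (suc e) ys , λ u →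
    lemma (Y² u) (F-below (suc e) (Y² u ∷ ys) (s≤s h)) (F-below e (Y² u ∷ ys) (ℕP.m≤n⇒m≤1+n h))
    where
    lemma : ∀ y {a b c} → a ≈ 0# → c ≈ 0# → y * a + b + - c ≈ b
    lemma y {a} {b} {c} p r = solve-by 4 0 (λ y a b c →
        y :* a :+ b :+ :- c := b ,
        (y , a := :0) ∷
        (:- :1 , c := :0) ∷ []) refl y a b c p r
  Degree-F (suc d) (suc (suc e)) ys (s≤s h) = Degree-+ (suc d ℕ.* 2)
    (Degree-+ (suc d ℕ.* 2) (Degree-Y² (d ℕ.* 2) (Degree-F d (suc e) ys h)) (Degree-const (suc d) (F (suc e) ys)))
    (Degree-cong (suc d ℕ.* 2) (λ u → minus-one (F e (Y² u ∷ ys)))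
      (Degree-scale (suc d ℕ.* 2) (- 1#) (Degree-F (suc d) e ys (ℕP.≤-trans (ℕP.n≤1+n e) (ℕP.m≤n⇒m≤1+n h)))))
    where
    minus-one : ∀ x → - x ≈ - 1# * x
    minus-one = solve 1 0 (λ x → :- x := :- :1 :* x) refl

  DegreeΛ : ℕ → ∀ n → (Invertible K → Λ n) → Set
  DegreeΛ d zero    f = Degree d f
  DegreeΛ d (suc n) f = DegreeΛ d n (λ u → proj₁ (f u)) × DegreeΛ d n (λ u → proj₂ (f u))

  data DegreeVec (d : ℕ) : ∀ n → (Invertible K → Vec Carrier n) → Set where
    []  : DegreeVec d 0 λ _ → []
    _∷_ : ∀ {n f g} → Degree d f → DegreeVec d n g → DegreeVec d (suc n) λ u → f u ∷ g u

  DegreeΛ-scale : ∀ d n c {f} → DegreeΛ d n f → DegreeΛ d n λ u → scaleΛ c (f u)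
  DegreeΛ-scale d zero    c D       = Degree-scale d c D
  DegreeΛ-scale d (suc n) c (D , E) = DegreeΛ-scale d n c D , DegreeΛ-scale d n c E

  DegreeΛ-add : ∀ d n {f g} → DegreeΛ d n f → DegreeΛ d n g → DegreeΛ d n λ u → addΛ (f u) (g u)
  DegreeΛ-add d zero    D       E         = Degree-+ d D E
  DegreeΛ-add d (suc n) (D , E) (D′ , E′) = DegreeΛ-add d n D D′ , DegreeΛ-add d n E E′

  DegreeΛ-scale-const : ∀ d n {f} x → Degree d f → DegreeΛ d n λ u → scaleΛ (f u) x
  DegreeΛ-scale-const d zero    x       D = Degree-cong d (λ u → *-comm _ _) (Degree-scale d x D)
  DegreeΛ-scale-const d (suc n) (x , y) D = DegreeΛ-scale-const d n x D , DegreeΛ-scale-const d n y D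

  Degree-wedge-const : ∀ d {n} v {f} → DegreeΛ d n f → DegreeΛ d n λ u → wedge v (f u)
  Degree-wedge-const d []      D = Degree-zero d
  Degree-wedge-const d {suc n} (a ∷ v) (D , E) = Degree-wedge-const d v D ,
    DegreeΛ-add d n (DegreeΛ-scale d n a D) (DegreeΛ-scale d n _ (Degree-wedge-const d v E))

  Degree-wedge : ∀ d {n} {v} x → DegreeVec d n v → DegreeΛ d n λ u → wedge (v u) x
  Degree-wedge d x       []       = Degree-zero d
  Degree-wedge d {suc n} (x , y) (D ∷ E) = Degree-wedge d x E ,
    DegreeΛ-add d n (DegreeΛ-scale-const d n x D) (DegreeΛ-scale d n _ (Degree-wedge d y E))

  Degree-top : ∀ d n {f} → DegreeΛ d n f → Degree d λ u → top (f u)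
  Degree-top d zero    D       = D
  Degree-top d (suc n) (D , E) = Degree-top d n E

  -- The variable is placed last, so that only the last row contains it.
  Degree-newton : ∀ d {n} (es : Vec ℕ n) ps xs →
    (∀ l → length l ≡ length ps ℕ.+ length xs → DegreeVec d n λ u → rowF es (Y² u ∷ l)) →
    DegreeΛ d n λ u → wedges (newton es ps (List.map Y (xs ++ (u · u) ∷ []))) (1Λ n)
  Degree-newton d {n} es ps []       h = Degree-wedge d (1Λ n) (h ps (≡.sym (ℕP.+-identityʳ _)))
  Degree-newton d     es ps (x ∷ xs) h = Degree-wedge-const d (rowF es (Y x ∷ ps))
    (Degree-newton d es (Y x ∷ ps) xs λ l e → h l (≡.trans e (≡.sym (ℕP.+-suc (length ps) (length xs)))))

  Degree-rowF : ∀ d m l → hi m ℕ.≤ suc d ℕ.+ length l → DegreeVec (d ℕ.* 2) (size m) λ u → rowF (exponents m) (Y² u ∷ l)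
  Degree-rowF d zero    l h = Degree-F d 2 l h ∷ Degree-F d 1 l (ℕP.<⇒≤ h) ∷ []
  Degree-rowF d (suc m) l h = Degree-F d (hi (suc m)) l h ∷ Degree-F d (lo (suc m)) l (ℕP.≤-trans (lo≤hi (suc m)) h)
    ∷ Degree-rowF d m l (ℕP.≤-trans (ℕP.m≤n+m (hi m) 3) h)
    where
    lo≤hi : ∀ m → lo m ℕ.≤ hi m
    lo≤hi zero    = s≤s z≤n
    lo≤hi (suc m) = ℕP.+-monoʳ-≤ 3 (lo≤hi m)

  hi≡ : ∀ n → hi n ≡ suc n ℕ.+ suc (n ℕ.+ n)
  hi≡ zero    = refl
  hi≡ (suc n) = ≡.trans (≡.cong (3 ℕ.+_) (hi≡ n)) (lemma n)
    where
    lemma : ∀ n → 3 ℕ.+ (suc n ℕ.+ suc (n ℕ.+ n)) ≡ suc (suc n) ℕ.+ suc (suc n ℕ.+ suc n)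
    lemma = solve-∀

  -- The largest exponent 3n + 2 belongs to a polynomial of degree 3n + 1, and the 2n + 1 other
  -- points leave degree n in Y(u²).
  Degree-sp : ∀ n xs → length xs ≡ suc (n ℕ.+ n) → Degree (n ℕ.* 2) λ u → spOf (exponents n) (xs ++ (u · u) ∷ [])
  Degree-sp n xs l = Degree-scale (n ℕ.* 2) (ε (size n)) (Degree-top (n ℕ.* 2) (size n)
    (Degree-newton (n ℕ.* 2) (exponents n) [] xs λ k e →
      Degree-rowF n n k (ℕP.≤-reflexive (≡.trans (hi≡ n) (≡.cong (suc n ℕ.+_) (≡.sym (≡.trans e l)))))))

-- Parameters with q² + q⁻² = 1

record Cubic {K : CommutativeRing 0ℓ 0ℓ} (P : Parameters K) : Set where
  open CommutativeRing K
  open Parameters P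
  field
    lawful : Lawful P
    q²+q̄²  : val q * val q + inv q * inv q ≈ 1#
    σq*sq  : (val q + - inv q) * sq ≈ 1#
    ⅓      : Carrier
    3*⅓    : (1# + 1# + 1#) * ⅓ ≈ 1#

size≡ : ∀ n → size n ≡ suc (suc (n ℕ.+ n))
size≡ zero    = refl
size≡ (suc n) = ≡.cong (2 ℕ.+_) (≡.trans (size≡ n) (≡.cong suc (≡.sym (ℕP.+-suc n n))))

idHom : ∀ K → Hom K K
idHom K = record { ⟦_⟧ = λ x → x ; ⟦⟧-cong = λ h → h ; +-homo = λ _ _ → refl′ ; *-homo = λ _ _ → refl′ ; -‿homo = λ _ → refl′ ; 0-homo = refl′ ; 1-homo = refl′ }
  where open CommutativeRing K using () renaming (refl to refl′)

cubic-map : ∀ {A B} (f : Hom A B) (P : Parameters A) → Cubic P → Cubic (mapParameters f P)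
cubic-map {A} {B} f P c = record
  { lawful = lawful-map f P lawful
  ; q²+q̄² = image′ (maps-+ (maps-* q₁ q₁) (maps-* q₂ q₂)) q²+q̄²
  ; σq*sq = image′ (maps-* (maps-+ q₁ (maps-neg q₂)) (maps ≈-refl)) σq*sq
  ; ⅓ = ⟦ ⅓ ⟧
  ; 3*⅓ = image′ (maps-* (maps-+ (maps-+ (maps 1-homo) (maps 1-homo)) (maps 1-homo)) (maps ≈-refl)) 3*⅓ }
  where
  open Cubic c
  open Ring B
  open Hom f
  open Naturality f
  open MapsParameters (maps-mapParameters f P)
  q₁ = maps-val maps-q
  q₂ = maps-inv maps-q
  image′ : ∀ {x y} → Maps x y → CommutativeRing._≈_ A x (CommutativeRing.1# A) → y ≈ 1#
  image′ m e = ≈-trans (≈-sym (image m)) (≈-trans (⟦⟧-cong e) 1-homo)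

-- The symmetrised partition function

module Symmetrisation (K : CommutativeRing 0ℓ 0ℓ) (P : Parameters K) where
  open Ring K
  open Parameters P
  open Vertex K P
  open Permuting K P
  open Inv K
  open Interpolation K
  open Recursions K P
  open CotiedDefinition K P
  open CharacterOf K
  open CharacterProperties K
  open Alternants K using (Y; σᵤ)
  open ColumnOperations K using (factors)

  infix 4 _≈ᵤ_
  -- Equality of units as naturality for the identity homomorphism; congruence of Z and of products
  -- is then a case of naturality.
  _≈ᵤ_ : U → U → Set
  _≈ᵤ_ = Naturality.MapsUnit (idHom K)

  ≈ᵤ-intro : ∀ {u v : U} → val u ≈ val v → inv u ≈ inv v → u ≈ᵤ v
  ≈ᵤ-intro h k = Naturality.mapsUnit (Naturality.maps h) (Naturality.maps k)

  ≈ᵤ-refl : ∀ {u} → u ≈ᵤ u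
  ≈ᵤ-refl = ≈ᵤ-intro ≈-refl ≈-refl

  ≈ᵤ*-refl : ∀ {us} → ListPointwise _≈ᵤ_ us us
  ≈ᵤ*-refl = LPW.refl ≈ᵤ-refl

  private
    PP : Naturality.MapsParameters (idHom K) P P
    PP = record { maps-q = ≈ᵤ-refl ; maps-s = Naturality.maps ≈-refl ; maps-sq = Naturality.maps ≈-refl ; maps-sq4 = Naturality.maps ≈-refl }

  κ̄ : U → Carrier
  κ̄ u = κ (u ⁻¹)

  inverses : List U → List U
  inverses = List.map _⁻¹

  E : List U → Carrier
  E us = ∏ κ̄ us * Zₗ us + ∏ κ us * Zₗ (inverses us)

  maps-inverses : ∀ {us vs} → ListPointwise _≈ᵤ_ us vs → ListPointwise _≈ᵤ_ (inverses us) (inverses vs)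
  maps-inverses []       = []
  maps-inverses (h ∷ hs) = ≈ᵤ-intro (Naturality.image (Naturality.maps-inv h)) (Naturality.image (Naturality.maps-val h)) ∷ maps-inverses hs

  Zₗ-cong : ∀ {us vs} → ListPointwise _≈ᵤ_ us vs → Zₗ us ≈ Zₗ vs
  Zₗ-cong hs = Naturality.image (NaturalityOfLists.maps-Zₗ (idHom K) PP hs)

  ∏-κ-cong : ∀ {us vs} → ListPointwise _≈ᵤ_ us vs → ∏ κ us ≈ ∏ κ vs
  ∏-κ-cong hs = Naturality.image (NaturalityOfProducts.maps-∏ (idHom K) (Naturality.maps-κ (idHom K) PP) hs)

  ∏-map : ∀ {A B : Set} (f : B → Carrier) (g : A → B) xs → ∏ f (List.map g xs) ≈ ∏ (λ x → f (g x)) xs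
  ∏-map f g []       = ≈-refl
  ∏-map f g (x ∷ xs) = *-congˡ (∏-map f g xs)

  E-cong : ∀ {us vs} → ListPointwise _≈ᵤ_ us vs → E us ≈ E vs
  E-cong {us} {vs} hs = +-cong
    (*-cong (≈-trans (≈-sym (∏-map κ _⁻¹ us)) (≈-trans (∏-κ-cong (maps-inverses hs)) (∏-map κ _⁻¹ vs))) (Zₗ-cong hs))
    (*-cong (∏-κ-cong hs) (Zₗ-cong (maps-inverses hs)))

  inverses² : ∀ us → ListPointwise _≈ᵤ_ (inverses (inverses us)) us
  inverses² []       = []
  inverses² (u ∷ us) = ≈ᵤ-intro ≈-refl ≈-refl ∷ inverses² us

  E-inverses : ∀ us → E (inverses us) ≈ E us
  E-inverses us = ≈-trans (+-comm _ _) (+-cong (*-cong (∏-map κ _⁻¹ us) (Zₗ-cong (inverses² us)))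
    (*-congʳ (≈-trans (≈-sym (∏-map κ _⁻¹ (inverses us))) (∏-κ-cong (inverses² us)))))

  E-↭ : ∀ {us vs} → us ↭ vs → E us ≈ E vs
  E-↭ h = +-cong (*-cong (∏-↭ κ̄ h) (Zₗ-↭ h)) (*-cong (∏-↭ κ h) (Zₗ-↭ (map⁺ _⁻¹ h)))

  ∏-wB-inverse : ∀ u vs → ∏ (wB (u ⁻¹)) (inverses vs) ≈ ∏ (wA u) vs
  ∏-wB-inverse u []       = ≈-refl
  ∏-wB-inverse u (v ∷ vs) = *-congˡ (∏-wB-inverse u vs)

  -- Inversion makes a cotied pair of the tied one and turns `wB` into `wA`, so both summands
  -- acquire the same factor.
  E-tied : Lawful P → ∀ v vs → E (tied v ∷ v ∷ vs)
    ≈ κ (tied v) * κ v * (κ̄ (tied v) * κ̄ v) * (∏ (wA (tied v)) vs * ∏ (wA v) vs) * E vs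
  E-tied lawful v vs = ≈-trans (+-cong (*-congˡ (Z-tied lawful v vs)) (*-congˡ second))
    (lemma (κ̄ u) (κ̄ v) (∏ κ̄ vs) (κ u) (κ v) (∏ κ vs) (∏ (wA u) vs) (∏ (wA v) vs) (Zₗ vs) (Zₗ (inverses vs)))
    where
    u = tied v
    second : Zₗ (inverses (u ∷ v ∷ vs)) ≈ κ̄ u * κ̄ v * (∏ (wA u) vs * ∏ (wA v) vs * Zₗ (inverses vs))
    second = ≈-trans (Zₗ-cong {inverses (u ∷ v ∷ vs)} {cotied (v ⁻¹) ∷ v ⁻¹ ∷ inverses vs} (≈ᵤ-intro ≈-refl ≈-refl ∷ ≈ᵤ*-refl)) (≈-trans (Z-cotied K P lawful (v ⁻¹) (inverses vs))
      (*-congˡ (*-congʳ (*-cong (∏-wB-inverse u vs) (∏-wB-inverse v vs)))))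
    lemma : ∀ a b c k l m x y z z′ → a * (b * c) * (k * l * (x * y * z)) + k * (l * m) * (a * b * (x * y * z′))
      ≈ k * l * (a * b) * (x * y) * (c * z + m * z′)
    lemma = solve 10 0 (λ a b c k l m x y z z′ →
        a :* (b :* c) :* (k :* l :* (x :* y :* z)) :+ k :* (l :* m) :* (a :* b :* (x :* y :* z′))
          := k :* l :* (a :* b) :* (x :* y) :* (c :* z :+ m :* z′)) refl

  Degree-inverse : ∀ d {f} → Degree d f → Degree d λ u → f (u ⁻¹)
  Degree-inverse zero    (c , h)           = c , λ u → h (u ⁻¹)
  Degree-inverse (suc d) ((g , c) , D , h) = Degree-cong (suc d) (λ u → h (u ⁻¹))
    (Degree-+ (suc d) (Degree-inv d (Degree-inverse d D)) (Degree-scale (suc d) c (val-power (suc d))))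
    where
    val-power : ∀ d → Degree d λ u → pow K (val u) d
    val-power zero    = 1# , λ u → ≈-refl
    val-power (suc d) = Degree-val d (val-power d)

  Degree-E : ∀ vs → Degree (suc (length vs)) λ u → E (u ∷ vs)
  Degree-E vs = Degree-+ (suc n)
    (Degree-cong (suc n) (λ u → lemma₁ u (∏ κ̄ vs) (Zₗ (u ∷ vs)))
      (Degree-linear n (- (inv q * sq)) (val q * sq) (Degree-scale n (∏ κ̄ vs) (Degree-Z vs))))
    (Degree-cong (suc n) (λ u → *-assoc _ _ _)
      (Degree-κ n (Degree-scale n (∏ κ vs) (≡.subst (λ m → Degree m λ u → Zₗ (u ⁻¹ ∷ inverses vs)) (length-map _⁻¹ vs)
        (Degree-inverse (length (inverses vs)) (Degree-Z (inverses vs)))))))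
    where
    n = length vs
    lemma₁ : ∀ u c z → κ̄ u * c * z ≈ (- (inv q * sq) * val u + val q * sq * inv u) * (c * z)
    lemma₁ u c z = solve 3 2 (λ sq c z q q̄ u ū →
        (q :* ū :+ :- (q̄ :* u)) :* sq :* c :* z
          := (:- (q̄ :* sq) :* u :+ q :* sq :* ū) :* (c :* z)) refl sq c z q u

  -- In a generic extension these two points have the same degree, which says nothing about
  -- regularity. Their difference is the constant -σ(q⁴), a unit by `wC≈1`.
  δ-cotied-tied : ∀ v → - rc ≈ δ (cotied v) (tied v)
  δ-cotied-tied v = solve 0 2 (λ q q̄ v v̄ →
      :- (q :* q :* q :* q :+ :- (q̄ :* q̄ :* q̄ :* q̄))
        := q̄ :* q̄ :* v̄ :* (q̄ :* q̄ :* v) :+ :- (q :* q :* v :* (q :* q :* v̄))) refl q v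

  -1ᵤ : U
  -1ᵤ = unit (- 1#) (- 1#) (solve 0 0 (:- :1 :* :- :1 := :1) refl)

  squares : List U → List U
  squares = List.map λ u → u · u

  γ : U → Carrier
  γ u = val u + inv u

  spAt : ℕ → List U → Carrier
  spAt n us = spOf (exponents n) (squares us ++ -1ᵤ ∷ [])

  module _ (cubic : Cubic P) where
    open Cubic cubic
    open Lawful lawful

    normalisation : ℕ → Carrier
    normalisation zero    = 1#
    normalisation (suc n) = pow K ⅓ (suc (n ℕ.+ n)) * normalisation n

    R : ℕ → List U → Carrier
    R n us = s * (normalisation n * (∏ γ us * spAt n us))

    -- σ(q)² = q² + q⁻² - 2 = -1.
    sq² : sq * sq ≈ - 1#
    sq² = solve-by 1 1 (λ sq q q̄ →
        sq :* sq := :- :1 ,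
        (:- (:1 :+ (q :+ :- q̄) :* sq) , (q :+ :- q̄) :* sq := :1) ∷
        (sq :^ 2 , q :* q :+ q̄ :* q̄ := :1) ∷ []) refl sq q σq*sq q²+q̄²

    -- As q⁴ is a primitive cube root of unity, σ(q⁴)² = q⁸ + q⁻⁸ - 2 = -3. The powers of 3 in the
    -- theorem come from here.
    3*sq4² : (1# + 1# + 1#) * (sq4 * sq4) ≈ - 1#
    3*sq4² = solve-by 1 1 (λ sq4 q q̄ →
        (:1 :+ :1 :+ :1) :* (sq4 :* sq4) := :- :1 ,
        (:- (:1 :+ (q :* q :* q :* q :+ :- (q̄ :* q̄ :* q̄ :* q̄)) :* sq4) , (q :* q :* q :* q
          :+ :- (q̄ :* q̄ :* q̄ :* q̄)) :* sq4 := :1) ∷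
        ((q̄ :^ 6 :+ q̄ :^ 4 :+ :- :1 :+ q :^ 4 :+ q :^ 6) :* sq4 :^ 2 , q :* q :+ q̄ :* q̄
          := :1) ∷ []) refl sq4 q wC≈1 q²+q̄²

    κ*κ̄ : ∀ u → κ u * κ̄ u ≈ Y² u + - 1#
    κ*κ̄ u = solve-by 1 2 (λ sq q q̄ u ū →
        (q :* u :+ :- (q̄ :* ū)) :* sq :* ((q :* ū :+ :- (q̄ :* u)) :* sq) := u :* u :+ ū :* ū :+ :- :1 ,
        ((q :* u :+ :- (q̄ :* ū)) :* (q :* ū :+ :- (q̄ :* u)) , sq :* sq := :- :1) ∷
        (:- :1 , q :* q :+ q̄ :* q̄ := :1) ∷ []) refl sq q u sq² q²+q̄²

    w : U
    w = (q · q) · (q · q)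

    w-root : val w + inv w + 1# ≈ 0#
    w-root = solve-by 0 1 (λ q q̄ →
        q :* q :* (q :* q) :+ q̄ :* q̄ :* (q̄ :* q̄) :+ :1 := :0 ,
        (q̄ :^ 2 :+ :1 :+ q :^ 2 , q :* q :+ q̄ :* q̄ := :1) ∷ []) refl q q²+q̄²

    σw : σᵤ w * sq4 ≈ 1#
    σw = ≈-trans (solve 1 1 (λ sq4 q q̄ →
        (q :* q :* (q :* q) :+ :- (q̄ :* q̄ :* (q̄ :* q̄))) :* sq4
          := (q :* q :* q :* q :+ :- (q̄ :* q̄ :* q̄ :* q̄)) :* sq4) refl sq4 q) wC≈1

    -- The factor left by the recursion of the character is, up to 3, the pair of bulk weights in
    -- the recursion of Z.
    tied-factor : ∀ v z → Y² z + - third w (v · v) ≈ (1# + 1# + 1#) * (wA (tied v) z * wA v z)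
    tied-factor v z = solve-by 1 3 (λ sq4 z z̄ q q̄ v v̄ →
        z :* z :+ z̄ :* z̄ :+ :- (q̄ :* q̄ :* (q̄ :* q̄) :* (v :* v)
          :+ q :* q :* (q :* q) :* (v̄ :* v̄))
          := (:1 :+ :1 :+ :1) :* ((q :* q :* (q :* q :* v) :* z̄
          :+ :- (q̄ :* q̄ :* (q̄ :* q̄ :* v̄) :* z)) :* sq4 :* ((q :* q :* v̄ :* z̄
          :+ :- (q̄ :* q̄ :* v :* z)) :* sq4)) ,
        (:- ((q :* q :* (q :* q :* v) :* z̄
          :+ :- (q̄ :* q̄ :* (q̄ :* q̄ :* v̄) :* z)) :* (q :* q :* v̄ :* z̄
          :+ :- (q̄ :* q̄ :* v :* z))) , (:1 :+ :1 :+ :1) :* (sq4 :* sq4) := :- :1) ∷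
        ((q̄ :^ 4 :+ q̄ :^ 2) :* z :^ 2 :+ (q :^ 2 :+ q :^ 4) :* z̄ :^ 2 :+ (:- q̄ :^ 2
          :+ :- :1) :* v :^ 2 :+ (:- :1 :+ :- q :^ 2) :* v̄ :^ 2 , q :* q :+ q̄ :* q̄
          := :1) ∷ []) refl sq4 z q v 3*sq4² q²+q̄²

    -- The extra argument -1, where x + x⁻¹ = -2, contributes the third factor on the left; by
    -- `κ*κ̄` the right side is the product of boundary weights in `E-tied`.
    tied-scalar : ∀ v → γ (tied v) * γ v * (Y -1ᵤ + - third w (v · v)) ≈ (Y² (tied v) + - 1#) * (Y² v + - 1#)
    tied-scalar v = solve-by 0 2 (λ q q̄ v v̄ →
        (q̄ :* q̄ :* v̄ :+ q :* q :* v) :* (v :+ v̄) :* (:- :1 :+ :- :1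
          :+ :- (q̄ :* q̄ :* (q̄ :* q̄) :* (v :* v) :+ q :* q :* (q :* q) :* (v̄ :* v̄)))
          := (q̄ :* q̄ :* v̄ :* (q̄ :* q̄ :* v̄) :+ q :* q :* v :* (q :* q :* v) :+ :- :1) :* (v :* v
          :+ v̄ :* v̄ :+ :- :1) ,
        (:- q̄ :^ 4 :+ :- ((:1 :+ :1) :* q̄ :^ 2) :+ :- (:1 :+ :1 :+ :1) :+ :- ((:1 :+ :1) :* q :^ 2)
          :+ :- q :^ 4 :+ (:- q̄ :^ 4 :+ :- q̄ :^ 2 :+ :- :1 :+ q :^ 2) :* v :^ 2 :+ (q̄ :^ 2 :+ :- :1
          :+ :- q :^ 2 :+ :- q :^ 4) :* v̄ :^ 2 :+ (:- q̄ :^ 2 :+ :- :1) :* v̄ :^ 4 :+ (:- :1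
          :+ :- q :^ 2) :* v :^ 4 , q :* q :+ q̄ :* q̄ := :1) ∷ []) refl q v q²+q̄²

    private
      3# : Carrier
      3# = 1# + 1# + 1#

    pow-3-⅓ : ∀ n → pow K ⅓ n * pow K 3# n ≈ 1#
    pow-3-⅓ n = ≈-trans (≈-sym (pow-* ⅓ 3# n)) (≈-trans (pow-cong n (≈-trans (*-comm _ _) 3*⅓)) (pow-one n))

    factors-tied : ∀ v vs → factors (λ z → Y z + - third w (v · v)) (squares vs ++ -1ᵤ ∷ [])
      ≈ pow K 3# (length vs) * (∏ (wA (tied v)) vs * ∏ (wA v) vs) * (Y -1ᵤ + - third w (v · v))
    factors-tied v []       = lemma _
      where
      lemma : ∀ y → y * 1# ≈ 1# * (1# * 1#) * y
      lemma = solve 1 0 (λ y → y :* :1 := :1 :* (:1 :* :1) :* y) refl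
    factors-tied v (z ∷ vs) = ≈-trans (*-cong (tied-factor v z) (factors-tied v vs)) (lemma 3# _ _ _ _ _ _)
      where
      lemma : ∀ t a b p x y m → t * (a * b) * (p * (x * y) * m) ≈ t * p * (a * x * (b * y)) * m
      lemma = solve 7 0 (λ t a b p x y m →
          t :* (a :* b) :* (p :* (x :* y) :* m) := t :* p :* (a :* x :* (b :* y)) :* m) refl

    points-length : ∀ n us → length us ≡ suc (n ℕ.+ n) → length (squares us ++ -1ᵤ ∷ []) ≡ size n
    points-length n us l = ≡.trans (length-++ (squares us)) (≡.trans (ℕP.+-comm _ 1)
      (≡.trans (≡.cong suc (≡.trans (length-map _ us) l)) (≡.sym (size≡ n))))

    spAt-↭ : ∀ n {us vs} → length us ≡ suc (n ℕ.+ n) → us ↭ vs → spAt n us ≈ spAt n vs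
    spAt-↭ n {us} l h = sp-↭ (exponents n) (points-length n us l) (PermP.++⁺ʳ (-1ᵤ ∷ []) (map⁺ _ h))

    spAt-cong : ∀ n {us vs} → ListPointwise (λ u v → Y² u ≈ Y² v) us vs → spAt n us ≈ spAt n vs
    spAt-cong n hs = sp-cong (exponents n) (LPW.++⁺ (mapped hs) (≈-refl ∷ []))
      where
      mapped : ∀ {us vs} → ListPointwise (λ u v → Y² u ≈ Y² v) us vs → ListPointwise (λ x y → Y x ≈ Y y) (squares us) (squares vs)
      mapped []       = []
      mapped (h ∷ hs) = h ∷ mapped hs

    spAt-tied : ∀ n v vs → length vs ≡ suc (n ℕ.+ n) → spAt (suc n) (tied v ∷ v ∷ vs)
      ≈ pow K 3# (length vs) * (∏ (wA (tied v)) vs * ∏ (wA v) vs) * (Y -1ᵤ + - third w (v · v)) * spAt n vs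
    spAt-tied n v vs l = begin
      spAt (suc n) (tied v ∷ v ∷ vs)
        ≈⟨ sp-↭ (exponents (suc n)) {tied v · tied v ∷ v · v ∷ rest} {v · v ∷ tied v · tied v ∷ rest} (≡.cong (2 ℕ.+_) l′) (Perm.swap _ _ ↭-refl) ⟩
      spOf (exponents (suc n)) (v · v ∷ tied v · tied v ∷ rest)
        ≈⟨ sp-cong (exponents (suc n)) {v · v ∷ tied v · tied v ∷ rest} {v · v ∷ partner w w-root (v · v) ∷ rest} (≈-refl ∷ Y-partner ∷ LPW.refl ≈-refl) ⟩
      spOf (exponents (suc n)) (v · v ∷ partner w w-root (v · v) ∷ rest)
        ≈⟨ sp-recursion w w-root sq4 σw n (v · v) rest l′ ⟩
      factors (λ z → Y z + - third w (v · v)) rest * spAt n vs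
        ≈⟨ *-congʳ (factors-tied v vs) ⟩
      pow K 3# (length vs) * (∏ (wA (tied v)) vs * ∏ (wA v) vs) * (Y -1ᵤ + - third w (v · v)) * spAt n vs ∎
      where
      rest = squares vs ++ -1ᵤ ∷ []
      l′ = points-length n vs l
      Y-partner : Y (tied v · tied v) ≈ Y (partner w w-root (v · v))
      Y-partner = solve 0 2 (λ q q̄ v v̄ →
          q̄ :* q̄ :* v̄ :* (q̄ :* q̄ :* v̄) :+ q :* q :* v :* (q :* q :* v)
            := q̄ :* q̄ :* (q̄ :* q̄) :* (v̄ :* v̄) :+ q :* q :* (q :* q) :* (v :* v)) refl q v

    R-tied : ∀ n v vs → length vs ≡ suc (n ℕ.+ n) → R (suc n) (tied v ∷ v ∷ vs)
      ≈ κ (tied v) * κ v * (κ̄ (tied v) * κ̄ v) * (∏ (wA (tied v)) vs * ∏ (wA v) vs) * R n vs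
    R-tied n v vs l = ≈-trans
      (*-congˡ (*-cong (*-congʳ (reflexive (≡.cong (pow K ⅓) (≡.sym l)))) (*-congˡ (spAt-tied n v vs l))))
      (lemma s _ (normalisation n) (γ u) (γ v) (∏ γ vs) _ _ _ (Y -1ᵤ + - third w (v · v)) (spAt n vs) (κ u) (κ v) (κ̄ u) (κ̄ v)
        (pow-3-⅓ (length vs)) (≈-trans (tied-scalar v) (*-cong (≈-sym (κ*κ̄ u)) (≈-sym (κ*κ̄ v)))))
      where
      u = tied v
      lemma : ∀ s t c g h γγ p a b y z k l k′ l′ → t * p ≈ 1# → g * h * y ≈ k * k′ * (l * l′) →
        s * (t * c * (g * (h * γγ) * (p * (a * b) * y * z))) ≈ k * l * (k′ * l′) * (a * b) * (s * (c * (γγ * z)))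
      lemma = solve-by 15 0 (λ s t c g h γγ p a b y z k l k′ l′ →
          s :* (t :* c :* (g :* (h :* γγ) :* (p :* (a :* b) :* y :* z)))
            := k :* l :* (k′ :* l′) :* (a :* b) :* (s :* (c :* (γγ :* z))) ,
          (s :* c :* g :* h :* γγ :* a :* b :* y :* z , t :* p := :1) ∷
          (s :* c :* γγ :* a :* b :* z , g :* h :* y := k :* k′ :* (l :* l′)) ∷ []) refl

    R-↭ : ∀ n {us vs} → length us ≡ suc (n ℕ.+ n) → us ↭ vs → R n us ≈ R n vs
    R-↭ n l h = *-congˡ (*-congˡ (*-cong (∏-↭ γ h) (spAt-↭ n l h)))

    R-inverses : ∀ n us → R n (inverses us) ≈ R n us
    R-inverses n us = *-congˡ (*-congˡ (*-cong (products us) (spAt-cong n (swapped us))))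
      where
      products : ∀ us → ∏ γ (inverses us) ≈ ∏ γ us
      products []       = ≈-refl
      products (u ∷ us) = *-cong (+-comm _ _) (products us)
      swapped : ∀ us → ListPointwise (λ u v → Y² u ≈ Y² v) (inverses us) us
      swapped []       = []
      swapped (u ∷ us) = +-comm _ _ ∷ swapped us

    -- γ(u) contributes degree 1 and the character 2n.
    Degree-R : ∀ n vs → length vs ≡ n ℕ.+ n → Degree (suc (n ℕ.+ n)) λ u → R n (u ∷ vs)
    Degree-R n vs l = Degree-cong (suc (n ℕ.+ n))
      (λ u → ≈-trans (*-congˡ (*-congˡ (*-congˡ (sp-↭ (exponents n) (points-length n (u ∷ vs) (≡.cong suc l)) (++-comm (u · u ∷ []) rest)))))
        (lemma s (normalisation n) (val u) (inv u) (∏ γ vs) _))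
      (Degree-linear (n ℕ.+ n) 1# 1# (Degree-scale (n ℕ.+ n) (s * normalisation n * ∏ γ vs)
        (≡.subst (λ m → Degree m λ u → spOf (exponents n) (rest ++ u · u ∷ [])) (double n)
          (Degree-sp n rest (≡.trans (length-++ (squares vs)) (≡.trans (ℕP.+-comm _ 1) (≡.cong suc (≡.trans (length-map _ vs) l))))))))
      where
      rest = squares vs ++ -1ᵤ ∷ []
      double : ∀ n → n ℕ.* 2 ≡ n ℕ.+ n
      double = solve-∀
      lemma : ∀ s c x y g z → s * (c * ((x + y) * g * z)) ≈ (1# * x + 1# * y) * (s * c * g * z)
      lemma = solve 6 0 (λ s c x y g z →
          s :* (c :* ((x :+ y) :* g :* z)) := (:1 :* x :+ :1 :* y) :* (s :* c :* g :* z)) refl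

    E≈R-one : ∀ u → E (u ∷ []) ≈ R 0 (u ∷ [])
    E≈R-one u = ≈-trans (lemma (κ̄ u) (κ u) s (γ u) gamma) (*-congˡ (*-congˡ (*-congˡ (≈-sym spAt≈1))))
      where
      y₁ = Y² u
      y₂ = Y -1ᵤ
      -- σ(q u) + σ(q/u) = σ(q) (u + u⁻¹).
      gamma : κ̄ u + κ u ≈ γ u
      gamma = solve-by 1 2 (λ sq q q̄ u ū →
          (q :* ū :+ :- (q̄ :* u)) :* sq :+ (q :* u :+ :- (q̄ :* ū)) :* sq := u :+ ū ,
          (u :+ ū , (q :+ :- q̄) :* sq := :1) ∷ []) refl sq q u σq*sq
      spAt≈1 : spAt 0 (u ∷ []) ≈ 1#
      spAt≈1 = solve 2 0 (λ y₁ y₂ →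
          :- :1 :* :1 :* (:1 :* :1) :* ((y₁ :* :1 :+ :0 :+ :- :0) :* (:0 :* :1 :+ :- :1 :* :0)
            :+ :- :1 :* (:1 :* ((y₂ :* :0 :+ :1 :+ :- :0) :* :1 :+ :- :1 :* :0) :+ :- :1 :* :0))
            := :1) refl y₁ y₂
      lemma : ∀ a b s g → a + b ≈ g → a * 1# * (s * 1# + b * 0#) + b * 1# * (s * 1# + a * 0#) ≈ s * (1# * (g * 1# * 1#))
      lemma = solve-by 4 0 (λ a b s g →
          a :* :1 :* (s :* :1 :+ b :* :0) :+ b :* :1 :* (s :* :1 :+ a :* :0) := s :* (:1 :* (g :* :1 :* :1)) ,
          (s , a :+ b := g) ∷ []) refl

    module _ (n : ℕ) (ih : ∀ us → length us ≡ suc (n ℕ.+ n) → E us ≈ R n us) where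

      at-tied : ∀ {x} vs → length vs ≡ suc n ℕ.+ suc n → x ∈ vs → E (tied x ∷ vs) ≈ R (suc n) (tied x ∷ vs)
      at-tied {x} vs l h with ∈⇒↭ h
      ... | vs′ , p = begin
        E (tied x ∷ vs)             ≈⟨ E-↭ (Perm.prep _ p) ⟩
        E (tied x ∷ x ∷ vs′)        ≈⟨ E-tied lawful x vs′ ⟩
        k * E vs′                   ≈⟨ *-congˡ (ih vs′ l′) ⟩
        k * R n vs′                 ≈⟨ R-tied n x vs′ l′ ⟨
        R (suc n) (tied x ∷ x ∷ vs′) ≈⟨ R-↭ (suc n) {tied x ∷ vs} (≡.cong suc l) (Perm.prep (tied x) p) ⟨
        R (suc n) (tied x ∷ vs)     ∎
        where
        k = κ (tied x) * κ x * (κ̄ (tied x) * κ̄ x) * (∏ (wA (tied x)) vs′ * ∏ (wA x) vs′)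
        l′ : length vs′ ≡ suc (n ℕ.+ n)
        l′ = ℕP.suc-injective (≡.trans (≡.sym (↭-length p)) (≡.trans l (≡.cong suc (ℕP.+-suc n n))))

      -- Both sides are invariant under inversion of all parameters, which exchanges tied and cotied
      -- points.
      at-cotied : ∀ {x} vs → length vs ≡ suc n ℕ.+ suc n → x ∈ vs → E (cotied x ∷ vs) ≈ R (suc n) (cotied x ∷ vs)
      at-cotied {x} vs l h = begin
        E (cotied x ∷ vs)                         ≈⟨ E-inverses (cotied x ∷ vs) ⟨
        E (inverses (cotied x ∷ vs))              ≈⟨ E-cong {inverses (cotied x ∷ vs)} {tied (x ⁻¹) ∷ inverses vs} (≈ᵤ-intro ≈-refl ≈-refl ∷ ≈ᵤ*-refl) ⟩
        E (tied (x ⁻¹) ∷ inverses vs)             ≈⟨ at-tied (inverses vs) (≡.trans (length-map _⁻¹ vs) l) (∈-map⁺ _⁻¹ h) ⟩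
        R (suc n) (tied (x ⁻¹) ∷ inverses vs)     ≈⟨ *-congˡ (*-congˡ (*-congˡ (spAt-cong (suc n) {tied (x ⁻¹) ∷ inverses vs} {inverses (cotied x ∷ vs)} (≈-refl ∷ LPW.refl ≈-refl)))) ⟩
        R (suc n) (inverses (cotied x ∷ vs))      ≈⟨ R-inverses (suc n) (cotied x ∷ vs) ⟩
        R (suc n) (cotied x ∷ vs)                 ∎

      -- Degree 2n + 3 in u calls for 2n + 4 points. The 2n + 2 other parameters give one tied point
      -- each; the cotied points of `a` and `b` supply the missing two.
      E≈R-generic : ∀ u a b vs → length vs ≡ n ℕ.+ n →
        Separated (cotied a ∷ cotied b ∷ List.map tied (a ∷ b ∷ vs)) → E (u ∷ a ∷ b ∷ vs) ≈ R (suc n) (u ∷ a ∷ b ∷ vs)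
      E≈R-generic u a b vs l S = agreement (suc (suc n ℕ.+ suc n)) (cotied a) (cotied b ∷ List.map tied ws)
        (≡.subst (λ m → Degree (suc m) λ u → E (u ∷ ws)) lw (Degree-E ws)) (Degree-R (suc n) ws lw)
        (≡.cong suc (≡.trans (length-map tied ws) lw)) S
        (at-cotied ws lw (here refl) ∷ at-cotied ws lw (there (here refl)) ∷ AllP.map⁺ (All.tabulate (at-tied ws lw))) u
        where
        ws = a ∷ b ∷ vs
        lw : length ws ≡ suc n ℕ.+ suc n
        lw = ≡.cong suc (≡.trans (≡.cong suc l) (≡.sym (ℕP.+-suc n n)))

module NaturalityOfPoints {A B : CommutativeRing 0ℓ 0ℓ} (f : Hom A B) (P : Parameters A) (Q : Parameters B) where
  open Ring B
  open Hom f
  open Naturality f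
  private
    module SA = Symmetrisation A P
    module SB = Symmetrisation B Q

  maps-pow : ∀ {x y} n → Maps x y → Maps (pow A x n) (pow B y n)
  maps-pow zero    h = maps 1-homo
  maps-pow (suc n) h = maps-* h (maps-pow n h)

  maps-points : ∀ {us vs} → ListPointwise MapsUnit us vs →
    ListPointwise MapsUnit (SA.squares us ++ SA.-1ᵤ ∷ []) (SB.squares vs ++ SB.-1ᵤ ∷ [])
  maps-points []       = mapsUnit (maps-neg (maps 1-homo)) (maps-neg (maps 1-homo)) ∷ []
  maps-points (h ∷ hs) = mapsUnit (maps-* (maps-val h) (maps-val h)) (maps-* (maps-inv h) (maps-inv h)) ∷ maps-points hs

  maps-normalisation : ∀ cA cB → Maps (Cubic.⅓ cA) (Cubic.⅓ cB) → ∀ n → Maps (SA.normalisation cA n) (SB.normalisation cB n)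
  maps-normalisation cA cB h zero    = maps 1-homo
  maps-normalisation cA cB h (suc n) = maps-* (maps-pow (suc (n ℕ.+ n)) h) (maps-normalisation cA cB h n)

-- Again over all rings, so that the induction can pass to the generic extension.
IdentityAt : ℕ → Set₁
IdentityAt n = ∀ (K : CommutativeRing 0ℓ 0ℓ) (P : Parameters K) (cubic : Cubic P) us → length us ≡ suc (n ℕ.+ n) →
  CommutativeRing._≈_ K (Symmetrisation.E K P us) (Symmetrisation.R K P cubic n us)

module _ {K : CommutativeRing 0ℓ 0ℓ} (X : Extension K) (P : Parameters K) (cubic : Cubic P) where
  open Ring K
  open Parameters P
  open Extension X
  open Generic X
  private
    PL = mapParameters constant P
    cubicL = cubic-map constant P cubic
    PQ = maps-constParameters P
    module SL = Symmetrisation L PL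
    module SK = Symmetrisation K P
    module RL = Recursions L PL
    module CL = CotiedDefinition L PL
    open NaturalityOfLists atOne PQ
    open NaturalityOfProducts atOne

    maps-κ̄ : ∀ {u v} → MapsUnit u v → Maps (SL.κ̄ u) (SK.κ̄ v)
    maps-κ̄ {u} {v} h = maps-κ PQ {u I.⁻¹} {Inv._⁻¹ K v} (mapsUnit (maps-inv h) (maps-val h))

    maps-inverses : ∀ {us vs} → ListPointwise MapsUnit us vs → ListPointwise MapsUnit (SL.inverses us) (SK.inverses vs)
    maps-inverses []       = []
    maps-inverses (h ∷ hs) = mapsUnit (maps-inv h) (maps-val h) ∷ maps-inverses hs

    maps-E : ∀ {us vs} → ListPointwise MapsUnit us vs → Maps (SL.E us) (SK.E vs)
    maps-E hs = maps-+ (maps-* (maps-∏ maps-κ̄ hs) (maps-Zₗ hs)) (maps-* (maps-∏ (maps-κ PQ) hs) (maps-Zₗ (maps-inverses hs)))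

    open NaturalityOfPoints atOne PL P
    maps-normalised : ∀ n → Maps (SL.normalisation cubicL n) (SK.normalisation cubic n)
    maps-normalised = maps-normalisation cubicL cubic (maps-const _)

    maps-R : ∀ n {us vs} → ListPointwise MapsUnit us vs → Maps (SL.R cubicL n us) (SK.R cubic n vs)
    maps-R n hs = maps-* (maps-const _) (maps-* (maps-normalised n)
      (maps-* (maps-∏ (λ h → maps-+ (maps-val h) (maps-inv h)) hs) (maps-sp atOne (exponents n) (maps-points hs))))

    q₀ = like-const q

    like-tied : ∀ k us → AllLike (List.map RL.tied (spread k us)) (negatives k us)
    like-tied k []       = []
    like-tied k (u ∷ us) = like-⁻¹ (like-· (like-· q₀ q₀) (like-mono u (+ suc k))) ∷ like-tied (suc k) us

    like-cotied : ∀ u k → Like (CL.cotied (monomialUnit u (+ suc k))) -[1+ k ]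
    like-cotied u k = like-· (like-· q₀ q₀) (like-⁻¹ (like-mono u (+ suc k)))

    open I using (Regular; _·_; _⁻¹)
    open Interpolation L using (δ; Separated)

    regular-δ : ∀ v → Regular (δ (CL.cotied v) (RL.tied v))
    regular-δ v = I.Regular-cong (SL.δ-cotied-tied v)
      (I.Regular-neg (I.Regular-unit (unit (Vertex.rc L PL) (Parameters.sq4 PL) (Lawful.wC≈1 (Cubic.lawful cubicL)))))

  identity-step : ∀ n → IdentityAt n → ∀ u a b vs → length vs ≡ n ℕ.+ n → SK.E (u ∷ a ∷ b ∷ vs) ≈ SK.R cubic (suc n) (u ∷ a ∷ b ∷ vs)
  identity-step n ih u a b vs l = ≈-trans (≈-sym (image (maps-E us)))
    (≈-trans (Hom.⟦⟧-cong atOne (SL.E≈R-generic cubicL n (ih L PL cubicL) (constUnit u) a′ b′ (spread 2 vs) l′ S))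
      (image (maps-R (suc n) us)))
    where
    a′ = monomialUnit a (+ 1)
    b′ = monomialUnit b (+ 2)
    us = maps-constUnit u ∷ maps-spread 0 (a ∷ b ∷ vs)
    l′ : length (spread 2 vs) ≡ n ℕ.+ n
    l′ = ≡.trans (LPW.Pointwise-length (maps-spread 2 vs)) l
    -- The tied and the cotied point of one parameter have equal degrees, so these two pairs are
    -- separated by `regular-δ`; all other pairs differ in degree.
    S : Separated (CL.cotied a′ ∷ CL.cotied b′ ∷ List.map RL.tied (spread 0 (a ∷ b ∷ vs)))
    S with separated (like-cotied a 0 ∷ like-cotied b 1 ∷ like-tied 2 vs) (negatives-distinct 0 (a ∷ b ∷ vs))
         | separated (like-tied 0 (a ∷ b ∷ vs)) (negatives-distinct 0 (a ∷ b ∷ vs))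
    ... | (ab ∷ avs) ∷ (bvs ∷ _) | apart =
      (ab ∷ regular-δ a′ ∷ like-δ (like-cotied a 0) (tied-like b 1) (λ ()) ∷ avs)
      ∷ (like-δ (like-cotied b 1) (tied-like a 0) (λ ()) ∷ regular-δ b′ ∷ bvs)
      ∷ apart
      where
      tied-like : ∀ u k → Like (RL.tied (monomialUnit u (+ suc k))) -[1+ k ]
      tied-like u k = like-⁻¹ (like-· (like-· q₀ q₀) (like-mono u (+ suc k)))

identity : ∀ n → IdentityAt n
identity zero    K P cubic (u ∷ [])         l = Symmetrisation.E≈R-one K P cubic u
identity (suc n) K P cubic (u ∷ a ∷ b ∷ vs) l = identity-step (laurentExtension K) P cubic n (identity n) u a b vs
  (ℕP.suc-injective (ℕP.suc-injective (≡.trans (ℕP.suc-injective l) (≡.cong suc (ℕP.+-suc n n)))))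
identity (suc n) K P cubic (u ∷ [])     l with () ← ≡.trans (ℕP.suc-injective l) (≡.cong suc (ℕP.+-suc n n))
identity (suc n) K P cubic (u ∷ a ∷ []) l with () ← ℕP.suc-injective (≡.trans (ℕP.suc-injective l) (≡.cong suc (ℕP.+-suc n n)))

-- Sums over orientations, row by row

≡ᵇ-refl : ∀ i → (i ℕ.≡ᵇ i) ≡ true
≡ᵇ-refl zero    = refl
≡ᵇ-refl (suc i) = ≡ᵇ-refl i

eqE-refl : ∀ e → eqE e e ≡ true
eqE-refl (hor i j) = ≡.cong₂ _∧_ (≡ᵇ-refl i) (≡ᵇ-refl j)
eqE-refl (ver i j) = ≡.cong₂ _∧_ (≡ᵇ-refl i) (≡ᵇ-refl j)

eqE-sound : ∀ e e′ → T (eqE e e′) → e ≡ e′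
eqE-sound (hor i j) (hor k l) t with i ℕ.≡ᵇ k | ℕP.≡ᵇ⇒≡ i k
... | true | f = ≡.cong₂ hor (f tt) (ℕP.≡ᵇ⇒≡ j l t)
eqE-sound (ver i j) (ver k l) t with i ℕ.≡ᵇ k | ℕP.≡ᵇ⇒≡ i k
... | true | f = ≡.cong₂ ver (f tt) (ℕP.≡ᵇ⇒≡ j l t)

_≟E_ : (e e′ : Edge) → Dec (e ≡ e′)
e ≟E e′ with eqE e e′ in eq | eqE-sound e e′
... | true  | f = yes (f tt)
... | false | _ = no λ { refl → case ≡.trans (≡.sym eq) (eqE-refl e) of λ () }

set-same : ∀ e b f → setE e b f e ≡ b
set-same e b f rewrite eqE-refl e = refl

set-other : ∀ e b f {e′} → e′ ≢ e → setE e b f e′ ≡ f e′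
set-other e b f {e′} h with eqE e′ e | eqE-sound e′ e
... | true  | g = ⊥-elim (h (g tt))
... | false | _ = refl

span : ℕ → ℕ → List ℕ
span a zero    = []
span a (suc k) = a ∷ span (suc a) k

range≡span : ∀ a b → range a b ≡ span a (suc b ∸ a)
range≡span a b = ≡.trans (map-applyUpTo (λ x → x) (a ℕ.+_) (suc b ∸ a)) (applyUpTo-span (a ℕ.+_) a (suc b ∸ a) λ x → refl)
  where
  applyUpTo-span : ∀ f a k → (∀ x → f x ≡ a ℕ.+ x) → List.applyUpTo f k ≡ span a k
  applyUpTo-span f a zero    h = refl
  applyUpTo-span f a (suc k) h = ≡.cong₂ _∷_ (≡.trans (h 0) (ℕP.+-identityʳ a))
    (applyUpTo-span (λ x → f (suc x)) (suc a) k λ x → ≡.trans (h (suc x)) (ℕP.+-suc a x))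

-- Edges listed so that the assignment order of the sums below is from the top row down.
tailEdges : ℕ → ℕ → ℕ → List Edge
tailEdges i j zero    = []
tailEdges i j (suc n) = tailEdges i (suc j) n ++ ver i j ∷ hor i j ∷ []

rowEdges : ℕ → ℕ → List Edge
rowEdges i k = tailEdges i (suc i) k ++ hor i i ∷ []

lowerEdges : ℕ → ℕ → List Edge
lowerEdges i zero    = []
lowerEdges i (suc k) = lowerEdges (suc i) k ++ rowEdges i k

topEdges : ℕ → ℕ → List Edge
topEdges j zero    = []
topEdges j (suc n) = topEdges (suc j) n ++ ver 0 j ∷ []

module EdgePermutation where
  open Perm.PermutationReasoning

  horRows verRows : ℕ → ℕ → List Edge
  horRows i zero    = []
  horRows i (suc k) = List.map (hor i) (span i (suc k)) ++ horRows (suc i) k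
  verRows i zero    = []
  verRows i (suc k) = List.map (ver i) (span (suc i) (suc k)) ++ verRows (suc i) k

  verColumns : ℕ → ℕ → ℕ → ℕ → List Edge
  verColumns a j t zero    = []
  verColumns a j t (suc k) = List.map (λ i → ver i j) (span a t) ++ verColumns a (suc j) (suc t) k

  -- Columns of heights t + 1, t + 2, ... form a staircase. Removing its first row lowers every
  -- height by one.
  peel-row : ∀ a j t k → verColumns a j (suc t) k ↭ List.map (ver a) (span j k) ++ verColumns (suc a) j t k
  peel-row a j t zero    = ↭-refl
  peel-row a j t (suc k) = Perm.prep (ver a j) (begin
    c ++ verColumns a (suc j) (suc (suc t)) k   ↭⟨ PermP.++⁺ˡ c (peel-row a (suc j) (suc t) k) ⟩
    c ++ r ++ v                                 ↭⟨ ↭-reflexive (++-assoc c r v) ⟨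
    (c ++ r) ++ v                               ↭⟨ PermP.++⁺ʳ v (++-comm c r) ⟩
    (r ++ c) ++ v                               ↭⟨ ↭-reflexive (++-assoc r c v) ⟩
    r ++ c ++ v                                 ∎)
    where
    c = List.map (λ i → ver i j) (span (suc a) t)
    r = List.map (ver a) (span (suc j) k)
    v = verColumns (suc a) (suc j) (suc t) k

  rows↭columns : ∀ a k → verRows a k ↭ verColumns a (suc a) 1 k
  rows↭columns a zero    = ↭-refl
  rows↭columns a (suc k) = ↭-trans (PermP.++⁺ˡ (List.map (ver a) (span (suc a) (suc k))) (rows↭columns (suc a) k))
    (↭-sym (peel-row a (suc a) 0 (suc k)))

  tail↭ : ∀ i j n → tailEdges i j n ↭ List.map (hor i) (span j n) ++ List.map (ver i) (span j n)
  tail↭ i j zero    = ↭-refl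
  tail↭ i j (suc n) = begin
    tailEdges i (suc j) n ++ ver i j ∷ hor i j ∷ []   ↭⟨ ++-comm (tailEdges i (suc j) n) _ ⟩
    ver i j ∷ hor i j ∷ tailEdges i (suc j) n         ↭⟨ Perm.swap _ _ (tail↭ i (suc j) n) ⟩
    hor i j ∷ ver i j ∷ h ++ v                        ↭⟨ Perm.prep _ (↭-sym (PermP.shift (ver i j) h v)) ⟩
    hor i j ∷ h ++ ver i j ∷ v                        ∎
    where
    h = List.map (hor i) (span (suc j) n)
    v = List.map (ver i) (span (suc j) n)

  lower↭ : ∀ i k → lowerEdges i k ↭ horRows i k ++ verRows i (ℕ.pred k)
  lower↭ i zero          = ↭-refl
  lower↭ i (suc zero)    = ↭-refl
  lower↭ i (suc (suc k)) = begin
    lowerEdges (suc i) (suc k) ++ rowEdges i (suc k)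
      ↭⟨ PermP.++⁺ (lower↭ (suc i) (suc k)) (↭-trans (++-comm (tailEdges i (suc i) (suc k)) (hor i i ∷ [])) (Perm.prep _ (tail↭ i (suc i) (suc k)))) ⟩
    (H ++ V) ++ (h ++ v)      ↭⟨ ++-comm (H ++ V) (h ++ v) ⟩
    (h ++ v) ++ (H ++ V)      ↭⟨ ↭-reflexive (++-assoc h v (H ++ V)) ⟩
    h ++ v ++ H ++ V          ↭⟨ PermP.++⁺ˡ h (↭-trans (↭-reflexive (≡.sym (++-assoc v H V)))
                                   (↭-trans (PermP.++⁺ʳ V (++-comm v H)) (↭-reflexive (++-assoc H v V)))) ⟩
    h ++ H ++ v ++ V          ↭⟨ ↭-reflexive (++-assoc h H (v ++ V)) ⟨
    (h ++ H) ++ (v ++ V)      ∎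
    where
    H = horRows (suc i) (suc k)
    V = verRows (suc i) k
    h = List.map (hor i) (span i (suc (suc k)))
    v = List.map (ver i) (span (suc i) (suc k))

  top↭ : ∀ j n → topEdges j n ↭ List.map (ver 0) (span j n)
  top↭ j zero    = ↭-refl
  top↭ j (suc n) = ↭-trans (++-comm (topEdges (suc j) n) _) (Perm.prep _ (top↭ (suc j) n))

  horRows≡ : ∀ m i k → i ℕ.+ k ≡ suc m → List.concatMap (λ i → List.map (hor i) (range i m)) (span i k) ≡ horRows i k
  horRows≡ m i zero    h = refl
  horRows≡ m i (suc k) h = ≡.cong₂ _++_
    (≡.cong (List.map (hor i)) (≡.trans (range≡span i m) (≡.cong (span i) (≡.trans (≡.cong (_∸ i) (≡.sym h)) (ℕP.m+n∸m≡n i (suc k))))))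
    (horRows≡ m (suc i) k (≡.trans (≡.sym (ℕP.+-suc i k)) h))

  verColumns≡ : ∀ j k → List.concatMap (λ j → List.map (λ i → ver i j) (range 0 (j ∸ 1))) (span (suc j) k) ≡ verColumns 0 (suc j) (suc j) k
  verColumns≡ j zero    = refl
  verColumns≡ j (suc k) = ≡.cong₂ _++_ (≡.cong (List.map λ i → ver i (suc j)) (range≡span 0 j)) (verColumns≡ (suc j) k)

  edges↭ : ∀ m → edges m ↭ lowerEdges 1 m ++ topEdges 1 m
  edges↭ m = begin
    edges m
      ↭⟨ ↭-reflexive (≡.cong₂ _++_
           (≡.trans (≡.cong (List.concatMap _) (range≡span 1 m)) (horRows≡ m 1 m refl))
           (≡.trans (≡.cong (List.concatMap _) (range≡span 1 m)) (verColumns≡ 0 m))) ⟩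
    horRows 1 m ++ verColumns 0 1 1 m   ↭⟨ PermP.++⁺ˡ (horRows 1 m) (↭-sym (rows↭columns 0 m)) ⟩
    horRows 1 m ++ verRows 0 m          ↭⟨ PermP.++⁺ˡ (horRows 1 m) (split m) ⟩
    horRows 1 m ++ verRows 1 (ℕ.pred m) ++ List.map (ver 0) (span 1 m)
      ↭⟨ ↭-reflexive (++-assoc (horRows 1 m) _ _) ⟨
    (horRows 1 m ++ verRows 1 (ℕ.pred m)) ++ List.map (ver 0) (span 1 m)
      ↭⟨ PermP.++⁺ (lower↭ 1 m) (top↭ 1 m) ⟨
    lowerEdges 1 m ++ topEdges 1 m      ∎
    where
    split : ∀ m → verRows 0 m ↭ verRows 1 (ℕ.pred m) ++ List.map (ver 0) (span 1 m)
    split zero    = ↭-refl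
    split (suc m) = ++-comm (List.map (ver 0) (span 1 (suc m))) (verRows 1 m)

_≗E_ : Orientation → Orientation → Set
f ≗E g = ∀ e → f e ≡ g e

set-cong : ∀ e b {f g} → f ≗E g → setE e b f ≗E setE e b g
set-cong e b h e′ with eqE e′ e
... | true  = refl
... | false = h e′

set-commute : ∀ e e′ b b′ f → e ≢ e′ → setE e b (setE e′ b′ f) ≗E setE e′ b′ (setE e b f)
set-commute e e′ b b′ f h e″ with eqE e″ e | eqE-sound e″ e | eqE e″ e′ | eqE-sound e″ e′
... | true  | p | true  | q = ⊥-elim (h (≡.trans (≡.sym (p _)) (q _)))
... | true  | _ | false | _ = refl
... | false | _ | true  | _ = refl
... | false | _ | false | _ = refl

module Sums (K : CommutativeRing 0ℓ 0ℓ) where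
  open Ring K

  -- The head of es is assigned last.
  sumOver : List Edge → (Orientation → Carrier) → Orientation → Carrier
  sumOver []       W f = W f
  sumOver (e ∷ es) W f = sumOver es (λ g → W (setE e true g) + W (setE e false g)) f

  sumOver-cong : ∀ es {W V} → (∀ g → W g ≈ V g) → ∀ f → sumOver es W f ≈ sumOver es V f
  sumOver-cong []       h f = h f
  sumOver-cong (e ∷ es) h f = sumOver-cong es (λ g → +-cong (h _) (h _)) f

  -- Orientations are functions, and reordering assignments changes them only up to pointwise
  -- equality.
  Extensional : (Orientation → Carrier) → Set
  Extensional W = ∀ {f g} → f ≗E g → W f ≈ W g

  extensional-step : ∀ e {W} → Extensional W → Extensional λ g → W (setE e true g) + W (setE e false g)
  extensional-step e h p = +-cong (h (set-cong e true p)) (h (set-cong e false p))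

  +-cross : ∀ a b c d → (a + b) + (c + d) ≈ (a + c) + (b + d)
  +-cross = solve 4 0 (λ a b c d → a :+ b :+ (c :+ d) := a :+ c :+ (b :+ d)) refl

  sumOver-↭ : ∀ {es es′} → es ↭ es′ → ∀ {W} → Extensional W → ∀ f → sumOver es W f ≈ sumOver es′ W f
  sumOver-↭ Perm.refl         ext f = ≈-refl
  sumOver-↭ (Perm.prep e p)   ext f = sumOver-↭ p (extensional-step e ext) f
  sumOver-↭ (Perm.swap {xs} e e′ p) {W} ext f with e ≟E e′
  ... | yes refl = sumOver-↭ p (extensional-step e (extensional-step e ext)) f
  ... | no h     = ≈-trans (sumOver-cong xs (λ g → ≈-trans (+-cross _ _ _ _)
      (+-cong (+-cong (ext (set-commute e e′ _ _ g h)) (ext (set-commute e e′ _ _ g h)))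
              (+-cong (ext (set-commute e e′ _ _ g h)) (ext (set-commute e e′ _ _ g h))))) f)
    (sumOver-↭ p (extensional-step e (extensional-step e′ ext)) f)
  sumOver-↭ (Perm.trans p p′) ext f = ≈-trans (sumOver-↭ p ext f) (sumOver-↭ p′ ext f)

  sumOver-++ : ∀ es es′ W f → sumOver (es ++ es′) W f ≡ sumOver es′ (sumOver es W) f
  sumOver-++ []       es′ W f = refl
  sumOver-++ (e ∷ es) es′ W f = sumOver-++ es es′ _ f

  -- Only the edges in `es` vary inside the sum, so summands are compared on orientations that agree
  -- with `f` on all other edges.
  sumOver-agree : ∀ es {W V} f → (∀ g → (∀ e → e ∉ es → g e ≡ f e) → W g ≈ V g) → sumOver es W f ≈ sumOver es V f
  sumOver-agree []       f h = h f λ e _ → refl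
  sumOver-agree (e ∷ es) {W} {V} f h = sumOver-agree es f λ g a → +-cong (h _ (agrees g true a)) (h _ (agrees g false a))
    where
    agrees : ∀ g b → (∀ e → e ∉ es → g e ≡ f e) → ∀ e′ → e′ ∉ e ∷ es → setE e b g e′ ≡ f e′
    agrees g b a e′ n = ≡.trans (set-other e b g λ { refl → n (here refl) }) (a e′ λ m → n (there m))

  sumOver-scale : ∀ es c W f → sumOver es (λ g → c * W g) f ≈ c * sumOver es W f
  sumOver-scale []       c W f = ≈-refl
  sumOver-scale (e ∷ es) c W f = ≈-trans (sumOver-cong es (λ g → ≈-sym (distribˡ _ _ _)) f) (sumOver-scale es c _ f)

  sumOver-factor : ∀ es {c W V} f → (∀ g → (∀ e → e ∉ es → g e ≡ f e) → W g ≈ c * V g) →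
    sumOver es W f ≈ c * sumOver es V f
  sumOver-factor es f h = ≈-trans (sumOver-agree es f h) (sumOver-scale es _ _ f)

  sumList : List Carrier → Carrier
  sumList = List.foldr _+_ 0#

  sumList-orientations : ∀ es W → sumList (List.map W (allOrients es)) ≈ sumOver es W (λ _ → false)
  sumList-orientations []       W = +-identityʳ _
  sumList-orientations (e ∷ es) W = ≈-trans (branches (allOrients es)) (sumList-orientations es _)
    where
    branches : ∀ fs → sumList (List.map W (List.concatMap (λ f → setE e true f ∷ setE e false f ∷ []) fs))
      ≈ sumList (List.map (λ g → W (setE e true g) + W (setE e false g)) fs)
    branches []       = ≈-refl
    branches (f ∷ fs) = ≈-trans (+-congˡ (+-congˡ (branches fs))) (≈-sym (+-assoc _ _ _))

edgeRow edgeColumn : Edge → ℕ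
edgeRow (hor i j) = i
edgeRow (ver i j) = i
edgeColumn (hor i j) = j
edgeColumn (ver i j) = j

tail-bounds : ∀ i j n → All (λ e → edgeRow e ≡ i × j ℕ.≤ edgeColumn e) (tailEdges i j n)
tail-bounds i j zero    = []
tail-bounds i j (suc n) = AllP.++⁺ (All.map (λ (r , c) → r , ℕP.<⇒≤ c) (tail-bounds i (suc j) n))
  ((refl , ℕP.≤-refl) ∷ (refl , ℕP.≤-refl) ∷ [])

row-bounds : ∀ i k → All (λ e → edgeRow e ≡ i) (rowEdges i k)
row-bounds i k = AllP.++⁺ (All.map proj₁ (tail-bounds i (suc i) k)) (refl ∷ [])

lower-bounds : ∀ i k → All (λ e → i ℕ.≤ edgeRow e) (lowerEdges i k)
lower-bounds i zero    = []
lower-bounds i (suc k) = AllP.++⁺ (All.map ℕP.<⇒≤ (lower-bounds (suc i) k)) (All.map (λ { refl → ℕP.≤-refl }) (row-bounds i k))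

top-bounds : ∀ j n → All (λ e → edgeRow e ≡ 0 × j ℕ.≤ edgeColumn e) (topEdges j n)
top-bounds j zero    = []
top-bounds j (suc n) = AllP.++⁺ (All.map (λ (r , c) → r , ℕP.<⇒≤ c) (top-bounds (suc j) n)) ((refl , ℕP.≤-refl) ∷ [])

∉-tail : ∀ i j n e → (edgeRow e ≡ i → j ℕ.≤ edgeColumn e → ⊥) → e ∉ tailEdges i j n
∉-tail i j n e h m = let r , c = All.lookup (tail-bounds i j n) m in h r c

module Configurations (K : CommutativeRing 0ℓ 0ℓ) (P : Parameters K) (m : ℕ)
  (units : ℕ → Invertible K) where
  open Ring K hiding (units)
  open Parameters P
  open Vertex K P
  open Exchange K P using (vertex-cong; boundary-cong; row-cong)
  open Sums K

  ind : Bool → Carrier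
  ind true  = 1#
  ind false = 0#

  bulk : U → U → Bool → Bool → Bool → Bool → Carrier
  bulk w v true  false false true  = 1#
  bulk w v false true  true  false = 1#
  bulk w v false false false false = wA w v
  bulk w v true  true  true  true  = wA w v
  bulk w v false false true  true  = wB w v
  bulk w v true  true  false false = wB w v
  bulk w v _     _     _     _     = 0#

  topWeight rightWeight leftWeight : Orientation → ℕ → Carrier
  topWeight f j = ind (not (f (ver 0 j)))
  rightWeight f i = ind (not (f (hor i m)))
  leftWeight f i = if f (ver (i ∸ 1) i) xor not (f (hor i i)) then s else κ (units i)

  bulkWeight : Orientation → ℕ → ℕ → Carrier
  bulkWeight f i j = bulk (units i) (units j) (f (hor i (j ∸ 1))) (f (hor i j)) (f (ver (i ∸ 1) j)) (f (ver i j))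

  bits : Orientation → ℕ → ℕ → (n : ℕ) → Vec Bool n
  bits f i j zero    = []
  bits f i j (suc n) = f (ver i j) ∷ bits f i (suc j) n

  unitsFrom : ℕ → (n : ℕ) → Vec U n
  unitsFrom j zero    = []
  unitsFrom j (suc n) = units j ∷ unitsFrom (suc j) n

  tailWeight : ℕ → ℕ → ℕ → Orientation → Carrier
  tailWeight i j zero    f = rightWeight f i
  tailWeight i j (suc n) f = bulkWeight f i j * tailWeight i (suc j) n f

  rowWeight : ℕ → ℕ → Orientation → Carrier
  rowWeight i k f = leftWeight f i * tailWeight i (suc i) k f

  rowWeights : ℕ → ℕ → Orientation → Carrier
  rowWeights i zero    f = 1#
  rowWeights i (suc k) f = rowWeight i k f * rowWeights (suc i) k f

  topWeights : ℕ → ℕ → Orientation → Carrier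
  topWeights j zero    f = 1#
  topWeights j (suc n) f = topWeight f j * topWeights (suc j) n f

  module _ (wC≈1 : wC ≈ 1#) where

    -- Of the four completions only those obeying the ice rule have a nonzero weight, and `wC≈1`
    -- identifies the weight 1 of a turning vertex.
    vertex-sum : ∀ w v h b (g : Bool → Bool → Carrier) → vertex w v h b g
      ≈ (bulk w v h true b true * g true true + bulk w v h true b false * g true false)
        + (bulk w v h false b true * g false true + bulk w v h false b false * g false false)
    vertex-sum w v false false g = lemma _ _ _ _ _
      where
      lemma : ∀ x a b c d → x * d ≈ (0# * a + 0# * b) + (0# * c + x * d)
      lemma = solve 5 0 (λ x a b c d → x :* d := :0 :* a :+ :0 :* b :+ (:0 :* c :+ x :* d)) refl
    vertex-sum w v true true g = lemma _ _ _ _ _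
      where
      lemma : ∀ x a b c d → x * a ≈ (x * a + 0# * b) + (0# * c + 0# * d)
      lemma = solve 5 0 (λ x a b c d → x :* a := x :* a :+ :0 :* b :+ (:0 :* c :+ :0 :* d)) refl
    vertex-sum w v false true g = ≈-trans (+-congˡ (*-congʳ wC≈1)) (lemma _ _ _ _ _)
      where
      lemma : ∀ x a b c d → x * c + 1# * b ≈ (0# * a + 1# * b) + (x * c + 0# * d)
      lemma = solve 5 0 (λ x a b c d → x :* c :+ :1 :* b := :0 :* a :+ :1 :* b :+ (x :* c :+ :0 :* d)) refl
    vertex-sum w v true false g = ≈-trans (+-congˡ (*-congʳ wC≈1)) (lemma _ _ _ _ _)
      where
      lemma : ∀ x a b c d → x * b + 1# * c ≈ (0# * a + x * b) + (1# * c + 0# * d)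
      lemma = solve 5 0 (λ x a b c d → x :* b :+ :1 :* c := :0 :* a :+ x :* b :+ (:1 :* c :+ :0 :* d)) refl

    -- The edges entering this part of the row, on its left and above it, are read from `f`. Those
    -- below it are summed here and handed to `k`.
    row-sum : ∀ i j n f (k : Vec Bool n → Carrier) → j ℕ.+ n ≡ m →
      sumOver (tailEdges (suc i) (suc j) n) (λ g → tailWeight (suc i) (suc j) n g * k (bits g (suc i) (suc j) n)) f
        ≈ row (units (suc i)) (f (hor (suc i) j)) (unitsFrom (suc j) n) (bits f i (suc j) n) k
    -- Now j = m, so the edge entering the empty rest of the row is the one at the right boundary.
    row-sum i j zero f k l rewrite ≡.trans (≡.sym (ℕP.+-identityʳ j)) l with f (hor (suc i) m)
    ... | true  = zeroˡ _
    ... | false = *-identityˡ _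
    row-sum i j (suc n) f k l = begin
      sumOver (tailEdges (suc i) (suc (suc j)) n ++ v ∷ h ∷ []) V f
        ≈⟨ reflexive (sumOver-++ (tailEdges (suc i) (suc (suc j)) n) _ V f) ⟩
      (S (setE v true (setE h true f)) + S (setE v false (setE h true f)))
        + (S (setE v true (setE h false f)) + S (setE v false (setE h false f)))
        ≈⟨ +-cong (+-cong (branch true true) (branch true false)) (+-cong (branch false true) (branch false false)) ⟩
      (B true true * r true true + B true false * r true false) + (B false true * r false true + B false false * r false false)
        ≈⟨ vertex-sum (units (suc i)) (units (suc j)) (f (hor (suc i) j)) (f (ver i (suc j))) r ⟨
      row (units (suc i)) (f (hor (suc i) j)) (unitsFrom (suc j) (suc n)) (bits f i (suc j) (suc n)) k ∎
      where
      h = hor (suc i) (suc j)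
      v = ver (suc i) (suc j)
      es = tailEdges (suc i) (suc (suc j)) n
      V : Orientation → Carrier
      V g = tailWeight (suc i) (suc j) (suc n) g * k (bits g (suc i) (suc j) (suc n))
      S = sumOver es V
      B r : Bool → Bool → Carrier
      B a b = bulk (units (suc i)) (units (suc j)) (f (hor (suc i) j)) a (f (ver i (suc j))) b
      r a b = row (units (suc i)) a (unitsFrom (suc (suc j)) n) (bits f i (suc (suc j)) n) (λ x → k (b ∷ x))
      branch : ∀ a b → S (setE v b (setE h a f)) ≈ B a b * r a b
      branch a b = ≈-trans (sumOver-factor es f′ factor)
        (*-congˡ (≈-trans (row-sum i (suc j) n f′ (λ x → k (b ∷ x)) (≡.trans (≡.sym (ℕP.+-suc j n)) l))
          (reflexive (≡.cong₂ (λ h bs → row (units (suc i)) h (unitsFrom (suc (suc j)) n) bs (λ x → k (b ∷ x))) h′ (bits′ (suc (suc j)) n)))))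
        where
        f′ = setE v b (setE h a f)
        h′ : f′ h ≡ a
        h′ = ≡.trans (set-other v b (setE h a f) λ ()) (set-same h a f)
        unchanged : ∀ e → e ≢ v → e ≢ h → f′ e ≡ f e
        unchanged e p q = ≡.trans (set-other v b (setE h a f) p) (set-other h a f q)
        bits′ : ∀ j′ n → bits f′ i j′ n ≡ bits f i j′ n
        bits′ j′ zero    = refl
        bits′ j′ (suc n) = ≡.cong₂ _∷_ (unchanged (ver i j′) (λ ()) λ ()) (bits′ (suc j′) n)
        factor : ∀ g → (∀ e → e ∉ es → g e ≡ f′ e) → V g ≈ B a b * (tailWeight (suc i) (suc (suc j)) n g * k (b ∷ bits g (suc i) (suc (suc j)) n))
        factor g ag
          rewrite ≡.trans (ag (hor (suc i) j) (∉-tail (suc i) (suc (suc j)) n _ λ _ c → ℕP.<⇒≱ (ℕP.m≤n⇒m≤1+n ℕP.≤-refl) c)) (unchanged (hor (suc i) j) (λ ()) λ ())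
                | ≡.trans (ag h (∉-tail (suc i) (suc (suc j)) n h λ _ c → ℕP.<-irrefl refl c)) h′
                | ≡.trans (ag (ver i (suc j)) (∉-tail (suc i) (suc (suc j)) n _ λ ())) (unchanged (ver i (suc j)) (λ ()) λ ())
                | ≡.trans (ag v (∉-tail (suc i) (suc (suc j)) n v λ _ c → ℕP.<-irrefl refl c)) (set-same v b (setE h a f))
          = *-assoc _ _ _

    -- The sum over the lower rows sees the current row only through its downward vertical edges,
    -- which form the top state of the smaller triangle.
    rows-sum : ∀ i k f → i ℕ.+ k ≡ m →
      sumOver (lowerEdges (suc i) k) (rowWeights (suc i) k) f ≈ Ψ (unitsFrom (suc i) k) (bits f i (suc i) k)
    rows-sum i zero    f l = ≈-refl
    rows-sum i (suc k) f l = begin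
      sumOver (lowerEdges (suc (suc i)) k ++ tailEdges (suc i) (suc (suc i)) k ++ h ∷ []) (rowWeights (suc i) (suc k)) f
        ≈⟨ reflexive (≡.trans (sumOver-++ (lowerEdges (suc (suc i)) k) _ _ f) (sumOver-++ (tailEdges (suc i) (suc (suc i)) k) _ _ f)) ⟩
      S (setE h true f) + S (setE h false f)
        ≈⟨ +-cong (branch true) (branch false) ⟩
      c true * r true + c false * r false
        ≈⟨ boundary-sum (f (ver i (suc i))) ⟩
      boundary (units (suc i)) (f (ver i (suc i))) r ∎
      where
      h = hor (suc i) (suc i)
      es = tailEdges (suc i) (suc (suc i)) k
      L = lowerEdges (suc (suc i)) k
      l′ : suc i ℕ.+ k ≡ m
      l′ = ≡.trans (≡.sym (ℕP.+-suc i k)) l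
      S = sumOver es (sumOver L (rowWeights (suc i) (suc k)))
      V : Orientation → Carrier
      V g = tailWeight (suc i) (suc (suc i)) k g * Ψ (unitsFrom (suc (suc i)) k) (bits g (suc i) (suc (suc i)) k)
      c r : Bool → Carrier
      c a = if f (ver i (suc i)) xor not a then s else κ (units (suc i))
      r a = row (units (suc i)) a (unitsFrom (suc (suc i)) k) (bits f i (suc (suc i)) k) (Ψ (unitsFrom (suc (suc i)) k))
      boundary-sum : ∀ b → (if b xor false then s else κ (units (suc i))) * r true + (if b xor true then s else κ (units (suc i))) * r false
        ≈ boundary (units (suc i)) b r
      boundary-sum true  = ≈-refl
      boundary-sum false = +-comm _ _
      ∉-lower : ∀ e → edgeRow e ≡ suc i ⊎ edgeRow e ≡ i → e ∉ L
      ∉-lower e (inj₁ p) m = ℕP.<-irrefl (≡.sym p) (All.lookup (lower-bounds (suc (suc i)) k) m)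
      ∉-lower e (inj₂ p) m = ℕP.<-irrefl (≡.sym p) (ℕP.<-trans (ℕP.n<1+n i) (All.lookup (lower-bounds (suc (suc i)) k) m))
      tail-agree : ∀ {g g′} → (∀ e → edgeRow e ≡ suc i ⊎ edgeRow e ≡ i → g e ≡ g′ e) → ∀ j n → tailWeight (suc i) j n g ≡ tailWeight (suc i) j n g′
      tail-agree a j zero    = ≡.cong (λ b → ind (not b)) (a (hor (suc i) m) (inj₁ refl))
      tail-agree a j (suc n) rewrite a (hor (suc i) (j ∸ 1)) (inj₁ refl) | a (hor (suc i) j) (inj₁ refl) | a (ver i j) (inj₂ refl) | a (ver (suc i) j) (inj₁ refl)
        = ≡.cong (_ *_) (tail-agree a (suc j) n)
      left-agree : ∀ {g g′} → (∀ e → edgeRow e ≡ suc i ⊎ edgeRow e ≡ i → g e ≡ g′ e) → leftWeight g (suc i) ≡ leftWeight g′ (suc i)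
      left-agree a rewrite a (ver i (suc i)) (inj₂ refl) | a h (inj₁ refl) = refl
      lower : ∀ g → sumOver L (rowWeights (suc i) (suc k)) g ≈ leftWeight g (suc i) * V g
      lower g = ≈-trans (sumOver-factor L g λ g′ a → *-congʳ (reflexive (≡.cong₂ _*_ (left-agree λ e p → a e (∉-lower e p)) (tail-agree (λ e p → a e (∉-lower e p)) (suc (suc i)) k))))
        (≈-trans (*-congˡ (rows-sum (suc i) k g l′)) (*-assoc _ _ _))
      branch : ∀ a → S (setE h a f) ≈ c a * r a
      branch a = ≈-trans (sumOver-cong es lower f′)
        (≈-trans (sumOver-factor es f′ λ g ag → *-congʳ (reflexive (left-value g ag)))
          (*-congˡ (≈-trans (row-sum i (suc i) k f′ (Ψ (unitsFrom (suc (suc i)) k)) l′)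
            (reflexive (≡.cong₂ (λ h bs → row (units (suc i)) h (unitsFrom (suc (suc i)) k) bs (Ψ (unitsFrom (suc (suc i)) k))) (set-same h a f) (bits′ (suc (suc i)) k))))))
        where
        f′ = setE h a f
        bits′ : ∀ j′ n → bits f′ i j′ n ≡ bits f i j′ n
        bits′ j′ zero    = refl
        bits′ j′ (suc n) = ≡.cong₂ _∷_ (set-other h a f λ ()) (bits′ (suc j′) n)
        left-value : ∀ g → (∀ e → e ∉ es → g e ≡ f′ e) → leftWeight g (suc i) ≡ c a
        left-value g ag
          rewrite ≡.trans (ag (ver i (suc i)) (∉-tail (suc i) (suc (suc i)) k _ λ ())) (set-other h a f {ver i (suc i)} λ ())
                | ≡.trans (ag h (∉-tail (suc i) (suc (suc i)) k h λ _ c → ℕP.<-irrefl refl c)) (set-same h a f) = refl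

    top-sum : ∀ j n f (k : Vec Bool n → Carrier) →
      sumOver (topEdges j n) (λ g → topWeights j n g * k (bits g 0 j n)) f ≈ k (Vec.replicate n false)
    top-sum j zero    f k = *-identityˡ _
    top-sum j (suc n) f k = begin
      sumOver (topEdges (suc j) n ++ v ∷ []) V f     ≈⟨ reflexive (sumOver-++ (topEdges (suc j) n) _ V f) ⟩
      S (setE v true f) + S (setE v false f)         ≈⟨ +-cong (≈-trans (branch true) (zeroˡ _)) (≈-trans (branch false) (*-identityˡ _)) ⟩
      0# + k (false ∷ Vec.replicate n false)         ≈⟨ +-identityˡ _ ⟩
      k (Vec.replicate (suc n) false)                ∎
      where
      v = ver 0 j
      V : Orientation → Carrier
      V g = topWeights j (suc n) g * k (bits g 0 j (suc n))
      S = sumOver (topEdges (suc j) n) V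
      branch : ∀ b → S (setE v b f) ≈ ind (not b) * k (b ∷ Vec.replicate n false)
      branch b = ≈-trans (sumOver-factor (topEdges (suc j) n) f′ factor) (*-congˡ (top-sum (suc j) n f′ (λ x → k (b ∷ x))))
        where
        f′ = setE v b f
        factor : ∀ g → (∀ e → e ∉ topEdges (suc j) n → g e ≡ f′ e) →
          V g ≈ ind (not b) * (topWeights (suc j) n g * k (b ∷ bits g 0 (suc j) n))
        factor g ag rewrite ≡.trans (ag v λ m → ℕP.<-irrefl refl (proj₂ (All.lookup (top-bounds (suc j) n) m))) (set-same v b f) = *-assoc _ _ _

    total : ∀ f → sumOver (lowerEdges 1 m ++ topEdges 1 m) (λ g → topWeights 1 m g * rowWeights 1 m g) f ≈ Z (unitsFrom 1 m)
    total f = ≈-trans (reflexive (sumOver-++ (lowerEdges 1 m) _ _ f))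
      (≈-trans (sumOver-cong (topEdges 1 m) (λ g → ≈-trans (sumOver-factor (lowerEdges 1 m) g λ g′ a → *-congʳ (reflexive (top-agree g′ g a 1 m)))
          (*-congˡ (rows-sum 0 m g refl))) f)
        (top-sum 1 m f (Ψ (unitsFrom 1 m))))
      where
      top-agree : ∀ g′ g → (∀ e → e ∉ lowerEdges 1 m → g′ e ≡ g e) → ∀ j n → topWeights j n g′ ≡ topWeights j n g
      top-agree g′ g a j zero    = refl
      top-agree g′ g a j (suc n) = ≡.cong₂ _*_
        (≡.cong (λ b → ind (not b)) (a (ver 0 j) λ h → ℕP.<-irrefl refl (All.lookup (lower-bounds 1 m) h))) (top-agree g′ g a (suc j) n)

-- The dual numbers R[s]/(s²): the coefficient of s¹ of a product only needs the
-- factors modulo s².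
module DualNumbers (R : CommutativeRing 0ℓ 0ℓ) where
  open Ring R

  dual : CommutativeRing 0ℓ 0ℓ
  dual = record
    { Carrier = Carrier × Carrier
    ; _≈_ = λ (a , b) (c , d) → (a ≈ c) × (b ≈ d)
    ; _+_ = λ (a , b) (c , d) → a + c , b + d
    ; _*_ = λ (a , b) (c , d) → a * c , a * d + b * c
    ; -_ = λ (a , b) → - a , - b
    ; 0# = 0# , 0#
    ; 1# = 1# , 0#
    ; isCommutativeRing = record
      { isRing = record
        { +-isAbelianGroup = record
          { isGroup = record
            { isMonoid = record
              { isSemigroup = record
                { isMagma = record
                  { isEquivalence = record
                    { refl = ≈-refl , ≈-refl ; sym = λ (h , k) → ≈-sym h , ≈-sym k
                    ; trans = λ (h , k) (h′ , k′) → ≈-trans h h′ , ≈-trans k k′ }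
                  ; ∙-cong = λ (h , k) (h′ , k′) → +-cong h h′ , +-cong k k′ }
                ; assoc = λ x y z → +-assoc _ _ _ , +-assoc _ _ _ }
              ; identity = (λ x → +-identityˡ _ , +-identityˡ _) , λ x → +-identityʳ _ , +-identityʳ _ }
            ; inverse = (λ x → -‿inverseˡ _ , -‿inverseˡ _) , λ x → -‿inverseʳ _ , -‿inverseʳ _
            ; ⁻¹-cong = λ (h , k) → -‿cong h , -‿cong k }
          ; comm = λ x y → +-comm _ _ , +-comm _ _ }
        ; *-cong = λ (h , k) (h′ , k′) → *-cong h h′ , +-cong (*-cong h k′) (*-cong k h′)
        ; *-assoc = λ (a , b) (c , d) (e , f) → *-assoc _ _ _ , assoc₂ a b c d e f
        ; *-identity = (λ (a , b) → *-identityˡ _ , idˡ a b) , λ (a , b) → *-identityʳ _ , idʳ a b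
        ; distrib = (λ (a , b) (c , d) (e , f) → distribˡ _ _ _ , distrib₂ a b c d e f)
                  , λ (a , b) (c , d) (e , f) → distribʳ _ _ _ , distrib₃ a b c d e f }
      ; *-comm = λ (a , b) (c , d) → *-comm _ _ , comm₂ a b c d } }
    where
    assoc₂ : ∀ a b c d e f → a * c * f + (a * d + b * c) * e ≈ a * (c * f + d * e) + b * (c * e)
    assoc₂ = solve 6 0 (λ a b c d e f →
        a :* c :* f :+ (a :* d :+ b :* c) :* e := a :* (c :* f :+ d :* e) :+ b :* (c :* e)) refl
    idˡ : ∀ a b → 1# * b + 0# * a ≈ b
    idˡ = solve 2 0 (λ a b → :1 :* b :+ :0 :* a := b) refl
    idʳ : ∀ a b → a * 0# + b * 1# ≈ b
    idʳ = solve 2 0 (λ a b → a :* :0 :+ b :* :1 := b) refl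
    distrib₂ : ∀ a b c d e f → a * (d + f) + b * (c + e) ≈ (a * d + b * c) + (a * f + b * e)
    distrib₂ = solve 6 0 (λ a b c d e f →
        a :* (d :+ f) :+ b :* (c :+ e) := a :* d :+ b :* c :+ (a :* f :+ b :* e)) refl
    distrib₃ : ∀ a b c d e f → (c + e) * b + (d + f) * a ≈ (c * b + d * a) + (e * b + f * a)
    distrib₃ = solve 6 0 (λ a b c d e f →
        (c :+ e) :* b :+ (d :+ f) :* a := c :* b :+ d :* a :+ (e :* b :+ f :* a)) refl
    comm₂ : ∀ a b c d → a * d + b * c ≈ c * b + d * a
    comm₂ = solve 4 0 (λ a b c d → a :* d :+ b :* c := c :* b :+ d :* a) refl

  private module D = CommutativeRing dual

  embed : Hom R dual
  embed = record
    { ⟦_⟧ = λ a → a , 0#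
    ; ⟦⟧-cong = λ h → h , ≈-refl
    ; +-homo = λ a b → ≈-refl , ≈-sym (+-identityˡ _)
    ; *-homo = λ a b → ≈-refl , ≈-sym (≈-trans (+-cong (zeroʳ _) (zeroˡ _)) (+-identityˡ _))
    ; -‿homo = λ a → ≈-refl , ≈-sym -0#≈0#
    ; 0-homo = ≈-refl , ≈-refl
    ; 1-homo = ≈-refl , ≈-refl }

  jet : Poly R → D.Carrier
  jet p = coeff R 0 p , coeff R 1 p

  jet-+ : ∀ p q → jet (_+P_ R p q) D.≈ (jet p D.+ jet q)
  jet-+ []          q           = ≈-sym (+-identityˡ _) , ≈-sym (+-identityˡ _)
  jet-+ (a ∷ p)     []          = ≈-sym (+-identityʳ _) , ≈-sym (+-identityʳ _)
  jet-+ (a ∷ p)     (b ∷ q)     = ≈-refl , head p q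
    where
    head : ∀ p q → coeff R 0 (_+P_ R p q) ≈ coeff R 0 p + coeff R 0 q
    head []      q       = ≈-sym (+-identityˡ _)
    head (a ∷ p) []      = ≈-sym (+-identityʳ _)
    head (a ∷ p) (b ∷ q) = ≈-refl

  jet-scale : ∀ a q → jet (List.map (a *_) q) D.≈ (a * coeff R 0 q , a * coeff R 1 q)
  jet-scale a []          = ≈-sym (zeroʳ _) , ≈-sym (zeroʳ _)
  jet-scale a (b ∷ [])    = ≈-refl , ≈-sym (zeroʳ _)
  jet-scale a (b ∷ c ∷ q) = ≈-refl , ≈-refl

  jet-* : ∀ p q → jet (_*P_ R p q) D.≈ (jet p D.* jet q)
  jet-* []      q = ≈-sym (zeroˡ _) , ≈-sym (≈-trans (+-cong (zeroˡ _) (zeroˡ _)) (+-identityˡ _))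
  jet-* (a ∷ p) q with jet-+ (List.map (a *_) q) (0# ∷ _*P_ R p q) | jet-scale a q | jet-* p q
  ... | h , k | h′ , k′ | h″ , _ =
    ≈-trans h (≈-trans (+-identityʳ _) h′) , ≈-trans k (+-cong k′ h″)

module _ {A : Set} {n : ℕ} (v : Fin n → A) (d : A) where
  atℕ-toℕ : ∀ i → atℕ v d (toℕ i) ≡ v i
  atℕ-toℕ i with toℕ i ℕ.<? n
  ... | yes p = ≡.cong v (FinP.fromℕ<-toℕ i p)
  ... | no ¬p = ⊥-elim (¬p (FinP.toℕ<n i))

  atℕ-default : atℕ v d n ≡ d
  atℕ-default with n ℕ.<? n
  ... | yes p = ⊥-elim (ℕP.<-irrefl refl p)
  ... | no _  = refl

span-++ : ∀ a j k → span a (j ℕ.+ k) ≡ span a j ++ span (a ℕ.+ j) k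
span-++ a zero    k = ≡.cong (λ b → span b k) (≡.sym (ℕP.+-identityʳ a))
span-++ a (suc j) k = ≡.cong (a ∷_) (≡.trans (span-++ (suc a) j k) (≡.cong (λ b → span (suc a) j ++ span b k) (≡.sym (ℕP.+-suc a j))))

span-tabulate : ∀ {A B : Set} {_~_ : A → B → Set} n (f : ℕ → A) (g : Fin n → B) a → (∀ i → f (a ℕ.+ toℕ i) ~ g i) →
  ListPointwise _~_ (List.map f (span a n)) (List.tabulate g)
span-tabulate zero    f g a h = []
span-tabulate {_~_ = _~_} (suc n) f g a h = ≡.subst (λ b → f b ~ g zero) (ℕP.+-identityʳ a) (h zero) ∷
  span-tabulate n f (g ∘ suc) (suc a) λ i → ≡.subst (λ b → f b ~ g (suc i)) (ℕP.+-suc a (toℕ i)) (h (suc i))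

-- The given partition function to first order in s

module Link (R : CommutativeRing 0ℓ 0ℓ) (q q̄ sq sq4 : CommutativeRing.Carrier R)
  (qq̄ : CommutativeRing._≈_ R (CommutativeRing._*_ R q q̄) (CommutativeRing.1# R))
  (unitsR : ℕ → Invertible R) (m : ℕ) where
  open DualNumbers R
  private module RR = CommutativeRing R
  open Ring dual
  open Naturality embed
  open Hom embed using (⟦_⟧; mapUnit)

  PR : Parameters R
  PR = record { q = unit q q̄ qq̄ ; s = RR.0# ; sq = sq ; sq4 = sq4 }

  -- With (0, 1) for `s`, the coefficient of s¹ is the second component.
  PD : Parameters dual
  PD = record { q = mapUnit (unit q q̄ qq̄) ; s = RR.0# , RR.1# ; sq = ⟦ sq ⟧ ; sq4 = ⟦ sq4 ⟧ }

  unitsD : ℕ → Invertible dual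
  unitsD k = mapUnit (unitsR k)

  open SixVertex R q q̄ sq sq4 (λ k → val (unitsR k)) (λ k → inv (unitsR k)) using (topW; rightW; leftW; bulkP; bulkW; weight; Ztilde)
  open Configurations dual PD m unitsD
  open Sums dual

  private
    maps-unit : ∀ u → MapsUnit u (mapUnit u)
    maps-unit u = mapsUnit (maps ≈-refl) (maps ≈-refl)
    -- The image of `PR` differs from `PD` in `s` alone, and `wA`, `wB`, `κ` do not contain `s`;
    -- their naturality for `PR` therefore gives the weights of `PD`.
    PQ = maps-mapParameters embed PR

  top-jet : ∀ f j → jet (topW f j) ≈ topWeight f j
  top-jet f j with f (ver 0 j)
  ... | true  = ≈-refl
  ... | false = ≈-refl

  right-jet : ∀ f i → jet (rightW m f i) ≈ rightWeight f i
  right-jet f i with f (hor i m)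
  ... | true  = ≈-refl
  ... | false = ≈-refl

  left-jet : ∀ f i → jet (leftW f i) ≈ leftWeight f i
  left-jet f i with f (ver (i ∸ 1) i) xor not (f (hor i i))
  ... | true  = ≈-refl
  ... | false = image (maps-κ PQ (maps-unit (unitsR i)))

  bulk-jet : ∀ f i j → jet (bulkP f i j) ≈ bulkWeight f i j
  bulk-jet f i j with f (hor i (j ∸ 1)) | f (hor i j) | f (ver (i ∸ 1) j) | f (ver i j)
  ... | true  | false | false | true  = ≈-refl
  ... | false | true  | true  | false = ≈-refl
  ... | false | false | false | false = image (maps-wA PQ (maps-unit (unitsR i)) (maps-unit (unitsR j)))
  ... | true  | true  | true  | true  = image (maps-wA PQ (maps-unit (unitsR i)) (maps-unit (unitsR j)))
  ... | false | false | true  | true  = image (maps-wB PQ (maps-unit (unitsR i)) (maps-unit (unitsR j)))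
  ... | true  | true  | false | false = image (maps-wB PQ (maps-unit (unitsR i)) (maps-unit (unitsR j)))
  ... | false | false | false | true  = ≈-refl
  ... | false | false | true  | false = ≈-refl
  ... | false | true  | false | false = ≈-refl
  ... | false | true  | false | true  = ≈-refl
  ... | false | true  | true  | true  = ≈-refl
  ... | true  | false | false | false = ≈-refl
  ... | true  | false | true  | false = ≈-refl
  ... | true  | false | true  | true  = ≈-refl
  ... | true  | true  | false | true  = ≈-refl
  ... | true  | true  | true  | false = ≈-refl

  Π : List (Poly R) → Carrier
  Π []       = 1#
  Π (p ∷ ps) = jet p * Π ps

  jet-prod : ∀ ps → jet (prodP R ps) ≈ Π ps
  jet-prod []       = ≈-refl
  jet-prod (p ∷ ps) = ≈-trans (jet-* p (prodP R ps)) (*-congˡ (jet-prod ps))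

  Π-++ : ∀ ps qs → Π (ps ++ qs) ≈ Π ps * Π qs
  Π-++ []       qs = ≈-sym (*-identityˡ _)
  Π-++ (p ∷ ps) qs = ≈-trans (*-congˡ (Π-++ ps qs)) (≈-sym (*-assoc _ _ _))

  Π-top : ∀ f j n → Π (List.map (topW f) (span j n)) ≈ topWeights j n f
  Π-top f j zero    = ≈-refl
  Π-top f j (suc n) = *-cong (top-jet f j) (Π-top f (suc j) n)

  Π-tail : ∀ f i j n → jet (rightW m f i) * Π (List.map (bulkP f i) (span j n)) ≈ tailWeight i j n f
  Π-tail f i j zero    = ≈-trans (*-identityʳ _) (right-jet f i)
  Π-tail f i j (suc n) = ≈-trans (*-swap _ _ _) (*-cong (bulk-jet f i j) (Π-tail f i (suc j) n))

  -- The given weight groups the vertices by kind, whereas the transfer sums take them row by row.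
  Π-rows : ∀ f i k → i ℕ.+ k ≡ suc m →
    Π (List.map (rightW m f) (span i k)) * (Π (List.map (leftW f) (span i k))
      * Π (List.concatMap (λ i → List.map (bulkP f i) (range (suc i) m)) (span i k))) ≈ rowWeights i k f
  Π-rows f i zero    l = ≈-trans (*-identityˡ _) (*-identityˡ _)
  Π-rows f i (suc k) l = begin
    (r * rs) * ((x * xs) * Π (List.map (bulkP f i) (range (suc i) m) ++ B))
      ≈⟨ *-congˡ (*-congˡ (≈-trans (Π-++ (List.map (bulkP f i) (range (suc i) m)) B)
           (*-congʳ (reflexive (≡.cong (λ l → Π (List.map (bulkP f i) l)) (≡.trans (range≡span (suc i) m) (≡.cong (span (suc i)) l′))))))) ⟩
    (r * rs) * ((x * xs) * (b * Π B))            ≈⟨ lemma r rs x xs b (Π B) ⟩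
    (x * (r * b)) * (rs * (xs * Π B))            ≈⟨ *-cong (*-cong (left-jet f i) (Π-tail f i (suc i) k)) (Π-rows f (suc i) k (≡.trans (≡.sym (ℕP.+-suc i k)) l)) ⟩
    rowWeights i (suc k) f                       ∎
    where
    r = jet (rightW m f i)
    rs = Π (List.map (rightW m f) (span (suc i) k))
    x = jet (leftW f i)
    xs = Π (List.map (leftW f) (span (suc i) k))
    B = List.concatMap (λ i → List.map (bulkP f i) (range (suc i) m)) (span (suc i) k)
    b = Π (List.map (bulkP f i) (span (suc i) k))
    l′ : m ∸ i ≡ k
    l′ = ≡.trans (≡.cong (_∸ i) (≡.sym (ℕP.suc-injective (≡.trans (≡.sym (ℕP.+-suc i k)) l)))) (ℕP.m+n∸m≡n i k)
    lemma : ∀ r rs x xs b bs → (r * rs) * ((x * xs) * (b * bs)) ≈ (x * (r * b)) * (rs * (xs * bs))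
    lemma = solve 6 0 (λ r rs x xs b bs →
        r :* rs :* (x :* xs :* (b :* bs)) := x :* (r :* b) :* (rs :* (xs :* bs))) refl

  weight-jet : ∀ f → jet (weight m f) ≈ topWeights 1 m f * rowWeights 1 m f
  weight-jet f = ≈-trans (jet-prod (T′ ++ R′ ++ L′ ++ B′)) (≈-trans (Π-++ T′ (R′ ++ L′ ++ B′))
    (*-cong (≈-trans (reflexive (≡.cong (Π ∘ List.map (topW f)) r)) (Π-top f 1 m))
      (≈-trans (Π-++ R′ (L′ ++ B′)) (≈-trans (*-congˡ (Π-++ L′ B′))
        (≈-trans (reflexive (≡.cong (λ r → Π (List.map (rightW m f) r) * (Π (List.map (leftW f) r) * Π (List.concatMap (λ i → List.map (bulkP f i) (range (suc i) m)) r))) r))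
          (Π-rows f 1 m refl))))))
    where
    T′ = List.map (topW f) (range 1 m)
    R′ = List.map (rightW m f) (range 1 m)
    L′ = List.map (leftW f) (range 1 m)
    B′ = List.concatMap (λ i → List.map (bulkP f i) (range (suc i) m)) (range 1 m)
    r = range≡span 1 m

  sum-jet : ∀ fs → jet (sumP R (List.map (weight m) fs)) ≈ sumList (List.map (λ f → topWeights 1 m f * rowWeights 1 m f) fs)
  sum-jet []       = ≈-refl
  sum-jet (f ∷ fs) = ≈-trans (jet-+ (weight m f) _) (+-cong (weight-jet f) (sum-jet fs))

  top-extensional : ∀ j n → Extensional (topWeights j n)
  top-extensional j zero    h = ≈-refl
  top-extensional j (suc n) h = *-cong (reflexive (≡.cong (ind ∘ not) (h (ver 0 j)))) (top-extensional (suc j) n h)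

  tail-extensional : ∀ i j n → Extensional (tailWeight i j n)
  tail-extensional i j zero    h = reflexive (≡.cong (ind ∘ not) (h (hor i m)))
  tail-extensional i j (suc n) {f} {g} h = *-cong (reflexive same) (tail-extensional i (suc j) n h)
    where
    same : bulkWeight f i j ≡ bulkWeight g i j
    same rewrite h (hor i (j ∸ 1)) | h (hor i j) | h (ver (i ∸ 1) j) | h (ver i j) = refl

  rows-extensional : ∀ i k → Extensional (rowWeights i k)
  rows-extensional i zero    h = ≈-refl
  rows-extensional i (suc k) {f} {g} h = *-cong (*-cong (reflexive same) (tail-extensional i (suc i) k h)) (rows-extensional (suc i) k h)
    where
    same : leftWeight f i ≡ leftWeight g i
    same rewrite h (ver (i ∸ 1) i) | h (hor i i) = refl

  Ztilde-jet : Vertex.wC dual PD ≈ 1# → jet (Ztilde m) ≈ Vertex.Z dual PD (unitsFrom 1 m)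
  Ztilde-jet wC≈1 = begin
    jet (Ztilde m)                                     ≈⟨ sum-jet (allOrients (edges m)) ⟩
    sumList (List.map W (allOrients (edges m)))        ≈⟨ sumList-orientations (edges m) W ⟩
    sumOver (edges m) W (λ _ → false)
      ≈⟨ sumOver-↭ (EdgePermutation.edges↭ m) (λ h → *-cong (top-extensional 1 m h) (rows-extensional 1 m h)) _ ⟩
    sumOver (lowerEdges 1 m ++ topEdges 1 m) W (λ _ → false) ≈⟨ total wC≈1 _ ⟩
    Vertex.Z dual PD (unitsFrom 1 m)                   ∎
    where
    W : Orientation → Carrier
    W f = topWeights 1 m f * rowWeights 1 m f

-- The character as a Laurent polynomial expression

exprOperations : ∀ k → Operations (Expr k)
exprOperations k = record
  { add = _⊕_ ; mul = _⊗_ ; neg = λ e → con -[1+ 0 ] ⊗ e ; nil = con (+ 0) ; one = con (+ 1) }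

columns : ℕ → (k : ℕ) → Vec ℕ k
columns n k = tabulate {n = k} λ j → (n ∸ toℕ j ℕ./ 2) ℕ.+ (k ∸ toℕ j)

-- Being free of division, the determinant of divided differences can be written as an expression in
-- the variables and their inverses, which a quotient of alternants cannot.
spExpr : (n : ℕ) → Expr (suc (suc (n ℕ.+ n)))
spExpr n = DividedDifferences.character (exprOperations _) (columns n (suc (suc (n ℕ.+ n)))) (List.tabulate λ i → var i ⊕ ivar i)

module _ (S : CommutativeRing 0ℓ 0ℓ) where
  open Ring S
  open Alternants S
  open Exterior S

  module _ {k} (x x̄ : Fin k → Carrier) where
    EvaluatesTo : Expr k → Carrier → Set
    EvaluatesTo e y = evalE S x x̄ e ≈ y

    evaluates : Parametricity.Respects (exprOperations k) (operations S) EvaluatesTo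
    evaluates = record
      { add = +-cong ; mul = *-cong ; nil = ≈-refl ; one = +-identityʳ _
      ; neg = λ {a} {b} h → ≈-trans (*-congˡ h) (minus b) }
      where
      minus : ∀ b → - (1# + 0#) * b ≈ - b
      minus = solve 1 0 (λ b → :- (:1 :+ :0) :* b := :- b) refl

    evaluate-character : ∀ {n} (es : Vec ℕ n) → evalE S x x̄ (DividedDifferences.character (exprOperations k) es (List.tabulate λ i → var i ⊕ ivar i))
      ≈ character es (List.tabulate λ i → x i + x̄ i)
    evaluate-character es = Parametricity.R-character (exprOperations k) (operations S) EvaluatesTo evaluates es
      {List.tabulate λ i → var i ⊕ ivar i} {List.tabulate λ i → x i + x̄ i} (LPW.tabulate⁺ λ i → ≈-refl)

  rowsOf-φ : ∀ {m n} (e : Fin n → ℕ) (x : Fin m → Invertible S) →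
    rowsOf (λ i j → φ (e j) (x i)) ≡ List.map (rowφ (tabulate e)) (List.tabulate x)
  rowsOf-φ {zero}  e x = refl
  rowsOf-φ {suc m} e x = ≡.cong₂ _∷_ (VecP.tabulate-∘ (λ e → φ e (x zero)) e) (rowsOf-φ e (x ∘ suc))

  tabulate-descending : ∀ n → tabulate {n = n} (λ j → n ∸ toℕ j) ≡ descending n
  tabulate-descending zero    = refl
  tabulate-descending (suc n) = ≡.cong (suc n ∷_) (tabulate-descending n)

isSp : ∀ n → IsSp (suc (suc (n ℕ.+ n))) (spLam n) (spExpr n)
isSp n S x x̄ h = begin
  evalE S x x̄ (spExpr n) * det S N (denMat S N x x̄)
    ≈⟨ *-cong (evaluate-character S x x̄ es) (≈-trans (det-volume N (denMat S N x x̄))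
         (reflexive (≡.cong volume (≡.trans (rowsOf-φ S (λ j → N ∸ toℕ j) u) (≡.cong (λ d → List.map (rowφ d) us) (tabulate-descending S N)))))) ⟩
  character es (List.tabulate λ i → x i + x̄ i) * alternant (descending N) us
    ≈⟨ *-congʳ (reflexive (≡.cong (character es) (≡.sym (map-tabulate u Y)))) ⟩
  character es (List.map Y us) * alternant (descending N) us
    ≈⟨ character-quotient es us (length-tabulate u) ⟩
  alternant es us
    ≈⟨ ≈-trans (det-volume N (numMat S N (spLam n) x x̄)) (reflexive (≡.cong volume (rowsOf-φ S (λ j → spLam n j ℕ.+ (N ∸ toℕ j)) u))) ⟨
  det S N (numMat S N (spLam n) x x̄) ∎
  where
  open Ring S
  open Alternants S
  open Exterior S
  N = suc (suc (n ℕ.+ n))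
  es = columns n N
  u : Fin N → Invertible S
  u i = unit (x i) (x̄ i) (h i)
  us = List.tabulate u

hi≡n+size : ∀ n → hi n ≡ n ℕ.+ size n
hi≡n+size zero    = refl
hi≡n+size (suc n) = ≡.trans (≡.cong (3 ℕ.+_) (hi≡n+size n)) (lemma n (size n))
  where
  lemma : ∀ n k → 3 ℕ.+ (n ℕ.+ k) ≡ suc n ℕ.+ (2 ℕ.+ k)
  lemma = solve-∀

hi≡1+lo : ∀ n → hi n ≡ suc (lo n)
hi≡1+lo zero    = refl
hi≡1+lo (suc n) = ≡.cong (3 ℕ.+_) (hi≡1+lo n)

-- λ_j = n - ⌊j/2⌋ in 0-indexed columns: dropping the first two columns lowers both n and ⌊j/2⌋ by
-- one and the number of variables by two.
columns≡exponents : ∀ n → columns n (size n) ≡ exponents n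
columns≡exponents zero    = refl
columns≡exponents (suc n) = ≡.cong₂ _∷_ (≡.sym (hi≡n+size (suc n))) (≡.cong₂ _∷_
  (ℕP.suc-injective (≡.trans (lemma n (size n)) (≡.trans (≡.sym (hi≡n+size (suc n))) (hi≡1+lo (suc n)))))
  (≡.trans (VecP.tabulate-cong λ j → ≡.cong (λ i → (suc n ∸ i) ℕ.+ (size n ∸ toℕ j)) (m/n≡1+[m∸n]/n {suc (suc (toℕ j))} {2} (s≤s (s≤s z≤n)))) (columns≡exponents n)))
  where
  lemma : ∀ n k → suc (suc n ℕ.+ suc k) ≡ suc n ℕ.+ suc (suc k)
  lemma = solve-∀

-- The point (u, u⁻¹, 1)

module SymmetricPoint (K : CommutativeRing 0ℓ 0ℓ) (P : Parameters K) (cubic : Cubic P) where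
  open Ring K
  open Parameters P
  open Vertex K P
  open Permuting K P
  open Inv K
  open Recursions K P
  open Symmetrisation K P
  open Cubic cubic
  open CharacterProperties K using (Y²)

  symmetric : List U → List U
  symmetric us = us ++ inverses us ++ 1ᵤ ∷ []

  ∏-++ : ∀ (f : U → Carrier) us vs → ∏ f (us ++ vs) ≈ ∏ f us * ∏ f vs
  ∏-++ f []       vs = ≈-sym (*-identityˡ _)
  ∏-++ f (u ∷ us) vs = ≈-trans (*-congˡ (∏-++ f us vs)) (≈-sym (*-assoc _ _ _))

  ∏-symmetric : ∀ f us → ∏ f (symmetric us) ≈ ∏ (λ u → f u * f (u ⁻¹)) us * f 1ᵤ
  ∏-symmetric f us = begin
    ∏ f (symmetric us)                                    ≈⟨ ≈-trans (∏-++ f us _) (*-congˡ (∏-++ f (inverses us) _)) ⟩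
    ∏ f us * (∏ f (inverses us) * (f 1ᵤ * 1#))            ≈⟨ *-congˡ (*-cong (∏-map f _⁻¹ us) (*-identityʳ _)) ⟩
    ∏ f us * (∏ (λ u → f (u ⁻¹)) us * f 1ᵤ)               ≈⟨ *-assoc _ _ _ ⟨
    ∏ f us * ∏ (λ u → f (u ⁻¹)) us * f 1ᵤ                 ≈⟨ *-congʳ (∏-* f (λ u → f (u ⁻¹)) us) ⟨
    ∏ (λ u → f u * f (u ⁻¹)) us * f 1ᵤ                    ∎

  -- Inversion exchanges the two blocks and fixes 1, so it permutes the list.
  inverses-symmetric : ∀ us → Σ[ vs ∈ List U ] (ListPointwise _≈ᵤ_ (inverses (symmetric us)) vs × vs ↭ symmetric us)
  inverses-symmetric us = inverses us ++ us ++ 1ᵤ ∷ [] ,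
    ≡.subst (λ l → ListPointwise _≈ᵤ_ l (inverses us ++ us ++ 1ᵤ ∷ [])) (≡.sym e)
      (LPW.++⁺ (≈ᵤ*-refl {inverses us}) (LPW.++⁺ (inverses² us) (≈ᵤ-intro ≈-refl ≈-refl ∷ []))) ,
    ↭-trans (Perm.↭-reflexive (≡.sym (++-assoc (inverses us) us _)))
      (↭-trans (PermP.++⁺ʳ _ (++-comm (inverses us) us)) (Perm.↭-reflexive (++-assoc us (inverses us) _)))
    where
    e : inverses (symmetric us) ≡ inverses us ++ inverses (inverses us) ++ 1ᵤ ⁻¹ ∷ []
    e = ≡.trans (map-++ _⁻¹ us _) (≡.cong (inverses us ++_) (map-++ _⁻¹ (inverses us) _))

  -- Each summand of `E` becomes ∏ (u² + u⁻² - 1) Z, because κ(u) κ(u⁻¹) = u² + u⁻² - 1 and κ(1) =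
  -- 1. The resulting factor 2 is matched by γ(1) = 2 on the other side.
  Z-symmetric : ∀ n us → length us ≡ n → ∀ ½ → (1# + 1#) * ½ ≈ 1# → ∀ d → ∏ (λ u → Y² u + - 1#) us * d ≈ 1# →
    Zₗ (symmetric us) ≈ s * (normalisation cubic n * (∏ (λ u → γ u * γ u) us * d * spAt n (symmetric us)))
  Z-symmetric n us l ½ h½ d hd with inverses-symmetric us
  ... | vs , inverted , perm = lemma _ _ _ _ _ _ _ (begin
    k * z + k * z                                               ≈⟨ +-cong (*-congʳ κ̄s) (*-cong κs Z-inverse) ⟨
    E (symmetric us)                                            ≈⟨ identity n K P cubic (symmetric us) length≡ ⟩
    s * (normalisation cubic n * (∏ γ (symmetric us) * p))      ≈⟨ *-congˡ (*-congˡ (*-congʳ γs)) ⟩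
    s * (normalisation cubic n * (g * (1# + 1#) * p))           ∎) h½ hd
    where
    z = Zₗ (symmetric us)
    p = spAt n (symmetric us)
    k = ∏ (λ u → Y² u + - 1#) us
    g = ∏ (λ u → γ u * γ u) us
    κ1 : κ 1ᵤ ≈ 1#
    κ1 = solve-by 1 1 (λ sq q q̄ →
        (q :* :1 :+ :- (q̄ :* :1)) :* sq := :1 ,
        (:1 , (q :+ :- q̄) :* sq := :1) ∷ []) refl sq q σq*sq
    κs : ∏ κ (symmetric us) ≈ k
    κs = ≈-trans (∏-symmetric κ us) (≈-trans (*-cong (∏-cong (κ*κ̄ cubic) us) κ1) (*-identityʳ _))
    κ̄s : ∏ κ̄ (symmetric us) ≈ k
    κ̄s = ≈-trans (≈-sym (∏-map κ _⁻¹ (symmetric us))) (≈-trans (∏-κ-cong inverted) (≈-trans (∏-↭ κ perm) κs))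
    γs : ∏ γ (symmetric us) ≈ g * (1# + 1#)
    γs = ≈-trans (∏-symmetric γ us) (*-congʳ (∏-cong (λ u → *-congˡ (+-comm _ _)) us))
    Z-inverse : Zₗ (inverses (symmetric us)) ≈ z
    Z-inverse = ≈-trans (Zₗ-cong inverted) (Zₗ-↭ perm)
    length≡ : length (symmetric us) ≡ suc (n ℕ.+ n)
    length≡ = ≡.trans (length-++ us) (≡.trans (≡.cong₂ ℕ._+_ l (≡.trans (length-++ (inverses us)) (≡.cong (ℕ._+ 1) (≡.trans (length-map _⁻¹ us) l)))) (lemma′ n))
      where
      lemma′ : ∀ n → n ℕ.+ (n ℕ.+ 1) ≡ suc (n ℕ.+ n)
      lemma′ = solve-∀
    lemma : ∀ k z s c g p d → k * z + k * z ≈ s * (c * (g * (1# + 1#) * p)) → (1# + 1#) * ½ ≈ 1# → k * d ≈ 1# →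
      z ≈ s * (c * (g * d * p))
    lemma k z s c g p d h h½ hd = solve-by 8 0 (λ z s c g d p ½ k →
        z := s :* (c :* (g :* d :* p)) ,
        (½ :* d , k :* z :+ k :* z := s :* (c :* (g :* (:1 :+ :1) :* p))) ∷
        (:- z :+ s :* c :* g :* d :* p , (:1 :+ :1) :* ½ := :1) ∷
        (:- ((:1 :+ :1) :* ½ :* z) , k :* d := :1) ∷ []) refl z s c g d p ½ k h h½ hd

-- Spectral parameters and arguments of the character by index

module Specialised (R : CommutativeRing 0ℓ 0ℓ) {n : ℕ} (u ū : Fin n → CommutativeRing.Carrier R) where
  open Ring R

  if-true : ∀ {b} {x y : Carrier} → b ≡ true → (if b then x else y) ≡ x
  if-true refl = refl

  if-false : ∀ {b} {x y : Carrier} → b ≡ false → (if b then x else y) ≡ y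
  if-false refl = refl

  <ᵇ-true : ∀ {a b} → a ℕ.< b → (a ℕ.<ᵇ b) ≡ true
  <ᵇ-true {a} {b} h with a ℕ.<ᵇ b | ℕP.<⇒<ᵇ h
  ... | true | _ = refl

  <ᵇ-false : ∀ {a b} → b ℕ.≤ a → (a ℕ.<ᵇ b) ≡ false
  <ᵇ-false {a} {b} h with a ℕ.<ᵇ b | ℕP.<ᵇ⇒< a b
  ... | true  | f = ⊥-elim (ℕP.<⇒≱ (f tt) h)
  ... | false | _ = refl

  ≡ᵇ-true : ∀ a → (a ℕ.≡ᵇ a) ≡ true
  ≡ᵇ-true zero    = refl
  ≡ᵇ-true (suc a) = ≡ᵇ-true a

  ≡ᵇ-suc : ∀ a → (suc a ℕ.≡ᵇ a) ≡ false
  ≡ᵇ-suc zero    = refl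
  ≡ᵇ-suc (suc a) = ≡ᵇ-suc a

  spec-first : ∀ i → specU R n u ū (suc (toℕ i)) ≡ u i
  spec-first i = ≡.trans (if-true (<ᵇ-true (FinP.toℕ<n i))) (atℕ-toℕ u 1# i)

  spec-second : ∀ i → specU R n u ū (suc n ℕ.+ toℕ i) ≡ ū i
  spec-second i = ≡.trans (if-false (<ᵇ-false (ℕP.m≤m+n n (toℕ i))))
    (≡.trans (≡.cong (atℕ ū 1#) (ℕP.m+n∸m≡n n (toℕ i))) (atℕ-toℕ ū 1# i))

  spec-last : specU R n u ū (suc n ℕ.+ n) ≡ 1#
  spec-last = ≡.trans (if-false (<ᵇ-false (ℕP.m≤m+n n n)))
    (≡.trans (≡.cong (atℕ ū 1#) (ℕP.m+n∸m≡n n n)) (atℕ-default ū 1#))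

  pointAt : ℕ → Carrier
  pointAt k =
    if k ℕ.<ᵇ n then atℕ (λ i → u i * u i) 1# k
    else if k ℕ.<ᵇ (n ℕ.+ n) then atℕ (λ i → ū i * ū i) 1# (k ∸ n)
    else if k ℕ.≡ᵇ (n ℕ.+ n) then 1#
    else - 1#

  point-first : ∀ i → pointAt (toℕ i) ≡ u i * u i
  point-first i = ≡.trans (if-true (<ᵇ-true (FinP.toℕ<n i))) (atℕ-toℕ _ 1# i)

  point-second : ∀ i → pointAt (n ℕ.+ toℕ i) ≡ ū i * ū i
  point-second i = ≡.trans (if-false (<ᵇ-false (ℕP.m≤m+n n (toℕ i))))
    (≡.trans (if-true (<ᵇ-true (ℕP.+-monoʳ-< n (FinP.toℕ<n i))))
      (≡.trans (≡.cong (atℕ (λ i → ū i * ū i) 1#) (ℕP.m+n∸m≡n n (toℕ i))) (atℕ-toℕ (λ i → ū i * ū i) 1# i)))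

  point-third : pointAt (n ℕ.+ n) ≡ 1#
  point-third = ≡.trans (if-false (<ᵇ-false (ℕP.m≤m+n n n)))
    (≡.trans (if-false (<ᵇ-false (ℕP.≤-refl {n ℕ.+ n}))) (if-true (≡ᵇ-true (n ℕ.+ n))))

  point-fourth : pointAt (suc (n ℕ.+ n)) ≡ - 1#
  point-fourth = ≡.trans (if-false (<ᵇ-false (ℕP.m≤n⇒m≤1+n (ℕP.m≤m+n n n))))
    (≡.trans (if-false (<ᵇ-false (ℕP.n≤1+n (n ℕ.+ n)))) (if-false (≡ᵇ-suc (n ℕ.+ n))))

blocks : ∀ {A B : Set} {_~_ : A → B → Set} n (f : ℕ → A) (v w : Fin n → B) (x : B) a →
  (∀ i → f (a ℕ.+ toℕ i) ~ v i) → (∀ i → f (a ℕ.+ n ℕ.+ toℕ i) ~ w i) → f (a ℕ.+ n ℕ.+ n) ~ x →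
  ListPointwise _~_ (List.map f (span a (suc (n ℕ.+ n)))) (List.tabulate v ++ List.tabulate w ++ x ∷ [])
blocks {_~_ = _~_} n f v w x a h k l = ≡.subst (λ xs → ListPointwise _~_ (List.map f xs) (List.tabulate v ++ List.tabulate w ++ x ∷ [])) (≡.sym e)
  (≡.subst (λ ys → ListPointwise _~_ ys (List.tabulate v ++ List.tabulate w ++ x ∷ [])) (≡.sym e′)
    (LPW.++⁺ (span-tabulate n f v a h) (LPW.++⁺ (span-tabulate n f w (a ℕ.+ n) k) (l ∷ []))))
  where
  e : span a (suc (n ℕ.+ n)) ≡ span a n ++ span (a ℕ.+ n) n ++ (a ℕ.+ n ℕ.+ n) ∷ []
  e = ≡.trans (≡.cong (span a) (lemma n)) (≡.trans (span-++ a n (n ℕ.+ 1)) (≡.cong (span a n ++_) (span-++ (a ℕ.+ n) n 1)))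
    where
    lemma : ∀ n → suc (n ℕ.+ n) ≡ n ℕ.+ (n ℕ.+ 1)
    lemma = solve-∀
  e′ : List.map f (span a n ++ span (a ℕ.+ n) n ++ (a ℕ.+ n ℕ.+ n) ∷ []) ≡ List.map f (span a n) ++ List.map f (span (a ℕ.+ n) n) ++ f (a ℕ.+ n ℕ.+ n) ∷ []
  e′ = ≡.trans (map-++ f (span a n) _) (≡.cong (List.map f (span a n) ++_) (map-++ f (span (a ℕ.+ n) n) _))

span-∷ʳ : ∀ a k → span a (suc k) ≡ span a k ++ (a ℕ.+ k) ∷ []
span-∷ʳ a k = ≡.trans (≡.cong (span a) (ℕP.+-comm 1 k)) (span-++ a k 1)

-- Extraction of the coefficient of s

module Assembly (R : CommutativeRing 0ℓ 0ℓ) where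
  open Ring R
  open DualNumbers R
  open Alternants R using (Y; character)
  open CharacterOf R using (spOf)
  open CharacterProperties R using (Y²)
  open Products R
  open Hom embed using (⟦_⟧; mapUnit)
  open Naturality embed
  open NaturalityOfProducts embed
  private module D = Ring dual

  ∏-tabulate-inverse : ∀ n (f : Invertible R → Carrier) (v : Fin n → Invertible R) d →
    (∀ i → f (v i) * d i ≈ 1#) → ∏ f (List.tabulate v) * prodFin R n d ≈ 1#
  ∏-tabulate-inverse zero    f v d h = *-identityˡ _
  ∏-tabulate-inverse (suc n) f v d h = ≈-trans (*-interchange _ _ _ _)
    (≈-trans (*-cong (h zero) (∏-tabulate-inverse n f (v ∘ suc) (d ∘ suc) (h ∘ suc))) (*-identityˡ _))

  ∏-tabulate-product : ∀ n (f : Invertible R → Carrier) (v : Fin n → Invertible R) d (g : Fin n → Carrier) →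
    (∀ i → f (v i) * d i ≈ g i) → ∏ f (List.tabulate v) * prodFin R n d ≈ prodFin R n g
  ∏-tabulate-product zero    f v d g h = *-identityˡ _
  ∏-tabulate-product (suc n) f v d g h = ≈-trans (*-interchange _ _ _ _)
    (*-cong (h zero) (∏-tabulate-product n f (v ∘ suc) (d ∘ suc) (g ∘ suc) (h ∘ suc)))

  module _ {n : ℕ} (u ū : Fin n → Carrier) (uū : ∀ i → u i * ū i ≈ 1#) where

    -- Beyond the range both functions default to 1, which is its own inverse; the last spectral
    -- parameter is such a default.
    atℕ-inverse : ∀ k → atℕ u 1# k * atℕ ū 1# k ≈ 1#
    atℕ-inverse k with k ℕ.<? n
    ... | yes p = uū _
    ... | no _  = *-identityˡ _

    specU-inverse : ∀ k → specU R n u ū k * specU R n ū u k ≈ 1#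
    specU-inverse k = choose (k ℕ.≤ᵇ n) (atℕ-inverse (k ∸ 1)) (second (k ∸ suc n))
      where
      choose : ∀ b {x y z w} → x * z ≈ 1# → y * w ≈ 1# → (if b then x else y) * (if b then z else w) ≈ 1#
      choose true  h k = h
      choose false h k = k
      second : ∀ k → atℕ ū 1# k * atℕ u 1# k ≈ 1#
      second k = ≈-trans (*-comm _ _) (atℕ-inverse k)

    v : Fin n → Invertible R
    v i = unit (u i) (ū i) (uū i)

    points : List (Invertible R)
    points = List.tabulate v ++ List.tabulate (λ i → Inv._⁻¹ R (v i)) ++ 1ᵤ ∷ []

    module S₁ = Specialised R u ū
    module S₂ = Specialised R ū u

    -- The character depends on its arguments only through x + x⁻¹, so the points are matched
    -- through these sums. The exponents are left general until `evaluation` identifies them.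
    evaluation-at : ∀ P {k} (es : Vec ℕ k) →
      evalE R (spPoint R n u ū) (spPoint R n ū u)
          (DividedDifferences.character (exprOperations (suc (suc (n ℕ.+ n)))) es (List.tabulate λ i → var i ⊕ ivar i))
        ≈ spOf es (List.map (λ x → Inv._·_ R x x) points ++ Symmetrisation.-1ᵤ R P ∷ [])
    evaluation-at P es = ≈-trans (evaluate-character R (spPoint R n u ū) (spPoint R n ū u) es)
      (Parametricity.R-character (operations R) (operations R) _≈_
        (record { add = +-cong ; mul = *-cong ; neg = -‿cong ; nil = ≈-refl ; one = ≈-refl }) es
        (≡.subst (λ ys → ListPointwise _≈_ ys (List.map Y (List.map (λ x → Inv._·_ R x x) points ++ -1ᵤ ∷ []))) as-list matches))
      where
      N = suc (suc (n ℕ.+ n))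
      -1ᵤ = Symmetrisation.-1ᵤ R P
      g : ℕ → Carrier
      g k = S₁.pointAt k + S₂.pointAt k
      as-span : List.map g (span 0 N) ≡ List.tabulate {n = N} (λ i → g (toℕ i))
      as-span = LPW.Pointwise-≡⇒≡ (span-tabulate N g (λ i → g (toℕ i)) 0 λ i → refl)
      as-list : List.map g (span 0 (suc (n ℕ.+ n))) ++ g (suc (n ℕ.+ n)) ∷ [] ≡ List.tabulate {n = N} (λ i → g (toℕ i))
      as-list = ≡.trans (≡.sym (≡.trans (≡.cong (List.map g) (span-∷ʳ 0 (suc (n ℕ.+ n)))) (map-++ g (span 0 (suc (n ℕ.+ n))) _))) as-span
      mapped : ∀ {xs us} → ListPointwise (λ x u → x ≈ Y² u) xs us → ListPointwise _≈_ xs (List.map Y (List.map (λ x → Inv._·_ R x x) us))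
      mapped []       = []
      mapped (h ∷ hs) = h ∷ mapped hs
      matches : ListPointwise _≈_ (List.map g (span 0 (suc (n ℕ.+ n))) ++ g (suc (n ℕ.+ n)) ∷ [])
        (List.map Y (List.map (λ x → Inv._·_ R x x) points ++ -1ᵤ ∷ []))
      matches = ≡.subst (ListPointwise _≈_ _) (≡.sym (map-++ Y (List.map (λ x → Inv._·_ R x x) points) _))
        (LPW.++⁺ (mapped (blocks n g v (λ i → Inv._⁻¹ R (v i)) 1ᵤ 0
            (λ i → reflexive (≡.cong₂ _+_ (S₁.point-first i) (S₂.point-first i)))
            (λ i → reflexive (≡.cong₂ _+_ (S₁.point-second i) (S₂.point-second i)))
            (≈-trans (reflexive (≡.cong₂ _+_ S₁.point-third S₂.point-third)) (+-cong (≈-sym (*-identityˡ _)) (≈-sym (*-identityˡ _))))))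
          (reflexive (≡.cong₂ _+_ S₁.point-fourth S₂.point-fourth) ∷ []))

    evaluation : ∀ P → evalE R (spPoint R n u ū) (spPoint R n ū u) (spExpr n)
      ≈ spOf (exponents n) (List.map (λ x → Inv._·_ R x x) points ++ Symmetrisation.-1ᵤ R P ∷ [])
    evaluation P = ≈-trans (evaluation-at P (columns n (suc (suc (n ℕ.+ n)))))
      (reflexive (≡.cong (λ (k , es) → spOf {k} es (List.map (λ x → Inv._·_ R x x) points ++ Symmetrisation.-1ᵤ R P ∷ [])) same-columns))
      where
      same-columns : _≡_ {A = Σ ℕ (Vec ℕ)} (suc (suc (n ℕ.+ n)) , columns n (suc (suc (n ℕ.+ n)))) (size n , exponents n)
      same-columns = ≡.trans (≡.cong (λ k → k , columns n k) (≡.sym (size≡ n))) (≡.cong (size n ,_) (columns≡exponents n))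

  module _ (n : ℕ) (inv′ : (k : ℕ) → Σ Carrier (λ y → natR R (suc k) * y ≈ 1#))
    (q q̄ : Carrier) (qq̄ : q * q̄ ≈ 1#) (q²+q̄² : (q * q) + (q̄ * q̄) ≈ 1#)
    (sq sq4 : Carrier) (σq : σ R q q̄ * sq ≈ 1#) (σq⁴ : σ R (pow R q 4) (pow R q̄ 4) * sq4 ≈ 1#)
    (u ū d : Fin n → Carrier) (uū : ∀ i → u i * ū i ≈ 1#)
    (hd : ∀ i → (((u i * u i) + (ū i * ū i)) + (- 1#)) * d i ≈ 1#) where

    unitsR : ℕ → Invertible R
    unitsR k = unit (specU R n u ū k) (specU R n ū u k) (specU-inverse u ū uū k)

    m : ℕ
    m = suc (n ℕ.+ n)

    open Link R q q̄ sq sq4 qq̄ unitsR m using (PR; PD; unitsD; Ztilde-jet)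
    open Configurations dual PD m unitsD using (unitsFrom)
    open Permuting dual PD using (Zₗ)

    private
      module SR = Symmetrisation R PR
      module SD = Symmetrisation dual PD
      w = v u ū uū
      ps = points u ū uū
      ⅓ = proj₁ (inv′ 2)
      ½ = proj₁ (inv′ 1)

    cubicR : Cubic PR
    cubicR = record
      { lawful = record
        { s*s≈0 = zeroˡ _
        ; wC≈1 = ≈-trans (solve 3 0 (λ q e₁ sq4 →
            (q :* q :* q :* q :+ :- (e₁ :* e₁ :* e₁ :* e₁)) :* sq4
              := (q :* (q :* (q :* (q :* :1))) :+ :- (e₁ :* (e₁ :* (e₁ :* (e₁ :* :1))))) :* sq4) refl q q̄ sq4) σq⁴ }
      ; q²+q̄² = q²+q̄² ; σq*sq = σq ; ⅓ = ⅓
      ; 3*⅓ = ≈-trans (solve 1 0 (λ ⅓ → (:1 :+ :1 :+ :1) :* ⅓ := (:1 :+ (:1 :+ (:1 :+ :0))) :* ⅓) refl ⅓) (proj₂ (inv′ 2)) }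

    cubicD : Cubic PD
    cubicD = record
      -- `s` = (0, 1) is not the image of the parameter in `PR`, so s² = 0 is computed directly; the
      -- other laws are images under `embed`.
      { lawful = record { s*s≈0 = zeroˡ _ , (solve 0 0 (:0 :* :1 :+ :1 :* :0 := :0) refl) ; wC≈1 = Lawful.wC≈1 (Cubic.lawful mapped) }
      ; q²+q̄² = Cubic.q²+q̄² mapped ; σq*sq = Cubic.σq*sq mapped ; ⅓ = ⟦ ⅓ ⟧ ; 3*⅓ = Cubic.3*⅓ mapped }
      where mapped = cubic-map embed PR cubicR

    open SymmetricPoint dual PD cubicD using (symmetric; Z-symmetric)

    us : List (Invertible dual)
    us = List.tabulate λ i → mapUnit (w i)

    Zcoeff-symmetric : jet (SixVertex.Ztilde R q q̄ sq sq4 (specU R n u ū) (specU R n ū u) m) D.≈ Zₗ (symmetric us)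
    Zcoeff-symmetric = D.≈-trans (Ztilde-jet (Lawful.wC≈1 (Cubic.lawful cubicD)))
      (D.≈-trans (D.reflexive (as-list 1 m)) (SD.Zₗ-cong same))
      where
      as-list : ∀ j k → Vertex.Z dual PD (unitsFrom j k) ≡ Zₗ (List.map unitsD (span j k))
      as-list j k = ≡.cong (λ (k , us) → Vertex.Z dual PD {k} us) (vectors j k)
        where
        vectors : ∀ j k → _≡_ {A = Σ ℕ (Vec (Invertible dual))} (k , unitsFrom j k) (_ , Vec.fromList (List.map unitsD (span j k)))
        vectors j zero    = refl
        vectors j (suc k) = ≡.cong (λ (k , us) → suc k , unitsD j ∷ us) (vectors (suc j) k)
      at : ∀ k (x : Invertible R) → specU R n u ū k ≡ val x → specU R n ū u k ≡ inv x → unitsD k SD.≈ᵤ mapUnit x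
      at k x h h′ = SD.≈ᵤ-intro (reflexive h , ≈-refl) (reflexive h′ , ≈-refl)
      module T₁ = Specialised R u ū
      module T₂ = Specialised R ū u
      same : ListPointwise SD._≈ᵤ_ (List.map unitsD (span 1 m)) (symmetric us)
      same = ≡.subst (λ ys → ListPointwise SD._≈ᵤ_ (List.map unitsD (span 1 m)) (us ++ ys ++ _ ∷ []))
        (≡.sym (map-tabulate (λ i → mapUnit (w i)) (Inv._⁻¹ dual)))
        (blocks n unitsD (λ i → mapUnit (w i)) (λ i → Inv._⁻¹ dual (mapUnit (w i))) _ 1
          (λ i → at _ (w i) (T₁.spec-first i) (T₂.spec-first i))
          (λ i → SD.≈ᵤ-intro (reflexive (T₁.spec-second i) , ≈-refl) (reflexive (T₂.spec-second i) , ≈-refl))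
          (SD.≈ᵤ-intro (reflexive T₁.spec-last , ≈-refl) (reflexive T₂.spec-last , ≈-refl)))

    -- Formed over `R`, so that Z at the symmetric point is `s` times its embedding.
    value : Carrier
    value = SR.normalisation cubicR n * (∏ (λ x → SR.γ x * SR.γ x) (List.tabulate w) * prodFin R n d * SR.spAt n ps)

    Zcoeff-value : Zcoeff1 R n q q̄ sq sq4 u ū ≈ value
    Zcoeff-value = begin
      proj₂ (jet (SixVertex.Ztilde R q q̄ sq sq4 (specU R n u ū) (specU R n ū u) m))
        ≈⟨ proj₂ (D.≈-trans Zcoeff-symmetric (D.≈-trans
             (Z-symmetric n us (length-tabulate _) ⟦ ½ ⟧ half ⟦ prodFin R n d ⟧ denominators)
             (D.*-congˡ (D.≈-sym (image maps-value))))) ⟩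
      -- The second component of (0, 1) times (`value`, 0).
      0# * 0# + 1# * value ≈⟨ solve 1 0 (λ value → :0 :* :0 :+ :1 :* value := value) refl value ⟩
      value ∎
      where
      units* : ListPointwise MapsUnit (List.tabulate w) us
      units* = LPW.tabulate⁺ λ i → mapsUnit (maps D.≈-refl) (maps D.≈-refl)
      points* : ListPointwise MapsUnit ps (symmetric us)
      points* = ≡.subst (λ ys → ListPointwise MapsUnit ps (us ++ ys ++ _ ∷ []))
        (≡.sym (map-tabulate (λ i → mapUnit (w i)) (Inv._⁻¹ dual)))
        (LPW.++⁺ units* (LPW.++⁺ (LPW.tabulate⁺ λ i → mapsUnit (maps D.≈-refl) (maps D.≈-refl))
          (mapsUnit (maps D.≈-refl) (maps D.≈-refl) ∷ [])))
      maps-γ² : ∀ {x y} → MapsUnit x y → Maps (SR.γ x * SR.γ x) (SD.γ y D.* SD.γ y)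
      maps-γ² h = maps-* (maps-+ (maps-val h) (maps-inv h)) (maps-+ (maps-val h) (maps-inv h))
      maps-value : Maps value (SD.normalisation cubicD n D.* (Products.∏ dual (λ x → SD.γ x D.* SD.γ x) us D.* ⟦ prodFin R n d ⟧ D.* SD.spAt n (symmetric us)))
      maps-value = maps-* (NaturalityOfPoints.maps-normalisation embed PR PD cubicR cubicD (maps D.≈-refl) n)
        (maps-* (maps-* (maps-∏ maps-γ² units*) (maps D.≈-refl)) (maps-sp embed (exponents n) (NaturalityOfPoints.maps-points embed PR PD points*)))
      to-one : ∀ {x y} → Maps x y → x ≈ 1# → y D.≈ D.1#
      to-one h e = D.≈-trans (D.≈-sym (image h)) (Hom.⟦⟧-cong embed e)
      half : (D.1# D.+ D.1#) D.* ⟦ ½ ⟧ D.≈ D.1#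
      half = to-one (maps-* (maps-+ (maps D.≈-refl) (maps D.≈-refl)) (maps D.≈-refl))
        (≈-trans (solve 1 0 (λ ½ → (:1 :+ :1) :* ½ := (:1 :+ (:1 :+ :0)) :* ½) refl ½) (proj₂ (inv′ 1)))
      denominators : Products.∏ dual (λ x → CharacterProperties.Y² dual x D.+ D.- D.1#) us D.* ⟦ prodFin R n d ⟧ D.≈ D.1#
      denominators = to-one
        (maps-* (maps-∏ (λ h → maps-+ (maps-+ (maps-* (maps-val h) (maps-val h)) (maps-* (maps-inv h) (maps-inv h))) (maps-neg (maps D.≈-refl))) units*) (maps D.≈-refl))
        (∏-tabulate-inverse n (λ x → Y² x + - 1#) w d hd)

    value-formula : value ≈ (pow R ⅓ (n ℕ.* n) * prodFin R n (λ i → pow R (u i + ū i) 2 * d i))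
      * evalE R (spPoint R n u ū) (spPoint R n ū u) (spExpr n)
    value-formula = ≈-trans (≈-sym (*-assoc _ _ _)) (*-cong (*-cong (⅓-power n) products) (≈-sym (evaluation u ū uū PR)))
      where
      ⅓-power : ∀ n → SR.normalisation cubicR n ≈ pow R ⅓ (n ℕ.* n)
      ⅓-power zero    = ≈-refl
      ⅓-power (suc n) = ≈-trans (*-congˡ (⅓-power n)) (≈-trans (≈-sym (pow-+ ⅓ (suc (n ℕ.+ n)) (n ℕ.* n))) (reflexive (≡.cong (pow R ⅓) (lemma n))))
        where
        lemma : ∀ n → suc (n ℕ.+ n) ℕ.+ n ℕ.* n ≡ suc n ℕ.* suc n
        lemma = solve-∀
      products : ∏ (λ x → SR.γ x * SR.γ x) (List.tabulate w) * prodFin R n d ≈ prodFin R n (λ i → pow R (u i + ū i) 2 * d i)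
      products = ∏-tabulate-product n _ w d _ λ i → *-congʳ (*-congˡ (≈-sym (*-identityʳ _)))

theorem4p1 : (n : ℕ) (R : CommutativeRing 0ℓ 0ℓ) →
    let open CommutativeRing R in
    (inv : (k : ℕ) → Σ Carrier (λ y → natR R (suc k) * y ≈ 1#)) →
    (q q̄ : Carrier) → q * q̄ ≈ 1# → (q * q) + (q̄ * q̄) ≈ 1# →
    (sq sq4 : Carrier) → σ R q q̄ * sq ≈ 1# →
    σ R (pow R q 4) (pow R q̄ 4) * sq4 ≈ 1# →
    (u ū d : Fin n → Carrier) → (∀ i → u i * ū i ≈ 1#) →
    (∀ i → (((u i * u i) + (ū i * ū i)) + (- 1#)) * d i ≈ 1#) →
    Σ (Expr (suc (suc (n ℕ.+ n)))) λ P →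
    IsSp (suc (suc (n ℕ.+ n))) (spLam n) P ×
    (Zcoeff1 R n q q̄ sq sq4 u ū ≈
    (pow R (proj₁ (inv 2)) (n ℕ.* n)
    * prodFin R n (λ i → pow R (u i + ū i) 2 * d i))
    * evalE R (spPoint R n u ū) (spPoint R n ū u) P)
theorem4p1 n R inv q q̄ qq̄ q²+q̄² sq sq4 σq σq⁴ u ū d uū hd = spExpr n , isSp n ,
  CommutativeRing.trans R
    (Assembly.Zcoeff-value R n inv q q̄ qq̄ q²+q̄² sq sq4 σq σq⁴ u ū d uū hd)
    (Assembly.value-formula R n inv q q̄ qq̄ q²+q̄² sq sq4 σq σq⁴ u ū d uū hd)
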